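{- Let $t(n)=s_2(n) \bmod 2\in\{0,1\}$ denote the Thue--Morse sequence, where $s_2(n)$ is the sum of the binary digits of $n$, and let $\mu$ be the M\"obius function. Then, as $N\to\infty$, \[ \sum_{n< N} \mu(n)\, t(n^2) = o(N). \]
   Context: $\mu(n)=(-1)^{\omega(n)}$ if $n$ is squarefree and $\mu(n)=0$ otherwise, where $\omega(n)$ is the number of distinct prime factors of $n$. -}

module Defs where

open import Data.Nat using (ℕ; zero; suc; _+_; _*_; _%_; _/_)
open import Data.Nat.Divisibility using (_∣_; _∣?_)
open import Data.Nat.Primality using (Prime; prime?)
open import Data.Integer as ℤ using (ℤ; +_; -_)
open import Data.List using (List; length; filter; upTo)
open import Data.List.Relation.Unary.All using (All; all?)
open import Relation.Nullary using (Dec; does; ¬?; ¬_)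
open import Relation.Nullary.Decidable using (_×-dec_; _→-dec_)
open import Data.Bool using (if_then_else_)

-- s₂ n : sum of binary digits of n (fuel = n suffices since n / 2 < n for n > 0)
s₂-aux : ℕ → ℕ → ℕ
s₂-aux zero    n = 0
s₂-aux (suc f) n = n % 2 + s₂-aux f (n / 2)

s₂ : ℕ → ℕ
s₂ n = s₂-aux n n

t : ℕ → ℕ
t n = s₂ n % 2

-- candidate primes dividing n all lie in 0..n (for n ≥ 1)
candidates : ℕ → List ℕ
candidates n = upTo (suc n)

ω : ℕ → ℕ
ω n = length (filter (λ p → prime? p ×-dec (p ∣? n)) (candidates n))

Squarefree : ℕ → Set
Squarefree n = All (λ p → Prime p → ¬ ((p * p) ∣ n)) (candidates n)

squarefree? : (n : ℕ) → Dec (Squarefree n)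
squarefree? n = all? (λ p → prime? p →-dec ¬? ((p * p) ∣? n)) (candidates n)

-- Möbius function; μ 0 = 0 by convention (it is never used in the sum below)
μ : ℕ → ℤ
μ zero = + 0
μ n@(suc _) = if does (squarefree? n) then (- (+ 1)) ℤ.^ ω n else + 0

S : ℕ → ℤ
S zero    = + 0
S (suc N) = S N ℤ.+ μ N ℤ.* (+ t (N * N))

{-# OPTIONS --safe #-}
module Submission where

-- Put T(n) = (−1)^{s₂(n)} = 1 − 2 t(n).  Then 2 S(N) = M(N) − F(N), where M(N) = Σ μ(n) and
-- F(N) = Σ μ(n) T(n²) over n < N, and both are o(N).
--
-- Turán–Kubilius: for a bounded sequence a there is a scale (64^κ, 64^{κ+1}] on which, for most primes p,
-- p Σ_{p ∣ n} a(n) ≈ Σ a(n).  With μ(pm) = −μ(m) this gives p M(N / p) ≈ −M(N).  If M(N) were not o(N), then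
-- M would change sign on a bounded multiplicative range, hence take values ≈ (i / qI) X at points Xᵢ for all
-- i < I; the points Xᵢ / p with p on a good scale would then be separated for different i, and Chebyshev's
-- bounds for primes in short intervals would contradict this for large I.
--
-- The same relation and Cauchy–Schwarz (Kátai) reduce F(N) = o(N) to Σ_{n < N} T(a n²) T(b n²) = o(N) for odd
-- a < b.  Since T(2n) = T(n), only odd n = 2(e + E x + 2ˡ(h + E v)) + 1 matter.  Two applications of
-- Cauchy–Schwarz, in e and in h, leave a product over the eight corners (coefficient, e or e′, h or h′).
-- Low digits cancel in h and high digits in e, so only a window of w digits remains.  For most x the low digits
-- of x contain an isolated one, and moving x by multiples of a suitable power of 2 then shifts the window
-- uniformly; summing over the window digit block by digit block, each block in which x has a prescribed pattern
-- loses a fixed proportion, because T(aY) T(bY) T(a(Y + d)) T(b(Y + d)) takes both signs as Y varies.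

open import Data.Nat as ℕ using (ℕ; zero; suc; NonZero)
open import Data.Nat.Primality using (Prime; prime?; prime⇒nonZero)
open import Data.Nat.Induction using (<-rec)
open import Data.Integer as ℤ using (ℤ; 0ℤ; 1ℤ)
open import Data.Bool using (Bool; true; false; if_then_else_)
open import Data.Product using (∃; ∃₂; _×_; _,_; proj₁; proj₂)
open import Data.Sum using (_⊎_; inj₁; inj₂)
open import Data.Empty using (⊥; ⊥-elim)
open import Relation.Nullary using (Dec; yes; no; does; ¬_)
open import Relation.Binary using (tri<; tri≈; tri>)
open import Relation.Binary.PropositionalEquality hiding (J)
import Data.Nat.Properties as ℕₚ
import Data.Nat.Tactic.RingSolver as ℕR
import Data.Integer.Properties as ℤₚ
import Data.Integer.Tactic.RingSolver as ℤR

-- M(N) = o(N) has the strength of the prime number theorem, yet only Chebyshev-type bounds enter.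
-- The count is balanced: a number of cells proportional to qI is available for the points Xᵢ / p,
-- and each cell holds primes of one level i from a window of length proportional to 1 / (qI). So
-- the I levels share a supply of primes that grows with I only through a factor log(qI), which the
-- crude bound for short intervals loses; I beats log(qI). In the Thue-Morse part the obstacle is
-- that the low digits of c n² depend on x quadratically. The digits of x therefore have separate
-- tasks: the lowest blocks produce the cancellation, the next ones are searched for the isolated
-- one, and the digits that are moved lie above both. The gain from the blocks is then constant
-- along each orbit. Everything is integral: F = o(N) means that for each k eventually k |F(N)| ≤ N,
-- and denominators are cleared. Parameters are chosen in a fixed order, and primes stay in a range
-- bounded before N is given; only the scale inside that range depends on N.

module ℤ-Arithmetic where
  open import Data.Integer public hiding (suc; pred; pos; NonZero; _/_; _%_; _⊓_)
  open import Data.Integer.Properties public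
  open import Data.Integer.Tactic.RingSolver public using (solve-∀)

module ℕ-Arithmetic where
  open import Data.Nat public hiding (_≟_)
  open import Data.Nat.Properties public hiding (_≟_)
  open import Data.Nat.Tactic.RingSolver public using (solve-∀)
  open import Data.Integer public using () renaming (_*_ to _·_; _+_ to _⊕_; _-_ to _⊖_; _≤_ to _≼_; -_ to neg; +_ to pos)

-- Inequalities by certificates, finite sums, Cauchy-Schwarz, indicators.

module IntegerSums where
  open ℤ-Arithmetic

  private
    ring₁ : ∀ a b → b - (1ℤ + a) ≡ b - a - 1ℤ
    ring₁ = solve-∀

    ring₂ : ∀ a b c d → b * d - a * c ≡ (b - a) * (c + (d - c)) + a * (d - c)
    ring₂ = solve-∀

    ring₃ : ∀ a b c → c * b - c * a ≡ c * (b - a)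
    ring₃ = solve-∀

    ring₄ : ∀ a b → a * a - b * b - 1ℤ ≡ (a - b - 1ℤ) * (a - b - 1ℤ) + (+ 2 * (a - b - 1ℤ) + + 2 * b * (a - b - 1ℤ) + + 2 * b)
    ring₄ = solve-∀

    ring₅ : ∀ a b c d → (a + b) + (c + d) ≡ (a + c) + (b + d)
    ring₅ = solve-∀

    ring₆ : ∀ n c → n * c + c ≡ (1ℤ + n) * c
    ring₆ = solve-∀

    ring₇ : ∀ a b c d → (a * d - c * b) * (a * d - c * b) ≡ (a * a) * (d * d) + (b * b) * (c * c) - + 2 * ((a * b) * (c * d))
    ring₇ = solve-∀

    ring₈ : ∀ F G P → + 2 * (F * G) - + 2 * (P * P) ≡ F * G + G * F - + 2 * (P * P)
    ring₈ = solve-∀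

  -- The standard form of a nonlinear estimate below: the difference of the two sides is written as
  -- a sum of products of quantities known to be nonnegative, built with `gap`, `_⊞_` and `_⊠_`, and
  -- a ring identity confirms the rewriting.
  cert : ∀ {a b d} → 0ℤ ≤ d → b - a ≡ d → a ≤ b
  cert p eq = 0≤i-j⇒j≤i (subst (0ℤ ≤_) (sym eq) p)

  gap : ∀ {a b} → a ≤ b → 0ℤ ≤ b - a
  gap = i≤j⇒0≤j-i

  gap< : ∀ {a b} → a < b → 0ℤ ≤ b - a - 1ℤ
  gap< {a} {b} p = subst (0ℤ ≤_) (ring₁ a b) (gap (i<j⇒suc[i]≤j p))

  cert< : ∀ {a b d} → 0ℤ ≤ d → b - a - 1ℤ ≡ d → a < b
  cert< {a} {b} p eq = suc[i]≤j⇒i<j (cert p (trans (ring₁ a b) eq))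

  nneg : ∀ n → 0ℤ ≤ + n
  nneg n = +≤+ ℕ.z≤n

  infixl 6 _⊞_
  infixl 7 _⊠_

  _⊞_ : ∀ {a b} → 0ℤ ≤ a → 0ℤ ≤ b → 0ℤ ≤ a + b
  p ⊞ q = +-mono-≤ p q

  _⊠_ : ∀ {a b} → 0ℤ ≤ a → 0ℤ ≤ b → 0ℤ ≤ a * b
  _⊠_ {+ m} {+ n} p q = subst (0ℤ ≤_) (pos-* m n) (nneg (m ℕ.* n))

  sq : ∀ a → 0ℤ ≤ a * a
  sq (+ n) = nneg n ⊠ nneg n
  sq -[1+ n ] = nneg _

  *-mono-≤ : ∀ {a b c d} → 0ℤ ≤ a → 0ℤ ≤ c → a ≤ b → c ≤ d → a * c ≤ b * d
  *-mono-≤ {a} {b} {c} {d} 0≤a 0≤c p q =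
    cert (gap p ⊠ (0≤c ⊞ gap q) ⊞ 0≤a ⊠ gap q) (ring₂ a b c d)

  *-monoˡ : ∀ c {a b} → 0ℤ ≤ c → a ≤ b → c * a ≤ c * b
  *-monoˡ c {a} {b} 0≤c p = cert (0≤c ⊠ gap p) (ring₃ a b c)

  *-monoʳ : ∀ c {a b} → 0ℤ ≤ c → a ≤ b → a * c ≤ b * c
  *-monoʳ c {a} {b} 0≤c p = subst₂ _≤_ (*-comm c a) (*-comm c b) (*-monoˡ c 0≤c p)

  *-cancelˡ : ∀ c {a b} → 0ℤ < c → c * a ≤ c * b → a ≤ b
  *-cancelˡ c {a} {b} 0<c p = *-cancelˡ-≤-pos a b c {{positive 0<c}} p

  abs : ℤ → ℤ
  abs z = + ∣ z ∣

  abs-nonneg : ∀ z → 0ℤ ≤ abs z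
  abs-nonneg z = nneg ∣ z ∣

  abs-of-nonneg : ∀ {z} → 0ℤ ≤ z → abs z ≡ z
  abs-of-nonneg = 0≤i⇒+∣i∣≡i

  abs-+ : ∀ a b → abs (a + b) ≤ abs a + abs b
  abs-+ a b = +≤+ (∣i+j∣≤∣i∣+∣j∣ a b)

  abs-mul : ∀ a b → abs (a * b) ≡ abs a * abs b
  abs-mul a b = trans (cong +_ (∣i*j∣≡∣i∣*∣j∣ a b)) (pos-* ∣ a ∣ ∣ b ∣)

  abs-neg : ∀ a → abs (- a) ≡ abs a
  abs-neg a = cong +_ (∣-i∣≡∣i∣ a)

  ≤-abs : ∀ z → z ≤ abs z
  ≤-abs (+ n) = ≤-refl
  ≤-abs -[1+ n ] = -≤+

  -≤-abs : ∀ z → - z ≤ abs z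
  -≤-abs z = subst (- z ≤_) (abs-neg z) (≤-abs (- z))

  abs-≤ : ∀ z {b} → z ≤ b → - z ≤ b → abs z ≤ b
  abs-≤ (+ n) p q = p
  abs-≤ -[1+ n ] p q = q

  abs-sq : ∀ z → abs z * abs z ≡ z * z
  abs-sq (+ n) = refl
  abs-sq -[1+ n ] = refl

  abs-flip : ∀ a b → abs (a - b) ≡ abs (b - a)
  abs-flip a b = cong +_ (∣i-j∣≡∣j-i∣ a b)

  sq-cancel-≤ : ∀ {a b} → 0ℤ ≤ b → a * a ≤ b * b → a ≤ b
  sq-cancel-≤ {a} {b} 0≤b p with a ≤? b
  ... | yes q = q
  ... | no q = ⊥-elim (<⇒≱ b²<a² p)
    where
    b<a = ≰⇒> q
    b²<a² : b * b < a * a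
    b²<a² = cert< (sq (a - b - 1ℤ) ⊞ (nneg 2 ⊠ gap< b<a ⊞ nneg 2 ⊠ 0≤b ⊠ gap< b<a ⊞ nneg 2 ⊠ 0≤b)) (ring₄ a b)

  n<2^n : ∀ n → n ℕ.< 2 ℕ.^ n
  n<2^n zero = ℕ.s≤s ℕ.z≤n
  n<2^n (suc n) = ℕₚ.+-mono-≤ (ℕₚ.m^n>0 2 n) (ℕₚ.≤-trans (n<2^n n) (ℕₚ.m≤m+n (2 ℕ.^ n) 0))

  Σ : ℕ → (ℕ → ℤ) → ℤ
  Σ zero f = 0ℤ
  Σ (suc n) f = Σ n f + f n

  Σ-cong< : ∀ n {f g : ℕ → ℤ} → (∀ i → i ℕ.< n → f i ≡ g i) → Σ n f ≡ Σ n g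
  Σ-cong< zero h = refl
  Σ-cong< (suc n) h = cong₂ _+_ (Σ-cong< n (λ i i<n → h i (ℕₚ.m<n⇒m<1+n i<n))) (h n ℕₚ.≤-refl)

  Σ-cong : ∀ n {f g : ℕ → ℤ} → (∀ i → f i ≡ g i) → Σ n f ≡ Σ n g
  Σ-cong n h = Σ-cong< n (λ i _ → h i)

  Σ-mono< : ∀ n {f g : ℕ → ℤ} → (∀ i → i ℕ.< n → f i ≤ g i) → Σ n f ≤ Σ n g
  Σ-mono< zero h = ≤-refl
  Σ-mono< (suc n) h = +-mono-≤ (Σ-mono< n (λ i i<n → h i (ℕₚ.m<n⇒m<1+n i<n))) (h n ℕₚ.≤-refl)

  Σ-mono : ∀ n {f g : ℕ → ℤ} → (∀ i → f i ≤ g i) → Σ n f ≤ Σ n g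
  Σ-mono n h = Σ-mono< n (λ i _ → h i)

  Σ-zero : ∀ n → Σ n (λ _ → 0ℤ) ≡ 0ℤ
  Σ-zero zero = refl
  Σ-zero (suc n) = trans (+-identityʳ _) (Σ-zero n)

  Σ-nonneg : ∀ n {f : ℕ → ℤ} → (∀ i → 0ℤ ≤ f i) → 0ℤ ≤ Σ n f
  Σ-nonneg n {f} h = subst (_≤ Σ n f) (Σ-zero n) (Σ-mono n h)

  Σ-+ : ∀ n (f g : ℕ → ℤ) → Σ n (λ i → f i + g i) ≡ Σ n f + Σ n g
  Σ-+ zero f g = refl
  Σ-+ (suc n) f g = trans (cong (_+ (f n + g n)) (Σ-+ n f g)) (ring₅ (Σ n f) (Σ n g) (f n) (g n))

  Σ-*ˡ : ∀ n c (f : ℕ → ℤ) → Σ n (λ i → c * f i) ≡ c * Σ n f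
  Σ-*ˡ zero c f = sym (*-zeroʳ c)
  Σ-*ˡ (suc n) c f = trans (cong (_+ c * f n) (Σ-*ˡ n c f)) (sym (*-distribˡ-+ c (Σ n f) (f n)))

  Σ-*ʳ : ∀ n c (f : ℕ → ℤ) → Σ n (λ i → f i * c) ≡ Σ n f * c
  Σ-*ʳ n c f = trans (Σ-cong n (λ i → *-comm (f i) c)) (trans (Σ-*ˡ n c f) (*-comm c (Σ n f)))

  Σ-neg : ∀ n (f : ℕ → ℤ) → Σ n (λ i → - f i) ≡ - Σ n f
  Σ-neg zero f = refl
  Σ-neg (suc n) f = trans (cong (_+ - f n) (Σ-neg n f)) (sym (neg-distrib-+ (Σ n f) (f n)))

  Σ-minus : ∀ n (f g : ℕ → ℤ) → Σ n (λ i → f i - g i) ≡ Σ n f - Σ n g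
  Σ-minus n f g = trans (Σ-+ n f (λ i → - g i)) (cong (λ z → Σ n f + z) (Σ-neg n g))

  Σ-const : ∀ n c → Σ n (λ _ → c) ≡ + n * c
  Σ-const zero c = refl
  Σ-const (suc n) c = trans (cong (_+ c) (Σ-const n c)) (ring₆ (+ n) c)

  Σ-≤-const : ∀ n {f : ℕ → ℤ} c → (∀ i → i ℕ.< n → f i ≤ c) → Σ n f ≤ + n * c
  Σ-≤-const n c h = subst (_ ≤_) (Σ-const n c) (Σ-mono< n h)

  Σ-swap : ∀ m n (f : ℕ → ℕ → ℤ) → Σ m (λ i → Σ n (λ j → f i j)) ≡ Σ n (λ j → Σ m (λ i → f i j))
  Σ-swap zero n f = sym (Σ-zero n)
  Σ-swap (suc m) n f = trans (cong (_+ Σ n (f m)) (Σ-swap m n f)) (sym (Σ-+ n (λ j → Σ m (λ i → f i j)) (f m)))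

  Σ-split : ∀ m n (f : ℕ → ℤ) → Σ (m ℕ.+ n) f ≡ Σ m f + Σ n (λ i → f (m ℕ.+ i))
  Σ-split m zero f rewrite ℕₚ.+-identityʳ m = sym (+-identityʳ _)
  Σ-split m (suc n) f rewrite ℕₚ.+-suc m n =
    trans (cong (_+ f (m ℕ.+ n)) (Σ-split m n f)) (+-assoc (Σ m f) _ _)

  Σ-head : ∀ n (f : ℕ → ℤ) → Σ (suc n) f ≡ f 0 + Σ n (λ i → f (suc i))
  Σ-head n f = trans (Σ-split 1 n f) (cong (_+ Σ n (λ i → f (suc i))) (+-identityˡ (f 0)))

  -- An index below m n is a digit `j` in base `n` plus `n` times the rest. With `n` a power of 2
  -- this separates low binary digits from high ones.
  Σ-block : ∀ m n (f : ℕ → ℤ) → Σ (m ℕ.* n) f ≡ Σ m (λ i → Σ n (λ j → f (j ℕ.+ n ℕ.* i)))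
  Σ-block zero n f = refl
  Σ-block (suc m) n f = begin
    Σ (n ℕ.+ m ℕ.* n) f ≡⟨ cong (λ k → Σ k f) (ℕₚ.+-comm n (m ℕ.* n)) ⟩
    Σ (m ℕ.* n ℕ.+ n) f ≡⟨ Σ-split (m ℕ.* n) n f ⟩
    Σ (m ℕ.* n) f + Σ n (λ j → f (m ℕ.* n ℕ.+ j))
      ≡⟨ cong₂ _+_ (Σ-block m n f) (Σ-cong n (λ j → cong f (trans (ℕₚ.+-comm (m ℕ.* n) j) (cong (j ℕ.+_) (ℕₚ.*-comm m n))))) ⟩
    Σ m (λ i → Σ n (λ j → f (j ℕ.+ n ℕ.* i))) + Σ n (λ j → f (j ℕ.+ n ℕ.* m)) ∎
    where open ≡-Reasoning

  Σ-abs : ∀ n (f : ℕ → ℤ) → abs (Σ n f) ≤ Σ n (λ i → abs (f i))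
  Σ-abs zero f = ≤-refl
  Σ-abs (suc n) f = ≤-trans (abs-+ (Σ n f) (f n)) (+-monoˡ-≤ (abs (f n)) (Σ-abs n f))

  Σ-abs-≤ : ∀ n (f : ℕ → ℤ) → (∀ i → abs (f i) ≤ 1ℤ) → abs (Σ n f) ≤ + n
  Σ-abs-≤ n f h = ≤-trans (Σ-abs n f) (subst (Σ n (λ i → abs (f i)) ≤_) (*-identityʳ (+ n)) (Σ-≤-const n 1ℤ (λ i _ → h i)))

  Σ-Σ-* : ∀ m n (f g : ℕ → ℤ) → Σ m (λ i → Σ n (λ j → f i * g j)) ≡ Σ m f * Σ n g
  Σ-Σ-* m n f g = trans (Σ-cong m (λ i → Σ-*ˡ n (f i) g)) (Σ-*ʳ m (Σ n g) f)

  -- Lagrange's identity: twice the difference of the two sides is the double sum of the squares (fᵢ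
  -- gⱼ - fⱼ gᵢ)².
  cauchy-schwarz : ∀ n (f g : ℕ → ℤ) →
    Σ n (λ i → f i * g i) * Σ n (λ i → f i * g i) ≤ Σ n (λ i → f i * f i) * Σ n (λ i → g i * g i)
  cauchy-schwarz n f g = *-cancelˡ (+ 2) (+<+ (ℕ.s≤s ℕ.z≤n)) (cert nn eq)
    where
    open ≡-Reasoning
    F = Σ n (λ i → f i * f i)
    G = Σ n (λ i → g i * g i)
    P = Σ n (λ i → f i * g i)
    q : ℕ → ℕ → ℤ
    q i j = (f i * g j - f j * g i) * (f i * g j - f j * g i)
    nn : 0ℤ ≤ Σ n (λ i → Σ n (q i))
    nn = Σ-nonneg n (λ i → Σ-nonneg n (λ j → sq (f i * g j - f j * g i)))
    eq : + 2 * (F * G) - + 2 * (P * P) ≡ Σ n (λ i → Σ n (q i))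
    eq = sym (begin
      Σ n (λ i → Σ n (q i))
        ≡⟨ Σ-cong n (λ i → trans (Σ-cong n (λ j → ring₇ (f i) (g i) (f j) (g j)))
              (trans (Σ-minus n (λ j → (f i * f i) * (g j * g j) + (g i * g i) * (f j * f j)) (λ j → + 2 * ((f i * g i) * (f j * g j))))
                (cong₂ _-_ (Σ-+ n (λ j → (f i * f i) * (g j * g j)) (λ j → (g i * g i) * (f j * f j))) refl))) ⟩
      Σ n (λ i → (Σ n (λ j → (f i * f i) * (g j * g j)) + Σ n (λ j → (g i * g i) * (f j * f j))) - Σ n (λ j → + 2 * ((f i * g i) * (f j * g j))))
        ≡⟨ trans (Σ-minus n _ _) (cong₂ _-_ (Σ-+ n _ _) refl) ⟩
      Σ n (λ i → Σ n (λ j → (f i * f i) * (g j * g j))) + Σ n (λ i → Σ n (λ j → (g i * g i) * (f j * f j))) - Σ n (λ i → Σ n (λ j → + 2 * ((f i * g i) * (f j * g j))))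
        ≡⟨ cong₂ _-_ (cong₂ _+_ (Σ-Σ-* n n (λ i → f i * f i) (λ i → g i * g i)) (Σ-Σ-* n n (λ i → g i * g i) (λ i → f i * f i)))
             (trans (Σ-cong n (λ i → Σ-*ˡ n (+ 2) (λ j → (f i * g i) * (f j * g j)))) (trans (Σ-*ˡ n (+ 2) _) (cong (+ 2 *_) (Σ-Σ-* n n (λ i → f i * g i) (λ i → f i * g i))))) ⟩
      F * G + G * F - + 2 * (P * P) ≡⟨ sym (ring₈ F G P) ⟩
      + 2 * (F * G) - + 2 * (P * P) ∎)

  Σ-square-≤ : ∀ n (f : ℕ → ℤ) → Σ n f * Σ n f ≤ + n * Σ n (λ i → f i * f i)
  Σ-square-≤ n f = subst₂ _≤_ (cong (λ x → x * x) (Σ-cong n (λ i → *-identityˡ (f i))))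
    (cong (_* Σ n (λ i → f i * f i)) (trans (Σ-const n 1ℤ) (*-identityʳ (+ n))))
    (cauchy-schwarz n (λ _ → 1ℤ) f)

  Σ-square : ∀ n (f : ℕ → ℤ) → Σ n f * Σ n f ≡ Σ n (λ i → Σ n (λ j → f i * f j))
  Σ-square n f = sym (Σ-Σ-* n n f f)

  𝟙 : ∀ {p} {P : Set p} → Dec P → ℤ
  𝟙 P? = if does P? then 1ℤ else 0ℤ

  module _ {p} {P : Set p} where
    𝟙-yes : (P? : Dec P) → P → 𝟙 P? ≡ 1ℤ
    𝟙-yes (yes _) _ = refl
    𝟙-yes (no ¬p) p = ⊥-elim (¬p p)

    𝟙-no : (P? : Dec P) → ¬ P → 𝟙 P? ≡ 0ℤ
    𝟙-no (yes p) ¬p = ⊥-elim (¬p p)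
    𝟙-no (no _) _ = refl

    𝟙-nonneg : (P? : Dec P) → 0ℤ ≤ 𝟙 P?
    𝟙-nonneg (yes _) = nneg 1
    𝟙-nonneg (no _) = nneg 0

    𝟙-≤1 : (P? : Dec P) → 𝟙 P? ≤ 1ℤ
    𝟙-≤1 (yes _) = ≤-refl
    𝟙-≤1 (no _) = nneg 1

    𝟙-idem : (P? : Dec P) → 𝟙 P? * 𝟙 P? ≡ 𝟙 P?
    𝟙-idem (yes _) = refl
    𝟙-idem (no _) = refl

  𝟙-cong : ∀ {p q} {P : Set p} {Q : Set q} (P? : Dec P) (Q? : Dec Q) → (P → Q) → (Q → P) → 𝟙 P? ≡ 𝟙 Q?
  𝟙-cong (yes p) Q? f g = sym (𝟙-yes Q? (f p))
  𝟙-cong (no ¬p) Q? f g = sym (𝟙-no Q? (λ q → ¬p (g q)))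

  Σ-pick : ∀ n k (f : ℕ → ℤ) → k ℕ.< n → Σ n (λ i → 𝟙 (i ℕ.≟ k) * f i) ≡ f k
  Σ-pick (suc n) k f k<1+n = step (n ℕ.≟ k)
    where
    f′ : ℕ → ℤ
    f′ i = 𝟙 (i ℕ.≟ k) * f i
    zeros : n ≡ k → ∀ i → i ℕ.< n → f′ i ≡ 0ℤ
    zeros refl i i<n = cong (_* f i) (𝟙-no (i ℕ.≟ k) (λ i≡k → ℕₚ.<-irrefl i≡k i<n))
    step : Dec (n ≡ k) → Σ n f′ + f′ n ≡ f k
    step (yes refl) = trans (cong₂ _+_ (trans (Σ-cong< n (zeros refl)) (Σ-zero n))
      (trans (cong (_* f n) (𝟙-yes (n ℕ.≟ n) refl)) (*-identityˡ (f n)))) (+-identityˡ (f n))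
    step (no n≢k) = trans (cong₂ _+_ (Σ-pick n k f (ℕₚ.≤∧≢⇒< (ℕ.s≤s⁻¹ k<1+n) (λ k≡n → n≢k (sym k≡n))))
      (cong (_* f n) (𝟙-no (n ℕ.≟ k) n≢k))) (+-identityʳ (f k))

  Σ-extend : ∀ {m n} (f : ℕ → ℤ) → m ℕ.≤ n → (∀ i → m ℕ.≤ i → f i ≡ 0ℤ) → Σ n f ≡ Σ m f
  Σ-extend {m} {n} f m≤n h = begin
    Σ n f ≡⟨ cong (λ k → Σ k f) (sym (ℕₚ.m+[n∸m]≡n m≤n)) ⟩
    Σ (m ℕ.+ (n ℕ.∸ m)) f ≡⟨ Σ-split m (n ℕ.∸ m) f ⟩
    Σ m f + Σ (n ℕ.∸ m) (λ i → f (m ℕ.+ i))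
      ≡⟨ cong (λ z → Σ m f + z) (trans (Σ-cong (n ℕ.∸ m) (λ i → h (m ℕ.+ i) (ℕₚ.m≤m+n m i))) (Σ-zero (n ℕ.∸ m))) ⟩
    Σ m f + 0ℤ ≡⟨ +-identityʳ _ ⟩
    Σ m f ∎
    where open ≡-Reasoning

-- The Möbius function at p m.

module Moebius where
  open import Defs
  open import Data.Nat.Divisibility
  open import Data.Nat.Primality
  open import Data.List using (_∷_; length; filter; applyUpTo)
  open import Data.List.Relation.Unary.All.Properties using (applyUpTo⁺₁; applyUpTo⁻)
  open import Function using (id; _∘_)
  open import Relation.Nullary.Decidable using (_×-dec_)
  open import Relation.Unary using (Decidable)
  open ℤ-Arithmetic
  open IntegerSums

  length-filter-applyUpTo : ∀ {ℓ} {P : ℕ → Set ℓ} (P? : Decidable P) (f : ℕ → ℕ) n →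
    + length (filter P? (applyUpTo f n)) ≡ Σ n (λ i → 𝟙 (P? (f i)))
  length-filter-applyUpTo P? f zero = refl
  length-filter-applyUpTo P? f (suc n) =
    trans (step (applyUpTo (f ∘ suc) n) (length-filter-applyUpTo P? (f ∘ suc) n)) (sym (Σ-head n (λ i → 𝟙 (P? (f i)))))
    where
    step : ∀ xs → + length (filter P? xs) ≡ Σ n (λ i → 𝟙 (P? (f (suc i)))) →
      + length (filter P? (f 0 ∷ xs)) ≡ 𝟙 (P? (f 0)) + Σ n (λ i → 𝟙 (P? (f (suc i))))
    step xs eq with does (P? (f 0))
    ... | true = cong (λ z → 1ℤ + z) eq
    ... | false = trans eq (sym (+-identityˡ _))

  -- The candidate lists of different arguments have different lengths; as indicator sums they can
  -- be extended by zeros to a common range and compared term by term.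
  ω-as-Σ : ∀ n → + ω n ≡ Σ (suc n) (λ q → 𝟙 (prime? q ×-dec (q ∣? n)))
  ω-as-Σ n = length-filter-applyUpTo (λ q → prime? q ×-dec (q ∣? n)) id (suc n)

  prime∣prime⇒≡ : ∀ {p q} → Prime p → Prime q → q ∣ p → q ≡ p
  prime∣prime⇒≡ p-prime q-prime q∣p with prime⇒irreducible p-prime q∣p
  ... | inj₁ refl = ⊥-elim (¬prime[1] q-prime)
  ... | inj₂ q≡p = q≡p

  module _ {p m} (p-prime : Prime p) (p∤m : ¬ p ∣ m) {{_ : NonZero m}} where

    private instance
      p≢0 : NonZero p
      p≢0 = prime⇒nonZero p-prime
      pm≢0 : NonZero (p ℕ.* m)
      pm≢0 = ℕₚ.m*n≢0 p m

    private
      indicator-split : ∀ q → 𝟙 (prime? q ×-dec (q ∣? (p ℕ.* m))) ≡ 𝟙 (prime? q ×-dec (q ∣? m)) + 𝟙 (q ℕ.≟ p) * 1ℤ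
      indicator-split q with q ℕ.≟ p
      ... | yes refl = begin
        𝟙 (prime? p ×-dec (p ∣? (p ℕ.* m))) ≡⟨ 𝟙-yes (prime? p ×-dec (p ∣? (p ℕ.* m))) (p-prime , m∣m*n m) ⟩
        1ℤ ≡⟨ sym (cong₂ _+_ (𝟙-no (prime? p ×-dec (p ∣? m)) (p∤m ∘ proj₂)) (cong (_* 1ℤ) (𝟙-yes (p ℕ.≟ p) refl))) ⟩
        𝟙 (prime? p ×-dec (p ∣? m)) + 𝟙 (p ℕ.≟ p) * 1ℤ ∎
        where open ≡-Reasoning
      ... | no q≢p = begin
        𝟙 (prime? q ×-dec (q ∣? (p ℕ.* m))) ≡⟨ 𝟙-cong (prime? q ×-dec (q ∣? (p ℕ.* m))) (prime? q ×-dec (q ∣? m)) to from ⟩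
        𝟙 (prime? q ×-dec (q ∣? m)) ≡⟨ sym (+-identityʳ _) ⟩
        𝟙 (prime? q ×-dec (q ∣? m)) + 0ℤ ≡⟨ cong (λ z → 𝟙 (prime? q ×-dec (q ∣? m)) + z * 1ℤ) (sym (𝟙-no (q ℕ.≟ p) q≢p)) ⟩
        𝟙 (prime? q ×-dec (q ∣? m)) + 𝟙 (q ℕ.≟ p) * 1ℤ ∎
        where
        open ≡-Reasoning
        to : Prime q × q ∣ p ℕ.* m → Prime q × q ∣ m
        to (q-prime , q∣pm) with euclidsLemma p m q-prime q∣pm
        ... | inj₁ q∣p = ⊥-elim (q≢p (prime∣prime⇒≡ p-prime q-prime q∣p))
        ... | inj₂ q∣m = q-prime , q∣m
        from : Prime q × q ∣ m → Prime q × q ∣ p ℕ.* m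
        from (q-prime , q∣m) = q-prime , ∣n⇒∣m*n p q∣m

      ω-prime-* : ω (p ℕ.* m) ≡ suc (ω m)
      ω-prime-* = +-injective (begin
        + ω (p ℕ.* m) ≡⟨ ω-as-Σ (p ℕ.* m) ⟩
        Σ (suc (p ℕ.* m)) (λ q → 𝟙 (prime? q ×-dec (q ∣? (p ℕ.* m)))) ≡⟨ Σ-cong (suc (p ℕ.* m)) indicator-split ⟩
        Σ (suc (p ℕ.* m)) (λ q → 𝟙 (prime? q ×-dec (q ∣? m)) + 𝟙 (q ℕ.≟ p) * 1ℤ) ≡⟨ Σ-+ (suc (p ℕ.* m)) (λ q → 𝟙 (prime? q ×-dec (q ∣? m))) (λ q → 𝟙 (q ℕ.≟ p) * 1ℤ) ⟩
        Σ (suc (p ℕ.* m)) (λ q → 𝟙 (prime? q ×-dec (q ∣? m))) + Σ (suc (p ℕ.* m)) (λ q → 𝟙 (q ℕ.≟ p) * 1ℤ)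
          ≡⟨ cong₂ _+_ (Σ-extend _ (ℕ.s≤s (ℕₚ.m≤n*m m p)) (λ q m<q → 𝟙-no (prime? q ×-dec (q ∣? m)) (λ pr → ℕₚ.<⇒≱ m<q (∣⇒≤ (proj₂ pr)))))
               (Σ-pick (suc (p ℕ.* m)) p (λ _ → 1ℤ) (ℕ.s≤s (ℕₚ.m≤m*n p m))) ⟩
        Σ (suc m) (λ q → 𝟙 (prime? q ×-dec (q ∣? m))) + 1ℤ ≡⟨ cong (_+ 1ℤ) (sym (ω-as-Σ m)) ⟩
        + ω m + 1ℤ ≡⟨ +-comm (+ ω m) 1ℤ ⟩
        + suc (ω m) ∎)
        where open ≡-Reasoning

    private
      squarefree-down : Squarefree (p ℕ.* m) → Squarefree m
      squarefree-down sf = applyUpTo⁺₁ id (suc m) (λ {q} q<1+m q-prime q²∣m →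
        applyUpTo⁻ id (suc (p ℕ.* m)) sf (ℕₚ.≤-trans q<1+m (ℕ.s≤s (ℕₚ.m≤n*m m p))) q-prime (∣n⇒∣m*n p q²∣m))

      squarefree-up : Squarefree m → Squarefree (p ℕ.* m)
      squarefree-up sf = applyUpTo⁺₁ id (suc (p ℕ.* m)) (λ {q} _ → go q)
        where
        go : ∀ q → Prime q → ¬ (q ℕ.* q ∣ p ℕ.* m)
        go q q-prime q²∣pm with q ℕ.≟ p
        ... | yes refl = p∤m (*-cancelˡ-∣ p q²∣pm)
        ... | no q≢p with euclidsLemma p m q-prime (∣-trans (m∣m*n q) q²∣pm)
        ...   | inj₁ q∣p = q≢p (prime∣prime⇒≡ p-prime q-prime q∣p)
        ...   | inj₂ (divides m′ refl) with euclidsLemma p m′ q-prime (*-cancelˡ-∣ q {{prime⇒nonZero q-prime}} (subst (q ℕ.* q ∣_) (trans (sym (ℕₚ.*-assoc p m′ q)) (ℕₚ.*-comm (p ℕ.* m′) q)) q²∣pm))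
        ...     | inj₁ q∣p = q≢p (prime∣prime⇒≡ p-prime q-prime q∣p)
        -- `Squarefree` only tests primes up to its argument; `q` divides `m`, so it lies in that
        -- range.
        ...     | inj₂ q∣m′ = applyUpTo⁻ id (suc (m′ ℕ.* q)) sf (ℕ.s≤s (∣⇒≤ (∣n⇒∣m*n m′ ∣-refl))) q-prime (*-monoʳ-∣ q q∣m′ ∣∣ ℕₚ.*-comm q m′)
          where
          _∣∣_ : ∀ {a b c} → a ∣ b → b ≡ c → a ∣ c
          x ∣∣ refl = x

    μ-unfold : ∀ n → {{NonZero n}} → μ n ≡ (if does (squarefree? n) then (- (+ 1)) ^ ω n else + 0)
    μ-unfold (suc n) = refl

    μ-prime-* : μ (p ℕ.* m) ≡ - μ m
    μ-prime-* = begin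
      μ (p ℕ.* m) ≡⟨ μ-unfold (p ℕ.* m) ⟩
      (if does (squarefree? (p ℕ.* m)) then (- (+ 1)) ^ ω (p ℕ.* m) else + 0) ≡⟨ cong (λ k → if does (squarefree? (p ℕ.* m)) then (- (+ 1)) ^ k else + 0) ω-prime-* ⟩
      (if does (squarefree? (p ℕ.* m)) then (- (+ 1)) ^ suc (ω m) else + 0) ≡⟨ same (squarefree? (p ℕ.* m)) (squarefree? m) ⟩
      - (if does (squarefree? m) then (- (+ 1)) ^ ω m else + 0) ≡⟨ cong -_ (sym (μ-unfold m)) ⟩
      - μ m ∎
      where
      open ≡-Reasoning
      same : (A : Dec (Squarefree (p ℕ.* m))) (B : Dec (Squarefree m)) →
        (if does A then (- (+ 1)) ^ suc (ω m) else + 0) ≡ - (if does B then (- (+ 1)) ^ ω m else + 0)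
      same (yes _) (yes _) = -1*i≡-i ((- (+ 1)) ^ ω m)
      same (yes a) (no ¬b) = ⊥-elim (¬b (squarefree-down a))
      same (no ¬a) (yes b) = ⊥-elim (¬a (squarefree-up b))
      same (no _) (no _) = refl

  abs-μ-≤1 : ∀ n → abs (μ n) ≤ 1ℤ
  abs-μ-≤1 zero = nneg 1
  abs-μ-≤1 n@(suc _) with does (squarefree? n)
  ... | false = nneg 1
  ... | true = ≤-reflexive (power (ω n))
    where
    power : ∀ k → abs ((- (+ 1)) ^ k) ≡ 1ℤ
    power zero = refl
    power (suc k) = trans (cong abs (-1*i≡-i ((- (+ 1)) ^ k))) (trans (abs-neg ((- (+ 1)) ^ k)) (power k))

-- Chebyshev bounds and primes in short intervals.

module Chebyshev where
  open import Data.Nat.Divisibility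
  open import Data.Nat.Primality
  open import Data.Nat.LCM using (lcm; m∣lcm[m,n]; n∣lcm[m,n]; lcm-least)
  open ℕ-Arithmetic
  open Moebius using (prime∣prime⇒≡)

  private
    ring₁ : ∀ b → 1 * (1 + b) ≡ 1 + 1 * b
    ring₁ = solve-∀

    ring₂ : ∀ k a b → (2 + k) * (a + b) ≡ a + ((1 + k) * a + (2 + k) * b)
    ring₂ = solve-∀

    ring₃ : ∀ n a b → (a + b) + ((1 + n) * a + (1 + n) * b) ≡ (2 + n) * (a + b)
    ring₃ = solve-∀

    ring₄ : ∀ a → 1 * (1 * a) ≡ a
    ring₄ = solve-∀

    ring₅ : ∀ b s h x → b * (s * h * x) ≡ s * b * (h * x)
    ring₅ = solve-∀

    ring₆ : ∀ a → a + a ≡ 2 * a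
    ring₆ = solve-∀

    ring₇ : ∀ a b m p → (a + b) * (m * p) ≡ m * (a * p) + m * (b * p)
    ring₇ = solve-∀

    ring₈ : ∀ m a b → m * (a * b) + m * (a * (m * b)) ≡ (1 + m) * a * (m * b)
    ring₈ = solve-∀

    ring₉ : ∀ a b c → a * b * c ≡ b * (a * c)
    ring₉ = solve-∀

    ring₁₀ : ∀ a b c → a * (b * c) ≡ b * (a * c)
    ring₁₀ = solve-∀

    ring₁₁ : ∀ j d → (1 + (j + d)) * d + j ≡ (j + d) * (1 + d)
    ring₁₁ = solve-∀

    ring₁₂ : ∀ a b c d → a * b * (c * d) ≡ a * c * (b * d)
    ring₁₂ = solve-∀

    ring₁₃ : ∀ a b c → a * (b * a) * c ≡ (a * a) * (c * b)
    ring₁₃ = solve-∀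

    ring₁₄ : ∀ a b c → a + (b + c) ≡ b + (a + c)
    ring₁₄ = solve-∀

    ring₁₅ : ∀ b h → b * (2 * h) ≡ 2 * b * h
    ring₁₅ = solve-∀

    ring₁₆ : ∀ k P R → k * ((1 + k) * (P + R)) ≡ (1 + k) * (k * P + k * R)
    ring₁₆ = solve-∀

    ring₁₇ : ∀ k X → (3 + k) * (6 * X + 2 * X) + 4 * k * X ≡ (2 + k) * (6 * (2 * X))
    ring₁₇ = solve-∀

    ring₁₈ : ∀ p a b → a * b * p ≡ p * a * b
    ring₁₈ = solve-∀

    ring₁₉ : ∀ y C L A B → (y * C + L) * (A * B) ≡ (y * B) * (A * C) + L * (A * B)
    ring₁₉ = solve-∀

    ring₂₀ : ∀ x A C B → x * A * (C * B) ≡ x * C * (A * B)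
    ring₂₀ = solve-∀

    ring₂₁ : ∀ s k b c → s * c * (k * (b + c)) ≡ k * c * (s * b) + k * c * (s * c)
    ring₂₁ = solve-∀

    ring₂₂ : ∀ n → 2 + (n + n) ≡ 2 * (1 + n)
    ring₂₂ = solve-∀

    ring₂₃ : ∀ k → 6 * (1 + k) + 6 + 6 * k ≡ 12 * (1 + k)
    ring₂₃ = solve-∀

    ring₂₄ : ∀ k X → (1 + k) * X + (12 * (1 + k) * X + (6 * (1 + k) + 6) * X) + (13 * k + 7) * X ≡ (1 + k) * (32 * X)
    ring₂₄ = solve-∀

    ring₂₅ : ∀ k a P S → k * (1 + a * (P + S)) ≡ k + (a * (k * S) + a * (k * P))
    ring₂₅ = solve-∀

  binom : ℕ → ℕ → ℕ
  binom n zero = 1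
  binom zero (suc k) = 0
  binom (suc n) (suc k) = binom n k + binom n (suc k)

  binom-absorb : ∀ n k → suc k * binom (suc n) (suc k) ≡ suc n * binom n k
  binom-absorb zero zero = refl
  binom-absorb zero (suc k) = *-zeroʳ (suc (suc k))
  binom-absorb (suc n) zero = trans (ring₁ (binom (suc n) 1)) (cong suc (trans (binom-absorb n zero) refl))
  binom-absorb (suc n) (suc k) = begin
    suc (suc k) * (b₁ + b₂) ≡⟨ ring₂ k b₁ b₂ ⟩
    b₁ + (suc k * b₁ + suc (suc k) * b₂) ≡⟨ cong₂ (λ x y → b₁ + (x + y)) (binom-absorb n k) (binom-absorb n (suc k)) ⟩
    b₁ + (suc n * binom n k + suc n * binom n (suc k)) ≡⟨ ring₃ n (binom n k) (binom n (suc k)) ⟩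
    suc (suc n) * b₁ ∎
    where
    open ≡-Reasoning
    b₁ = binom (suc n) (suc k)
    b₂ = binom (suc n) (suc (suc k))

  binom-factorial : ∀ x h → binom (x + h) h * (h ! * x !) ≡ (x + h) !
  binom-factorial x zero rewrite +-identityʳ x = ring₄ (x !)
  binom-factorial x (suc h) rewrite +-suc x h = begin
    b * (suc h * h ! * x !) ≡⟨ ring₅ b (suc h) (h !) (x !) ⟩
    suc h * b * (h ! * x !) ≡⟨ cong (_* (h ! * x !)) (binom-absorb (x + h) h) ⟩
    suc (x + h) * binom (x + h) h * (h ! * x !) ≡⟨ *-assoc (suc (x + h)) (binom (x + h) h) (h ! * x !) ⟩
    suc (x + h) * (binom (x + h) h * (h ! * x !)) ≡⟨ cong (suc (x + h) *_) (binom-factorial x h) ⟩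
    suc (x + h) * (x + h) ! ∎
    where
    open ≡-Reasoning
    b = binom (suc (x + h)) (suc h)

  binom-monoˡ : ∀ n k → binom n k ≤ binom (suc n) k
  binom-monoˡ n zero = ≤-refl
  binom-monoˡ n (suc k) = m≤n+m (binom n (suc k)) (binom n k)

  binom-mono : ∀ {m n} k → m ≤ n → binom m k ≤ binom n k
  binom-mono {m} k m≤n with m≤n⇒∃[o]m+o≡n m≤n
  ... | o , refl = go o
    where
    go : ∀ o → binom m k ≤ binom (m + o) k
    go zero rewrite +-identityʳ m = ≤-refl
    go (suc o) rewrite +-suc m o = ≤-trans (go o) (binom-monoˡ (m + o) k)

  2^n≤binom : ∀ n → 2 ^ n ≤ binom (n + n) n
  2^n≤binom zero = ≤-refl
  2^n≤binom (suc n) rewrite +-suc n n = begin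
    2 * 2 ^ n ≤⟨ *-monoʳ-≤ 2 (2^n≤binom n) ⟩
    2 * binom (n + n) n ≡⟨ cong (binom (n + n) n +_) (+-identityʳ _) ⟩
    binom (n + n) n + binom (n + n) n ≤⟨ +-mono-≤ (binom-monoˡ (n + n) n) (m≤m+n (binom (n + n) n) (binom (n + n) (suc n))) ⟩
    binom (suc (n + n)) n + binom (suc (n + n)) (suc n) ∎
    where open ≤-Reasoning

  binom≤2^n : ∀ n k → binom n k ≤ 2 ^ n
  binom≤2^n n zero = m^n>0 2 n
  binom≤2^n zero (suc k) = z≤n
  binom≤2^n (suc n) (suc k) = subst (binom (suc n) (suc k) ≤_) (ring₆ (2 ^ n)) (+-mono-≤ (binom≤2^n n k) (binom≤2^n n (suc k)))

  -- One term of the binomial expansion of (m + 1)ⁿ, namely C(n, k) mⁿ⁻ᵏ, multiplied by mᵏ so that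
  -- no exponent is subtracted.
  binom-weighted : ∀ m n k → binom n k * m ^ n ≤ suc m ^ n * m ^ k
  binom-weighted m n zero = subst₂ _≤_ (sym (*-identityˡ (m ^ n))) (sym (*-identityʳ (suc m ^ n))) (^-monoˡ-≤ n (n≤1+n m))
  binom-weighted m zero (suc k) = z≤n
  binom-weighted m (suc n) (suc k) = begin
    (binom n k + binom n (suc k)) * (m * m ^ n) ≡⟨ ring₇ (binom n k) (binom n (suc k)) m (m ^ n) ⟩
    m * (binom n k * m ^ n) + m * (binom n (suc k) * m ^ n) ≤⟨ +-mono-≤ (*-monoʳ-≤ m (binom-weighted m n k)) (*-monoʳ-≤ m (binom-weighted m n (suc k))) ⟩
    m * (suc m ^ n * m ^ k) + m * (suc m ^ n * (m * m ^ k)) ≡⟨ ring₈ m (suc m ^ n) (m ^ k) ⟩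
    suc m * suc m ^ n * (m * m ^ k) ∎
    where
    open ≤-Reasoning

  -- For 1 ≤ d ≤ m one has 1 + 1/m ≤ (d + 1)/d, and the product of the right-hand sides telescopes
  -- to m + 1. This replaces the bound by e.
  [1+m]^m≤m^m*[1+m] : ∀ m → suc m ^ m ≤ m ^ m * suc m
  [1+m]^m≤m^m*[1+m] m = subst (_≤ m ^ m * suc m) (*-identityʳ (suc m ^ m)) (go m 1 (+-comm m 1))
    where
    go : ∀ j d → j + d ≡ suc m → suc m ^ j * d ≤ m ^ j * suc m
    go zero d refl = ≤-refl
    go (suc j) d eq = begin
      suc m * suc m ^ j * d ≡⟨ ring₉ (suc m) (suc m ^ j) d ⟩
      suc m ^ j * (suc m * d) ≤⟨ *-monoʳ-≤ (suc m ^ j) (subst₂ _≤_ (cong (_* d) eq) (cong (_* suc d) (suc-injective eq)) (≤-trans (m≤m+n (suc (j + d) * d) j) (≤-reflexive (ring₁₁ j d)))) ⟩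
      suc m ^ j * (m * suc d) ≡⟨ ring₁₀ (suc m ^ j) m (suc d) ⟩
      m * (suc m ^ j * suc d) ≤⟨ *-monoʳ-≤ m (go j (suc d) (trans (+-suc j d) eq)) ⟩
      m * (m ^ j * suc m) ≡⟨ sym (*-assoc m (m ^ j) (suc m)) ⟩
      m * m ^ j * suc m ∎
      where
      open ≤-Reasoning

  ^-distribʳ-* : ∀ n a b → (a * b) ^ n ≡ a ^ n * b ^ n
  ^-distribʳ-* zero a b = refl
  ^-distribʳ-* (suc n) a b = trans (cong (a * b *_) (^-distribʳ-* n a b)) (ring₁₂ a b (a ^ n) (b ^ n))

  -- Put M for `suc (suc m)`. `binom-weighted` gives C(M h, h) ≤ Mʰ (1 + 1/(M - 1))^((M - 1) h), and
  -- the second factor is at most Mʰ.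
  binom-short : ∀ m h → binom (suc (suc m) * h) h ≤ suc (suc m) ^ (2 * h)
  binom-short m′ h = *-cancelʳ-≤ (binom (suc m * h) h) (suc m ^ (2 * h)) (m ^ (suc m * h)) {{m^n≢0 m (suc m * h)}} (begin
    binom (suc m * h) h * m ^ (suc m * h) ≤⟨ binom-weighted m (suc m * h) h ⟩
    suc m ^ (h + m * h) * m ^ h ≡⟨ cong (_* m ^ h) (trans (^-distribˡ-+-* (suc m) h (m * h)) (cong (suc m ^ h *_) (sym (^-*-assoc (suc m) m h)))) ⟩
    suc m ^ h * (suc m ^ m) ^ h * m ^ h ≤⟨ *-monoˡ-≤ (m ^ h) (*-monoʳ-≤ (suc m ^ h) (^-monoˡ-≤ h ([1+m]^m≤m^m*[1+m] m))) ⟩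
    suc m ^ h * (m ^ m * suc m) ^ h * m ^ h ≡⟨ cong (λ z → suc m ^ h * z * m ^ h) (^-distribʳ-* h (m ^ m) (suc m)) ⟩
    suc m ^ h * ((m ^ m) ^ h * suc m ^ h) * m ^ h ≡⟨ ring₁₃ (suc m ^ h) ((m ^ m) ^ h) (m ^ h) ⟩
    (suc m ^ h * suc m ^ h) * (m ^ h * (m ^ m) ^ h) ≡⟨ cong₂ _*_ (trans (sym (^-distribˡ-+-* (suc m) h h)) (cong (λ z → suc m ^ (h + z)) (sym (+-identityʳ h))))
        (trans (cong (m ^ h *_) (^-*-assoc m m h)) (sym (^-distribˡ-+-* m h (m * h)))) ⟩
    suc m ^ (2 * h) * m ^ (suc m * h) ∎)
    where
    open ≤-Reasoning
    m = suc m′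

  primeCount : ℕ → ℕ → ℕ
  primeCount x zero = 0
  primeCount x (suc h) = (if does (prime? (suc (x + h))) then 1 else 0) + primeCount x h

  primeCount-+ : ∀ x h k → primeCount x (h + k) ≡ primeCount x h + primeCount (x + h) k
  primeCount-+ x h zero rewrite +-identityʳ h = sym (+-identityʳ _)
  primeCount-+ x h (suc k) rewrite +-suc h k | +-assoc x h k =
    trans (cong (i +_) (primeCount-+ x h k)) (ring₁₄ i (primeCount x h) (primeCount (x + h) k))
    where
    i = if does (prime? (suc (x + (h + k)))) then 1 else 0

  -- Distinct prime divisors multiply up: the largest one is divided out, and by Euclid's lemma the
  -- smaller ones still divide the quotient. Only the lower bound `y` for each prime is kept.
  primeCount-divisors : ∀ y x h m → y ≤ x → NonZero m →
    (∀ p → Prime p → x < p → p ≤ x + h → p ∣ m) → y ^ primeCount x h ≤ m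
  primeCount-divisors y x zero m y≤x m≢0 div = >-nonZero⁻¹ m {{m≢0}}
  primeCount-divisors y x (suc h) m y≤x m≢0 div = go (prime? P)
    where
    open ≤-Reasoning
    P = suc (x + h)
    go : (d : Dec (Prime P)) → y ^ ((if does d then 1 else 0) + primeCount x h) ≤ m
    go (no _) = primeCount-divisors y x h m y≤x m≢0 (λ p pp x<p p≤ → div p pp x<p (≤-trans p≤ (+-monoʳ-≤ x (n≤1+n h))))
    go (yes P-prime) with div P P-prime (s≤s (m≤m+n x h)) (≤-reflexive (sym (+-suc x h)))
    ... | divides m′ refl = begin
      y * y ^ primeCount x h ≤⟨ *-mono-≤ (≤-trans y≤x (≤-trans (m≤m+n x h) (n≤1+n _))) (primeCount-divisors y x h m′ y≤x m′≢0 div′) ⟩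
      P * m′ ≡⟨ *-comm P m′ ⟩
      m′ * P ∎
      where
      m′≢0 : NonZero m′
      m′≢0 = m*n≢0⇒m≢0 m′ {{m≢0}}
      div′ : ∀ p → Prime p → x < p → p ≤ x + h → p ∣ m′
      div′ p pp x<p p≤ with euclidsLemma m′ P pp (div p pp x<p (≤-trans p≤ (+-monoʳ-≤ x (n≤1+n h))))
      ... | inj₁ p∣m′ = p∣m′
      ... | inj₂ p∣P with prime∣prime⇒≡ P-prime pp p∣P
      ...   | refl = ⊥-elim (<-irrefl refl p≤)

  prime∣!⇒≤ : ∀ {p} → Prime p → ∀ n → p ∣ n ! → p ≤ n
  prime∣!⇒≤ pp zero p∣1 with ∣1⇒≡1 p∣1
  ... | refl = ⊥-elim (¬prime[1] pp)
  prime∣!⇒≤ pp (suc n) p∣ with euclidsLemma (suc n) (n !) pp p∣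
  ... | inj₁ p∣n = ∣⇒≤ p∣n
  ... | inj₂ p∣n! = m≤n⇒m≤1+n (prime∣!⇒≤ pp n p∣n!)

  -- The prime divides (x + h)!, and because h ≤ x < p it divides neither h! nor x!.
  prime∣binom : ∀ {p} x h → h ≤ x → Prime p → x < p → p ≤ x + h → p ∣ binom (x + h) h
  prime∣binom {p} x h h≤x pp x<p p≤x+h with euclidsLemma (binom (x + h) h) (h ! * x !) pp
      (subst (p ∣_) (sym (binom-factorial x h)) (∣-trans (n∣n! p {{prime⇒nonZero pp}}) (m≤n⇒m!∣n! p≤x+h)))
    where
    n∣n! : ∀ n → {{NonZero n}} → n ∣ n !
    n∣n! (suc n) = m∣m*n (n !)
  ... | inj₁ p∣b = p∣b
  ... | inj₂ p∣ with euclidsLemma (h !) (x !) pp p∣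
  ...   | inj₁ p∣h! = ⊥-elim (<⇒≱ x<p (≤-trans (prime∣!⇒≤ pp h p∣h!) h≤x))
  ...   | inj₂ p∣x! = ⊥-elim (<⇒≱ x<p (prime∣!⇒≤ pp x p∣x!))

  binom≢0 : ∀ x h → NonZero (binom (x + h) h)
  binom≢0 x h = m*n≢0⇒m≢0 (binom (x + h) h) {{subst NonZero (sym (binom-factorial x h)) ((x + h) !≢0)}}

  2^-cancel-≤ : ∀ {a b} → 2 ^ a ≤ 2 ^ b → a ≤ b
  2^-cancel-≤ {a} {b} p with a ≤? b
  ... | yes q = q
  ... | no q = ⊥-elim (<⇒≱ (^-monoʳ-< 2 (s≤s (s≤s z≤n)) (≰⇒> q)) p)

  primeCount-binom : ∀ j x h → 2 ^ j ≤ x → h ≤ x → 2 ^ (j * primeCount x h) ≤ binom (x + h) h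
  primeCount-binom j x h 2^j≤x h≤x = subst (_≤ binom (x + h) h) (^-*-assoc 2 j (primeCount x h))
    (primeCount-divisors (2 ^ j) x h _ 2^j≤x (binom≢0 x h) (λ p pp → prime∣binom x h h≤x pp))

  -- A weak Brun-Titchmarsh inequality: the primes of (x, x + h] divide C(x + h, h), which is at
  -- most C(2^β h, h) ≤ 2^(2βh). The loss is the factor β, the logarithm of the ratio of x + h to h.
  primeCount-short : ∀ j x h β → 1 ≤ β → 2 ^ j ≤ x → h ≤ x → x + h ≤ 2 ^ β * h → j * primeCount x h ≤ 2 * β * h
  primeCount-short j x h (suc β) _ 2^j≤x h≤x x+h≤ = 2^-cancel-≤ (begin
    2 ^ (j * primeCount x h) ≤⟨ primeCount-binom j x h 2^j≤x h≤x ⟩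
    binom (x + h) h ≤⟨ binom-mono h x+h≤ ⟩
    binom (2 ^ suc β * h) h ≡⟨ cong (λ z → binom (z * h) h) (sym eq) ⟩
    binom (suc (suc m) * h) h ≤⟨ binom-short m h ⟩
    suc (suc m) ^ (2 * h) ≡⟨ cong (_^ (2 * h)) eq ⟩
    (2 ^ suc β) ^ (2 * h) ≡⟨ ^-*-assoc 2 (suc β) (2 * h) ⟩
    2 ^ (suc β * (2 * h)) ≡⟨ cong (2 ^_) (ring₁₅ (suc β) h) ⟩
    2 ^ (2 * suc β * h) ∎)
    where
    open ≤-Reasoning
    m = 2 ^ suc β ∸ 2
    eq : suc (suc m) ≡ 2 ^ suc β
    eq = m+[n∸m]≡n (*-monoʳ-≤ 2 (m^n>0 2 β))

  primeCount-dyadic : ∀ k → k * primeCount (2 ^ k) (2 ^ k) ≤ 2 * 2 ^ k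
  primeCount-dyadic k = 2^-cancel-≤ (≤-trans (primeCount-binom k (2 ^ k) (2 ^ k) ≤-refl ≤-refl)
    (≤-trans (binom≤2^n (2 ^ k + 2 ^ k) (2 ^ k)) (≤-reflexive (cong (λ z → 2 ^ (2 ^ k + z)) (sym (+-identityʳ _))))))

  -- Chebyshev's upper bound π(2ᵏ) ≪ 2ᵏ / k, summed over dyadic intervals.
  π-upper : ∀ k → k * primeCount 0 (2 ^ k) ≤ 6 * 2 ^ k
  π-upper 0 = z≤n
  π-upper 1 = s≤s z≤n
  π-upper 2 = m≤m+n 4 20
  π-upper (suc k@(suc (suc k′))) = *-cancelˡ-≤ k (begin
    k * (suc k * primeCount 0 (2 * 2 ^ k)) ≡⟨ cong (λ z → k * (suc k * z)) (trans (cong (primeCount 0) (cong (2 ^ k +_) (+-identityʳ (2 ^ k)))) (primeCount-+ 0 (2 ^ k) (2 ^ k))) ⟩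
    k * (suc k * (P + R)) ≡⟨ ring₁₆ k P R ⟩
    suc k * (k * P + k * R) ≤⟨ *-monoʳ-≤ (suc k) (+-mono-≤ (π-upper k) (primeCount-dyadic k)) ⟩
    suc k * (6 * X + 2 * X) ≤⟨ m≤m+n _ (4 * k′ * X) ⟩
    suc k * (6 * X + 2 * X) + 4 * k′ * X ≡⟨ ring₁₇ k′ X ⟩
    k * (6 * (2 * X)) ∎)
    where
    open ≤-Reasoning
    X = 2 ^ k
    P = primeCount 0 (2 ^ k)
    R = primeCount (2 ^ k) (2 ^ k)

  extract-prime-power : ∀ {p} → Prime p → ∀ m → .{{NonZero m}} → ∃₂ λ e m′ → m ≡ p ^ e * m′ × ¬ p ∣ m′
  extract-prime-power {p} pp m {{m≢0}} = <-rec (λ m → .{{NonZero m}} → ∃₂ λ e m′ → m ≡ p ^ e * m′ × ¬ p ∣ m′) step m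
    where
    step : ∀ m → (∀ {k} → k < m → .{{NonZero k}} → ∃₂ λ e m′ → k ≡ p ^ e * m′ × ¬ p ∣ m′) →
      .{{NonZero m}} → ∃₂ λ e m′ → m ≡ p ^ e * m′ × ¬ p ∣ m′
    step m rec {{m≢0}} with p ∣? m
    ... | no p∤m = 0 , m , sym (*-identityˡ m) , p∤m
    ... | yes (divides k refl) with rec {k} (m<m*n k p {{m*n≢0⇒m≢0 k}} (nonTrivial⇒n>1 p {{prime⇒nonTrivial pp}})) {{m*n≢0⇒m≢0 k}}
    ...   | e , m′ , eq , p∤m′ = suc e , m′ , trans (cong (_* p) eq) (ring₁₈ p (p ^ e) m′) , p∤m′

  ^-∣-^ : ∀ p {e f} → e ≤ f → p ^ e ∣ p ^ f
  ^-∣-^ p {e} e≤f with m≤n⇒∃[o]m+o≡n e≤f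
  ... | o , refl = subst (p ^ e ∣_) (sym (^-distribˡ-+-* p e o)) (m∣m*n (p ^ o))

  -- The exponent of p in a least common multiple is the maximum of the two exponents. If e exceeded
  -- both, then p would divide the product of the parts prime to p.
  prime-power∣lcm : ∀ {p} → Prime p → ∀ e a b → .{{NonZero a}} → .{{NonZero b}} → p ^ e ∣ lcm a b → p ^ e ∣ a ⊎ p ^ e ∣ b
  prime-power∣lcm {p} pp e a b p^e∣ with extract-prime-power pp a | extract-prime-power pp b
  ... | α , a′ , refl , p∤a′ | β , b′ , refl , p∤b′ with e ≤? α
  ...   | yes e≤α = inj₁ (∣m⇒∣m*n a′ (^-∣-^ p e≤α))
  ...   | no e≰α with e ≤? β
  ...     | yes e≤β = inj₂ (∣m⇒∣m*n b′ (^-∣-^ p e≤β))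
  ...     | no e≰β = ⊥-elim (absurd (euclidsLemma a′ b′ pp p∣a′b′))
    where
    M = α ⊔ β
    instance
      pM≢0 : NonZero (p ^ M)
      pM≢0 = m^n≢0 p M {{prime⇒nonZero pp}}
    bound : lcm (p ^ α * a′) (p ^ β * b′) ∣ p ^ M * (a′ * b′)
    bound = lcm-least (*-pres-∣ (^-∣-^ p (m≤m⊔n α β)) (m∣m*n b′)) (*-pres-∣ (^-∣-^ p (m≤n⊔m α β)) (n∣m*n a′))
    p∣a′b′ : p ∣ a′ * b′
    p∣a′b′ = *-cancelˡ-∣ (p ^ M) (subst (_∣ p ^ M * (a′ * b′)) (*-comm p (p ^ M))
      (∣-trans (^-∣-^ p (⊔-lub (≰⇒> e≰α) (≰⇒> e≰β))) (∣-trans p^e∣ bound)))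
    absurd : p ∣ a′ ⊎ p ∣ b′ → _
    absurd (inj₁ x) = p∤a′ x
    absurd (inj₂ x) = p∤b′ x

  lcmUpTo : ℕ → ℕ
  lcmUpTo zero = 1
  lcmUpTo (suc n) = lcm (suc n) (lcmUpTo n)

  ∣⇒nonZero : ∀ {m n} → m ∣ n → NonZero n → NonZero m
  ∣⇒nonZero {suc m} _ _ = _
  ∣⇒nonZero {zero} 0∣n n≢0 with 0∣⇒≡0 0∣n
  ... | refl = n≢0

  lcmUpTo≢0 : ∀ n → NonZero (lcmUpTo n)
  lcmUpTo≢0 zero = _
  lcmUpTo≢0 (suc n) = ∣⇒nonZero (lcm-least (m∣m*n (lcmUpTo n)) (n∣m*n (suc n))) (m*n≢0 (suc n) (lcmUpTo n) {{_}} {{lcmUpTo≢0 n}})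

  -- The bound is `suc n` rather than `n` so that it covers the empty case, where the least common
  -- multiple is 1.
  prime-power∣lcmUpTo : ∀ {p} → Prime p → ∀ e n → p ^ e ∣ lcmUpTo n → p ^ e ≤ suc n
  prime-power∣lcmUpTo pp e zero d = ≤-reflexive (∣1⇒≡1 d)
  prime-power∣lcmUpTo pp e (suc n) d with prime-power∣lcm pp e (suc n) (lcmUpTo n) {{_}} {{lcmUpTo≢0 n}} d
  ... | inj₁ d₁ = m≤n⇒m≤1+n (∣⇒≤ d₁)
  ... | inj₂ d₂ = m≤n⇒m≤1+n (prime-power∣lcmUpTo pp e n d₂)

  -- If 1/A = 1/B + 1/C and A, B divide L, then so does C.
  reciprocal-∣ : ∀ {A B C L} → NonZero (A * B) → C * B ≡ A * B + A * C → A ∣ L → B ∣ L → C ∣ L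
  reciprocal-∣ {A} {B} {C} {L} AB≢0 CB≡A[B+C] (divides x L≡xA) (divides y L≡yB) = ∣m+n∣m⇒∣n (divides x eq) (n∣m*n y)
    where
    open ≡-Reasoning
    eq : y * C + L ≡ x * C
    eq = *-cancelʳ-≡ (y * C + L) (x * C) (A * B) {{AB≢0}} (begin
      (y * C + L) * (A * B) ≡⟨ ring₁₉ y C L A B ⟩
      (y * B) * (A * C) + L * (A * B) ≡⟨ cong (λ z → z * (A * C) + L * (A * B)) (sym L≡yB) ⟩
      L * (A * C) + L * (A * B) ≡⟨ trans (sym (*-distribˡ-+ L (A * C) (A * B))) (cong (L *_) (trans (+-comm (A * C) (A * B)) (sym CB≡A[B+C]))) ⟩
      L * (C * B) ≡⟨ cong (_* (C * B)) L≡xA ⟩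
      x * A * (C * B) ≡⟨ ring₂₀ x A C B ⟩
      x * C * (A * B) ∎)

  -- The rows of the Leibniz harmonic triangle.
  leibniz : ∀ n k → k ≤ n → suc n * binom n k ∣ lcmUpTo (suc n)
  leibniz n zero _ = subst (_∣ lcmUpTo (suc n)) (sym (*-identityʳ (suc n))) (m∣lcm[m,n] (suc n) (lcmUpTo n))
  leibniz (suc n) (suc k) (s≤s k≤n) = reciprocal-∣ AB≢0 (identity (suc (suc n)) (suc k) (binom (suc n) k) (binom (suc n) (suc k)) (binom-absorb (suc n) k) (binom-absorb n k))
    (∣-trans (leibniz n k k≤n) (n∣lcm[m,n] (suc (suc n)) (lcmUpTo (suc n)))) (leibniz (suc n) k (m≤n⇒m≤1+n k≤n))
    where
    identity : ∀ s k b c {A} → k * (b + c) ≡ s * b → k * c ≡ A → s * c * (s * b) ≡ A * (s * b) + A * (s * c)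
    identity s k b c h refl = trans (cong (s * c *_) (sym h)) (ring₂₁ s k b c)
    AB≢0 : NonZero (suc n * binom n k * (suc (suc n) * binom (suc n) k))
    AB≢0 = m*n≢0 _ _ {{∣⇒nonZero (leibniz n k k≤n) (lcmUpTo≢0 (suc n))}} {{∣⇒nonZero (leibniz (suc n) k (m≤n⇒m≤1+n k≤n)) (lcmUpTo≢0 (suc (suc n)))}}

  ∃-prime-divisor : ∀ m → 1 < m → ∃ λ p → Prime p × p ∣ m
  ∃-prime-divisor = <-rec (λ m → 1 < m → ∃ λ p → Prime p × p ∣ m) step
    where
    step : ∀ m → (∀ {k} → k < m → 1 < k → ∃ λ p → Prime p × p ∣ k) → 1 < m → ∃ λ p → Prime p × p ∣ m
    step m rec 1<m with prime? m
    ... | yes m-prime = m , m-prime , ∣-refl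
    ... | no ¬m-prime with ¬prime⇒composite {{n>1⇒nonTrivial 1<m}} ¬m-prime
    ...   | composite {d} d<m d∣m with rec d<m (nonTrivial⇒n>1 d)
    ...     | p , pp , p∣d = p , pp , ∣-trans p∣d d∣m

  -- Every prime up to n contributes to m a prime power of size at most B; the induction removes the
  -- largest prime together with its full power.
  prime-power-bound : ∀ B n m → 1 ≤ B → .{{NonZero m}} → (∀ p → Prime p → p ∣ m → p ≤ n) →
    (∀ p e → Prime p → p ^ e ∣ m → p ^ e ≤ B) → m ≤ B ^ primeCount 0 n
  prime-power-bound B zero m 1≤B small _ with 1 <? m
  ... | no 1≮m = ≮⇒≥ 1≮m
  ... | yes 1<m with ∃-prime-divisor m 1<m
  ...   | p , pp , p∣m with small p pp p∣m
  ...     | z≤n = ⊥-elim (¬prime[0] pp)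
  prime-power-bound B (suc n) m 1≤B small powers = go (prime? (suc n))
    where
    go : (d : Dec (Prime (suc n))) → m ≤ B ^ ((if does d then 1 else 0) + primeCount 0 n)
    go (no ¬pp) = prime-power-bound B n m 1≤B (λ p pp p∣m → s≤s⁻¹ (≤∧≢⇒< (small p pp p∣m) (λ { refl → ¬pp pp }))) powers
    go (yes q-prime) with extract-prime-power q-prime m
    ... | e , m′ , refl , q∤m′ = *-mono-≤ (powers (suc n) e q-prime (m∣m*n m′))
      (prime-power-bound B n m′ 1≤B {{m*n≢0⇒n≢0 (suc n ^ e)}}
        (λ p pp p∣m′ → s≤s⁻¹ (≤∧≢⇒< (small p pp (∣n⇒∣m*n (suc n ^ e) p∣m′)) (λ { refl → q∤m′ p∣m′ })))
        (λ p f pp d → powers p f pp (∣n⇒∣m*n (suc n ^ e) d)))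

  -- Chebyshev's lower bound π(2ᴷ) ≫ 2ᴷ / K, from 2ⁿ ≤ lcm(1, …, 2n + 1).
  π-lower : ∀ K → 2 ^ K ≤ suc (suc K * primeCount 0 (2 ^ suc K))
  π-lower K = subst (_≤ suc (suc K * primeCount 0 (2 ^ suc K))) eq (s≤s (2^-cancel-≤ (begin
    2 ^ n ≤⟨ 2^n≤binom n ⟩
    binom (n + n) n ≤⟨ m≤n*m (binom (n + n) n) (suc (n + n)) ⟩
    suc (n + n) * binom (n + n) n ≤⟨ ∣⇒≤ {{lcmUpTo≢0 (suc (n + n))}} (leibniz (n + n) n (m≤m+n n n)) ⟩
    lcmUpTo (suc (n + n)) ≤⟨ prime-power-bound (2 ^ suc K) (2 ^ suc K) (lcmUpTo (suc (n + n))) (m^n>0 2 (suc K)) {{lcmUpTo≢0 (suc (n + n))}}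
        (λ p pp d → subst (_≤ 2 ^ suc K) (*-identityʳ p) (power p 1 pp (subst (_∣ _) (sym (*-identityʳ p)) d))) power ⟩
    (2 ^ suc K) ^ primeCount 0 (2 ^ suc K) ≡⟨ ^-*-assoc 2 (suc K) (primeCount 0 (2 ^ suc K)) ⟩
    2 ^ (suc K * primeCount 0 (2 ^ suc K)) ∎)))
    where
    open ≤-Reasoning
    n = pred (2 ^ K)
    eq : suc n ≡ 2 ^ K
    eq = suc-pred (2 ^ K) {{m^n≢0 2 K}}
    power : ∀ p e → Prime p → p ^ e ∣ lcmUpTo (suc (n + n)) → p ^ e ≤ 2 ^ suc K
    power p e pp d = ≤-trans (prime-power∣lcmUpTo pp e (suc (n + n)) d)
      (≤-reflexive (trans (ring₂₂ n) (cong (2 *_) eq)))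

  scaleCount : ℕ → ℕ
  scaleCount κ = primeCount (64 ^ κ) (63 * 64 ^ κ)

  -- The constants of the two Chebyshev bounds are far apart, so the ratio of consecutive scales has
  -- to be large. With X = 64^κ, κ ≥ 1, the upper bound gives π(X) ≤ X / κ and the lower bound π(64
  -- X) ≥ (32 X - 1) / (6κ + 6); the difference is at least X / κ.
  scaleCount-lower : ∀ κ → 64 ^ suc κ ≤ suc κ * scaleCount (suc κ)
  scaleCount-lower κ′ = *-cancelˡ-≤ (12 * κ) (begin
    12 * κ * X ≤⟨ +-cancelʳ-≤ ((6 * κ + 6) * (κ * P)) (12 * κ * X) ((6 * κ + 6) * (κ * S)) step₁ ⟩
    (6 * κ + 6) * (κ * S) ≤⟨ *-monoˡ-≤ (κ * S) (≤-trans (m≤m+n (6 * κ + 6) (6 * κ′)) (≤-reflexive (ring₂₃ κ′))) ⟩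
    12 * κ * (κ * S) ∎)
    where
    open ≤-Reasoning
    κ = suc κ′
    X = 64 ^ κ
    P = primeCount 0 X
    S = scaleCount κ
    X≡ : X ≡ 2 ^ (6 * κ)
    X≡ = ^-*-assoc 2 6 κ
    P-upper : κ * P ≤ X
    P-upper = *-cancelˡ-≤ 6 (subst₂ _≤_ (trans (*-assoc 6 κ _) (cong (λ z → 6 * (κ * primeCount 0 z)) (sym X≡))) (cong (6 *_) (sym X≡)) (π-upper (6 * κ)))
    PS-lower : 32 * X ≤ suc ((6 * κ + 6) * (P + S))
    PS-lower = begin
      32 * X ≡⟨ trans (cong (32 *_) X≡) (trans (*-comm 32 (2 ^ (6 * κ))) (sym (^-distribˡ-+-* 2 (6 * κ) 5))) ⟩
      2 ^ (6 * κ + 5) ≤⟨ π-lower (6 * κ + 5) ⟩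
      suc (suc (6 * κ + 5) * primeCount 0 (2 ^ suc (6 * κ + 5))) ≡⟨ cong₂ (λ a b → suc (a * primeCount 0 b)) (sym (+-suc (6 * κ) 5)) eq ⟩
      suc ((6 * κ + 6) * primeCount 0 (X + 63 * X)) ≡⟨ cong (λ z → suc ((6 * κ + 6) * z)) (primeCount-+ 0 X (63 * X)) ⟩
      suc ((6 * κ + 6) * (P + S)) ∎
      where
      eq : 2 ^ suc (6 * κ + 5) ≡ X + 63 * X
      eq = trans (cong (2 ^_) (sym (+-suc (6 * κ) 5))) (trans (^-distribˡ-+-* 2 (6 * κ) 6) (trans (*-comm (2 ^ (6 * κ)) 64) (cong (64 *_) (sym X≡))))
    step₁ : 12 * κ * X + (6 * κ + 6) * (κ * P) ≤ (6 * κ + 6) * (κ * S) + (6 * κ + 6) * (κ * P)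
    step₁ = +-cancelˡ-≤ κ _ _ (begin
      κ + (12 * κ * X + (6 * κ + 6) * (κ * P)) ≤⟨ +-mono-≤ (m≤m*n κ X {{m^n≢0 64 κ}}) (+-monoʳ-≤ (12 * κ * X) (*-monoʳ-≤ (6 * κ + 6) P-upper)) ⟩
      κ * X + (12 * κ * X + (6 * κ + 6) * X) ≤⟨ m≤m+n _ ((13 * κ′ + 7) * X) ⟩
      κ * X + (12 * κ * X + (6 * κ + 6) * X) + (13 * κ′ + 7) * X ≡⟨ ring₂₄ κ′ X ⟩
      κ * (32 * X) ≤⟨ *-monoʳ-≤ κ PS-lower ⟩
      κ * suc ((6 * κ + 6) * (P + S)) ≡⟨ ring₂₅ κ (6 * κ + 6) P S ⟩
      κ + ((6 * κ + 6) * (κ * S) + (6 * κ + 6) * (κ * P)) ∎)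

-- The dual Turán-Kubilius inequality.

module TuranKubilius where
  open import Data.Nat.Divisibility using (_∣_; _∣?_; divides; m∣m*n; n∣m*n; ∣-trans)
  open import Data.Nat.Primality using (Prime; prime⇒nonZero; euclidsLemma)
  open ℤ-Arithmetic
  open IntegerSums
  open Moebius using (prime∣prime⇒≡)

  private
    ring₁ : ∀ p x → p + 1ℤ - (p * x - 1ℤ) ≡ p * (1ℤ - x) + + 2
    ring₁ = solve-∀

    ring₂ : ∀ p x → p + 1ℤ - (- (p * x - 1ℤ)) ≡ p * x + p
    ring₂ = solve-∀

    ring₃ : ∀ p N c → p * N - ((p * p - + 2 * p) * c + N) ≡ p * (N + p - p * c) + + 2 * (p * c - N) + (N - p * p)
    ring₃ = solve-∀

    ring₄ : ∀ p x → (p * x - 1ℤ) * (p * x - 1ℤ) ≡ p * p * (x * x) - + 2 * p * x + 1ℤ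
    ring₄ = solve-∀

    ring₅ : ∀ p x → p * p * x - + 2 * p * x + 1ℤ ≡ (p * p - + 2 * p) * x + 1ℤ
    ring₅ = solve-∀

    ring₆ : ∀ p q N x y z → (p + 1ℤ) * (q + 1ℤ) - (p * q * x + (- p * y + (- q * z + N))) ≡ (N + p * q - p * q * x) + (p * y - N) + (q * z - N) + (p + q + 1ℤ)
    ring₆ = solve-∀

    ring₇ : ∀ p q N x y z → (p + 1ℤ) * (q + 1ℤ) - - (p * q * x + (- p * y + (- q * z + N))) ≡ (p * q * x - N) + (N + p - p * y) + (N + q - q * z) + (p * q + 1ℤ)
    ring₇ = solve-∀

    ring₈ : ∀ p q x y → (p * x - 1ℤ) * (q * y - 1ℤ) ≡ p * q * (x * y) + (- p * x + (- q * y + 1ℤ))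
    ring₈ = solve-∀

    ring₉ : ∀ x y z → x * (y * z) ≡ y * (x * z)
    ring₉ = solve-∀

    ring₁₀ : ∀ x y z t → (x * y) * (z * t) ≡ x * z * (y * t)
    ring₁₀ = solve-∀

    ring₁₁ : ∀ w p → w * p - w ≡ w * (p - 1ℤ)
    ring₁₁ = solve-∀

    ring₁₂ : ∀ W p N → W * (N * (p + 1ℤ)) * (p + 1ℤ) ≡ W * ((p + 1ℤ) * (p + 1ℤ)) * N
    ring₁₂ = solve-∀

    ring₁₃ : ∀ x y z → 0ℤ * x * y * z ≡ 0ℤ
    ring₁₃ = solve-∀

    ring₁₄ : ∀ x y z → x * (0ℤ * y) * z ≡ 0ℤ
    ring₁₄ = solve-∀

    ring₁₅ : ∀ x y → 1ℤ * x + y - x ≡ y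
    ring₁₅ = solve-∀

    ring₁₆ : ∀ w b X q N W → W * N * (w * (b * b)) - (w * b) * (w * b) * X ≡ w * (b * b) * (w * (q * N - X) + N * (W - w * q))
    ring₁₆ = solve-∀

    ring₁₇ : ∀ x y p q → x * y * ((p + 1ℤ) * (q + 1ℤ)) ≡ x * (p + 1ℤ) * (y * (q + 1ℤ))
    ring₁₇ = solve-∀

  -- Zero counts as a multiple, so this is N / p rounded up; hence the shape N ≤ p c < N + p of the
  -- bounds.
  multiples : ℕ → ℕ → ℕ
  multiples p zero = 0
  multiples p (suc N) = if does (p ∣? N) then suc (multiples p N) else multiples p N

  multiples-bounds : ∀ p → .{{NonZero p}} → ∀ N → N ℕ.≤ p ℕ.* multiples p N × p ℕ.* multiples p N ℕ.< N ℕ.+ p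
  private
    multiples-exact : ∀ p → .{{NonZero p}} → ∀ N → p ∣ N → p ℕ.* multiples p N ≡ N

  multiples-bounds p zero = ℕ.z≤n , subst (ℕ._< p) (sym (ℕₚ.*-zeroʳ p)) (ℕₚ.n≢0⇒n>0 (ℕ.≢-nonZero⁻¹ p))
  multiples-bounds p (suc N) = go (p ∣? N)
    where
    c = multiples p N
    go : (d : Dec (p ∣ N)) → let c′ = if does d then suc c else c in suc N ℕ.≤ p ℕ.* c′ × p ℕ.* c′ ℕ.< suc N ℕ.+ p
    go (yes p∣N) = subst (suc N ℕ.≤_) (sym eq) (ℕₚ.+-monoˡ-≤ N (ℕₚ.n≢0⇒n>0 (ℕ.≢-nonZero⁻¹ p))) ,
      ℕ.s≤s (ℕₚ.≤-reflexive (trans eq (ℕₚ.+-comm p N)))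
      where
      eq : p ℕ.* suc c ≡ p ℕ.+ N
      eq = trans (ℕₚ.*-suc p c) (cong (p ℕ.+_) (multiples-exact p N p∣N))
    go (no p∤N) with multiples-bounds p N
    ... | lo , hi = ℕₚ.≤∧≢⇒< lo (λ N≡pc → p∤N (subst (p ∣_) (sym N≡pc) (m∣m*n c))) , ℕₚ.m<n⇒m<1+n hi

  multiples-exact p N (divides k refl) with multiples-bounds p (k ℕ.* p)
  ... | lo , hi = trans (ℕₚ.*-comm p c) (cong (ℕ._* p) (ℕₚ.≤-antisym (ℕ.s≤s⁻¹ c<1+k) k≤c))
    where
    c = multiples p (k ℕ.* p)
    k≤c : k ℕ.≤ c
    k≤c = ℕₚ.*-cancelˡ-≤ p (subst (ℕ._≤ p ℕ.* c) (ℕₚ.*-comm k p) lo)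
    c<1+k : c ℕ.< suc k
    c<1+k = ℕₚ.*-cancelˡ-< p c (suc k) (subst (p ℕ.* c ℕ.<_) (trans (ℕₚ.+-comm (k ℕ.* p) p) (ℕₚ.*-comm (suc k) p)) hi)

  Σ-multiples : ∀ p → .{{NonZero p}} → ∀ N (f : ℕ → ℤ) →
    Σ N (λ n → 𝟙 (p ∣? n) * f n) ≡ Σ (multiples p N) (λ m → f (p ℕ.* m))
  Σ-multiples p zero f = refl
  Σ-multiples p (suc N) f = go (p ∣? N)
    where
    S = Σ N (λ n → 𝟙 (p ∣? n) * f n)
    c = multiples p N
    go : (d : Dec (p ∣ N)) → S + 𝟙 d * f N ≡ Σ (if does d then suc c else c) (λ m → f (p ℕ.* m))
    go (yes p∣N) = cong₂ _+_ (Σ-multiples p N f) (trans (*-identityˡ (f N)) (cong f (sym (multiples-exact p N p∣N))))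
    go (no _) = trans (+-identityʳ S) (Σ-multiples p N f)

  Σ-𝟙-multiples : ∀ p → .{{NonZero p}} → ∀ N → Σ N (λ n → 𝟙 (p ∣? n)) ≡ + multiples p N
  Σ-𝟙-multiples p N = trans (Σ-cong N (λ n → sym (*-identityʳ (𝟙 (p ∣? n)))))
    (trans (Σ-multiples p N (λ _ → 1ℤ)) (trans (Σ-const (multiples p N) 1ℤ) (*-identityʳ (+ multiples p N))))

  multiples-lowerℤ : ∀ p → .{{NonZero p}} → ∀ N → + N ≤ + p * + multiples p N
  multiples-lowerℤ p N = subst (+ N ≤_) (pos-* p (multiples p N)) (+≤+ (proj₁ (multiples-bounds p N)))

  multiples-upperℤ : ∀ p → .{{NonZero p}} → ∀ N → + p * + multiples p N ≤ + N + + p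
  multiples-upperℤ p N = subst (_≤ + N + + p) (pos-* p (multiples p N)) (+≤+ (ℕₚ.<⇒≤ (proj₂ (multiples-bounds p N))))

  -- p·1[p ∣ n] − 1, a function of n with mean value nearly 0.
  centred : ℕ → ℕ → ℤ
  centred p n = + p * 𝟙 (p ∣? n) - 1ℤ

  deviation : (ℕ → ℤ) → ℕ → ℕ → ℤ
  deviation a N p = Σ N (λ n → a n * centred p n)

  abs-centred : ∀ p n → abs (centred p n) ≤ + p + 1ℤ
  abs-centred p n = abs-≤ (centred p n) (cert (nneg p ⊠ gap (𝟙-≤1 (p ∣? n)) ⊞ nneg 2) (ring₁ (+ p) (𝟙 (p ∣? n))))
    (cert (nneg p ⊠ 𝟙-nonneg (p ∣? n) ⊞ nneg p) (ring₂ (+ p) (𝟙 (p ∣? n))))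

  -- The sum equals (p² - 2p) c + N with c = `multiples p N`, about (p - 1) N. The hypothesis p² ≤ N
  -- absorbs the rounding in c.
  Σ-centred² : ∀ p → .{{NonZero p}} → ∀ N → p ℕ.* p ℕ.≤ N → Σ N (λ n → centred p n * centred p n) ≤ + p * + N
  Σ-centred² p N p²≤N = subst (_≤ + p * + N) (sym eq)
    (cert (nneg p ⊠ gap (multiples-upperℤ p N) ⊞ nneg 2 ⊠ gap (multiples-lowerℤ p N) ⊞ gap p²≤N′) (ring₃ (+ p) (+ N) c))
    where
    c = + multiples p N
    p²≤N′ : + p * + p ≤ + N
    p²≤N′ = subst (_≤ + N) (pos-* p p) (+≤+ p²≤N)
    eq : Σ N (λ n → centred p n * centred p n) ≡ (+ p * + p - + 2 * + p) * c + + N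
    eq = begin
      Σ N (λ n → centred p n * centred p n)
        ≡⟨ Σ-cong N (λ n → trans (ring₄ (+ p) (𝟙 (p ∣? n))) (trans (cong (λ z → + p * + p * z - + 2 * + p * 𝟙 (p ∣? n) + 1ℤ) (𝟙-idem (p ∣? n))) (ring₅ (+ p) (𝟙 (p ∣? n))))) ⟩
      Σ N (λ n → (+ p * + p - + 2 * + p) * 𝟙 (p ∣? n) + 1ℤ)
        ≡⟨ Σ-+ N (λ n → (+ p * + p - + 2 * + p) * 𝟙 (p ∣? n)) (λ _ → 1ℤ) ⟩
      Σ N (λ n → (+ p * + p - + 2 * + p) * 𝟙 (p ∣? n)) + Σ N (λ _ → 1ℤ)
        ≡⟨ cong₂ _+_ (trans (Σ-*ˡ N (+ p * + p - + 2 * + p) (λ n → 𝟙 (p ∣? n))) (cong ((+ p * + p - + 2 * + p) *_) (Σ-𝟙-multiples p N))) (trans (Σ-const N 1ℤ) (*-identityʳ (+ N))) ⟩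
      (+ p * + p - + 2 * + p) * c + + N ∎
      where open ≡-Reasoning

  prime*prime∣ : ∀ {p q n} → Prime p → Prime q → ¬ p ≡ q → p ∣ n → q ∣ n → p ℕ.* q ∣ n
  prime*prime∣ {p} {q} pp qq p≢q (divides k refl) q∣n with euclidsLemma k p qq q∣n
  ... | inj₁ (divides j refl) = divides j (trans (ℕₚ.*-assoc j q p) (cong (j ℕ.*_) (ℕₚ.*-comm q p)))
  ... | inj₂ q∣p = ⊥-elim (p≢q (sym (prime∣prime⇒≡ pp qq q∣p)))

  -- Quasi-orthogonality: common multiples of p and q are the multiples of p q, so in p q c(pq) - p
  -- c(p) - q c(q) + N the main terms N cancel and only the three rounding errors remain.
  Σ-centred-cross : ∀ {p q} → Prime p → Prime q → ¬ p ≡ q → ∀ N →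
    abs (Σ N (λ n → centred p n * centred q n)) ≤ (+ p + 1ℤ) * (+ q + 1ℤ)
  Σ-centred-cross {p} {q} pp qq p≢q N = subst (λ z → abs z ≤ (+ p + 1ℤ) * (+ q + 1ℤ)) (sym eq) (abs-≤ (+ p * + q * cpq + (- + p * cp + (- + q * cq + + N)))
      (cert (gap up₁ ⊞ gap lo₂ ⊞ gap lo₃ ⊞ (nneg p ⊞ nneg q ⊞ nneg 1)) (ring₆ (+ p) (+ q) (+ N) (+ multiples (p ℕ.* q) N) (+ multiples p N) (+ multiples q N)))
      (cert (gap lo₁ ⊞ gap up₂ ⊞ gap up₃ ⊞ (nneg p ⊠ nneg q ⊞ nneg 1)) (ring₇ (+ p) (+ q) (+ N) (+ multiples (p ℕ.* q) N) (+ multiples p N) (+ multiples q N))))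
    where
    instance
      p≢0 = prime⇒nonZero pp
      q≢0 = prime⇒nonZero qq
      pq≢0 = ℕₚ.m*n≢0 p q
    cpq = + multiples (p ℕ.* q) N
    cp = + multiples p N
    cq = + multiples q N
    up₁ : + p * + q * cpq ≤ + N + + p * + q
    up₁ = subst₂ (λ x y → x * cpq ≤ + N + y) (pos-* p q) (pos-* p q) (multiples-upperℤ (p ℕ.* q) N)
    lo₁ : + N ≤ + p * + q * cpq
    lo₁ = subst (λ x → + N ≤ x * cpq) (pos-* p q) (multiples-lowerℤ (p ℕ.* q) N)
    up₂ = multiples-upperℤ p N
    lo₂ = multiples-lowerℤ p N
    up₃ = multiples-upperℤ q N
    lo₃ = multiples-lowerℤ q N
    𝟙-product : ∀ n → 𝟙 (p ∣? n) * 𝟙 (q ∣? n) ≡ 𝟙 ((p ℕ.* q) ∣? n)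
    𝟙-product n = go (p ∣? n) (q ∣? n)
      where
      go : (d : Dec (p ∣ n)) (e : Dec (q ∣ n)) → 𝟙 d * 𝟙 e ≡ 𝟙 ((p ℕ.* q) ∣? n)
      go (yes x) (yes y) = sym (𝟙-yes ((p ℕ.* q) ∣? n) (prime*prime∣ pp qq p≢q x y))
      go (yes x) (no y) = sym (𝟙-no ((p ℕ.* q) ∣? n) (λ z → y (∣-trans (n∣m*n p) z)))
      go (no x) e = sym (𝟙-no ((p ℕ.* q) ∣? n) (λ z → x (∣-trans (m∣m*n q) z)))
    eq : Σ N (λ n → centred p n * centred q n) ≡ + p * + q * cpq + (- + p * cp + (- + q * cq + + N))
    eq = begin
      Σ N (λ n → centred p n * centred q n)
        ≡⟨ Σ-cong N (λ n → trans (ring₈ (+ p) (+ q) (𝟙 (p ∣? n)) (𝟙 (q ∣? n))) (cong (λ z → + p * + q * z + (- + p * 𝟙 (p ∣? n) + (- + q * 𝟙 (q ∣? n) + 1ℤ))) (𝟙-product n))) ⟩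
      Σ N (λ n → + p * + q * 𝟙 ((p ℕ.* q) ∣? n) + (- + p * 𝟙 (p ∣? n) + (- + q * 𝟙 (q ∣? n) + 1ℤ)))
        ≡⟨ Σ-+ N (λ n → + p * + q * 𝟙 ((p ℕ.* q) ∣? n)) (λ n → - + p * 𝟙 (p ∣? n) + (- + q * 𝟙 (q ∣? n) + 1ℤ)) ⟩
      Σ N (λ n → + p * + q * 𝟙 ((p ℕ.* q) ∣? n)) + Σ N (λ n → - + p * 𝟙 (p ∣? n) + (- + q * 𝟙 (q ∣? n) + 1ℤ))
        ≡⟨ cong₂ _+_ (scaled (+ p * + q) (p ℕ.* q)) (trans (Σ-+ N (λ n → - + p * 𝟙 (p ∣? n)) (λ n → - + q * 𝟙 (q ∣? n) + 1ℤ))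
             (cong₂ _+_ (scaled (- + p) p) (trans (Σ-+ N (λ n → - + q * 𝟙 (q ∣? n)) (λ _ → 1ℤ))
               (cong₂ _+_ (scaled (- + q) q) (trans (Σ-const N 1ℤ) (*-identityʳ (+ N))))))) ⟩
      + p * + q * cpq + (- + p * cp + (- + q * cq + + N)) ∎
      where
      open ≡-Reasoning
      scaled : ∀ z d → .{{NonZero d}} → Σ N (λ n → z * 𝟙 (d ∣? n)) ≡ z * + multiples d N
      scaled z d = trans (Σ-*ˡ N z (λ n → 𝟙 (d ∣? n))) (cong (z *_) (Σ-𝟙-multiples d N))

  -- Duality: `Q` pairs `a` with φ(n) = Σ w(p) b(p) centred(p, n), so Q² ≤ N Σ φ² by Cauchy-Schwarz.
  -- In Σ φ² the diagonal is at most W N Q by `w-bound` and `Σ-centred²`; the off-diagonal terms,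
  -- with |b(p)| ≤ N (p + 1) inserted trivially, add at most (Z N)².
  module DualTuránKubilius
    (a : ℕ → ℤ) (a≤1 : ∀ n → abs (a n) ≤ 1ℤ) (N P : ℕ) (w : ℕ → ℤ) (W : ℤ)
    (w≥0 : ∀ p → 0ℤ ≤ w p) (w-supp : ∀ p → w p ≡ 0ℤ ⊎ Prime p) (w-bound : ∀ p → p ℕ.< P → w p * + p ≤ W)
    (P²≤N : P ℕ.* P ℕ.≤ N) (1≤W : 1ℤ ≤ W)
    where

    b : ℕ → ℤ
    b = deviation a N

    Q = Σ P (λ p → w p * (b p * b p))
    Z = Σ P (λ p → W * ((+ p + 1ℤ) * (+ p + 1ℤ)))

    private
      0≤W : 0ℤ ≤ W
      0≤W = ≤-trans (nneg 1) 1≤W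

      φ : ℕ → ℤ
      φ n = Σ P (λ p → w p * b p * centred p n)

      Q≡ : Q ≡ Σ N (λ n → a n * φ n)
      Q≡ = begin
        Σ P (λ p → w p * (b p * b p)) ≡⟨ Σ-cong P (λ p → trans (sym (*-assoc (w p) (b p) (b p))) (sym (Σ-*ˡ N (w p * b p) (λ n → a n * centred p n)))) ⟩
        Σ P (λ p → Σ N (λ n → w p * b p * (a n * centred p n))) ≡⟨ Σ-swap P N (λ p n → w p * b p * (a n * centred p n)) ⟩
        Σ N (λ n → Σ P (λ p → w p * b p * (a n * centred p n))) ≡⟨ Σ-cong N (λ n → trans (Σ-cong P (λ p → ring₉ (w p * b p) (a n) (centred p n))) (Σ-*ˡ P (a n) (λ p → w p * b p * centred p n))) ⟩
        Σ N (λ n → a n * φ n) ∎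
        where
        open ≡-Reasoning

      Σφ² : Σ N (λ n → φ n * φ n) ≡ Σ P (λ p → Σ P (λ q → (w p * b p) * (w q * b q) * Σ N (λ n → centred p n * centred q n)))
      Σφ² = begin
        Σ N (λ n → φ n * φ n) ≡⟨ Σ-cong N (λ n → Σ-square P (λ p → w p * b p * centred p n)) ⟩
        Σ N (λ n → Σ P (λ p → Σ P (λ q → (w p * b p * centred p n) * (w q * b q * centred q n)))) ≡⟨ Σ-swap N P (λ n p → Σ P (λ q → (w p * b p * centred p n) * (w q * b q * centred q n))) ⟩
        Σ P (λ p → Σ N (λ n → Σ P (λ q → (w p * b p * centred p n) * (w q * b q * centred q n)))) ≡⟨ Σ-cong P (λ p → Σ-swap N P (λ n q → (w p * b p * centred p n) * (w q * b q * centred q n))) ⟩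
        Σ P (λ p → Σ P (λ q → Σ N (λ n → (w p * b p * centred p n) * (w q * b q * centred q n))))
          ≡⟨ Σ-cong P (λ p → Σ-cong P (λ q → trans (Σ-cong N (λ n → ring₁₀ (w p * b p) (centred p n) (w q * b q) (centred q n))) (Σ-*ˡ N ((w p * b p) * (w q * b q)) (λ n → centred p n * centred q n)))) ⟩
        Σ P (λ p → Σ P (λ q → (w p * b p) * (w q * b q) * Σ N (λ n → centred p n * centred q n))) ∎
        where
        open ≡-Reasoning

      |b|≤ : ∀ p → abs (b p) ≤ + N * (+ p + 1ℤ)
      |b|≤ p = ≤-trans (Σ-abs N (λ n → a n * centred p n)) (Σ-≤-const N (+ p + 1ℤ) (λ n _ →
        ≤-trans (≤-reflexive (abs-mul (a n) (centred p n)))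
          (≤-trans (*-mono-≤ (abs-nonneg (a n)) (abs-nonneg (centred p n)) (a≤1 n) (abs-centred p n)) (≤-reflexive (*-identityˡ (+ p + 1ℤ))))))

      w≤W : ∀ p → p ℕ.< P → w p ≤ W
      w≤W p p<P with w-supp p
      ... | inj₁ wp≡0 = subst (_≤ W) (sym wp≡0) 0≤W
      ... | inj₂ pp = ≤-trans (cert (w≥0 p ⊠ gap {1ℤ} {+ p} (+≤+ (ℕₚ.n≢0⇒n>0 (ℕ.≢-nonZero⁻¹ p {{prime⇒nonZero pp}})))) (ring₁₁ (w p) (+ p))) (w-bound p p<P)

      g : ℕ → ℤ
      g p = abs (w p * b p) * (+ p + 1ℤ)

      g≥0 : ∀ p → 0ℤ ≤ g p
      g≥0 p = abs-nonneg (w p * b p) ⊠ (nneg p ⊞ nneg 1)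

      Σg≤ : Σ P g ≤ Z * + N
      Σg≤ = subst (Σ P g ≤_) (Σ-*ʳ P (+ N) (λ p → W * ((+ p + 1ℤ) * (+ p + 1ℤ)))) (Σ-mono< P (λ p p<P → subst₂ _≤_ (cong (_* (+ p + 1ℤ)) (sym (abs-mul (w p) (b p)))) (ring₁₂ W (+ p) (+ N))
        (*-monoʳ (+ p + 1ℤ) (nneg p ⊞ nneg 1) (*-mono-≤ (abs-nonneg (w p)) (abs-nonneg (b p)) (subst (_≤ W) (sym (abs-of-nonneg (w≥0 p))) (w≤W p p<P)) (|b|≤ p)))))

      term≤ : ∀ p q → p ℕ.< P → q ℕ.< P → (w p * b p) * (w q * b q) * Σ N (λ n → centred p n * centred q n)
        ≤ 𝟙 (q ℕ.≟ p) * (W * + N * (w q * (b q * b q))) + g p * g q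
      term≤ p q p<P q<P with w-supp p | w-supp q
      ... | inj₁ wp≡0 | _ = subst (_≤ rhs) (sym (trans (cong (λ z → z * b p * (w q * b q) * X) wp≡0) (ring₁₃ (b p) (w q * b q) X))) rhs≥0
        where
        X = Σ N (λ n → centred p n * centred q n)
        rhs = 𝟙 (q ℕ.≟ p) * (W * + N * (w q * (b q * b q))) + g p * g q
        rhs≥0 : 0ℤ ≤ rhs
        rhs≥0 = 𝟙-nonneg (q ℕ.≟ p) ⊠ (0≤W ⊠ nneg N ⊠ (w≥0 q ⊠ sq (b q))) ⊞ g≥0 p ⊠ g≥0 q
      ... | inj₂ _ | inj₁ wq≡0 = subst (_≤ rhs) (sym (trans (cong (λ z → (w p * b p) * (z * b q) * X) wq≡0) (ring₁₄ (w p * b p) (b q) X))) rhs≥0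
        where
        X = Σ N (λ n → centred p n * centred q n)
        rhs = 𝟙 (q ℕ.≟ p) * (W * + N * (w q * (b q * b q))) + g p * g q
        rhs≥0 : 0ℤ ≤ rhs
        rhs≥0 = 𝟙-nonneg (q ℕ.≟ p) ⊠ (0≤W ⊠ nneg N ⊠ (w≥0 q ⊠ sq (b q))) ⊞ g≥0 p ⊠ g≥0 q
      ... | inj₂ pp | inj₂ qq with q ℕ.≟ p
      ...   | yes refl = ≤-trans diag (subst (λ z → W * + N * (w q * (b q * b q)) ≤ z * (W * + N * (w q * (b q * b q))) + g q * g q) (sym (𝟙-yes (q ℕ.≟ q) refl))
                           (cert (g≥0 q ⊠ g≥0 q) (ring₁₅ (W * + N * (w q * (b q * b q))) (g q * g q))))
        where
        X = Σ N (λ n → centred q n * centred q n)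
        diag : (w q * b q) * (w q * b q) * X ≤ W * + N * (w q * (b q * b q))
        diag = cert (w≥0 q ⊠ sq (b q) ⊠ (w≥0 q ⊠ gap X≤ ⊞ nneg N ⊠ gap (w-bound q q<P))) (ring₁₆ (w q) (b q) X (+ q) (+ N) W)
          where
          X≤ : X ≤ + q * + N
          X≤ = Σ-centred² q {{prime⇒nonZero qq}} N (ℕₚ.≤-trans (ℕₚ.*-mono-≤ (ℕₚ.<⇒≤ q<P) (ℕₚ.<⇒≤ q<P)) P²≤N)
      ...   | no q≢p = ≤-trans (≤-abs ((w p * b p) * (w q * b q) * X)) (≤-trans off (≤-reflexive (trans (sym (+-identityˡ (g p * g q)))
                         (cong (λ z → z * (W * + N * (w q * (b q * b q))) + g p * g q) (sym (𝟙-no (q ℕ.≟ p) q≢p))))))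
        where
        X = Σ N (λ n → centred p n * centred q n)
        x = w p * b p
        y = w q * b q
        off : abs (x * y * X) ≤ g p * g q
        off = subst₂ _≤_ (sym (trans (abs-mul (x * y) X) (cong (_* abs X) (abs-mul x y)))) (ring₁₇ (abs x) (abs y) (+ p) (+ q))
          (*-monoˡ (abs x * abs y) (abs-nonneg x ⊠ abs-nonneg y) (Σ-centred-cross pp qq (λ p≡q → q≢p (sym p≡q)) N))

      Σφ²≤ : Σ N (λ n → φ n * φ n) ≤ W * + N * Q + Z * + N * (Z * + N)
      Σφ²≤ = ≤-trans (≤-reflexive Σφ²) (≤-trans (Σ-mono< P (λ p p<P → ≤-trans (Σ-mono< P (λ q q<P → term≤ p q p<P q<P)) (≤-reflexive (inner p p<P))))
        (≤-trans (≤-reflexive (trans (Σ-+ P (λ p → W * + N * (w p * (b p * b p))) (λ p → g p * Σ P g)) (cong₂ _+_ (Σ-*ˡ P (W * + N) (λ p → w p * (b p * b p))) (Σ-*ʳ P (Σ P g) g))))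
          (+-monoʳ-≤ (W * + N * Q) (*-mono-≤ (Σ-nonneg P g≥0) (Σ-nonneg P g≥0) Σg≤ Σg≤))))
        where
        inner : ∀ p → p ℕ.< P → Σ P (λ q → 𝟙 (q ℕ.≟ p) * (W * + N * (w q * (b q * b q))) + g p * g q) ≡ W * + N * (w p * (b p * b p)) + g p * Σ P g
        inner p p<P = trans (Σ-+ P (λ q → 𝟙 (q ℕ.≟ p) * (W * + N * (w q * (b q * b q)))) (λ q → g p * g q))
          (cong₂ _+_ (Σ-pick P p (λ q → W * + N * (w q * (b q * b q))) p<P) (Σ-*ˡ P (g p) g))

      Q²≤ : Q * Q ≤ + N * (W * + N * Q + Z * + N * (Z * + N))
      Q²≤ = ≤-trans (≤-reflexive (cong (λ z → z * z) Q≡)) (≤-trans (cauchy-schwarz N a φ)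
        (*-mono-≤ (Σ-nonneg N (λ n → sq (a n))) (Σ-nonneg N (λ n → sq (φ n))) (subst (Σ N (λ n → a n * a n) ≤_) (*-identityʳ (+ N)) (Σ-≤-const N 1ℤ (λ n _ → a²≤1 n))) Σφ²≤))
        where
        a²≤1 : ∀ n → a n * a n ≤ 1ℤ
        a²≤1 n = subst (_≤ 1ℤ) (abs-sq (a n)) (*-mono-≤ (abs-nonneg (a n)) (abs-nonneg (a n)) (a≤1 n) (a≤1 n))

    -- The inequality Q² ≤ W N² Q + Z² N³ is quadratic in Q. With Z² ≤ N its last term is at most
    -- N⁴, and Q > 2 W N² would violate it.
    bound : Z * Z ≤ + N → Q ≤ + 2 * W * (+ N * + N)
    bound Z²≤N with Q ≤? + 2 * W * (+ N * + N)
    ... | yes p = p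
    ... | no ¬p = ⊥-elim (<⇒≱ (cert< certificate (lem Q W (+ N) Z)) Q²≤)
      where
      n = + N
      y = W * (n * n)
      u = Q - + 2 * W * (n * n) - 1ℤ
      0≤u : 0ℤ ≤ u
      0≤u = gap< (≰⇒> ¬p)
      0≤y : 0ℤ ≤ y
      0≤y = 0≤W ⊠ (nneg N ⊠ nneg N)
      certificate : 0ℤ ≤ y * y + (W - 1ℤ) * (W + 1ℤ) * (n * n * (n * n)) + n * n * n * (n - Z * Z) + + 3 * y + + 3 * y * u + + 2 * u + u * u
      certificate = sq y ⊞ gap 1≤W ⊠ (0≤W ⊞ nneg 1) ⊠ (nneg N ⊠ nneg N ⊠ (nneg N ⊠ nneg N)) ⊞ nneg N ⊠ nneg N ⊠ nneg N ⊠ gap Z²≤N ⊞ nneg 3 ⊠ 0≤y ⊞ nneg 3 ⊠ 0≤y ⊠ 0≤u ⊞ nneg 2 ⊠ 0≤u ⊞ 0≤u ⊠ 0≤u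
      lem : ∀ Q W n Z → let y = W * (n * n) ; u = Q - + 2 * W * (n * n) - 1ℤ in
        Q * Q - n * (W * n * Q + Z * n * (Z * n)) - 1ℤ ≡ y * y + (W - 1ℤ) * (W + 1ℤ) * (n * n * (n * n)) + n * n * n * (n - Z * Z) + + 3 * y + + 3 * y * u + + 2 * u + u * u
      lem = solve-∀

-- Scales of primes on which the mean square deviation is small.

module GoodScales where
  open ℤ-Arithmetic
  open IntegerSums
  open Chebyshev using (primeCount; scaleCount; scaleCount-lower)
  open TuranKubilius

  private
    ring₁ : ∀ K Λ E → (K * Λ + K) * E ≡ K * ((1ℤ + Λ) * E)
    ring₁ = solve-∀

    ring₂ : ∀ K c → + 128 * K * c ≡ K * (+ 128 * c)
    ring₂ = solve-∀

    ring₃ : ∀ K Λ E → K * (Λ * E) ≡ (K * Λ + 0ℤ) * E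
    ring₃ = solve-∀

    ring₄ : ∀ K Λ m E c s → + 128 * K * (+ 64 * c + s) - (K * Λ + (1ℤ + m)) * (+ 64 * E) ≡ + 64 * (+ 128 * K * c - (K * Λ + m) * E) + + 64 * ((K + K) * s - E)
    ring₄ = solve-∀

    ring₅ : ∀ M D c S s F → D * (+ 64 * S + F) - M * (+ 64 * c + s) ≡ + 64 * (D * S - M * c) + (D * F - M * s)
    ring₅ = solve-∀

    ring₆ : ∀ D I X M c V → M * ((1ℤ + + 256 * (D * I)) * X) - M * (+ 128 * c) - 1ℤ ≡ + 128 * (D * V - M * c) + + 128 * D * (I * (+ 2 * X * M) - V) + (M * X - 1ℤ)
    ring₆ = solve-∀

  scaleSum : ℕ → (ℕ → ℤ) → ℤ
  scaleSum κ F = Σ (63 ℕ.* 64 ℕ.^ κ) (λ i → 𝟙 (prime? (suc (64 ℕ.^ κ ℕ.+ i))) * F (suc (64 ℕ.^ κ ℕ.+ i)))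

  Σ-primes : ∀ x h → Σ h (λ i → 𝟙 (prime? (suc (x ℕ.+ i)))) ≡ + primeCount x h
  Σ-primes x zero = refl
  Σ-primes x (suc h) = trans (+-comm (Σ h (λ i → 𝟙 (prime? (suc (x ℕ.+ i))))) (𝟙 (prime? (suc (x ℕ.+ h)))))
    (trans (cong (λ z → 𝟙 (prime? (suc (x ℕ.+ h))) + z) (Σ-primes x h)) (go (prime? (suc (x ℕ.+ h)))))
    where
    go : (d : Dec (Prime (suc (x ℕ.+ h)))) → 𝟙 d + + primeCount x h ≡ + ((if does d then 1 else 0) ℕ.+ primeCount x h)
    go (yes _) = refl
    go (no _) = refl

  scaleSum-const : ∀ κ c → scaleSum κ (λ _ → c) ≡ + scaleCount κ * c
  scaleSum-const κ c = trans (Σ-*ʳ (63 ℕ.* 64 ℕ.^ κ) c (λ i → 𝟙 (prime? (suc (64 ℕ.^ κ ℕ.+ i))))) (cong (_* c) (Σ-primes (64 ℕ.^ κ) (63 ℕ.* 64 ℕ.^ κ)))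

  module Weights (κ₀ : ℕ) where

    -- An integral substitute for X / p with X = 64^(n + κ₀): a prime in (64^κ, 64^(κ+1)], κ₀ ≤ κ <
    -- n + κ₀, has weight 64^(n + κ₀ - 1 - κ), and p ≤ 64^κ₀ has weight 0. The recursion in `n`
    -- multiplies the old weights by 64 and adds one new scale.
    weight : ℕ → ℕ → ℤ
    weight zero p = 0ℤ
    weight (suc n) p = if does (p ℕ.≤? 64 ℕ.^ (n ℕ.+ κ₀)) then + 64 * weight n p else 𝟙 (prime? p)

    private
      weight-≤ : ∀ n p → p ℕ.≤ 64 ℕ.^ (n ℕ.+ κ₀) → weight (suc n) p ≡ + 64 * weight n p
      weight-≤ n p p≤ = go (p ℕ.≤? 64 ℕ.^ (n ℕ.+ κ₀))
        where
        go : (d : Dec (p ℕ.≤ 64 ℕ.^ (n ℕ.+ κ₀))) → (if does d then + 64 * weight n p else 𝟙 (prime? p)) ≡ + 64 * weight n p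
        go (yes _) = refl
        go (no ¬p≤) = ⊥-elim (¬p≤ p≤)

      weight-> : ∀ n p → 64 ℕ.^ (n ℕ.+ κ₀) ℕ.< p → weight (suc n) p ≡ 𝟙 (prime? p)
      weight-> n p p> = go (p ℕ.≤? 64 ℕ.^ (n ℕ.+ κ₀))
        where
        go : (d : Dec (p ℕ.≤ 64 ℕ.^ (n ℕ.+ κ₀))) → (if does d then + 64 * weight n p else 𝟙 (prime? p)) ≡ 𝟙 (prime? p)
        go (yes p≤) = ⊥-elim (ℕₚ.<⇒≱ p> p≤)
        go (no _) = refl

    weight≥0 : ∀ n p → 0ℤ ≤ weight n p
    weight≥0 zero p = nneg 0
    weight≥0 (suc n) p with ℕₚ.≤-<-connex p (64 ℕ.^ (n ℕ.+ κ₀))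
    ... | inj₁ p≤ = subst (0ℤ ≤_) (sym (weight-≤ n p p≤)) (nneg 64 ⊠ weight≥0 n p)
    ... | inj₂ p> = subst (0ℤ ≤_) (sym (weight-> n p p>)) (𝟙-nonneg (prime? p))

    weight-supp : ∀ n p → weight n p ≡ 0ℤ ⊎ Prime p
    weight-supp zero p = inj₁ refl
    weight-supp (suc n) p with ℕₚ.≤-<-connex p (64 ℕ.^ (n ℕ.+ κ₀)) | weight-supp n p
    ... | inj₁ p≤ | inj₁ eq = inj₁ (trans (weight-≤ n p p≤) (cong (+ 64 *_) eq))
    ... | inj₁ p≤ | inj₂ pp = inj₂ pp
    ... | inj₂ p> | _ = go (prime? p)
      where
      go : Dec (Prime p) → weight (suc n) p ≡ 0ℤ ⊎ Prime p
      go (yes pp) = inj₂ pp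
      go (no ¬pp) = inj₁ (trans (weight-> n p p>) (𝟙-no (prime? p) ¬pp))

    weight-bound : ∀ n p → p ℕ.< suc (64 ℕ.^ (n ℕ.+ κ₀)) → weight n p * + p ≤ + (64 ℕ.^ (n ℕ.+ κ₀))
    weight-bound zero p _ = nneg (64 ℕ.^ κ₀)
    weight-bound (suc n) p p<P with ℕₚ.≤-<-connex p (64 ℕ.^ (n ℕ.+ κ₀))
    ... | inj₁ p≤ = subst₂ _≤_ (trans (sym (*-assoc (+ 64) (weight n p) (+ p))) (cong (_* + p) (sym (weight-≤ n p p≤)))) (sym (pos-* 64 (64 ℕ.^ (n ℕ.+ κ₀))))
                      (*-monoˡ (+ 64) (nneg 64) (weight-bound n p (ℕ.s≤s p≤)))
    ... | inj₂ p> = ≤-trans (≤-reflexive (cong (_* + p) (weight-> n p p>))) (≤-trans (*-monoʳ (+ p) (nneg p) (𝟙-≤1 (prime? p)))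
                      (≤-trans (≤-reflexive (*-identityˡ (+ p))) (+≤+ (ℕ.s≤s⁻¹ p<P))))

    weightedSum : ℕ → (ℕ → ℤ) → ℤ
    weightedSum n F = Σ (suc (64 ℕ.^ (n ℕ.+ κ₀))) (λ p → weight n p * F p)

    weightedSum-zero : ∀ F → weightedSum 0 F ≡ 0ℤ
    weightedSum-zero F = Σ-zero (suc (64 ℕ.^ κ₀))

    weightedSum-suc : ∀ n F → weightedSum (suc n) F ≡ + 64 * weightedSum n F + scaleSum (n ℕ.+ κ₀) F
    weightedSum-suc n F = trans (Σ-split (suc X) (63 ℕ.* X) (λ p → weight (suc n) p * F p)) (cong₂ _+_
      (trans (Σ-cong< (suc X) (λ p p<1+X → trans (cong (_* F p) (weight-≤ n p (ℕ.s≤s⁻¹ p<1+X))) (*-assoc (+ 64) (weight n p) (F p))))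
        (Σ-*ˡ (suc X) (+ 64) (λ p → weight n p * F p)))
      (Σ-cong (63 ℕ.* X) (λ i → cong (_* F (suc (X ℕ.+ i))) (weight-> n (suc (X ℕ.+ i)) (ℕ.s≤s (ℕₚ.m≤m+n X i))))))
      where X = 64 ℕ.^ (n ℕ.+ κ₀)

    count : ℕ → ℤ
    count n = weightedSum n (λ _ → 1ℤ)

    count-suc : ∀ n → count (suc n) ≡ + 64 * count n + + scaleCount (n ℕ.+ κ₀)
    count-suc n = trans (weightedSum-suc n (λ _ → 1ℤ)) (cong (λ z → + 64 * count n + z) (trans (scaleSum-const (n ℕ.+ κ₀) 1ℤ) (*-identityʳ (+ scaleCount (n ℕ.+ κ₀)))))

    -- Σ |S_κ| / 64^κ diverges: each doubling of the range of κ adds at least 1/128.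
    count-doubling : 1 ℕ.≤ κ₀ → ∀ n Λ → + Λ * + (64 ℕ.^ (n ℕ.+ κ₀)) ≤ + 128 * count n →
      ∃ λ n′ → + suc Λ * + (64 ℕ.^ (n′ ℕ.+ κ₀)) ≤ + 128 * count n′
    count-doubling 1≤κ₀ n Λ hyp = K ℕ.+ n , *-cancelˡ (+ K) (+<+ 1≤K) (subst₂ _≤_ (ring₁ (+ K) (+ Λ) (E (K ℕ.+ n))) (ring₂ (+ K) (count (K ℕ.+ n))) (claim K ℕₚ.≤-refl))
      where
      K = n ℕ.+ κ₀
      1≤K : 1 ℕ.≤ K
      1≤K = ℕₚ.≤-trans 1≤κ₀ (ℕₚ.m≤n+m κ₀ n)
      E : ℕ → ℤ
      E j = + (64 ℕ.^ (j ℕ.+ κ₀))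
      E-suc : ∀ j → E (suc j) ≡ + 64 * E j
      E-suc j = pos-* 64 (64 ℕ.^ (j ℕ.+ κ₀))
      lower : ∀ k → 1 ℕ.≤ k → k ℕ.≤ K ℕ.+ K → + (64 ℕ.^ k) ≤ (+ K + + K) * + scaleCount k
      lower (suc k) _ k≤ = ≤-trans (+≤+ (scaleCount-lower k)) (≤-trans (≤-reflexive (pos-* (suc k) (scaleCount (suc k)))) (*-monoʳ (+ scaleCount (suc k)) (nneg (scaleCount (suc k))) (+≤+ k≤)))
      -- Each of the K scales K ≤ κ < 2K contributes |S_κ| / 64^(κ+1) ≥ 1 / (64 · 2K) to the
      -- normalised count, in total 1/128.
      claim : ∀ m → m ℕ.≤ K → (+ K * + Λ + + m) * E (m ℕ.+ n) ≤ + 128 * + K * count (m ℕ.+ n)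
      claim zero _ = subst₂ _≤_ (ring₃ (+ K) (+ Λ) (E n)) (sym (ring₂ (+ K) (count n))) (*-monoˡ (+ K) (nneg K) hyp)
      claim (suc m) m<K = subst₂ _≤_ (cong (λ z → (+ K * + Λ + + suc m) * z) (sym (E-suc (m ℕ.+ n)))) (cong (λ z → + 128 * + K * z) (sym (count-suc (m ℕ.+ n))))
        (cert (nneg 64 ⊠ gap (claim m (ℕₚ.<⇒≤ m<K)) ⊞ nneg 64 ⊠ gap (lower (m ℕ.+ n ℕ.+ κ₀) (ℕₚ.≤-trans 1≤κ₀ (ℕₚ.m≤n+m κ₀ (m ℕ.+ n)))
            (subst (ℕ._≤ K ℕ.+ K) (sym (ℕₚ.+-assoc m n κ₀)) (ℕₚ.+-monoˡ-≤ K (ℕₚ.<⇒≤ m<K)))))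
          (ring₄ (+ K) (+ Λ) (+ m) (E (m ℕ.+ n)) (count (m ℕ.+ n)) (+ scaleCount (m ℕ.+ n ℕ.+ κ₀))))

    count-diverges : 1 ℕ.≤ κ₀ → ∀ Λ → ∃ λ n → + Λ * + (64 ℕ.^ (n ℕ.+ κ₀)) ≤ + 128 * count n
    count-diverges 1≤κ₀ zero = 0 , ≤-reflexive (sym (cong (+ 128 *_) (weightedSum-zero (λ _ → 1ℤ))))
    count-diverges 1≤κ₀ (suc Λ) = let (n , hyp) = count-diverges 1≤κ₀ Λ in count-doubling 1≤κ₀ n Λ hyp

    -- Pigeonhole: if the bound fails on every scale, the reversed inequalities add up, with the
    -- weights, to one for the weighted sums.
    find-scale : ∀ (F : ℕ → ℤ) (D M : ℤ) n →
      (∃ λ j → j ℕ.< n × D * scaleSum (j ℕ.+ κ₀) F ≤ M * + scaleCount (j ℕ.+ κ₀)) ⊎ (M * count n ≤ D * weightedSum n F)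
    find-scale F D M zero = inj₂ (≤-reflexive (trans (cong (M *_) (weightedSum-zero (λ _ → 1ℤ))) (trans (*-zeroʳ M) (sym (trans (cong (D *_) (weightedSum-zero F)) (*-zeroʳ D))))))
    find-scale F D M (suc n) = go (D * scaleSum (n ℕ.+ κ₀) F ≤? M * + scaleCount (n ℕ.+ κ₀)) (find-scale F D M n)
      where
      go : Dec (D * scaleSum (n ℕ.+ κ₀) F ≤ M * + scaleCount (n ℕ.+ κ₀)) →
        (∃ λ j → j ℕ.< n × D * scaleSum (j ℕ.+ κ₀) F ≤ M * + scaleCount (j ℕ.+ κ₀)) ⊎ (M * count n ≤ D * weightedSum n F) →
        (∃ λ j → j ℕ.< suc n × D * scaleSum (j ℕ.+ κ₀) F ≤ M * + scaleCount (j ℕ.+ κ₀)) ⊎ (M * count (suc n) ≤ D * weightedSum (suc n) F)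
      go (yes p) _ = inj₁ (n , ℕₚ.≤-refl , p)
      go (no _) (inj₁ (j , j<n , p)) = inj₁ (j , ℕₚ.m<n⇒m<1+n j<n , p)
      go (no ¬p) (inj₂ q) = inj₂ (subst₂ _≤_ (cong (M *_) (sym (count-suc n))) (cong (D *_) (sym (weightedSum-suc n F)))
        (cert (nneg 64 ⊠ gap q ⊞ gap (<⇒≤ (≰⇒> ¬p))) (ring₅ M D (count n) (weightedSum n F) (+ scaleCount (n ℕ.+ κ₀)) (scaleSum (n ℕ.+ κ₀) F))))

  scaleSum-mono : ∀ κ {F G : ℕ → ℤ} → (∀ p → Prime p → 64 ℕ.^ κ ℕ.< p → p ℕ.≤ 64 ℕ.^ suc κ → F p ≤ G p) → scaleSum κ F ≤ scaleSum κ G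
  scaleSum-mono κ {F} {G} h = Σ-mono< (63 ℕ.* X) (λ i i< → go i i< (prime? (suc (X ℕ.+ i))))
    where
    X = 64 ℕ.^ κ
    go : ∀ i → i ℕ.< 63 ℕ.* X → (d : Dec (Prime (suc (X ℕ.+ i)))) → 𝟙 d * F (suc (X ℕ.+ i)) ≤ 𝟙 d * G (suc (X ℕ.+ i))
    go i i< (yes pp) = *-monoˡ 1ℤ (nneg 1) (h (suc (X ℕ.+ i)) pp (ℕ.s≤s (ℕₚ.m≤m+n X i)) (subst (ℕ._≤ X ℕ.+ 63 ℕ.* X) (ℕₚ.+-suc X i) (ℕₚ.+-monoʳ-≤ X i<)))
    go i i< (no _) = ≤-refl

  -- The order of quantifiers matters. The range `n` of scales and the threshold `N₀` precede `N`
  -- and the sequences, so the primes remain bounded as N grows; and one κ serves all I sequences,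
  -- whose lengths may differ.
  GoodScale : (κ₀ D I n N₀ : ℕ) → Set
  GoodScale κ₀ D I n N₀ = ∀ N (a : ℕ → ℕ → ℤ) (Nᵢ : ℕ → ℕ) →
    (∀ i m → abs (a i m) ≤ 1ℤ) → (∀ i → i ℕ.< I → N₀ ℕ.≤ Nᵢ i × Nᵢ i ℕ.≤ N) →
    ∃ λ κ → κ₀ ℕ.≤ κ × κ ℕ.< n ℕ.+ κ₀ × (∀ i → i ℕ.< I →
      + D * scaleSum κ (λ p → deviation (a i) (Nᵢ i) p * deviation (a i) (Nᵢ i) p) ≤ + N * + N * + scaleCount κ)

  good-scale : ∀ κ₀ → 1 ℕ.≤ κ₀ → ∀ D I′ → ∃₂ λ n N₀ → GoodScale κ₀ D (suc I′) n N₀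
  good-scale κ₀ 1≤κ₀ D I′ = n , N₀ , result
    where
    open Weights κ₀
    I = suc I′
    -- The Turán-Kubilius bound summed over I sequences is 2 I X N². If every scale failed, 128
    -- times the count would be at most 256 D I X; the extra 1 contradicts this.
    Λ = suc (256 ℕ.* (D ℕ.* I))
    n = proj₁ (count-diverges 1≤κ₀ Λ)
    diverges = proj₂ (count-diverges 1≤κ₀ Λ)
    X = 64 ℕ.^ (n ℕ.+ κ₀)
    P = suc X
    Z = Σ P (λ p → + X * ((+ p + 1ℤ) * (+ p + 1ℤ)))
    N₀ = P ℕ.* P ℕ.+ ∣ Z * Z ∣
    1≤X : 1ℤ ≤ + X
    1≤X = +≤+ (ℕₚ.m^n>0 64 (n ℕ.+ κ₀))

    result : GoodScale κ₀ D I n N₀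
    result N a Nᵢ a≤1 Nᵢ-bounds = conclude (find-scale total (+ D) M n)
      where
      M = + N * + N
      sqr : ℕ → ℕ → ℤ
      sqr i p = deviation (a i) (Nᵢ i) p * deviation (a i) (Nᵢ i) p
      total : ℕ → ℤ
      total p = Σ I (λ i → sqr i p)
      V = weightedSum n total
      single : ∀ i → i ℕ.< I → ∀ p → sqr i p ≤ total p
      single i i<I p = subst (_≤ total p) (Σ-pick I i (λ k → sqr k p) i<I)
        (Σ-mono I (λ k → ≤-trans (*-monoʳ (sqr k p) (sq (deviation (a k) (Nᵢ k) p)) (𝟙-≤1 (k ℕ.≟ i))) (≤-reflexive (*-identityˡ (sqr k p)))))
      N≥1 : 1 ℕ.≤ N
      N≥1 = ℕₚ.≤-trans (ℕ.s≤s ℕ.z≤n) (ℕₚ.≤-trans (proj₁ (Nᵢ-bounds 0 (ℕ.s≤s ℕ.z≤n))) (proj₂ (Nᵢ-bounds 0 (ℕ.s≤s ℕ.z≤n))))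
      each : ∀ i → i ℕ.< I → weightedSum n (sqr i) ≤ + 2 * + X * M
      each i i<I = ≤-trans
        (DualTuránKubilius.bound (a i) (a≤1 i) (Nᵢ i) P (weight n) (+ X) (weight≥0 n) (weight-supp n) (weight-bound n)
          (ℕₚ.≤-trans (ℕₚ.m≤m+n (P ℕ.* P) ∣ Z * Z ∣) N₀≤) 1≤X
          (≤-trans (≤-reflexive (sym (abs-of-nonneg (sq Z)))) (+≤+ (ℕₚ.≤-trans (ℕₚ.m≤n+m ∣ Z * Z ∣ (P ℕ.* P)) N₀≤))))
        (*-monoˡ (+ 2 * + X) (nneg 2 ⊠ nneg X) (*-mono-≤ (nneg (Nᵢ i)) (nneg (Nᵢ i)) (+≤+ Nᵢ≤N) (+≤+ Nᵢ≤N)))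
        where
        N₀≤ = proj₁ (Nᵢ-bounds i i<I)
        Nᵢ≤N = proj₂ (Nᵢ-bounds i i<I)
      V≤ : V ≤ + I * (+ 2 * + X * M)
      V≤ = subst (_≤ + I * (+ 2 * + X * M)) (trans (Σ-swap I P (λ i p → weight n p * sqr i p)) (Σ-cong P (λ p → Σ-*ˡ I (weight n p) (λ i → sqr i p))))
        (Σ-≤-const I (+ 2 * + X * M) each)
      M≥1 : 1ℤ ≤ M
      M≥1 = *-mono-≤ (nneg 1) (nneg 1) (+≤+ N≥1) (+≤+ N≥1)
      Λ≡ : + Λ ≡ 1ℤ + + 256 * (+ D * + I)
      Λ≡ = cong (λ z → 1ℤ + z) (trans (pos-* 256 (D ℕ.* I)) (cong (+ 256 *_) (pos-* D I)))
      contradict : ∀ D I X M c V Λ → Λ ≡ 1ℤ + + 256 * (D * I) → 0ℤ ≤ D → 0ℤ ≤ M → M * c ≤ D * V → V ≤ I * (+ 2 * X * M) → 1ℤ ≤ M * X →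
        ¬ (Λ * X ≤ + 128 * c)
      contradict D I X M c V _ refl 0≤D 0≤M h₁ h₂ h₃ h₄ = <⇒≱
        (cert< {M * (+ 128 * c)} {M * ((1ℤ + + 256 * (D * I)) * X)} (nneg 128 ⊠ gap h₁ ⊞ nneg 128 ⊠ 0≤D ⊠ gap h₂ ⊞ gap h₃) (ring₆ D I X M c V)) (*-monoˡ M 0≤M h₄)
      conclude : (∃ λ j → j ℕ.< n × + D * scaleSum (j ℕ.+ κ₀) total ≤ M * + scaleCount (j ℕ.+ κ₀)) ⊎ (M * count n ≤ + D * V) →
        ∃ λ κ → κ₀ ℕ.≤ κ × κ ℕ.< n ℕ.+ κ₀ × (∀ i → i ℕ.< I → + D * scaleSum κ (sqr i) ≤ M * + scaleCount κ)
      conclude (inj₁ (j , j<n , hyp)) = j ℕ.+ κ₀ , ℕₚ.m≤n+m κ₀ j , ℕₚ.+-monoˡ-< κ₀ j<n , λ i i<I →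
        ≤-trans (*-monoˡ (+ D) (nneg D) (scaleSum-mono (j ℕ.+ κ₀) (λ p _ _ _ → single i i<I p))) hyp
      conclude (inj₂ hyp) = ⊥-elim (contradict (+ D) (+ I) (+ X) M (count n) V (+ Λ) Λ≡ (nneg D) (nneg N ⊠ nneg N) hyp V≤ (*-mono-≤ (nneg 1) (nneg 1) M≥1 1≤X) diverges)

-- From deviations to sums of μ(m) f(p m).

module Twists where
  open import Defs using (μ)
  open import Data.Nat.Divisibility using (_∣_; _∣?_; _∣0)
  open ℤ-Arithmetic
  open IntegerSums
  open Moebius
  open TuranKubilius

  private
    ring₁ : ∀ x p d → x * (p * d - 1ℤ) ≡ p * (d * x) - x
    ring₁ = solve-∀

    ring₂ : ∀ p A B F → p * B + F ≡ p * (A + B) + - (p * A - F)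
    ring₂ = solve-∀

    ring₃ : ∀ p m → + 2 * (p * m) ≡ p * (+ 2 * m)
    ring₃ = solve-∀

  abs-triangle : ∀ {x y b c} → abs x ≤ b → abs y ≤ c → abs (x + y) ≤ b + c
  abs-triangle {x} {y} p q = ≤-trans (abs-+ x y) (+-mono-≤ p q)

  abs-mul-≤1 : ∀ {x y} → abs x ≤ 1ℤ → abs y ≤ 1ℤ → abs (x * y) ≤ 1ℤ
  abs-mul-≤1 {x} {y} p q = ≤-trans (≤-reflexive (abs-mul x y)) (*-mono-≤ (abs-nonneg x) (abs-nonneg y) p q)

  μ-cancel : ∀ {p} → Prime p → ∀ m → abs (μ (p ℕ.* m) + μ m) ≤ + 2 * 𝟙 (p ∣? m)
  μ-cancel {p} pp m = go (p ∣? m)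
    where
    go : (d : Dec (p ∣ m)) → abs (μ (p ℕ.* m) + μ m) ≤ + 2 * 𝟙 d
    go (yes _) = abs-triangle {μ (p ℕ.* m)} {μ m} (abs-μ-≤1 (p ℕ.* m)) (abs-μ-≤1 m)
    go (no p∤m) = ≤-reflexive (cong abs (trans (cong (_+ μ m) (μ-prime-* pp p∤m {{m≢0}})) (+-inverseˡ (μ m))))
      where
      m≢0 : NonZero m
      m≢0 = ℕ.≢-nonZero (λ { refl → p∤m (p ∣0) })

  module _ (f : ℕ → ℤ) (f≤1 : ∀ n → abs (f n) ≤ 1ℤ) where

    -- For p ∤ m the summand at pm is −μ(m) f(pm), so a small deviation forces p Σ μ(m) f(pm) ≈ −Σ μ(n) f(n).
    deviation-twist : ∀ {p} → Prime p → ∀ N → let c = multiples p N in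
      abs (+ p * Σ c (λ m → μ m * f (p ℕ.* m)) + Σ N (λ n → μ n * f n)) ≤ abs (deviation (λ n → μ n * f n) N p) + + 2 * (+ c + + p)
    deviation-twist {p} pp N = begin
      abs (+ p * B + F) ≡⟨ cong abs relation ⟩
      abs (+ p * (A + B) + - dev) ≤⟨ abs-+ (+ p * (A + B)) (- dev) ⟩
      abs (+ p * (A + B)) + abs (- dev) ≤⟨ +-mono-≤ p[A+B]≤ (≤-reflexive (abs-neg dev)) ⟩
      + 2 * (+ c + + p) + abs dev ≡⟨ +-comm (+ 2 * (+ c + + p)) (abs dev) ⟩
      abs dev + + 2 * (+ c + + p) ∎
      where
      open ≤-Reasoning
      instance p≢0 = prime⇒nonZero pp
      c = multiples p N
      F = Σ N (λ n → μ n * f n)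
      A = Σ c (λ m → μ (p ℕ.* m) * f (p ℕ.* m))
      B = Σ c (λ m → μ m * f (p ℕ.* m))
      dev = deviation (λ n → μ n * f n) N p
      dev≡ : dev ≡ + p * A - F
      dev≡ = begin-equality
        Σ N (λ n → μ n * f n * (+ p * 𝟙 (p ∣? n) - 1ℤ)) ≡⟨ Σ-cong N (λ n → ring₁ (μ n * f n) (+ p) (𝟙 (p ∣? n))) ⟩
        Σ N (λ n → + p * (𝟙 (p ∣? n) * (μ n * f n)) - μ n * f n) ≡⟨ Σ-minus N (λ n → + p * (𝟙 (p ∣? n) * (μ n * f n))) (λ n → μ n * f n) ⟩
        Σ N (λ n → + p * (𝟙 (p ∣? n) * (μ n * f n))) - F
          ≡⟨ cong (_- F) (trans (Σ-*ˡ N (+ p) (λ n → 𝟙 (p ∣? n) * (μ n * f n))) (cong (+ p *_) (Σ-multiples p N (λ n → μ n * f n)))) ⟩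
        + p * A - F ∎
      relation : + p * B + F ≡ + p * (A + B) + - dev
      relation = trans (ring₂ (+ p) A B F) (cong (λ z → + p * (A + B) + - z) (sym dev≡))
      A+B≤ : abs (A + B) ≤ + 2 * + multiples p c
      A+B≤ = begin
        abs (A + B) ≡⟨ cong abs (trans (sym (Σ-+ c (λ m → μ (p ℕ.* m) * f (p ℕ.* m)) (λ m → μ m * f (p ℕ.* m)))) (Σ-cong c (λ m → sym (*-distribʳ-+ (f (p ℕ.* m)) (μ (p ℕ.* m)) (μ m))))) ⟩
        abs (Σ c (λ m → (μ (p ℕ.* m) + μ m) * f (p ℕ.* m))) ≤⟨ Σ-abs c (λ m → (μ (p ℕ.* m) + μ m) * f (p ℕ.* m)) ⟩
        Σ c (λ m → abs ((μ (p ℕ.* m) + μ m) * f (p ℕ.* m))) ≤⟨ Σ-mono c (λ m → subst₂ _≤_ (sym (abs-mul (μ (p ℕ.* m) + μ m) (f (p ℕ.* m)))) (*-identityʳ (+ 2 * 𝟙 (p ∣? m)))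
            (*-mono-≤ (abs-nonneg (μ (p ℕ.* m) + μ m)) (abs-nonneg (f (p ℕ.* m))) (μ-cancel pp m) (f≤1 (p ℕ.* m)))) ⟩
        Σ c (λ m → + 2 * 𝟙 (p ∣? m)) ≡⟨ trans (Σ-*ˡ c (+ 2) (λ m → 𝟙 (p ∣? m))) (cong (+ 2 *_) (Σ-𝟙-multiples p c)) ⟩
        + 2 * + multiples p c ∎
      p[A+B]≤ : abs (+ p * (A + B)) ≤ + 2 * (+ c + + p)
      p[A+B]≤ = subst (_≤ + 2 * (+ c + + p)) (sym (abs-mul (+ p) (A + B)))
        (≤-trans (*-monoˡ (+ p) (nneg p) A+B≤) (subst (_≤ + 2 * (+ c + + p)) (ring₃ (+ p) (+ multiples p c)) (*-monoˡ (+ 2) (nneg 2) (multiples-upperℤ p c))))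

-- Sums with concentrated support; a discrete intermediate value theorem.

module Counting where
  open ℤ-Arithmetic
  open IntegerSums

  private
    ring₁ : ∀ x y → x + y - x ≡ y
    ring₁ = solve-∀

    ring₂ : ∀ x y → y - x - y ≡ 0ℤ - x
    ring₂ = solve-∀

  first-nonzero : ∀ n (g : ℕ → ℤ) → (∀ t → t ℕ.< n → g t ≡ 0ℤ) ⊎ ∃ λ t₀ → t₀ ℕ.< n × ¬ g t₀ ≡ 0ℤ × (∀ t → t ℕ.< t₀ → g t ≡ 0ℤ)
  first-nonzero zero g = inj₁ (λ t ())
  first-nonzero (suc n) g with first-nonzero n g
  ... | inj₂ (t₀ , t₀<n , nz , z) = inj₂ (t₀ , ℕₚ.m<n⇒m<1+n t₀<n , nz , z)
  ... | inj₁ zeros with g n ≟ 0ℤ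
  ...   | no gn≢0 = inj₂ (n , ℕₚ.≤-refl , gn≢0 , zeros)
  ...   | yes gn≡0 = inj₁ (λ t t<1+n → case (ℕₚ.m≤n⇒m<n∨m≡n (ℕ.s≤s⁻¹ t<1+n)))
    where
    case : ∀ {t} → t ℕ.< n ⊎ t ≡ n → g t ≡ 0ℤ
    case (inj₁ t<n) = zeros _ t<n
    case (inj₂ refl) = gn≡0

  Σ-vanishing : ∀ n (g : ℕ → ℤ) → (∀ t → t ℕ.< n → g t ≡ 0ℤ) → Σ n g ≡ 0ℤ
  Σ-vanishing n g z = trans (Σ-cong< n z) (Σ-zero n)

  -- The window of length h starts at the first zero-free place of `g`; closeness makes `g` vanish
  -- from its end on. The majorant χ stands for all primes of the window, for which a bound is
  -- available, whereas g selects some of them.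
  Σ-concentrated : ∀ n h B (g χ : ℕ → ℤ) → 0ℤ ≤ B → (∀ t → g t ≤ χ t) → (∀ t → 0ℤ ≤ χ t) →
    (∀ t t′ → t ℕ.≤ t′ → ¬ g t ≡ 0ℤ → ¬ g t′ ≡ 0ℤ → t′ ℕ.< t ℕ.+ h) →
    (∀ t → t ℕ.< n → ¬ g t ≡ 0ℤ → Σ h (λ i → χ (t ℕ.+ i)) ≤ B) → Σ n g ≤ B
  Σ-concentrated n h B g χ 0≤B g≤χ 0≤χ close bound with first-nonzero n g
  ... | inj₁ zeros = subst (_≤ B) (sym (Σ-vanishing n g zeros)) 0≤B
  ... | inj₂ (t₀ , t₀<n , nz , zeros) = ≤-trans total (bound t₀ t₀<n nz)
    where
    rest : ∀ d k → (∀ i → k ℕ.≤ i → g (t₀ ℕ.+ i) ≡ 0ℤ) → Σ d (λ i → g (t₀ ℕ.+ i)) ≤ Σ k (λ i → χ (t₀ ℕ.+ i))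
    rest d k z with ℕₚ.≤-total k d
    ... | inj₁ k≤d = ≤-trans (≤-reflexive (Σ-extend (λ i → g (t₀ ℕ.+ i)) k≤d z)) (Σ-mono k (λ i → g≤χ (t₀ ℕ.+ i)))
    ... | inj₂ d≤k = ≤-trans (Σ-mono d (λ i → g≤χ (t₀ ℕ.+ i))) (subst (Σ d (λ i → χ (t₀ ℕ.+ i)) ≤_) (trans (sym (Σ-split d (k ℕ.∸ d) (λ i → χ (t₀ ℕ.+ i)))) (cong (λ z → Σ z (λ i → χ (t₀ ℕ.+ i))) (ℕₚ.m+[n∸m]≡n d≤k)))
        (cert (Σ-nonneg (k ℕ.∸ d) (λ i → 0≤χ (t₀ ℕ.+ (d ℕ.+ i)))) (ring₁ (Σ d (λ i → χ (t₀ ℕ.+ i))) (Σ (k ℕ.∸ d) (λ i → χ (t₀ ℕ.+ (d ℕ.+ i)))))))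
    far : ∀ i → h ℕ.≤ i → g (t₀ ℕ.+ i) ≡ 0ℤ
    far i h≤i with g (t₀ ℕ.+ i) ≟ 0ℤ
    ... | yes z = z
    ... | no nz′ = ⊥-elim (ℕₚ.<⇒≱ (close t₀ (t₀ ℕ.+ i) (ℕₚ.m≤m+n t₀ i) nz nz′) (ℕₚ.+-monoʳ-≤ t₀ h≤i))
    total : Σ n g ≤ Σ h (λ i → χ (t₀ ℕ.+ i))
    total = ≤-trans (≤-reflexive (trans (cong (λ z → Σ z g) (sym (ℕₚ.m+[n∸m]≡n (ℕₚ.<⇒≤ t₀<n)))) (trans (Σ-split t₀ (n ℕ.∸ t₀) g)
      (trans (cong (_+ Σ (n ℕ.∸ t₀) (λ i → g (t₀ ℕ.+ i))) (Σ-vanishing t₀ g zeros)) (+-identityˡ _))))) (rest (n ℕ.∸ t₀) h far)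

  Σ-single : ∀ n B (g : ℕ → ℤ) → 0ℤ ≤ B → (∀ t → t ℕ.< n → g t ≤ B) →
    (∀ t t′ → t ℕ.< n → t′ ℕ.< n → ¬ g t ≡ 0ℤ → ¬ g t′ ≡ 0ℤ → t ≡ t′) → Σ n g ≤ B
  Σ-single zero B g 0≤B _ _ = 0≤B
  Σ-single (suc n) B g 0≤B g≤B unique with g n ≟ 0ℤ
  ... | yes gn≡0 = subst (_≤ B) (sym (trans (cong (λ z → Σ n g + z) gn≡0) (+-identityʳ (Σ n g))))
    (Σ-single n B g 0≤B (λ t t<n → g≤B t (ℕₚ.m<n⇒m<1+n t<n)) (λ t t′ t<n t′<n → unique t t′ (ℕₚ.m<n⇒m<1+n t<n) (ℕₚ.m<n⇒m<1+n t′<n)))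
  ... | no gn≢0 = subst (_≤ B) (sym (trans (cong (_+ g n) (Σ-vanishing n g others)) (+-identityˡ (g n)))) (g≤B n ℕₚ.≤-refl)
    where
    others : ∀ t → t ℕ.< n → g t ≡ 0ℤ
    others t t<n with g t ≟ 0ℤ
    ... | yes z = z
    ... | no nz = ⊥-elim (ℕₚ.<-irrefl (unique t n (ℕₚ.m<n⇒m<1+n t<n) ℕₚ.≤-refl nz gn≢0) t<n)

  discrete-ivt : ∀ (D : ℕ → ℤ) (B : ℤ) → (∀ n → abs (D (suc n) - D n) ≤ B) → ∀ d u → D u ≤ 0ℤ → 0ℤ ≤ D (u ℕ.+ d) →
    ∃ λ X → u ℕ.≤ X × X ℕ.≤ u ℕ.+ d × abs (D X) ≤ B
  discrete-ivt D B step zero u Du≤0 0≤Du = u , ℕₚ.≤-refl , ℕₚ.m≤m+n u 0 ,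
    ≤-trans (≤-reflexive (cong abs Du≡0)) (≤-trans (abs-nonneg (D 1 - D 0)) (step 0))
    where
    Du≡0 : D u ≡ 0ℤ
    Du≡0 = ≤-antisym Du≤0 (subst (λ z → 0ℤ ≤ D z) (ℕₚ.+-identityʳ u) 0≤Du)
  discrete-ivt D B step (suc d) u Du≤0 0≤D = go (0ℤ ≤? D (u ℕ.+ d))
    where
    v = u ℕ.+ d
    0≤D′ : 0ℤ ≤ D (suc v)
    0≤D′ = subst (λ z → 0ℤ ≤ D z) (ℕₚ.+-suc u d) 0≤D
    small : D v ≤ 0ℤ → abs (D (suc v)) ≤ B
    small p = begin
      abs (D (suc v)) ≡⟨ abs-of-nonneg 0≤D′ ⟩
      D (suc v) ≤⟨ cert (gap p) (ring₂ (D v) (D (suc v))) ⟩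
      D (suc v) - D v ≤⟨ ≤-abs (D (suc v) - D v) ⟩
      abs (D (suc v) - D v) ≤⟨ step v ⟩
      B ∎
      where open ≤-Reasoning
    go : Dec (0ℤ ≤ D v) → ∃ λ X → u ℕ.≤ X × X ℕ.≤ u ℕ.+ suc d × abs (D X) ≤ B
    go (yes p) = let (X , u≤X , X≤ , h) = discrete-ivt D B step d u Du≤0 p in X , u≤X , ℕₚ.≤-trans X≤ (ℕₚ.+-monoʳ-≤ u (ℕₚ.n≤1+n d)) , h
    go (no ¬p) = suc v , ℕₚ.≤-trans (ℕₚ.m≤m+n u d) (ℕₚ.n≤1+n v) , ℕₚ.≤-reflexive (sym (ℕₚ.+-suc u d)) , small (<⇒≤ (≰⇒> ¬p))

-- Transfer of values of M from X to X / p.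

module Transfer where
  open ℤ-Arithmetic
  open IntegerSums

  private
    ring₁ : ∀ x y → + 4 * (x * y) - 0ℤ - 1ℤ ≡ + 4 * ((x - 0ℤ - 1ℤ) * (y - 0ℤ - 1ℤ) + (x - 0ℤ - 1ℤ) + (y - 0ℤ - 1ℤ)) + + 3
    ring₁ = solve-∀

    ring₂ : ∀ N T u dev Y p X → + 3 * N - T * u ≡ T * (dev + + 2 * (Y + p) - u) + (N - T * dev) + (p - + 2 * T) * Y + (X + p - p * Y) + (N - X) + (N - p * (1ℤ + + 2 * T))
    ring₂ = solve-∀

    ring₃ : ∀ p q I m i Y mx X → p * (q * I * m + i * Y) ≡ (q * I * (p * m + mx) + - (q * I * mx - i * X)) + i * (p * Y - X)
    ring₃ = solve-∀

    ring₄ : ∀ q I p i Y X u → + 0 + (q * I * u + (+ 2 * (q * I) + I * p)) - (q * I * u + + 2 * (q * I) + i * (p * Y - X)) ≡ i * (X + p - p * Y) + (I - i) * p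
    ring₄ = solve-∀

    ring₅ : ∀ R p e → + 4 * (R * p) * (+ 16 * e) ≡ + 64 * R * (p * e)
    ring₅ = solve-∀

    ring₆ : ∀ R q I u p → + 64 * R * (q * I * u + (+ 2 * (q * I) + I * p)) ≡ + 64 * q * I * R * u + + 64 * R * (+ 2 * (q * I) + I * p)
    ring₆ = solve-∀

    ring₇ : ∀ N R X p Y → + 4 * (R * p) * Y - (+ 3 * N + N) ≡ + 4 * (R * X - N) + + 4 * R * (p * Y - X)
    ring₇ = solve-∀

    ring₈ : ∀ Y → + 191 * Y - 0ℤ - 1ℤ ≡ + 191 * (Y - 1ℤ) + + 190
    ring₈ = solve-∀

    ring₉ : ∀ ω → + 16 * ω - 0ℤ - 1ℤ ≡ + 16 * (ω - 1ℤ) + + 15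
    ring₉ = solve-∀

  -- If M(X) ≈ (i / qI) X and p M(Y) ≈ −M(X) with Y ≈ X / p, then M(Y) ≈ −(i / qI) Y.
  transfer : ∀ (p Y X N R T q I i m mx dev : ℤ) → T ≡ + 64 * q * I * R → 0ℤ < R → 0ℤ < p → 0ℤ ≤ T → 0ℤ ≤ q → 0ℤ ≤ I → 0ℤ ≤ Y →
    abs (p * m + mx) ≤ dev + + 2 * (Y + p) → T * dev ≤ N → X ≤ p * Y → p * Y ≤ X + p →
    abs (q * I * mx - i * X) ≤ + 2 * (q * I) → N ≤ R * X → X ≤ N → + 2 * T ≤ p → p * (1ℤ + + 2 * T) ≤ N →
    + 64 * R * (+ 2 * (q * I) + I * p) ≤ N → 0ℤ ≤ i → i ≤ I → + 16 * abs (q * I * m + i * Y) ≤ Y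
  transfer p Y X N R T q I i m mx dev T≡ 0<R 0<p 0≤T 0≤q 0≤I 0≤Y h₁ h₂ h₃ h₃′ h₄ h₅ h₅′ h₆ h₇ h₈ 0≤i i≤I =
    *-cancelˡ (+ 4 * (R * p)) (positive-product 0<R 0<p) (begin
      + 4 * (R * p) * (+ 16 * e) ≡⟨ ring₅ R p e ⟩
      + 64 * R * (p * e) ≤⟨ *-monoˡ (+ 64 * R) (nneg 64 ⊠ 0≤R) step₂ ⟩
      + 64 * R * (q * I * u + (+ 2 * (q * I) + I * p)) ≡⟨ ring₆ R q I u p ⟩
      + 64 * q * I * R * u + + 64 * R * (+ 2 * (q * I) + I * p) ≡⟨ cong (λ z → z * u + + 64 * R * (+ 2 * (q * I) + I * p)) (sym T≡) ⟩
      T * u + + 64 * R * (+ 2 * (q * I) + I * p) ≤⟨ +-mono-≤ step₁ h₈ ⟩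
      + 3 * N + N ≤⟨ cert (nneg 4 ⊠ gap h₅ ⊞ nneg 4 ⊠ 0≤R ⊠ gap h₃) (ring₇ N R X p Y) ⟩
      + 4 * (R * p) * Y ∎)
    where
    open ≤-Reasoning
    u = abs (p * m + mx)
    v = abs (q * I * mx - i * X)
    e = abs (q * I * m + i * Y)
    0≤R = <⇒≤ 0<R
    positive-product : ∀ {x y} → 0ℤ < x → 0ℤ < y → 0ℤ < + 4 * (x * y)
    positive-product {x} {y} p q = cert< (nneg 4 ⊠ (gap< p ⊠ gap< q ⊞ gap< p ⊞ gap< q) ⊞ nneg 3) (ring₁ x y)
    step₁ : T * u ≤ + 3 * N
    step₁ = cert (0≤T ⊠ gap h₁ ⊞ gap h₂ ⊞ gap h₆ ⊠ 0≤Y ⊞ gap h₃′ ⊞ gap h₅′ ⊞ gap h₇) (ring₂ N T u dev Y p X)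
    step₂ : p * e ≤ q * I * u + (+ 2 * (q * I) + I * p)
    step₂ = begin
      p * e ≡⟨ cong (_* e) (sym (abs-of-nonneg (<⇒≤ 0<p))) ⟩
      abs p * e ≡⟨ sym (abs-mul p (q * I * m + i * Y)) ⟩
      abs (p * (q * I * m + i * Y)) ≡⟨ cong abs (ring₃ p q I m i Y mx X) ⟩
      abs ((q * I * (p * m + mx) + - (q * I * mx - i * X)) + i * (p * Y - X)) ≤⟨ abs-+ (q * I * (p * m + mx) + - (q * I * mx - i * X)) (i * (p * Y - X)) ⟩
      abs (q * I * (p * m + mx) + - (q * I * mx - i * X)) + abs (i * (p * Y - X)) ≤⟨ +-monoˡ-≤ (abs (i * (p * Y - X))) (abs-+ (q * I * (p * m + mx)) (- (q * I * mx - i * X))) ⟩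
      abs (q * I * (p * m + mx)) + abs (- (q * I * mx - i * X)) + abs (i * (p * Y - X))
        ≡⟨ cong₂ _+_ (cong₂ _+_ (trans (abs-mul (q * I) (p * m + mx)) (cong (_* u) (abs-of-nonneg (0≤q ⊠ 0≤I)))) (abs-neg (q * I * mx - i * X))) (abs-of-nonneg (0≤i ⊠ gap h₃)) ⟩
      q * I * u + v + i * (p * Y - X) ≤⟨ +-monoˡ-≤ (i * (p * Y - X)) (+-monoʳ-≤ (q * I * u) h₄) ⟩
      q * I * u + + 2 * (q * I) + i * (p * Y - X) ≤⟨ cert (0≤i ⊠ gap h₃′ ⊞ gap i≤I ⊠ <⇒≤ 0<p) (ring₄ q I p i Y X u) ⟩
      + 0 + (q * I * u + (+ 2 * (q * I) + I * p)) ≡⟨ +-identityˡ _ ⟩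
      q * I * u + (+ 2 * (q * I) + I * p) ∎

  -- The values are about -(i / qI) Y and -(i′ / qI) Y′. Points within ω of each other have values
  -- of M within ω, and ω is at most a sixteenth of Y / (qI), so two different levels cannot meet.
  separated : ∀ (q I i i′ Y Y′ m m′ ω : ℤ) → 0ℤ ≤ q * I → 0ℤ ≤ i′ → i′ ≤ I → 0ℤ ≤ ω → 1ℤ ≤ Y →
    + 16 * abs (q * I * m + i * Y) ≤ Y → + 16 * abs (q * I * m′ + i′ * Y′) ≤ Y′ → abs (m - m′) ≤ ω → abs (Y - Y′) ≤ ω →
    + 16 * (q * I * ω) ≤ Y → + 16 * (I * ω) ≤ Y → + 16 * ω ≤ Y → ¬ (i′ < i)
  separated q I i i′ Y Y′ m m′ ω 0≤qI 0≤i′ i′≤I 0≤ω 1≤Y h₁ h₂ h₃ h₄ h₅ h₆ h₇ i′<i = <⇒≱ 191Y>0 191Y≤0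
    where
    E = q * I * m + i * Y
    E′ = q * I * m′ + i′ * Y′
    δm : 0ℤ ≤ ω - - (m - m′)
    δm = gap (≤-trans (-≤-abs (m - m′)) h₃)
    δY : 0ℤ ≤ ω - - (Y - Y′)
    δY = gap (≤-trans (-≤-abs (Y - Y′)) h₄)
    δE : 0ℤ ≤ abs E - E
    δE = gap (≤-abs E)
    δE′ : 0ℤ ≤ abs E′ - - E′
    δE′ = gap (-≤-abs E′)
    191Y>0 : 0ℤ < + 191 * Y
    191Y>0 = cert< (nneg 191 ⊠ gap 1≤Y ⊞ nneg 190) (ring₈ Y)
    -- After multiplication by 256 the levels differ by at least 256 Y. The two errors e and e′, the
    -- change in M and the change in Y cost 16 Y each, and replacing Y′ by Y costs one more Y: 256 -
    -- 65 = 191.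
    lem : ∀ qI I i i′ Y Y′ m m′ ω e e′ → 0ℤ - + 191 * Y ≡
      + 256 * (i - i′ - 1ℤ) * (1ℤ + (Y - 1ℤ)) + + 256 * (e - (qI * m + i * Y)) + + 256 * (e′ - - (qI * m′ + i′ * Y′)) + + 16 * (Y - + 16 * e) + + 16 * (Y′ - + 16 * e′)
      + + 256 * qI * (ω - - (m - m′)) + + 256 * i′ * (ω - - (Y - Y′)) + + 256 * (I - i′) * ω
      + + 16 * (Y - + 16 * (qI * ω)) + + 16 * (Y - + 16 * (I * ω)) + + 16 * (ω - - (Y - Y′)) + (Y - + 16 * ω)
    lem = solve-∀
    191Y≤0 : + 191 * Y ≤ 0ℤ
    191Y≤0 = cert
      (nneg 256 ⊠ gap< i′<i ⊠ (nneg 1 ⊞ gap 1≤Y) ⊞ nneg 256 ⊠ δE ⊞ nneg 256 ⊠ δE′ ⊞ nneg 16 ⊠ gap h₁ ⊞ nneg 16 ⊠ gap h₂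
       ⊞ nneg 256 ⊠ 0≤qI ⊠ δm ⊞ nneg 256 ⊠ 0≤i′ ⊠ δY ⊞ nneg 256 ⊠ gap i′≤I ⊠ 0≤ω
       ⊞ nneg 16 ⊠ gap h₅ ⊞ nneg 16 ⊠ gap h₆ ⊞ nneg 16 ⊠ δY ⊞ gap h₇)
      (lem (q * I) I i i′ Y Y′ m m′ ω (abs E) (abs E′))

  -- The two bounds on X give (p′ - p) Y′ ≤ p (Y - Y′) + p′ ≤ 128 s ω, and Y′ ≥ 16 q I ω; the 8 is
  -- 128 / 16.
  close-primes : ∀ (p p′ Y Y′ X s q I ω : ℤ) → 0ℤ ≤ p → p ≤ p′ → p′ ≤ + 64 * s → 1ℤ ≤ ω → X ≤ p * Y → p′ * Y′ ≤ X + p′ → Y - Y′ ≤ ω →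
    + 16 * (q * I * ω) ≤ Y′ → (p′ - p) * (q * I) ≤ + 8 * s
  close-primes p p′ Y Y′ X s q I ω 0≤p p≤p′ p′≤64s 1≤ω h₁ h₂ h₃ h₄ = *-cancelˡ (+ 16 * ω) 0<16ω
    (cert (gap p≤p′ ⊠ gap h₄ ⊞ gap h₁ ⊞ gap h₂ ⊞ 0≤p ⊠ gap h₃ ⊞ gap p≤p′ ⊠ gap 1≤ω ⊞ gap p≤p′ ⊞ gap p′≤64s ⊠ nneg 2 ⊠ (gap 1≤ω ⊞ nneg 1) ⊞ gap 1≤ω ⊠ 0≤p′) (lem p p′ Y Y′ X s (q * I) ω))
    where
    0≤p′ = ≤-trans 0≤p p≤p′
    0<16ω : 0ℤ < + 16 * ω
    0<16ω = cert< (nneg 16 ⊠ gap 1≤ω ⊞ nneg 15) (ring₉ ω)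
    lem : ∀ p p′ Y Y′ X s qI ω → + 16 * ω * (+ 8 * s) - + 16 * ω * ((p′ - p) * qI) ≡
      (p′ - p) * (Y′ - + 16 * (qI * ω)) + (p * Y - X) + (X + p′ - p′ * Y′) + p * (ω - (Y - Y′)) + (p′ - p) * (ω - 1ℤ) + (p′ - p) + (+ 64 * s - p′) * + 2 * (ω - 1ℤ + 1ℤ) + (ω - 1ℤ) * p′
    lem = solve-∀

-- Counting the primes p by the cell that contains Xᵢ / p.

module ScaleSums where
  open import Defs using (μ)
  open import Data.Nat.DivMod using (m≡m%n+[m/n]*n; m%n<n; m<n*o⇒m/o<n; m/n*n≤m)
  open import Data.Nat using (_/_; _%_)
  open ℤ-Arithmetic
  open IntegerSums
  open Moebius
  open Chebyshev using (primeCount; scaleCount; primeCount-short)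
  open TuranKubilius
  open GoodScales
  open Twists
  open Counting
  open Transfer

  private
    ring₁ : ∀ x c y → x * (c * y) ≡ c * (x * y)
    ring₁ = solve-∀

    ring₂ : ∀ x y → x - (x + y) ≡ - y
    ring₂ = solve-∀

    ring₃ : ∀ s T → + 64 * s * (1ℤ + + 2 * T) - 1ℤ ≡ + 64 * (s - 1ℤ) + + 128 * s * T + + 63
    ring₃ = solve-∀

    ring₄ : ∀ R s qI ω → + 64 * (R * s) * (+ 16 * (qI * ω)) ≡ + 1024 * R * qI * s * ω
    ring₄ = solve-∀

    ring₅ : ∀ R s Y → R * (+ 64 * s * Y) ≡ + 64 * (R * s) * Y
    ring₅ = solve-∀

    ring₆ : ∀ R s → + 64 * (R * s) - 0ℤ - 1ℤ ≡ + 64 * ((R - 0ℤ - 1ℤ) * s + (s - 1ℤ)) + + 63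
    ring₆ = solve-∀

    ring₇ : ∀ p s T → + 64 * s * (1ℤ + + 2 * T) - p - 1ℤ ≡ (+ 64 * s - p) + + 128 * (s - 1ℤ) * T + + 128 * (T - 1ℤ) + + 127
    ring₇ = solve-∀

    ring₈ : ∀ Ω s ω → + 2 * (Ω * s * ω) + + 2 * (Ω * s * ω) ≡ s * (+ 4 * Ω * ω)
    ring₈ = solve-∀

    ring₉ : ∀ x y → y + x * 1ℤ - x ≡ y
    ring₉ = solve-∀

    ring₁₀ : ∀ t d n → t * d * (t * d) ≡ t * t * (d * d) + n * 0ℤ
    ring₁₀ = solve-∀

    ring₁₁ : ∀ n c g t v → n * (+ 2 * g) - n * c ≡ (n * c - + 2 * t * v) + + 2 * (t * v + n * g - c * n)
    ring₁₁ = solve-∀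

    ring₁₂ : ∀ q I ω → + 16 * (q * I * ω) - + 16 * (I * ω) ≡ + 16 * (q - 1ℤ) * I * ω
    ring₁₂ = solve-∀

    ring₁₃ : ∀ I ω → + 16 * (I * ω) - + 16 * ω ≡ + 16 * (I - 1ℤ) * ω
    ring₁₃ = solve-∀

    ring₁₄ : ∀ ω → + 16 * ω - 1ℤ ≡ + 16 * (ω - 1ℤ) + + 15
    ring₁₄ = solve-∀

    ring₁₅ : ∀ K x u v w → K * x - K * (x * (u * v)) * w ≡ K * x * (1ℤ - u + u * (1ℤ - v + v * (1ℤ - w)))
    ring₁₅ = solve-∀

    ring₁₆ : ∀ p p′ h → p + h - p′ ≡ h - (p′ - p)
    ring₁₆ = solve-∀

    ring₁₇ : ∀ K x → K * (+ 2 * x) ≡ + 2 * (K * x)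
    ring₁₇ = solve-∀

  𝟙-nonzero : ∀ {p} {P : Set p} (d : Dec P) → ¬ 𝟙 d ≡ 0ℤ → P
  𝟙-nonzero (yes x) _ = x
  𝟙-nonzero (no _) nz = ⊥-elim (nz refl)

  *-nonzeroˡ : ∀ x y → ¬ x * y ≡ 0ℤ → ¬ x ≡ 0ℤ
  *-nonzeroˡ x y nz x≡0 = nz (cong (_* y) x≡0)

  *-nonzeroʳ : ∀ x y → ¬ x * y ≡ 0ℤ → ¬ y ≡ 0ℤ
  *-nonzeroʳ x y nz y≡0 = nz (trans (cong (x *_) y≡0) (*-zeroʳ x))

  scaleSum-+ : ∀ κ (F G : ℕ → ℤ) → scaleSum κ (λ p → F p + G p) ≡ scaleSum κ F + scaleSum κ G
  scaleSum-+ κ F G = trans (Σ-cong n (λ i → *-distribˡ-+ (𝟙 (prime? (at i))) (F (at i)) (G (at i)))) (Σ-+ n (λ i → 𝟙 (prime? (at i)) * F (at i)) (λ i → 𝟙 (prime? (at i)) * G (at i)))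
    where
    n = 63 ℕ.* 64 ℕ.^ κ
    at : ℕ → ℕ
    at i = suc (64 ℕ.^ κ ℕ.+ i)

  scaleSum-*ˡ : ∀ κ c (F : ℕ → ℤ) → scaleSum κ (λ p → c * F p) ≡ c * scaleSum κ F
  scaleSum-*ˡ κ c F = trans (Σ-cong n (λ i → ring₁ (𝟙 (prime? (at i))) c (F (at i)))) (Σ-*ˡ n c (λ i → 𝟙 (prime? (at i)) * F (at i)))
    where
    n = 63 ℕ.* 64 ℕ.^ κ
    at : ℕ → ℕ
    at i = suc (64 ℕ.^ κ ℕ.+ i)

  scaleSum-Σ : ∀ κ Q (F : ℕ → ℕ → ℤ) → scaleSum κ (λ p → Σ Q (λ j → F j p)) ≡ Σ Q (λ j → scaleSum κ (F j))
  scaleSum-Σ κ Q F = trans (Σ-cong n (λ i → sym (Σ-*ˡ Q (𝟙 (prime? (at i))) (λ j → F j (at i))))) (Σ-swap n Q (λ i j → 𝟙 (prime? (at i)) * F j (at i)))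
    where
    n = 63 ℕ.* 64 ℕ.^ κ
    at : ℕ → ℕ
    at i = suc (64 ℕ.^ κ ℕ.+ i)

  M : ℕ → ℤ
  M N = Σ N μ

  M-lipschitz : ∀ Y d → abs (M Y - M (Y ℕ.+ d)) ≤ + d
  M-lipschitz Y d = begin
    abs (M Y - M (Y ℕ.+ d)) ≡⟨ cong (λ z → abs (M Y - z)) (Σ-split Y d μ) ⟩
    abs (M Y - (M Y + Σ d (λ i → μ (Y ℕ.+ i)))) ≡⟨ cong abs (ring₂ (M Y) (Σ d (λ i → μ (Y ℕ.+ i)))) ⟩
    abs (- Σ d (λ i → μ (Y ℕ.+ i))) ≡⟨ abs-neg (Σ d (λ i → μ (Y ℕ.+ i))) ⟩
    abs (Σ d (λ i → μ (Y ℕ.+ i))) ≤⟨ Σ-abs-≤ d (λ i → μ (Y ℕ.+ i)) (λ i → abs-μ-≤1 (Y ℕ.+ i)) ⟩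
    + d ∎
    where
    open ≤-Reasoning

  deviation-M : ∀ {p} → Prime p → ∀ N → let c = multiples p N in
    abs (+ p * M c + M N) ≤ abs (deviation μ N p) + + 2 * (+ c + + p)
  deviation-M {p} pp N = subst₂ (λ x y → abs (+ p * x + y) ≤ abs (deviation μ N p) + + 2 * (+ c + + p))
      (Σ-cong c (λ m → *-identityʳ (μ m))) (Σ-cong N (λ n → *-identityʳ (μ n)))
    (subst (λ z → abs (+ p * Σ c (λ m → μ m * 1ℤ) + Σ N (λ n → μ n * 1ℤ)) ≤ abs z + + 2 * (+ c + + p)) (Σ-cong N (λ n → cong (_* centred p n) (*-identityʳ (μ n))))
      (deviation-twist (λ _ → 1ℤ) (λ _ → ≤-refl) pp N))
    where c = multiples p N

  same-cell : ∀ ω → .{{_ : NonZero ω}} → ∀ Y Y′ → Y ℕ./ ω ≡ Y′ ℕ./ ω → Y ℕ.≤ Y′ → ∃ λ d → Y′ ≡ Y ℕ.+ d × d ℕ.≤ ω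
  same-cell ω Y Y′ eq Y≤Y′ = Y′ ℕ.∸ Y , sym (ℕₚ.m+[n∸m]≡n Y≤Y′) , ℕₚ.m≤n+o⇒m∸n≤o Y′ Y Y′≤
    where
    Y′≤ : Y′ ℕ.≤ Y ℕ.+ ω
    Y′≤ = begin
      Y′ ≡⟨ m≡m%n+[m/n]*n Y′ ω ⟩
      Y′ % ω ℕ.+ Y′ / ω ℕ.* ω ≤⟨ ℕₚ.+-mono-≤ (ℕₚ.<⇒≤ (m%n<n Y′ ω)) (ℕₚ.≤-reflexive (cong (ℕ._* ω) (sym eq))) ⟩
      ω ℕ.+ Y / ω ℕ.* ω ≤⟨ ℕₚ.+-monoʳ-≤ ω (m/n*n≤m Y ω) ⟩
      ω ℕ.+ Y ≡⟨ ℕₚ.+-comm ω Y ⟩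
      Y ℕ.+ ω ∎
      where open ℕₚ.≤-Reasoning

  near-in-cell : ∀ ω → .{{_ : NonZero ω}} → ∀ Y Y′ → Y ℕ./ ω ≡ Y′ ℕ./ ω → abs (+ Y - + Y′) ≤ + ω × abs (M Y - M Y′) ≤ + ω
  near-in-cell ω Y Y′ eq = go (ℕₚ.≤-total Y Y′)
    where
    ordered : ∀ Y Y′ → Y ℕ./ ω ≡ Y′ ℕ./ ω → Y ℕ.≤ Y′ → abs (+ Y - + Y′) ≤ + ω × abs (M Y - M Y′) ≤ + ω
    ordered Y Y′ eq Y≤Y′ with same-cell ω Y Y′ eq Y≤Y′
    ... | d , refl , d≤ω = subst (_≤ + ω) (sym (trans (cong abs (ring₂ (+ Y) (+ d))) (abs-neg (+ d)))) (+≤+ d≤ω) , ≤-trans (M-lipschitz Y d) (+≤+ d≤ω)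
    go : Y ℕ.≤ Y′ ⊎ Y′ ℕ.≤ Y → abs (+ Y - + Y′) ≤ + ω × abs (M Y - M Y′) ≤ + ω
    go (inj₁ Y≤Y′) = ordered Y Y′ eq Y≤Y′
    go (inj₂ Y′≤Y) = let (p , r) = ordered Y′ Y (sym eq) Y′≤Y in
      subst (_≤ + ω) (abs-flip (+ Y′) (+ Y)) p , subst (_≤ + ω) (abs-flip (M Y′) (M Y)) r

  scaleSum-witness : ∀ κ (F : ℕ → ℤ) → ¬ scaleSum κ F ≡ 0ℤ → ∃ λ p → Prime p × 64 ℕ.^ κ ℕ.< p × p ℕ.≤ 64 ℕ.* 64 ℕ.^ κ × ¬ F p ≡ 0ℤ
  scaleSum-witness κ F nz = go (first-nonzero n g)
    where
    s = 64 ℕ.^ κ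
    n = 63 ℕ.* s
    g : ℕ → ℤ
    g t = 𝟙 (prime? (suc (s ℕ.+ t))) * F (suc (s ℕ.+ t))
    go : (∀ t → t ℕ.< n → g t ≡ 0ℤ) ⊎ (∃ λ t₀ → t₀ ℕ.< n × ¬ g t₀ ≡ 0ℤ × (∀ t → t ℕ.< t₀ → g t ≡ 0ℤ)) → _
    go (inj₁ zeros) = ⊥-elim (nz (Σ-vanishing n g zeros))
    go (inj₂ (t , t<n , nz′ , _)) = suc (s ℕ.+ t) , 𝟙-nonzero (prime? (suc (s ℕ.+ t))) (*-nonzeroˡ (𝟙 (prime? (suc (s ℕ.+ t)))) (F (suc (s ℕ.+ t))) nz′) ,
      ℕ.s≤s (ℕₚ.m≤m+n s t) , subst (ℕ._≤ s ℕ.+ n) (ℕₚ.+-suc s t) (ℕₚ.+-monoʳ-≤ s t<n) , *-nonzeroʳ (𝟙 (prime? (suc (s ℕ.+ t)))) (F (suc (s ℕ.+ t))) nz′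

  -- Here I is the number of levels, every X i lies in [N / R, N], and the numbers Y i p, about X i
  -- / p, are sorted into fewer than 4Ω cells of length ω, about N / (Ω s). A cell receives good
  -- primes from at most one level (`not-above`), and these lie in a window of length 2h with h = 8
  -- s / (qI) (`cluster-bound`). Ω is proportional to qI and h to its inverse, so the resulting
  -- bound for the number of good primes depends on I only through `b`, the logarithm of the ratio
  -- between scale and window.
  module Clusters
    (q I R T Ω N κ b h ω : ℕ) (X : ℕ → ℕ)
    (q≥1 : 1ℤ ≤ + q) (I≥1 : 1ℤ ≤ + I) (R>0 : 0ℤ < + R) (T≡ : + T ≡ + 64 * + q * + I * + R) (Ω≡ : + Ω ≡ + 1024 * + R * (+ q * + I))
    (T≤s : + 2 * + T ≤ + (64 ℕ.^ κ)) (N₁ : + 64 * + (64 ℕ.^ κ) * (1ℤ + + 2 * + T) ≤ + N) (N₂ : + 64 * + R * (+ 2 * (+ q * + I) + + I * (+ 64 * + (64 ℕ.^ κ))) ≤ + N)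
    (h≡ : + h * (+ q * + I) ≡ + 8 * + (64 ℕ.^ κ)) (2h≤s : 2 ℕ.* h ℕ.≤ 64 ℕ.^ κ) (h≥1 : 1 ℕ.≤ h) (b≥1 : 1 ℕ.≤ b) (2^b≥ : (64 ℕ.^ κ) ℕ.+ 63 ℕ.* (64 ℕ.^ κ) ℕ.+ (64 ℕ.^ κ) ℕ.≤ 2 ℕ.^ b ℕ.* (2 ℕ.* h))
    (ω≥1 : 1 ℕ.≤ ω) (ω-lower : + N ≤ + 2 * (+ Ω * + (64 ℕ.^ κ) * + ω)) (ω-upper : + Ω * + (64 ℕ.^ κ) * + ω ≤ + N)
    (X-lower : ∀ i → i ℕ.< I → + N ≤ + R * + X i) (X-upper : ∀ i → i ℕ.< I → + X i ≤ + N)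
    (X-value : ∀ i → i ℕ.< I → abs (+ q * + I * M (X i) - + i * + X i) ≤ + 2 * (+ q * + I))
    (dev-small : ∀ i → i ℕ.< I → + 2 * (+ T * + T) * scaleSum κ (λ p → deviation μ (X i) p * deviation μ (X i) p) ≤ + N * + N * + scaleCount κ)
    where

    open ≤-Reasoning

    s : ℕ
    s = 64 ℕ.^ κ

    instance
      ω≢0 : NonZero ω
      ω≢0 = ℕ.>-nonZero ω≥1

    Y : ℕ → ℕ → ℕ
    Y i p = multiples p (X i)

    good? : ∀ i p → Dec (+ T * abs (deviation μ (X i) p) ≤ + N)
    good? i p = + T * abs (deviation μ (X i) p) ≤? + N

    s≥1 : 1ℤ ≤ + s
    s≥1 = +≤+ (ℕₚ.m^n>0 64 κ)

    s≥0 : 0ℤ ≤ + s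
    s≥0 = nneg s

    N≥1 : 1ℤ ≤ + N
    N≥1 = ≤-trans (cert (nneg 64 ⊠ gap s≥1 ⊞ nneg 128 ⊠ s≥0 ⊠ nneg T ⊞ nneg 63) (ring₃ (+ s) (+ T))) N₁

    T≥1 : 1ℤ ≤ + T
    T≥1 = subst (1ℤ ≤_) (sym T≡) (*-mono-≤ (nneg 1) (nneg 1) (*-mono-≤ (nneg 1) (nneg 1) (*-mono-≤ {1ℤ} {+ 64} (nneg 1) (nneg 1) (+≤+ (ℕ.s≤s ℕ.z≤n)) q≥1) I≥1) (i<j⇒suc[i]≤j R>0))

    module _ {i p : ℕ} (i<I : i ℕ.< I) (pp : Prime p) (s<p : s ℕ.< p) (p≤64s : p ℕ.≤ 64 ℕ.* s) where

      private
        instance p≢0 = prime⇒nonZero pp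
        0<p : 0ℤ < + p
        0<p = +<+ (ℕₚ.≤-trans (ℕ.s≤s ℕ.z≤n) s<p)
        p≤64s′ : + p ≤ + 64 * + s
        p≤64s′ = ≤-trans (+≤+ p≤64s) (≤-reflexive (pos-* 64 s))
        s≤p : + s ≤ + p
        s≤p = +≤+ (ℕₚ.<⇒≤ s<p)

      X≤pY : + X i ≤ + p * + Y i p
      X≤pY = multiples-lowerℤ p (X i)

      pY≤X+p : + p * + Y i p ≤ + X i + + p
      pY≤X+p = multiples-upperℤ p (X i)

      -- The origin of Ω = 1024 R q I: from Y ≥ N / (64 R s) and ω ≤ N / (Ω s), the factor 64 is the
      -- width of a scale and 16 the margin demanded by `separated` and `close-primes`.
      16qIω≤Y : + 16 * (+ q * + I * + ω) ≤ + Y i p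
      16qIω≤Y = *-cancelˡ (+ 64 * (+ R * + s)) pos-Rs (begin
        + 64 * (+ R * + s) * (+ 16 * (+ q * + I * + ω)) ≡⟨ ring₄ (+ R) (+ s) (+ q * + I) (+ ω) ⟩
        + 1024 * + R * (+ q * + I) * + s * + ω ≡⟨ cong (λ z → z * + s * + ω) (sym Ω≡) ⟩
        + Ω * + s * + ω ≤⟨ ω-upper ⟩
        + N ≤⟨ X-lower i i<I ⟩
        + R * + X i ≤⟨ *-monoˡ (+ R) (nneg R) X≤pY ⟩
        + R * (+ p * + Y i p) ≤⟨ *-monoˡ (+ R) (nneg R) (*-monoʳ (+ Y i p) (nneg (Y i p)) p≤64s′) ⟩
        + R * (+ 64 * + s * + Y i p) ≡⟨ ring₅ (+ R) (+ s) (+ Y i p) ⟩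
        + 64 * (+ R * + s) * + Y i p ∎)
        where
        pos-Rs : 0ℤ < + 64 * (+ R * + s)
        pos-Rs = cert< (nneg 64 ⊠ (gap< R>0 ⊠ s≥0 ⊞ gap s≥1) ⊞ nneg 63) (ring₆ (+ R) (+ s))

      cell-bound : Y i p ℕ./ ω ℕ.< 4 ℕ.* Ω
      cell-bound = m<n*o⇒m/o<n (drop‿+<+ (subst (+ Y i p <_) (sym (trans (pos-* (4 ℕ.* Ω) ω) (cong (_* + ω) (pos-* 4 Ω))))
        (*-cancelˡ-<-nonNeg (+ s) {{+-nonneg}} (begin-strict
          + s * + Y i p ≤⟨ *-monoʳ (+ Y i p) (nneg (Y i p)) s≤p ⟩
          + p * + Y i p ≤⟨ pY≤X+p ⟩
          + X i + + p <⟨ +-mono-≤-< (X-upper i i<I) p<N ⟩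
          + N + + N ≤⟨ +-mono-≤ ω-lower ω-lower ⟩
          + 2 * (+ Ω * + s * + ω) + + 2 * (+ Ω * + s * + ω) ≡⟨ ring₈ (+ Ω) (+ s) (+ ω) ⟩
          + s * (+ 4 * + Ω * + ω) ∎))))
        where
        +-nonneg : NonNegative (+ s)
        +-nonneg = _
        p<N : + p < + N
        p<N = <-≤-trans (cert< (gap p≤64s′ ⊞ nneg 128 ⊠ gap s≥1 ⊠ nneg T ⊞ nneg 128 ⊠ gap T≥1 ⊞ nneg 127) (ring₇ (+ p) (+ s) (+ T))) N₁

      value : + T * abs (deviation μ (X i) p) ≤ + N → + 16 * abs (+ q * + I * M (Y i p) + + i * + Y i p) ≤ + Y i p
      value good = transfer (+ p) (+ Y i p) (+ X i) (+ N) (+ R) (+ T) (+ q) (+ I) (+ i) (M (Y i p)) (M (X i)) (abs (deviation μ (X i) p))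
        T≡ R>0 0<p (nneg T) (nneg q) (nneg I) (nneg (Y i p)) (deviation-M pp (X i)) good X≤pY pY≤X+p (X-value i i<I) (X-lower i i<I) (X-upper i i<I)
        (≤-trans T≤s s≤p) (≤-trans (*-monoʳ (1ℤ + + 2 * + T) (nneg 1 ⊞ nneg 2 ⊠ nneg T) p≤64s′) N₁)
        (≤-trans (*-monoˡ (+ 64 * + R) (nneg 64 ⊠ nneg R) (+-monoʳ-≤ (+ 2 * (+ q * + I)) (*-monoˡ (+ I) (nneg I) p≤64s′))) N₂)
        (nneg i) (+≤+ (ℕₚ.<⇒≤ i<I))

    G : ℕ → ℤ
    G i = scaleSum κ (λ p → 𝟙 (good? i p))

    -- Chebyshev's inequality: the mean of the squared deviations is at most N² / (2 T²), so at most
    -- half of the primes have T |dev| > N.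
    half-good : ∀ i → i ℕ.< I → + scaleCount κ ≤ + 2 * G i
    half-good i i<I = *-cancelˡ (+ N * + N) 0<N² (cert (gap (dev-small i i<I) ⊞ nneg 2 ⊠ gap total) (ring₁₁ (+ N * + N) (+ scaleCount κ) (G i) (+ T * + T) V))
      where
      dev : ℕ → ℤ
      dev p = deviation μ (X i) p
      V = scaleSum κ (λ p → dev p * dev p)
      0<N² : 0ℤ < + N * + N
      0<N² = suc[i]≤j⇒i<j (*-mono-≤ (nneg 1) (nneg 1) N≥1 N≥1)
      pointwise : ∀ p → (d : Dec (+ T * abs (dev p) ≤ + N)) → + N * + N ≤ + T * + T * (dev p * dev p) + + N * + N * 𝟙 d
      pointwise p (yes _) = cert (nneg T ⊠ nneg T ⊠ sq (dev p)) (ring₉ (+ N * + N) (+ T * + T * (dev p * dev p)))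
      pointwise p (no ¬good) = begin
        + N * + N ≤⟨ *-mono-≤ (nneg N) (nneg N) (<⇒≤ (≰⇒> ¬good)) (<⇒≤ (≰⇒> ¬good)) ⟩
        + T * abs (dev p) * (+ T * abs (dev p)) ≡⟨ ring₁₀ (+ T) (abs (dev p)) (+ N * + N) ⟩
        + T * + T * (abs (dev p) * abs (dev p)) + + N * + N * 0ℤ ≡⟨ cong (λ z → + T * + T * z + + N * + N * 0ℤ) (abs-sq (dev p)) ⟩
        + T * + T * (dev p * dev p) + + N * + N * 0ℤ ∎
      total : + scaleCount κ * (+ N * + N) ≤ + T * + T * V + + N * + N * G i
      total = begin
        + scaleCount κ * (+ N * + N) ≡⟨ sym (scaleSum-const κ (+ N * + N)) ⟩
        scaleSum κ (λ _ → + N * + N) ≤⟨ scaleSum-mono κ (λ p _ _ _ → pointwise p (good? i p)) ⟩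
        scaleSum κ (λ p → + T * + T * (dev p * dev p) + + N * + N * 𝟙 (good? i p)) ≡⟨ scaleSum-+ κ (λ p → + T * + T * (dev p * dev p)) (λ p → + N * + N * 𝟙 (good? i p)) ⟩
        scaleSum κ (λ p → + T * + T * (dev p * dev p)) + scaleSum κ (λ p → + N * + N * 𝟙 (good? i p)) ≡⟨ cong₂ _+_ (scaleSum-*ˡ κ (+ T * + T) (λ p → dev p * dev p)) (scaleSum-*ˡ κ (+ N * + N) (λ p → 𝟙 (good? i p))) ⟩
        + T * + T * V + + N * + N * G i ∎

    term : ℕ → ℕ → ℕ → ℤ
    term j i p = 𝟙 (j ℕ.≟ (Y i p ℕ./ ω)) * 𝟙 (good? i p)

    C : ℕ → ℕ → ℤ
    C j i = scaleSum κ (term j i)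

    term-cell : ∀ j i p → ¬ term j i p ≡ 0ℤ → j ≡ Y i p ℕ./ ω
    term-cell j i p nz = 𝟙-nonzero (j ℕ.≟ (Y i p ℕ./ ω)) (*-nonzeroˡ (𝟙 (j ℕ.≟ (Y i p ℕ./ ω))) (𝟙 (good? i p)) nz)

    term-good : ∀ j i p → ¬ term j i p ≡ 0ℤ → + T * abs (deviation μ (X i) p) ≤ + N
    term-good j i p nz = 𝟙-nonzero (good? i p) (*-nonzeroʳ (𝟙 (j ℕ.≟ (Y i p ℕ./ ω))) (𝟙 (good? i p)) nz)

    not-above : ∀ j i i′ → i ℕ.< I → i′ ℕ.< I → ¬ C j i ≡ 0ℤ → ¬ C j i′ ≡ 0ℤ → ¬ (i′ ℕ.< i)
    not-above j i i′ i<I i′<I nz nz′ i′<i with scaleSum-witness κ (term j i) nz | scaleSum-witness κ (term j i′) nz′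
    ... | p , pp , s<p , p≤ , t≢0 | p′ , pp′ , s<p′ , p′≤ , t′≢0 =
      separated (+ q) (+ I) (+ i) (+ i′) (+ Y i p) (+ Y i′ p′) (M (Y i p)) (M (Y i′ p′)) (+ ω) (nneg q ⊠ nneg I) (nneg i′) (+≤+ (ℕₚ.<⇒≤ i′<I)) (nneg ω) 1≤Y
        (value i<I pp s<p p≤ (term-good j i p t≢0)) (value i′<I pp′ s<p′ p′≤ (term-good j i′ p′ t′≢0)) (proj₂ near) (proj₁ near)
        16qIω 16Iω 16ω (+<+ i′<i)
      where
      near = near-in-cell ω (Y i p) (Y i′ p′) (trans (sym (term-cell j i p t≢0)) (term-cell j i′ p′ t′≢0))
      16qIω : + 16 * (+ q * + I * + ω) ≤ + Y i p
      16qIω = 16qIω≤Y i<I pp s<p p≤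
      16Iω : + 16 * (+ I * + ω) ≤ + Y i p
      16Iω = ≤-trans (cert (nneg 16 ⊠ gap q≥1 ⊠ nneg I ⊠ nneg ω) (ring₁₂ (+ q) (+ I) (+ ω))) 16qIω
      16ω : + 16 * + ω ≤ + Y i p
      16ω = ≤-trans (cert (nneg 16 ⊠ gap I≥1 ⊠ nneg ω) (ring₁₃ (+ I) (+ ω))) 16Iω
      1≤Y : 1ℤ ≤ + Y i p
      1≤Y = ≤-trans (cert (nneg 16 ⊠ gap {1ℤ} {+ ω} (+≤+ ω≥1) ⊞ nneg 15) (ring₁₄ (+ ω))) 16ω

    -- The binary logarithm of `s`. Multiplied by it, a count of primes has the size of the
    -- interval.
    K : ℤ
    K = + (6 ℕ.* κ)

    B : ℤ
    B = + (2 ℕ.* b ℕ.* (2 ℕ.* h))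

    cluster-bound : ∀ j i → i ℕ.< I → K * C j i ≤ B
    cluster-bound j i i<I = begin
      K * C j i ≡⟨ sym (Σ-*ˡ n K (λ t → 𝟙 (prime? (at t)) * term j i (at t))) ⟩
      Σ n (λ t → K * (𝟙 (prime? (at t)) * term j i (at t))) ≡⟨ Σ-cong< n (λ t t<n → trans (sym (*-identityʳ _)) (cong (K * (𝟙 (prime? (at t)) * term j i (at t)) *_) (sym (𝟙-yes (t ℕ.<? n) t<n)))) ⟩
      Σ n g ≤⟨ Σ-concentrated n (2 ℕ.* h) B g χ (nneg (2 ℕ.* b ℕ.* (2 ℕ.* h))) g≤χ χ≥0 close bound ⟩
      B ∎
      where
      n = 63 ℕ.* s
      at : ℕ → ℕ
      at t = suc (s ℕ.+ t)
      g χ : ℕ → ℤ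
      -- The last factor cuts the support down to t < n, because the closeness hypothesis of
      -- `Σ-concentrated` ranges over all t.
      g t = K * (𝟙 (prime? (at t)) * term j i (at t)) * 𝟙 (t ℕ.<? n)
      χ t = K * 𝟙 (prime? (at t))
      χ≥0 : ∀ t → 0ℤ ≤ χ t
      χ≥0 t = nneg (6 ℕ.* κ) ⊠ 𝟙-nonneg (prime? (at t))
      g≤χ : ∀ t → g t ≤ χ t
      g≤χ t = cert (nneg (6 ℕ.* κ) ⊠ 0≤x ⊠ (gap x≤1 ⊞ 𝟙-nonneg (j ℕ.≟ (Y i (at t) ℕ./ ω)) ⊠ (gap y≤1 ⊞ 𝟙-nonneg (good? i (at t)) ⊠ gap z≤1)))
          (ring₁₅ K (𝟙 (prime? (at t))) (𝟙 (j ℕ.≟ (Y i (at t) ℕ./ ω))) (𝟙 (good? i (at t))) (𝟙 (t ℕ.<? n)))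
        where
        0≤x = 𝟙-nonneg (prime? (at t))
        x≤1 = 𝟙-≤1 (j ℕ.≟ (Y i (at t) ℕ./ ω))
        y≤1 = 𝟙-≤1 (good? i (at t))
        z≤1 = 𝟙-≤1 (t ℕ.<? n)
      close : ∀ t t′ → t ℕ.≤ t′ → ¬ g t ≡ 0ℤ → ¬ g t′ ≡ 0ℤ → t′ ℕ.< t ℕ.+ 2 ℕ.* h
      close t t′ t≤t′ nz nz′ = ℕₚ.≤-<-trans t′≤t+h (ℕₚ.+-monoʳ-< t (ℕₚ.m<m+n h (ℕₚ.≤-trans h≥1 (ℕₚ.m≤m+n h 0))))
        where
        inner : ∀ t → ¬ g t ≡ 0ℤ → ¬ 𝟙 (prime? (at t)) * term j i (at t) ≡ 0ℤ
        inner t nz = *-nonzeroʳ K (𝟙 (prime? (at t)) * term j i (at t)) (*-nonzeroˡ (K * (𝟙 (prime? (at t)) * term j i (at t))) (𝟙 (t ℕ.<? n)) nz)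
        is-prime : ∀ t → ¬ g t ≡ 0ℤ → Prime (at t)
        is-prime t nz = 𝟙-nonzero (prime? (at t)) (*-nonzeroˡ (𝟙 (prime? (at t))) (term j i (at t)) (inner t nz))
        is-term : ∀ t → ¬ g t ≡ 0ℤ → ¬ term j i (at t) ≡ 0ℤ
        is-term t nz = *-nonzeroʳ (𝟙 (prime? (at t))) (term j i (at t)) (inner t nz)
        upper : ∀ t → ¬ g t ≡ 0ℤ → at t ℕ.≤ 64 ℕ.* s
        upper t nz = subst (ℕ._≤ s ℕ.+ n) (ℕₚ.+-suc s t) (ℕₚ.+-monoʳ-≤ s (𝟙-nonzero (t ℕ.<? n) (*-nonzeroʳ (K * (𝟙 (prime? (at t)) * term j i (at t))) (𝟙 (t ℕ.<? n)) nz)))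
        p = at t
        p′ = at t′
        near = near-in-cell ω (Y i p) (Y i p′) (trans (sym (term-cell j i p (is-term t nz))) (term-cell j i p′ (is-term t′ nz′)))
        lower : ∀ t → s ℕ.< at t
        lower t = ℕ.s≤s (ℕₚ.m≤m+n s t)
        gap-bound : (+ p′ - + p) * (+ q * + I) ≤ + 8 * + s
        gap-bound = close-primes (+ p) (+ p′) (+ Y i p) (+ Y i p′) (+ X i) (+ s) (+ q) (+ I) (+ ω) (nneg p) (+≤+ (ℕ.s≤s (ℕₚ.+-monoʳ-≤ s t≤t′)))
          (≤-trans (+≤+ (upper t′ nz′)) (≤-reflexive (pos-* 64 s))) (+≤+ ω≥1)
          (X≤pY i<I (is-prime t nz) (lower t) (upper t nz)) (pY≤X+p i<I (is-prime t′ nz′) (lower t′) (upper t′ nz′))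
          (≤-trans (≤-abs (+ Y i p - + Y i p′)) (proj₁ near)) (16qIω≤Y i<I (is-prime t′ nz′) (lower t′) (upper t′ nz′))
        p′-p≤h : + p′ - + p ≤ + h
        p′-p≤h = *-cancelˡ (+ q * + I) (suc[i]≤j⇒i<j (*-mono-≤ (nneg 1) (nneg 1) q≥1 I≥1))
          (subst₂ _≤_ (*-comm (+ p′ - + p) (+ q * + I)) (trans (sym h≡) (*-comm (+ h) (+ q * + I))) gap-bound)
        t′≤t+h : t′ ℕ.≤ t ℕ.+ h
        t′≤t+h = ℕₚ.+-cancelˡ-≤ (suc s) t′ (t ℕ.+ h) (subst (suc (s ℕ.+ t′) ℕ.≤_) (cong suc (ℕₚ.+-assoc s t h))
          (drop‿+≤+ (cert (gap p′-p≤h) (ring₁₆ (+ p) (+ p′) (+ h)))))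
      bound : ∀ t → t ℕ.< n → ¬ g t ≡ 0ℤ → Σ (2 ℕ.* h) (λ i → χ (t ℕ.+ i)) ≤ B
      bound t t<n _ = begin
        Σ (2 ℕ.* h) (λ i → K * 𝟙 (prime? (suc (s ℕ.+ (t ℕ.+ i))))) ≡⟨ Σ-*ˡ (2 ℕ.* h) K (λ i → 𝟙 (prime? (suc (s ℕ.+ (t ℕ.+ i))))) ⟩
        K * Σ (2 ℕ.* h) (λ i → 𝟙 (prime? (suc (s ℕ.+ (t ℕ.+ i))))) ≡⟨ cong (K *_) (trans (Σ-cong (2 ℕ.* h) (λ i → cong (λ z → 𝟙 (prime? (suc z))) (sym (ℕₚ.+-assoc s t i)))) (Σ-primes (s ℕ.+ t) (2 ℕ.* h))) ⟩
        K * + primeCount (s ℕ.+ t) (2 ℕ.* h) ≡⟨ sym (pos-* (6 ℕ.* κ) (primeCount (s ℕ.+ t) (2 ℕ.* h))) ⟩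
        + (6 ℕ.* κ ℕ.* primeCount (s ℕ.+ t) (2 ℕ.* h)) ≤⟨ +≤+ (primeCount-short (6 ℕ.* κ) (s ℕ.+ t) (2 ℕ.* h) b b≥1
            (ℕₚ.≤-trans (ℕₚ.≤-reflexive (sym (ℕₚ.^-*-assoc 2 6 κ))) (ℕₚ.m≤m+n s t)) (ℕₚ.≤-trans 2h≤s (ℕₚ.m≤m+n s t))
            (ℕₚ.≤-trans (ℕₚ.+-mono-≤ (ℕₚ.+-monoʳ-≤ s (ℕₚ.<⇒≤ t<n)) 2h≤s) 2^b≥)) ⟩
        B ∎

    conclusion : K * (+ I * + scaleCount κ) ≤ + 2 * (+ 4 * + Ω * B)
    conclusion = begin
      K * (+ I * + scaleCount κ) ≡⟨ cong (K *_) (sym (Σ-const I (+ scaleCount κ))) ⟩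
      K * Σ I (λ _ → + scaleCount κ) ≤⟨ *-monoˡ K (nneg (6 ℕ.* κ)) (Σ-mono< I half-good) ⟩
      K * Σ I (λ i → + 2 * G i) ≡⟨ trans (cong (K *_) (Σ-*ˡ I (+ 2) G)) (ring₁₇ K (Σ I G)) ⟩
      + 2 * (K * Σ I G) ≤⟨ *-monoˡ (+ 2) (nneg 2) (*-monoˡ K (nneg (6 ℕ.* κ)) (Σ-mono< I G≤)) ⟩
      + 2 * (K * Σ I (λ i → Σ Q (λ j → C j i))) ≡⟨ cong (+ 2 *_) (trans (cong (K *_) (Σ-swap I Q (λ i j → C j i))) (sym (Σ-*ˡ Q K (λ j → Σ I (λ i → C j i))))) ⟩
      + 2 * Σ Q (λ j → K * Σ I (λ i → C j i)) ≤⟨ *-monoˡ (+ 2) (nneg 2) (Σ-≤-const Q B (λ j _ → per-cell j)) ⟩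
      + 2 * (+ Q * B) ≡⟨ cong (λ z → + 2 * (z * B)) (pos-* 4 Ω) ⟩
      + 2 * (+ 4 * + Ω * B) ∎
      where
      Q = 4 ℕ.* Ω
      G≤ : ∀ i → i ℕ.< I → G i ≤ Σ Q (λ j → C j i)
      G≤ i i<I = begin
        G i ≤⟨ scaleSum-mono κ (λ p pp s<p p≤ → ≤-reflexive (sym (Σ-pick Q (Y i p ℕ./ ω) (λ _ → 𝟙 (good? i p)) (cell-bound i<I pp s<p p≤)))) ⟩
        scaleSum κ (λ p → Σ Q (λ j → term j i p)) ≡⟨ scaleSum-Σ κ Q (λ j → term j i) ⟩
        Σ Q (λ j → C j i) ∎
      per-cell : ∀ j → K * Σ I (λ i → C j i) ≤ B
      per-cell j = begin
        K * Σ I (λ i → C j i) ≡⟨ sym (Σ-*ˡ I K (λ i → C j i)) ⟩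
        Σ I (λ i → K * C j i) ≤⟨ Σ-single I B (λ i → K * C j i) (nneg (2 ℕ.* b ℕ.* (2 ℕ.* h))) (cluster-bound j) unique ⟩
        B ∎
        where
        unique : ∀ i i′ → i ℕ.< I → i′ ℕ.< I → ¬ K * C j i ≡ 0ℤ → ¬ K * C j i′ ≡ 0ℤ → i ≡ i′
        unique i i′ i<I i′<I nz nz′ = ℕₚ.≤-antisym
          (ℕₚ.≮⇒≥ (not-above j i i′ i<I i′<I (*-nonzeroʳ K (C j i) nz) (*-nonzeroʳ K (C j i′) nz′)))
          (ℕₚ.≮⇒≥ (not-above j i′ i i′<I i<I (*-nonzeroʳ K (C j i′) nz′) (*-nonzeroʳ K (C j i) nz)))

-- Sign changes of M, intermediate values, and the contradiction.

module SignChanges where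
  open import Defs using (μ)
  open import Data.Nat.DivMod using (m≡m%n+[m/n]*n; m%n<n; m/n*n≤m; m≥n⇒m/n>0)
  open import Data.Nat using (_/_; _%_)
  open ℤ-Arithmetic
  open IntegerSums
  open Moebius
  open Chebyshev using (scaleCount; scaleCount-lower)
  open TuranKubilius
  open GoodScales
  open Counting
  open ScaleSums

  private
    ring₁ : ∀ C d γ → C ℕ.* (γ ℕ.+ γ ℕ.+ d ℕ.* γ) ≡ C ℕ.* (2 ℕ.+ d) ℕ.* γ
    ring₁ = ℕR.solve-∀

    ring₂ : ∀ f b → f + (b + 1ℤ) * 1ℤ - (b + 1ℤ) ≡ f
    ring₂ = solve-∀

    ring₃ : ∀ f b → f + (b + 1ℤ) * 0ℤ - (b + 1ℤ) ≡ f - b - 1ℤ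
    ring₃ = solve-∀

    ring₄ : ∀ c b f → 0ℤ - c ≡ (f + (b + 1ℤ) * 0ℤ - c * (b + 1ℤ)) + (b * c - f)
    ring₄ = solve-∀

    ring₅ : ∀ k p c N m n u → p * - c - p * (+ 4 * k * m) ≡ (N - + 4 * k * u) + + 4 * k * (u - (p * m + n)) + + 4 * (k * n - N) + (N + p - p * c) + (N - p) + N
    ring₅ = solve-∀

    ring₆ : ∀ p k → p * (1ℤ + + 32 * k) - p ≡ p * (+ 32 * k)
    ring₆ = solve-∀

    ring₇ : ∀ k d → + 8 * k * d * (+ 8 * k * d) ≡ + 8 * k * (+ 8 * k) * (d * d)
    ring₇ = solve-∀

    ring₈ : ∀ k u d c p N → + 4 * N - + 4 * (+ 4 * k * u) ≡ + 16 * k * (d + + 2 * (c + p) - u) + + 2 * (N - + 8 * k * d) + (p - + 32 * k) * c + (N + p - p * c) + (N - p * (1ℤ + + 32 * k))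
    ring₈ = solve-∀

    ring₉ : ∀ N k x → + 4 * k * x - N ≡ (k * x - N) + + 3 * (k * x - N + N)
    ring₉ = solve-∀

    ring₁₀ : ∀ k x y → - x - + 4 * k * y ≡ + 4 * k * - y - x
    ring₁₀ = solve-∀

    ring₁₁ : ∀ k x y → + 4 * k * y - x ≡ - x - + 4 * k * - y
    ring₁₁ = solve-∀

    ring₁₂ : ∀ p m n → p * - m + - n ≡ - (p * m + n)
    ring₁₂ = solve-∀

    ring₁₃ : ∀ a m x i n → a * (m + x) - i * (1ℤ + n) - (a * m - i * n) ≡ a * x + - i
    ring₁₃ = solve-∀

    ring₁₄ : ∀ q I x i → + 2 * (q * I) - (q * I * x + i) ≡ q * I * (1ℤ - x) + (q - 1ℤ) * I + (I - i)
    ring₁₄ = solve-∀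

    ring₁₅ : ∀ q I m i n → I * (q * m - n) + (I - i) * n ≡ q * I * m - i * n
    ring₁₅ = solve-∀

    ring₁₆ : ∀ q I m i n → 0ℤ - (q * I * m - i * n) ≡ I * (- n - q * m) + (I + i) * n
    ring₁₆ = solve-∀

    ring₁₇ : ∀ x y → - x - - y ≡ - (x - y)
    ring₁₇ = solve-∀

    ring₁₈ : ∀ s → 2 ℕ.* (8 ℕ.* s) ≡ s ℕ.* 16
    ring₁₈ = ℕR.solve-∀

    ring₁₉ : ∀ s → s ℕ.+ 63 ℕ.* s ℕ.+ s ℕ.+ 63 ℕ.* s ≡ 16 ℕ.* (8 ℕ.* s)
    ring₁₉ = ℕR.solve-∀

    ring₂₀ : ∀ h x → 16 ℕ.* (h ℕ.* x) ≡ 8 ℕ.* x ℕ.* (2 ℕ.* h)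
    ring₂₀ = ℕR.solve-∀

    ring₂₁ : ∀ c R x b h → + 2 * (+ 4 * (c * R * x) * (+ 2 * b * (+ 2 * h))) ≡ + 32 * (c * R * b) * (h * x)
    ring₂₁ = solve-∀

    ring₂₂ : ∀ x s → + 32 * x * (+ 8 * s) ≡ + 256 * x * s
    ring₂₂ = solve-∀

    ring₂₃ : ∀ I s k c → + 6 * k * (I * c) - I * s ≡ + 6 * I * (k * c - s) + + 5 * I * s
    ring₂₃ = solve-∀

  exponential-beats-linear : ∀ C d → ∃ λ β → 2 ℕ.≤ β × C ℕ.* (β ℕ.+ d) ℕ.< 2 ℕ.^ β
  exponential-beats-linear C d = γ ℕ.+ γ , ℕₚ.+-mono-≤ {1} {γ} {1} {γ} (ℕ.s≤s ℕ.z≤n) (ℕ.s≤s ℕ.z≤n) , (begin-strict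
    C ℕ.* (γ ℕ.+ γ ℕ.+ d) ≤⟨ ℕₚ.*-monoʳ-≤ C (ℕₚ.+-monoʳ-≤ (γ ℕ.+ γ) (ℕₚ.m≤m*n d γ)) ⟩
    C ℕ.* (γ ℕ.+ γ ℕ.+ d ℕ.* γ) ≡⟨ ring₁ C d γ ⟩
    C ℕ.* (2 ℕ.+ d) ℕ.* γ ≤⟨ ℕₚ.*-monoˡ-≤ γ (ℕₚ.n≤1+n (C ℕ.* (2 ℕ.+ d))) ⟩
    γ ℕ.* γ <⟨ ℕₚ.*-mono-< (n<2^n γ) (n<2^n γ) ⟩
    2 ℕ.^ γ ℕ.* 2 ℕ.^ γ ≡⟨ sym (ℕₚ.^-distribˡ-+-* 2 γ γ) ⟩
    2 ℕ.^ (γ ℕ.+ γ) ∎)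
    where
    open ℕₚ.≤-Reasoning
    γ = suc (C ℕ.* (2 ℕ.+ d))

  scaleCount-positive : ∀ κ → 1 ℕ.≤ κ → 0ℤ < + scaleCount κ
  scaleCount-positive (suc κ) _ = +<+ (ℕₚ.n≢0⇒n>0 (λ c≡0 → ℕₚ.<⇒≱ (ℕₚ.m^n>0 64 (suc κ)) (ℕₚ.≤-trans (scaleCount-lower κ) (ℕₚ.≤-reflexive (trans (cong (suc κ ℕ.*_) c≡0) (ℕₚ.*-zeroʳ (suc κ)))))))

  -- If F exceeded B at every prime of the scale it would be at least B + 1 there, by integrality,
  -- and its sum would be too large.
  scale-average : ∀ κ → 1 ℕ.≤ κ → ∀ (F : ℕ → ℤ) (B : ℤ) → 0ℤ ≤ B → (∀ p → 0ℤ ≤ F p) → scaleSum κ F ≤ B * + scaleCount κ →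
    ∃ λ p → Prime p × 64 ℕ.^ κ ℕ.< p × p ℕ.≤ 64 ℕ.* 64 ℕ.^ κ × F p ≤ B
  scale-average κ 1≤κ F B 0≤B F≥0 hyp = go (scaleSum κ (λ p → 𝟙 (F p ≤? B)) ≟ 0ℤ)
    where
    open ≤-Reasoning
    c = + scaleCount κ
    G = scaleSum κ (λ p → 𝟙 (F p ≤? B))
    pointwise : ∀ p → (d : Dec (F p ≤ B)) → B + 1ℤ ≤ F p + (B + 1ℤ) * 𝟙 d
    pointwise p (yes _) = cert (F≥0 p) (ring₂ (F p) B)
    pointwise p (no ¬h) = cert (gap< (≰⇒> ¬h)) (ring₃ (F p) B)
    total : c * (B + 1ℤ) ≤ scaleSum κ F + (B + 1ℤ) * G
    total = begin
      c * (B + 1ℤ) ≡⟨ sym (scaleSum-const κ (B + 1ℤ)) ⟩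
      scaleSum κ (λ _ → B + 1ℤ) ≤⟨ scaleSum-mono κ (λ p _ _ _ → pointwise p (F p ≤? B)) ⟩
      scaleSum κ (λ p → F p + (B + 1ℤ) * 𝟙 (F p ≤? B)) ≡⟨ scaleSum-+ κ F (λ p → (B + 1ℤ) * 𝟙 (F p ≤? B)) ⟩
      scaleSum κ F + scaleSum κ (λ p → (B + 1ℤ) * 𝟙 (F p ≤? B)) ≡⟨ cong (λ z → scaleSum κ F + z) (scaleSum-*ˡ κ (B + 1ℤ) (λ p → 𝟙 (F p ≤? B))) ⟩
      scaleSum κ F + (B + 1ℤ) * G ∎
    go : Dec (G ≡ 0ℤ) → _
    go (no nz) with scaleSum-witness κ (λ p → 𝟙 (F p ≤? B)) nz
    ... | p , pp , s<p , p≤ , h = p , pp , s<p , p≤ , 𝟙-nonzero (F p ≤? B) h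
    go (yes G≡0) = ⊥-elim (<⇒≱ (scaleCount-positive κ 1≤κ) (cert (gap (subst (λ z → c * (B + 1ℤ) ≤ scaleSum κ F + (B + 1ℤ) * z) G≡0 total) ⊞ gap hyp) (ring₄ c B (scaleSum κ F))))

  -- One has 4k p m ≤ 4k |p m + n| - 4k n ≤ N - 4N, while p c ≤ N + p ≤ 2N. The factor 4 pays for
  -- the error term and for the rounding of c.
  opposite : ∀ (k p c N m n : ℤ) → 0ℤ ≤ k → 0ℤ < p → p * c ≤ N + p → p ≤ N → + 4 * k * abs (p * m + n) ≤ N → N ≤ k * n → + 4 * k * m ≤ - c
  opposite k p c N m n 0≤k 0<p h₁ h₂ h₃ h₄ = *-cancelˡ p 0<p (cert (gap h₃ ⊞ nneg 4 ⊠ 0≤k ⊠ gap (≤-abs (p * m + n)) ⊞ nneg 4 ⊠ gap h₄ ⊞ gap h₁ ⊞ gap h₂ ⊞ 0≤N) (ring₅ k p c N m n (abs (p * m + n))))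
    where
    0≤N = ≤-trans (<⇒≤ 0<p) h₂

  -- A prime p on a good scale has p M(N / p) ≈ −M(N).
  module SignChange (κ₁ k D n₁ N₁ R : ℕ) (1≤κ₁ : 1 ℕ.≤ κ₁) (gs : GoodScale κ₁ D 1 n₁ N₁)
    (D≡ : + D ≡ + 8 * + k * (+ 8 * + k)) (R≡ : R ≡ 64 ℕ.^ (n₁ ℕ.+ κ₁)) (32k≤64^κ₁ : + 32 * + k ≤ + (64 ℕ.^ κ₁)) where

    N₀ = N₁ ℕ.+ R ℕ.* (1 ℕ.+ 32 ℕ.* k)

    k≥0 : 0ℤ ≤ + k
    k≥0 = nneg k

    big : ∀ N → N₀ ℕ.≤ N → ∃ λ p → ∃ λ (pp : Prime p) → + p ≤ + R × + p ≤ + N × + 4 * + k * abs (+ p * M (multiples p N) + M N) ≤ + N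
    big N N₀≤N = conclude (gs N (λ _ → μ) (λ _ → N) (λ _ → abs-μ-≤1) (λ _ _ → ℕₚ.≤-trans (ℕₚ.m≤m+n N₁ (R ℕ.* (1 ℕ.+ 32 ℕ.* k))) N₀≤N , ℕₚ.≤-refl))
      where
      dev : ℕ → ℤ
      dev p = deviation μ N p
      Result = ∃ λ p → ∃ λ (pp : Prime p) → + p ≤ + R × + p ≤ + N × + 4 * + k * abs (+ p * M (multiples p N) + M N) ≤ + N
      conclude : (∃ λ κ → κ₁ ℕ.≤ κ × κ ℕ.< n₁ ℕ.+ κ₁ × (∀ i → i ℕ.< 1 → + D * scaleSum κ (λ p → dev p * dev p) ≤ + N * + N * + scaleCount κ)) → Result
      conclude (κ , κ₁≤κ , κ<K , hyp) = finish (scale-average κ (ℕₚ.≤-trans 1≤κ₁ κ₁≤κ) (λ p → + D * (dev p * dev p)) (+ N * + N) (nneg N ⊠ nneg N) (λ p → nneg D ⊠ sq (dev p))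
          (≤-trans (≤-reflexive (scaleSum-*ˡ κ (+ D) (λ p → dev p * dev p))) (hyp 0 (ℕ.s≤s ℕ.z≤n))))
       where
       finish : (∃ λ p → Prime p × 64 ℕ.^ κ ℕ.< p × p ℕ.≤ 64 ℕ.* 64 ℕ.^ κ × + D * (dev p * dev p) ≤ + N * + N) → Result
       finish (p , pp , s<p , p≤ , small) = p , pp , +≤+ p≤R , p≤N , 4ku≤N
        where
        instance p≢0 = prime⇒nonZero pp
        c = multiples p N
        u = abs (+ p * M c + M N)
        p≤R : p ℕ.≤ R
        p≤R = ℕₚ.≤-trans p≤ (ℕₚ.≤-trans (ℕₚ.^-monoʳ-≤ 64 κ<K) (ℕₚ.≤-reflexive (sym R≡)))
        R≤N : + R * (1ℤ + + 32 * + k) ≤ + N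
        R≤N = ≤-trans (≤-reflexive (sym (trans (pos-* R (1 ℕ.+ 32 ℕ.* k)) (cong (λ z → + R * (1ℤ + z)) (pos-* 32 k))))) (+≤+ (ℕₚ.≤-trans (ℕₚ.m≤n+m (R ℕ.* (1 ℕ.+ 32 ℕ.* k)) N₁) N₀≤N))
        p[1+32k]≤N : + p * (1ℤ + + 32 * + k) ≤ + N
        p[1+32k]≤N = ≤-trans (*-monoʳ (1ℤ + + 32 * + k) (nneg 1 ⊞ nneg 32 ⊠ k≥0) (+≤+ p≤R)) R≤N
        p≤N : + p ≤ + N
        p≤N = ≤-trans (cert (nneg p ⊠ (nneg 32 ⊠ k≥0)) (ring₆ (+ p) (+ k))) p[1+32k]≤N
        32k≤p : + 32 * + k ≤ + p
        32k≤p = ≤-trans 32k≤64^κ₁ (+≤+ (ℕₚ.≤-trans (ℕₚ.^-monoʳ-≤ 64 κ₁≤κ) (ℕₚ.<⇒≤ s<p)))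
        8k·dev≤N : + 8 * + k * abs (dev p) ≤ + N
        8k·dev≤N = sq-cancel-≤ (nneg N) (≤-trans (≤-reflexive eq) small)
          where
          eq : + 8 * + k * abs (dev p) * (+ 8 * + k * abs (dev p)) ≡ + D * (dev p * dev p)
          eq = trans (ring₇ (+ k) (abs (dev p))) (cong₂ _*_ (sym D≡) (abs-sq (dev p)))
        4ku≤N : + 4 * + k * u ≤ + N
        4ku≤N = *-cancelˡ (+ 4) (+<+ (ℕ.s≤s ℕ.z≤n)) (cert (nneg 16 ⊠ k≥0 ⊠ gap (deviation-M pp N) ⊞ nneg 2 ⊠ gap 8k·dev≤N ⊞ gap 32k≤p ⊠ nneg c ⊞ gap (multiples-upperℤ p N) ⊞ gap p[1+32k]≤N)
            (ring₈ (+ k) u (abs (dev p)) (+ c) (+ p) (+ N)))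

    multiples≤ : ∀ {p} → Prime p → ∀ N → multiples p N ℕ.≤ N
    multiples≤ {p} pp N = ℕₚ.≮⇒≥ (λ N<c → ℕₚ.<⇒≱ (proj₂ (multiples-bounds p {{prime⇒nonZero pp}} N))
      (ℕₚ.≤-trans (ℕₚ.+-monoˡ-≤ p (ℕₚ.m≤m*n N p {{prime⇒nonZero pp}})) (ℕₚ.≤-trans (ℕₚ.≤-reflexive (trans (ℕₚ.+-comm (N ℕ.* p) p) (ℕₚ.*-comm (suc N) p))) (ℕₚ.*-monoʳ-≤ p N<c))))

    Signs : ℕ → ℕ → Set
    Signs N c = (+ N ≤ + 4 * + k * M N × + 4 * + k * M c ≤ - + c) ⊎ (+ 4 * + k * M N ≤ - + N × + c ≤ + 4 * + k * M c)

    -- What matters is that R is fixed before N, so the two points of opposite sign lie within a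
    -- bounded ratio, and that the lower point loses only a factor 4 in relative size.
    sign-change : ∀ N → N₀ ℕ.≤ N → ¬ (+ k * abs (M N) ≤ + N) → ∃ λ c → c ℕ.≤ N × + N ≤ + R * + c × Signs N c
    sign-change N N₀≤N large = finish (big N N₀≤N)
      where
      open ≤-Reasoning
      N<k|M| : + N < + k * abs (M N)
      N<k|M| = ≰⇒> large
      quadruple : ∀ x → + N ≤ + k * x → + N ≤ + 4 * + k * x
      quadruple x h = cert (gap h ⊞ nneg 3 ⊠ (gap h ⊞ nneg N)) (ring₉ (+ N) (+ k) x)
      negate : ∀ x y → x ≤ + 4 * + k * - y → + 4 * + k * y ≤ - x
      negate x y h = cert (gap h) (ring₁₀ (+ k) x y)
      negate′ : ∀ x y → + 4 * + k * - y ≤ - x → x ≤ + 4 * + k * y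
      negate′ x y h = cert (gap h) (ring₁₁ (+ k) x y)
      finish : (∃ λ p → ∃ λ (pp : Prime p) → + p ≤ + R × + p ≤ + N × + 4 * + k * abs (+ p * M (multiples p N) + M N) ≤ + N) → _
      finish (p , pp , p≤R , p≤N , small) = c , multiples≤ pp N , N≤Rc , signs (≤-total 0ℤ (M N))
        where
        instance p≢0 = prime⇒nonZero pp
        c = multiples p N
        m = M c
        n = M N
        N≤Rc : + N ≤ + R * + c
        N≤Rc = begin
          + N ≤⟨ multiples-lowerℤ p N ⟩
          + p * + c ≤⟨ *-monoʳ (+ c) (nneg c) p≤R ⟩
          + R * + c ∎
        0<p : 0ℤ < + p
        0<p = +<+ (ℕₚ.n≢0⇒n>0 (ℕ.≢-nonZero⁻¹ p))
        signs : 0ℤ ≤ n ⊎ n ≤ 0ℤ → Signs N c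
        signs (inj₁ 0≤n) = inj₁ (quadruple n h , opposite (+ k) (+ p) (+ c) (+ N) m n k≥0 0<p (multiples-upperℤ p N) p≤N small h)
          where
          h : + N ≤ + k * n
          h = begin
            + N ≤⟨ <⇒≤ N<k|M| ⟩
            + k * abs n ≡⟨ cong (+ k *_) (abs-of-nonneg 0≤n) ⟩
            + k * n ∎
        signs (inj₂ n≤0) = inj₂ (negate (+ N) n (quadruple (- n) h) , negate′ (+ c) m opp)
          where
          h : + N ≤ + k * - n
          h = begin
            + N ≤⟨ <⇒≤ N<k|M| ⟩
            + k * abs n ≡⟨ cong (+ k *_) (trans (sym (abs-neg n)) (abs-of-nonneg (neg-mono-≤ n≤0))) ⟩
            + k * - n ∎
          small′ : + 4 * + k * abs (+ p * - m + - n) ≤ + N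
          small′ = begin
            + 4 * + k * abs (+ p * - m + - n) ≡⟨ cong (+ 4 * + k *_) (trans (cong abs (ring₁₂ (+ p) m n)) (abs-neg (+ p * m + n))) ⟩
            + 4 * + k * abs (+ p * m + n) ≤⟨ small ⟩
            + N ∎
          opp : + 4 * + k * - m ≤ - + c
          opp = opposite (+ k) (+ p) (+ c) (+ N) (- m) (- n) k≥0 0<p (multiples-upperℤ p N) p≤N small′ h

  -- The function q I M(n) - i n is nonnegative where M(n) ≥ n / q and nonpositive where M(n) ≤ -n /
  -- q, because 0 ≤ i ≤ I, and one step changes it by at most q I + i.
  intermediate-value : ∀ (q I i c N : ℕ) → 1ℤ ≤ + q → i ℕ.≤ I → c ℕ.≤ N →
    (+ N ≤ + q * M N × + q * M c ≤ - + c) ⊎ (+ q * M N ≤ - + N × + c ≤ + q * M c) →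
    ∃ λ X → c ℕ.≤ X × X ℕ.≤ N × abs (+ q * + I * M X - + i * + X) ≤ + 2 * (+ q * + I)
  intermediate-value q I i c N q≥1 i≤I c≤N = go
    where
    B = + 2 * (+ q * + I)
    D : ℕ → ℤ
    D n = + q * + I * M n - + i * + n
    i≤I′ : + i ≤ + I
    i≤I′ = +≤+ i≤I
    step : ∀ n → abs (D (suc n) - D n) ≤ B
    step n = begin
      abs (D (suc n) - D n) ≡⟨ cong abs (ring₁₃ (+ q * + I) (M n) (μ n) (+ i) (+ n)) ⟩
      abs (+ q * + I * μ n + - + i) ≤⟨ abs-+ (+ q * + I * μ n) (- + i) ⟩
      abs (+ q * + I * μ n) + abs (- + i) ≡⟨ cong₂ _+_ (trans (abs-mul (+ q * + I) (μ n)) (cong (_* abs (μ n)) (abs-of-nonneg (nneg q ⊠ nneg I)))) (abs-neg (+ i)) ⟩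
      + q * + I * abs (μ n) + + i ≤⟨ cert (nneg q ⊠ nneg I ⊠ gap (abs-μ-≤1 n) ⊞ gap q≥1 ⊠ nneg I ⊞ gap i≤I′) (ring₁₄ (+ q) (+ I) (abs (μ n)) (+ i)) ⟩
      B ∎
      where
      open ≤-Reasoning
    N≡ : c ℕ.+ (N ℕ.∸ c) ≡ N
    N≡ = ℕₚ.m+[n∸m]≡n c≤N
    high : ∀ n → + n ≤ + q * M n → 0ℤ ≤ D n
    high n h = subst (0ℤ ≤_) (ring₁₅ (+ q) (+ I) (M n) (+ i) (+ n)) (nneg I ⊠ gap h ⊞ gap i≤I′ ⊠ nneg n)
    low : ∀ n → + q * M n ≤ - + n → D n ≤ 0ℤ
    low n h = cert (nneg I ⊠ gap h ⊞ (nneg I ⊞ nneg i) ⊠ nneg n) (ring₁₆ (+ q) (+ I) (M n) (+ i) (+ n))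
    go : (+ N ≤ + q * M N × + q * M c ≤ - + c) ⊎ (+ q * M N ≤ - + N × + c ≤ + q * M c) → ∃ λ X → c ℕ.≤ X × X ℕ.≤ N × abs (D X) ≤ B
    go (inj₁ (hN , hc)) = let (X , c≤X , X≤ , h) = discrete-ivt D B step (N ℕ.∸ c) c (low c hc) (subst (λ z → 0ℤ ≤ D z) (sym N≡) (high N hN)) in
      X , c≤X , subst (X ℕ.≤_) N≡ X≤ , h
    go (inj₂ (hN , hc)) = let (X , c≤X , X≤ , h) = discrete-ivt (λ n → - D n) B step′ (N ℕ.∸ c) c (neg-mono-≤ (high c hc)) (subst (λ z → 0ℤ ≤ - D z) (sym N≡) (neg-mono-≤ (low N hN))) in
      X , c≤X , subst (X ℕ.≤_) N≡ X≤ , subst (_≤ B) (abs-neg (D X)) h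
      where
      step′ : ∀ n → abs (- D (suc n) - - D n) ≤ B
      step′ n = subst (_≤ B) (sym (trans (cong abs (ring₁₇ (D (suc n)) (D n))) (abs-neg (D (suc n) - D n)))) (step n)

  module Contradiction
    (q I R T Ω κ₂ n₂ N₂ S b N : ℕ) (c : ℕ) (e : ℕ) (D : ℕ)
    (q≥1 : 1ℤ ≤ + q) (I≥1 : 1 ℕ.≤ I) (R>0 : 0ℤ < + R) (T≡ : + T ≡ + 64 * + q * + I * + R) (Ω≡ : + Ω ≡ + 1024 * + R * (+ q * + I))
    (qI≡ : q ℕ.* I ≡ 2 ℕ.^ e) (e≥4 : 4 ℕ.≤ e) (b≡ : b ≡ 3 ℕ.+ e) (D≡ : + D ≡ + 2 * (+ T * + T)) (I-large : + 256 * (+ 1024 * + R * + b) < + I)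
    (κ₂≥1 : 1 ℕ.≤ κ₂) (T≤ : + 2 * + T ≤ + (64 ℕ.^ κ₂)) (e≤ : e ℕ.≤ 6 ℕ.* κ₂) (S≡ : S ≡ 64 ℕ.^ (n₂ ℕ.+ κ₂))
    (gs : GoodScale κ₂ D I n₂ N₂)
    (N-large₁ : + 64 * + S * (1ℤ + + 2 * + T) ≤ + N) (N-large₂ : + 64 * + R * (+ 2 * (+ q * + I) + + I * (+ 64 * + S)) ≤ + N)
    (N-large₃ : Ω ℕ.* S ℕ.≤ N) (N-large₄ : R ℕ.* N₂ ℕ.≤ N) (N≤Rc : + N ≤ + R * + c) (c≤N : c ℕ.≤ N)
    (signs : (+ N ≤ + q * M N × + q * M c ≤ - + c) ⊎ (+ q * M N ≤ - + N × + c ≤ + q * M c))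
    where

    Points : ℕ → Set
    Points i = ∃ λ X → c ℕ.≤ X × X ℕ.≤ N × (i ℕ.< I → abs (+ q * + I * M X - + i * + X) ≤ + 2 * (+ q * + I))

    points : ∀ i → Points i
    points i = go (i ℕ.<? I)
      where
      go : Dec (i ℕ.< I) → Points i
      go (yes i<I) = let (X , c≤X , X≤N , h) = intermediate-value q I i c N q≥1 (ℕₚ.<⇒≤ i<I) c≤N signs in X , c≤X , X≤N , λ _ → h
      -- Indices from I on only need some point of the range; N is used.
      go (no i≮I) = N , c≤N , ℕₚ.≤-refl , λ i<I → ⊥-elim (i≮I i<I)

    X : ℕ → ℕ
    X i = proj₁ (points i)

    X-lower : ∀ i → + N ≤ + R * + X i
    X-lower i = ≤-trans N≤Rc (*-monoˡ (+ R) (nneg R) (+≤+ (proj₁ (proj₂ (points i)))))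

    N₂≤X : ∀ i → N₂ ℕ.≤ X i
    N₂≤X i = drop‿+≤+ (*-cancelˡ (+ R) R>0 (≤-trans (≤-trans (≤-reflexive (sym (pos-* R N₂))) (+≤+ N-large₄)) (X-lower i)))

    contradiction : (∃ λ κ → κ₂ ℕ.≤ κ × κ ℕ.< n₂ ℕ.+ κ₂ × (∀ i → i ℕ.< I →
      + D * scaleSum κ (λ p → deviation μ (X i) p * deviation μ (X i) p) ≤ + N * + N * + scaleCount κ)) → ⊥
    contradiction (κ , κ₂≤κ , κ<K , hyp) = <⇒≱ strict upper
      where
      s = 64 ℕ.^ κ
      s≤S : s ℕ.≤ S
      s≤S = ℕₚ.≤-trans (ℕₚ.^-monoʳ-≤ 64 (ℕₚ.<⇒≤ κ<K)) (ℕₚ.≤-reflexive (sym S≡))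
      s≤S′ : + s ≤ + S
      s≤S′ = +≤+ s≤S
      e≤6κ : e ℕ.≤ 6 ℕ.* κ
      e≤6κ = ℕₚ.≤-trans e≤ (ℕₚ.*-monoʳ-≤ 6 κ₂≤κ)
      -- Since q I = 2ᵉ and s = 2^(6κ), the quotient 8 s / (qI) is exactly this power of two. This
      -- is the reason for taking k and I as powers of two.
      h = 2 ℕ.^ (6 ℕ.* κ ℕ.+ 3 ℕ.∸ e)
      h·qI : h ℕ.* 2 ℕ.^ e ≡ 8 ℕ.* s
      h·qI = trans (sym (ℕₚ.^-distribˡ-+-* 2 (6 ℕ.* κ ℕ.+ 3 ℕ.∸ e) e)) (trans (cong (2 ℕ.^_) (ℕₚ.m∸n+n≡m (ℕₚ.≤-trans e≤6κ (ℕₚ.m≤m+n (6 ℕ.* κ) 3))))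
        (trans (ℕₚ.^-distribˡ-+-* 2 (6 ℕ.* κ) 3) (trans (ℕₚ.*-comm (2 ℕ.^ (6 ℕ.* κ)) 8) (cong (8 ℕ.*_) (sym (ℕₚ.^-*-assoc 2 6 κ))))))
      h≡ : + h * (+ q * + I) ≡ + 8 * + s
      h≡ = trans (cong (+ h *_) (trans (sym (pos-* q I)) (cong +_ qI≡))) (trans (sym (pos-* h (2 ℕ.^ e))) (trans (cong +_ h·qI) (pos-* 8 s)))
      2h≤s : 2 ℕ.* h ℕ.≤ s
      2h≤s = ℕₚ.*-cancelʳ-≤ (2 ℕ.* h) s (2 ℕ.^ e) {{ℕₚ.m^n≢0 2 e}} (begin
        2 ℕ.* h ℕ.* 2 ℕ.^ e ≡⟨ trans (ℕₚ.*-assoc 2 h (2 ℕ.^ e)) (cong (2 ℕ.*_) h·qI) ⟩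
        2 ℕ.* (8 ℕ.* s) ≡⟨ ring₁₈ s ⟩
        s ℕ.* 2 ℕ.^ 4 ≤⟨ ℕₚ.*-monoʳ-≤ s (ℕₚ.^-monoʳ-≤ 2 e≥4) ⟩
        s ℕ.* 2 ℕ.^ e ∎)
        where
        open ℕₚ.≤-Reasoning
      2^b≥ : s ℕ.+ 63 ℕ.* s ℕ.+ s ℕ.≤ 2 ℕ.^ b ℕ.* (2 ℕ.* h)
      2^b≥ = begin
        s ℕ.+ 63 ℕ.* s ℕ.+ s ≤⟨ ℕₚ.m≤m+n _ (63 ℕ.* s) ⟩
        s ℕ.+ 63 ℕ.* s ℕ.+ s ℕ.+ 63 ℕ.* s ≡⟨ ring₁₉ s ⟩
        16 ℕ.* (8 ℕ.* s) ≡⟨ cong (16 ℕ.*_) (sym h·qI) ⟩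
        16 ℕ.* (h ℕ.* 2 ℕ.^ e) ≡⟨ ring₂₀ h (2 ℕ.^ e) ⟩
        8 ℕ.* 2 ℕ.^ e ℕ.* (2 ℕ.* h) ≡⟨ cong (ℕ._* (2 ℕ.* h)) (trans (sym (ℕₚ.^-distribˡ-+-* 2 3 e)) (cong (2 ℕ.^_) (sym b≡))) ⟩
        2 ℕ.^ b ℕ.* (2 ℕ.* h) ∎
        where
        open ℕₚ.≤-Reasoning
      Ω>0 : 0ℤ < + Ω
      Ω>0 = subst (0ℤ <_) (sym Ω≡) (suc[i]≤j⇒i<j (*-mono-≤ {1ℤ} {+ 1024 * + R} (nneg 1) (nneg 1) (*-mono-≤ {1ℤ} {+ 1024} (nneg 1) (nneg 1) (+≤+ (ℕ.s≤s ℕ.z≤n)) (i<j⇒suc[i]≤j R>0)) (*-mono-≤ (nneg 1) (nneg 1) q≥1 (+≤+ I≥1))))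
      instance
        Ωs≢0 : NonZero (Ω ℕ.* s)
        Ωs≢0 = ℕₚ.m*n≢0 Ω s {{ℕ.>-nonZero (drop‿+<+ Ω>0)}} {{ℕₚ.m^n≢0 64 κ}}
      Ωs≤N : Ω ℕ.* s ℕ.≤ N
      Ωs≤N = ℕₚ.≤-trans (ℕₚ.*-monoʳ-≤ Ω s≤S) N-large₃
      ω = N / (Ω ℕ.* s)
      ω≥1 : 1 ℕ.≤ ω
      ω≥1 = m≥n⇒m/n>0 Ωs≤N
      ωΩs : + (ω ℕ.* (Ω ℕ.* s)) ≡ + Ω * + s * + ω
      ωΩs = trans (pos-* ω (Ω ℕ.* s)) (trans (*-comm (+ ω) (+ (Ω ℕ.* s))) (cong (_* + ω) (pos-* Ω s)))
      ω-upper : + Ω * + s * + ω ≤ + N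
      ω-upper = subst (_≤ + N) ωΩs (+≤+ (m/n*n≤m N (Ω ℕ.* s)))
      ω-lower : + N ≤ + 2 * (+ Ω * + s * + ω)
      ω-lower = subst (+ N ≤_) (trans (pos-* 2 (ω ℕ.* (Ω ℕ.* s))) (cong (+ 2 *_) ωΩs)) (+≤+ (begin
        N ≡⟨ m≡m%n+[m/n]*n N (Ω ℕ.* s) ⟩
        N % (Ω ℕ.* s) ℕ.+ ω ℕ.* (Ω ℕ.* s) ≤⟨ ℕₚ.+-monoˡ-≤ (ω ℕ.* (Ω ℕ.* s)) (ℕₚ.≤-trans (ℕₚ.<⇒≤ (m%n<n N (Ω ℕ.* s))) (ℕₚ.m≤n*m (Ω ℕ.* s) ω {{ℕ.>-nonZero ω≥1}})) ⟩
        ω ℕ.* (Ω ℕ.* s) ℕ.+ ω ℕ.* (Ω ℕ.* s) ≡⟨ cong (ω ℕ.* (Ω ℕ.* s) ℕ.+_) (sym (ℕₚ.+-identityʳ _)) ⟩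
        2 ℕ.* (ω ℕ.* (Ω ℕ.* s)) ∎))
        where open ℕₚ.≤-Reasoning
      upper : + (6 ℕ.* κ) * (+ I * + scaleCount κ) ≤ + 2 * (+ 4 * + Ω * + (2 ℕ.* b ℕ.* (2 ℕ.* h)))
      upper = Clusters.conclusion q I R T Ω N κ b h ω X q≥1 (+≤+ I≥1) R>0 T≡ Ω≡
        (≤-trans T≤ (+≤+ (ℕₚ.^-monoʳ-≤ 64 κ₂≤κ)))
        (≤-trans (*-monoʳ (1ℤ + + 2 * + T) (nneg 1 ⊞ nneg 2 ⊠ nneg T) (*-monoˡ (+ 64) (nneg 64) s≤S′)) N-large₁)
        (≤-trans (*-monoˡ (+ 64 * + R) (nneg 64 ⊠ nneg R) (+-monoʳ-≤ (+ 2 * (+ q * + I)) (*-monoˡ (+ I) (nneg I) (*-monoˡ (+ 64) (nneg 64) s≤S′)))) N-large₂)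
        h≡ 2h≤s (ℕₚ.m^n>0 2 (6 ℕ.* κ ℕ.+ 3 ℕ.∸ e)) (subst (1 ℕ.≤_) (sym b≡) (ℕ.s≤s ℕ.z≤n)) 2^b≥ ω≥1 ω-lower ω-upper (λ i _ → X-lower i) (λ i _ → +≤+ (proj₁ (proj₂ (proj₂ (points i)))))
        (λ i → proj₂ (proj₂ (proj₂ (points i)))) (λ i i<I → subst (λ z → z * scaleSum κ (λ p → deviation μ (X i) p * deviation μ (X i) p) ≤ + N * + N * + scaleCount κ) D≡ (hyp i i<I))
      s≤κc : + s ≤ + κ * + scaleCount κ
      s≤κc = go κ (ℕₚ.≤-trans κ₂≥1 κ₂≤κ)
        where
        go : ∀ κ → 1 ℕ.≤ κ → + (64 ℕ.^ κ) ≤ + κ * + scaleCount κ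
        go (suc κ) _ = ≤-trans (+≤+ (scaleCount-lower κ)) (≤-reflexive (pos-* (suc κ) (scaleCount (suc κ))))
      -- The factor q I inside Ω meets h, and h q I = 8 s. What is left to compare with I is 256 ·
      -- 1024 R b, in which only b involves I.
      strict : + 2 * (+ 4 * + Ω * + (2 ℕ.* b ℕ.* (2 ℕ.* h))) < + (6 ℕ.* κ) * (+ I * + scaleCount κ)
      strict = begin-strict
        + 2 * (+ 4 * + Ω * + (2 ℕ.* b ℕ.* (2 ℕ.* h))) ≡⟨ cong₂ (λ x y → + 2 * (+ 4 * x * y)) Ω≡ (trans (pos-* (2 ℕ.* b) (2 ℕ.* h)) (cong₂ _*_ (pos-* 2 b) (pos-* 2 h))) ⟩
        + 2 * (+ 4 * (+ 1024 * + R * (+ q * + I)) * (+ 2 * + b * (+ 2 * + h))) ≡⟨ ring₂₁ (+ 1024) (+ R) (+ q * + I) (+ b) (+ h) ⟩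
        + 32 * (+ 1024 * + R * + b) * (+ h * (+ q * + I)) ≡⟨ cong (+ 32 * (+ 1024 * + R * + b) *_) h≡ ⟩
        + 32 * (+ 1024 * + R * + b) * (+ 8 * + s) ≡⟨ ring₂₂ (+ 1024 * + R * + b) (+ s) ⟩
        + 256 * (+ 1024 * + R * + b) * + s <⟨ *-monoʳ-<-pos (+ s) {{positive (+<+ (ℕₚ.m^n>0 64 κ))}} I-large ⟩
        + I * + s ≤⟨ cert (nneg 6 ⊠ nneg I ⊠ gap s≤κc ⊞ nneg 5 ⊠ nneg I ⊠ nneg s) (ring₂₃ (+ I) (+ s) (+ κ) (+ scaleCount κ)) ⟩
        + 6 * + κ * (+ I * + scaleCount κ) ≡⟨ cong (_* (+ I * + scaleCount κ)) (sym (pos-* 6 κ)) ⟩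
        + (6 ℕ.* κ) * (+ I * + scaleCount κ) ∎
        where
        open ≤-Reasoning

    absurd : ⊥
    absurd = contradiction (gs N (λ _ → μ) X (λ _ → abs-μ-≤1) (λ i _ → N₂≤X i , proj₁ (proj₂ (proj₂ (points i)))))

-- M(N) = o(N): the choice of the parameters.

module Mertens where
  open ℤ-Arithmetic
  open IntegerSums
  open GoodScales
  open ScaleSums using (M)
  open SignChanges

  private
    ring₁ : ∀ β α → β ℕ.+ (5 ℕ.+ α) ≡ 3 ℕ.+ (2 ℕ.+ α ℕ.+ β)
    ring₁ = ℕR.solve-∀

  MertensBound : ℕ → Set
  MertensBound k = ∃ λ N₀ → ∀ N → N₀ ℕ.≤ N → + k * abs (M N) ≤ + N

  pos-*₃ : ∀ a b c → + (a ℕ.* (b ℕ.* c)) ≡ + a * (+ b * + c)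
  pos-*₃ a b c = trans (pos-* a (b ℕ.* c)) (cong (+ a *_) (pos-* b c))

  module _ (α κ₁ k D₁ n₁ N₁ R : ℕ) (1≤κ₁ : 1 ℕ.≤ κ₁) (gs₁ : GoodScale κ₁ D₁ 1 n₁ N₁)
    (D₁≡ : + D₁ ≡ + 8 * + k * (+ 8 * + k)) (R≡ : R ≡ 64 ℕ.^ (n₁ ℕ.+ κ₁)) (32k≤ : + 32 * + k ≤ + (64 ℕ.^ κ₁)) (k≡ : k ≡ 2 ℕ.^ α) where

    private module SC = SignChange κ₁ k D₁ n₁ N₁ R 1≤κ₁ gs₁ D₁≡ R≡ 32k≤

    private
      module _ (β q I T Ω e b κ₂ D₂ n₂ N₂ S : ℕ) (β≥2 : 2 ℕ.≤ β) (large : 256 ℕ.* (1024 ℕ.* R ℕ.* b) ℕ.< I)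
        (q≡ : q ≡ 4 ℕ.* k) (I≡ : I ≡ 2 ℕ.^ β) (T≡ : T ≡ 64 ℕ.* q ℕ.* I ℕ.* R) (Ω≡ : Ω ≡ 1024 ℕ.* R ℕ.* (q ℕ.* I)) (e≡ : e ≡ 2 ℕ.+ α ℕ.+ β) (b≡ : b ≡ 3 ℕ.+ e)
        (κ₂≡ : κ₂ ≡ suc (T ℕ.+ e)) (D₂≡ : D₂ ≡ 2 ℕ.* (T ℕ.* T)) (S≡ : S ≡ 64 ℕ.^ (n₂ ℕ.+ κ₂)) (gs₂ : GoodScale κ₂ D₂ I n₂ N₂) where

        L₁ = 64 ℕ.* S ℕ.* (1 ℕ.+ 2 ℕ.* T)
        L₂ = 64 ℕ.* R ℕ.* (2 ℕ.* (q ℕ.* I) ℕ.+ I ℕ.* (64 ℕ.* S))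
        L₃ = Ω ℕ.* S
        L₄ = R ℕ.* N₂

        finish : MertensBound k
        finish = N₀ , bound
          where
          N₀ = SC.N₀ ℕ.+ (L₁ ℕ.+ (L₂ ℕ.+ (L₃ ℕ.+ L₄)))
          module _ (N : ℕ) (N₀≤N : N₀ ℕ.≤ N) where
            r₁ : L₁ ℕ.+ (L₂ ℕ.+ (L₃ ℕ.+ L₄)) ℕ.≤ N
            r₁ = ℕₚ.≤-trans (ℕₚ.m≤n+m _ SC.N₀) N₀≤N
            r₂ : L₂ ℕ.+ (L₃ ℕ.+ L₄) ℕ.≤ N
            r₂ = ℕₚ.≤-trans (ℕₚ.m≤n+m _ L₁) r₁
            r₃ : L₃ ℕ.+ L₄ ℕ.≤ N
            r₃ = ℕₚ.≤-trans (ℕₚ.m≤n+m _ L₂) r₂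
            l₁ : + 64 * + S * (1ℤ + + 2 * + T) ≤ + N
            l₁ = ≤-trans (≤-reflexive (sym (trans (pos-* (64 ℕ.* S) (1 ℕ.+ 2 ℕ.* T)) (cong₂ _*_ (pos-* 64 S) (cong (λ z → 1ℤ + z) (pos-* 2 T)))))) (+≤+ (ℕₚ.≤-trans (ℕₚ.m≤m+n L₁ _) r₁))
            l₂ : + 64 * + R * (+ 2 * (+ q * + I) + + I * (+ 64 * + S)) ≤ + N
            l₂ = ≤-trans (≤-reflexive (sym (trans (pos-* (64 ℕ.* R) (2 ℕ.* (q ℕ.* I) ℕ.+ I ℕ.* (64 ℕ.* S)))
              (cong₂ _*_ (pos-* 64 R) (cong₂ _+_ (pos-*₃ 2 q I) (pos-*₃ I 64 S)))))) (+≤+ (ℕₚ.≤-trans (ℕₚ.m≤m+n L₂ _) r₂))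
            +q≡ : + q ≡ + 4 * + k
            +q≡ = trans (cong +_ q≡) (pos-* 4 k)
            k>0 : 1 ℕ.≤ k
            k>0 = subst (1 ℕ.≤_) (sym k≡) (ℕₚ.m^n>0 2 α)
            R>0 : 1 ℕ.≤ R
            R>0 = subst (1 ℕ.≤_) (sym R≡) (ℕₚ.m^n>0 64 (n₁ ℕ.+ κ₁))
            qI≡ : q ℕ.* I ≡ 2 ℕ.^ e
            qI≡ = trans (cong₂ ℕ._*_ (trans q≡ (cong (4 ℕ.*_) k≡)) I≡) (trans (cong (ℕ._* 2 ℕ.^ β) (sym (ℕₚ.^-distribˡ-+-* 2 2 α))) (trans (sym (ℕₚ.^-distribˡ-+-* 2 (2 ℕ.+ α) β)) (cong (2 ℕ.^_) (sym e≡))))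
            T≤ : 2 ℕ.* T ℕ.≤ 64 ℕ.^ κ₂
            T≤ = subst (λ z → 2 ℕ.* T ℕ.≤ 64 ℕ.^ z) (sym κ₂≡) (ℕₚ.*-mono-≤ (ℕₚ.m≤m+n 2 62) (ℕₚ.≤-trans (ℕₚ.<⇒≤ (n<2^n T)) (ℕₚ.≤-trans (ℕₚ.^-monoˡ-≤ T (ℕₚ.m≤m+n 2 62)) (ℕₚ.^-monoʳ-≤ 64 (ℕₚ.m≤m+n T e)))))
            e≤ : e ℕ.≤ 6 ℕ.* κ₂
            e≤ = ℕₚ.≤-trans (ℕₚ.≤-trans (ℕₚ.m≤n+m e (suc T)) (ℕₚ.≤-reflexive (sym κ₂≡))) (ℕₚ.m≤n*m κ₂ 6)
            +T≡ : + T ≡ + 64 * + q * + I * + R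
            +T≡ = trans (cong +_ T≡) (trans (pos-* (64 ℕ.* q ℕ.* I) R) (cong (_* + R) (trans (pos-* (64 ℕ.* q) I) (cong (_* + I) (pos-* 64 q)))))
            +Ω≡ : + Ω ≡ + 1024 * + R * (+ q * + I)
            +Ω≡ = trans (cong +_ Ω≡) (trans (pos-* (1024 ℕ.* R) (q ℕ.* I)) (cong₂ _*_ (pos-* 1024 R) (pos-* q I)))
            +D≡ : + D₂ ≡ + 2 * (+ T * + T)
            +D≡ = trans (cong +_ D₂≡) (pos-*₃ 2 T T)
            +T≤ : + 2 * + T ≤ + (64 ℕ.^ κ₂)
            +T≤ = ≤-trans (≤-reflexive (sym (pos-* 2 T))) (+≤+ T≤)
            large′ : + (256 ℕ.* (1024 ℕ.* R ℕ.* b)) ≡ + 256 * (+ 1024 * + R * + b)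
            large′ = trans (pos-* 256 (1024 ℕ.* R ℕ.* b)) (cong (+ 256 *_) (trans (pos-* (1024 ℕ.* R) b) (cong (_* + b) (pos-* 1024 R))))
            +large : + 256 * (+ 1024 * + R * + b) < + I
            +large = subst (_< + I) large′ (+<+ large)
            bound″ : (∃ λ c → c ℕ.≤ N × + N ≤ + R * + c × SC.Signs N c) → ⊥
            bound″ (c , c≤N , N≤Rc , signs) = Contradiction.absurd q I R T Ω κ₂ n₂ N₂ S b N c e D₂
              (+≤+ (subst (1 ℕ.≤_) (sym q≡) (ℕₚ.≤-trans k>0 (ℕₚ.m≤n*m k 4)))) (subst (1 ℕ.≤_) (sym I≡) (ℕₚ.m^n>0 2 β)) (+<+ R>0)
              +T≡ +Ω≡ qI≡ (subst (4 ℕ.≤_) (sym e≡) (ℕₚ.+-mono-≤ (ℕₚ.m≤m+n 2 α) β≥2)) b≡ +D≡ +large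
              (subst (1 ℕ.≤_) (sym κ₂≡) (ℕ.s≤s ℕ.z≤n)) +T≤ e≤ S≡ gs₂
              l₁ l₂ (ℕₚ.≤-trans (ℕₚ.m≤m+n L₃ L₄) r₃) (ℕₚ.≤-trans (ℕₚ.m≤n+m L₄ L₃) r₃) N≤Rc c≤N
              (subst (λ z → (+ N ≤ z * M N × z * M c ≤ - + c) ⊎ (z * M N ≤ - + N × + c ≤ z * M c)) (sym +q≡) signs)
            bound′ : ¬ (+ k * abs (M N) ≤ + N) → ⊥
            bound′ big = bound″ (SC.sign-change N (ℕₚ.≤-trans (ℕₚ.m≤m+n SC.N₀ _) N₀≤N) big)
            bound : + k * abs (M N) ≤ + N
            bound = go (+ k * abs (M N) ≤? + N)
              where
              go : Dec (+ k * abs (M N) ≤ + N) → + k * abs (M N) ≤ + N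
              go (yes h) = h
              go (no ¬h) = ⊥-elim (bound′ ¬h)

      stage₂ : ∀ β q I T Ω e b κ₂ D₂ → 2 ℕ.≤ β → 256 ℕ.* (1024 ℕ.* R ℕ.* b) ℕ.< I → q ≡ 4 ℕ.* k → I ≡ 2 ℕ.^ β →
        T ≡ 64 ℕ.* q ℕ.* I ℕ.* R → Ω ≡ 1024 ℕ.* R ℕ.* (q ℕ.* I) → e ≡ 2 ℕ.+ α ℕ.+ β → b ≡ 3 ℕ.+ e → κ₂ ≡ suc (T ℕ.+ e) → D₂ ≡ 2 ℕ.* (T ℕ.* T) →
        (∃₂ λ n₂ N₂ → GoodScale κ₂ D₂ (suc (ℕ.pred I)) n₂ N₂) → MertensBound k
      stage₂ β q I T Ω e b κ₂ D₂ β≥2 large q≡ I≡ T≡ Ω≡ e≡ b≡ κ₂≡ D₂≡ (n₂ , N₂ , gs₂) =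
        finish β q I T Ω e b κ₂ D₂ n₂ N₂ (64 ℕ.^ (n₂ ℕ.+ κ₂)) β≥2 large q≡ I≡ T≡ Ω≡ e≡ b≡ κ₂≡ D₂≡ refl
          (subst (λ z → GoodScale κ₂ D₂ z n₂ N₂) (ℕₚ.suc-pred I {{subst NonZero (sym I≡) (ℕₚ.m^n≢0 2 β)}}) gs₂)

    -- R comes from the first good scale and is fixed before β. Then I = 2^β has to exceed a
    -- constant times R b with b = β + 5 + α, an exponential against a linear function. T, Ω and the
    -- starting point κ₂ of the second family of scales depend on β, and the bound S for its primes
    -- comes last.
    stage₁ : (∃ λ β → 2 ℕ.≤ β × 256 ℕ.* (1024 ℕ.* R) ℕ.* (β ℕ.+ (5 ℕ.+ α)) ℕ.< 2 ℕ.^ β) → MertensBound k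
    stage₁ (β , β≥2 , large) = with-parameters _ _ _ _ (2 ℕ.+ α ℕ.+ β) (3 ℕ.+ (2 ℕ.+ α ℕ.+ β)) _ _
      (subst (ℕ._< 2 ℕ.^ β) (trans (ℕₚ.*-assoc 256 (1024 ℕ.* R) (β ℕ.+ (5 ℕ.+ α))) (cong (λ z → 256 ℕ.* (1024 ℕ.* R ℕ.* z)) (ring₁ β α))) large)
      refl refl refl refl refl refl refl refl
      where
      with-parameters : ∀ q I T Ω e b κ₂ D₂ → 256 ℕ.* (1024 ℕ.* R ℕ.* b) ℕ.< I → q ≡ 4 ℕ.* k → I ≡ 2 ℕ.^ β →
        T ≡ 64 ℕ.* q ℕ.* I ℕ.* R → Ω ≡ 1024 ℕ.* R ℕ.* (q ℕ.* I) → e ≡ 2 ℕ.+ α ℕ.+ β → b ≡ 3 ℕ.+ e → κ₂ ≡ suc (T ℕ.+ e) → D₂ ≡ 2 ℕ.* (T ℕ.* T) → MertensBound k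
      with-parameters q I T Ω e b κ₂ D₂ large q≡ I≡ T≡ Ω≡ e≡ b≡ κ₂≡ D₂≡ =
        stage₂ β q I T Ω e b κ₂ D₂ β≥2 large q≡ I≡ T≡ Ω≡ e≡ b≡ κ₂≡ D₂≡ (good-scale κ₂ (subst (1 ℕ.≤_) (sym κ₂≡) (ℕ.s≤s ℕ.z≤n)) D₂ (ℕ.pred I))

  mertens : ∀ α → MertensBound (2 ℕ.^ α)
  -- 64^(α+1) ≥ 32 k makes the primes large enough, and D = (8k)² makes the deviation at a suitable
  -- prime at most N / (8k).
  mertens α = go (good-scale (suc α) (ℕ.s≤s ℕ.z≤n) (8 ℕ.* k ℕ.* (8 ℕ.* k)) 0)
    where
    k = 2 ℕ.^ α
    go : (∃₂ λ n₁ N₁ → GoodScale (suc α) (8 ℕ.* k ℕ.* (8 ℕ.* k)) 1 n₁ N₁) → MertensBound k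
    go (n₁ , N₁ , gs₁) = stage₁ α (suc α) k (8 ℕ.* k ℕ.* (8 ℕ.* k)) n₁ N₁ (64 ℕ.^ (n₁ ℕ.+ suc α)) (ℕ.s≤s ℕ.z≤n) gs₁
      (trans (pos-* (8 ℕ.* k) (8 ℕ.* k)) (cong₂ _*_ (pos-* 8 k) (pos-* 8 k))) refl
      (≤-trans (≤-reflexive (sym (pos-* 32 k))) (+≤+ (ℕₚ.*-mono-≤ (ℕₚ.m≤m+n 32 32) (ℕₚ.^-monoˡ-≤ α (ℕₚ.m≤m+n 2 62))))) refl
      (exponential-beats-linear (256 ℕ.* (1024 ℕ.* 64 ℕ.^ (n₁ ℕ.+ suc α))) (5 ℕ.+ α))

-- Thue-Morse signs and binary digits.

module ThueMorse where
  open import Defs using (s₂-aux; s₂; t)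
  open import Data.Nat.DivMod
  open import Data.Nat.Divisibility using (m∣m*n)
  open ℕ-Arithmetic
  open IntegerSums

  private
    ring₁ : ∀ x → neg x · neg x ≡ x · x
    ring₁ = ℤR.solve-∀

    ring₂ : ∀ x y → 2 * x * y ≡ 2 * (x * y)
    ring₂ = solve-∀

    ring₃ : ∀ r x p y → r + 2 * (x + p * y) ≡ r + 2 * x + 2 * p * y
    ring₃ = solve-∀

    ring₄ : ∀ x → 2 + 2 * x ≡ 2 * (1 + x)
    ring₄ = solve-∀

    ring₅ : ∀ x y → x · y · (x · y) ≡ x · x · (y · y)
    ring₅ = ℤR.solve-∀

  sgn : ℕ → ℤ
  sgn zero = 1ℤ
  sgn (suc n) = neg (sgn n)

  sgn-+ : ∀ m n → sgn (m + n) ≡ sgn m · sgn n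
  sgn-+ zero n = sym (ℤₚ.*-identityˡ (sgn n))
  sgn-+ (suc m) n = trans (cong neg (sgn-+ m n)) (ℤₚ.neg-distribˡ-* (sgn m) (sgn n))

  sgn-sq : ∀ n → sgn n · sgn n ≡ 1ℤ
  sgn-sq zero = refl
  sgn-sq (suc n) = trans (ring₁ (sgn n)) (sgn-sq n)

  half-+ : ∀ A X → (A + 2 * X) / 2 ≡ A / 2 + X
  half-+ A X = trans (+-distrib-/-∣ʳ A (m∣m*n X)) (cong (A / 2 +_) (trans (cong (_/ 2) (*-comm 2 X)) (m*n/n≡m X 2)))

  parity-+ : ∀ A X → (A + 2 * X) % 2 ≡ A % 2
  parity-+ A X = trans (cong (λ z → (A + z) % 2) (*-comm 2 X)) ([m+kn]%n≡m%n A X 2)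

  halves : ∀ A → A ≡ A % 2 + 2 * (A / 2)
  halves A = trans (m≡m%n+[m/n]*n A 2) (cong (A % 2 +_) (*-comm (A / 2) 2))

  -- The Thue-Morse sign of the lowest `w` binary digits: truncation to a window that starts at
  -- position 0.
  Tw : ℕ → ℕ → ℤ
  Tw zero A = 1ℤ
  Tw (suc w) A = sgn (A % 2) · Tw w (A / 2)

  -- The quotient by 2^θ; `low` below is the remainder. Both recurse on single digits so that they
  -- unfold in step with `Tw`.
  sh : ℕ → ℕ → ℕ
  sh zero A = A
  sh (suc θ) A = sh θ (A / 2)

  low : ℕ → ℕ → ℕ
  low zero A = 0
  low (suc θ) A = A % 2 + 2 * low θ (A / 2)

  abstract
    -- Since A < 2ᴬ, the lowest A digits of A are all its digits, so this is (-1) to the sum of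
    -- digits.
    T : ℕ → ℤ
    T A = Tw A A

    T-def : ∀ A → T A ≡ Tw A A
    T-def A = refl

  T-0 : T 0 ≡ 1ℤ
  T-0 = T-def 0

  T-1 : T 1 ≡ neg 1ℤ
  T-1 = T-def 1

  sh-+ : ∀ θ A B → sh θ (A + 2 ^ θ * B) ≡ sh θ A + B
  sh-+ zero A B = cong (A +_) (+-identityʳ B)
  sh-+ (suc θ) A B = trans (cong (sh θ) (trans (cong (λ z → (A + z) / 2) (ring₂ (2 ^ θ) B)) (half-+ A (2 ^ θ * B)))) (sh-+ θ (A / 2) B)

  low-+ : ∀ θ A B → low θ (A + 2 ^ θ * B) ≡ low θ A
  low-+ zero A B = refl
  low-+ (suc θ) A B = cong₂ (λ x y → x + 2 * y) (trans (cong (λ z → (A + z) % 2) (ring₂ (2 ^ θ) B)) (parity-+ A (2 ^ θ * B)))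
    (trans (cong (low θ) (trans (cong (λ z → (A + z) / 2) (ring₂ (2 ^ θ) B)) (half-+ A (2 ^ θ * B)))) (low-+ θ (A / 2) B))

  Tw-+ : ∀ θ A B → Tw θ (A + 2 ^ θ * B) ≡ Tw θ A
  Tw-+ zero A B = refl
  Tw-+ (suc θ) A B = cong₂ (λ x y → sgn x · y) (trans (cong (λ z → (A + z) % 2) (ring₂ (2 ^ θ) B)) (parity-+ A (2 ^ θ * B)))
    (trans (cong (Tw θ) (trans (cong (λ z → (A + z) / 2) (ring₂ (2 ^ θ) B)) (half-+ A (2 ^ θ * B)))) (Tw-+ θ (A / 2) B))

  low-sh : ∀ θ A → A ≡ low θ A + 2 ^ θ * sh θ A
  low-sh zero A = sym (+-identityʳ A)
  low-sh (suc θ) A = begin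
    A ≡⟨ halves A ⟩
    A % 2 + 2 * (A / 2) ≡⟨ cong (λ z → A % 2 + 2 * z) (low-sh θ (A / 2)) ⟩
    A % 2 + 2 * (low θ (A / 2) + 2 ^ θ * sh θ (A / 2)) ≡⟨ ring₃ (A % 2) (low θ (A / 2)) (2 ^ θ) (sh θ (A / 2)) ⟩
    A % 2 + 2 * low θ (A / 2) + 2 * 2 ^ θ * sh θ (A / 2) ∎
    where
    open ≡-Reasoning

  low< : ∀ θ A → low θ A < 2 ^ θ
  low< zero A = s≤s z≤n
  low< (suc θ) A = begin-strict
    A % 2 + 2 * low θ (A / 2) <⟨ +-monoˡ-< (2 * low θ (A / 2)) (m%n<n A 2) ⟩
    2 + 2 * low θ (A / 2) ≡⟨ ring₄ (low θ (A / 2)) ⟩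
    2 * suc (low θ (A / 2)) ≤⟨ *-monoʳ-≤ 2 (low< θ (A / 2)) ⟩
    2 * 2 ^ θ ∎
    where
    open ≤-Reasoning

  sh-small : ∀ θ A → A < 2 ^ θ → sh θ A ≡ 0
  sh-small zero A A<1 = n<1⇒n≡0 A<1
  sh-small (suc θ) A A< = sh-small θ (A / 2) (m<n*o⇒m/o<n (subst (A <_) (*-comm 2 (2 ^ θ)) A<))

  low-small : ∀ θ A → A < 2 ^ θ → low θ A ≡ A
  low-small θ A A< = sym (trans (low-sh θ A) (trans (cong (λ z → low θ A + 2 ^ θ * z) (sh-small θ A A<)) (trans (cong (low θ A +_) (*-zeroʳ (2 ^ θ))) (+-identityʳ _))))

  sh-unique : ∀ θ r q → r < 2 ^ θ → sh θ (r + 2 ^ θ * q) ≡ q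
  sh-unique θ r q r< = trans (sh-+ θ r q) (cong (_+ q) (sh-small θ r r<))

  low-unique : ∀ θ r q → r < 2 ^ θ → low θ (r + 2 ^ θ * q) ≡ r
  low-unique θ r q r< = trans (low-+ θ r q) (low-small θ r r<)

  2^θ*sh≤ : ∀ θ A → 2 ^ θ * sh θ A ≤ A
  2^θ*sh≤ θ A = subst (2 ^ θ * sh θ A ≤_) (sym (low-sh θ A)) (m≤n+m _ (low θ A))

  Tw-split : ∀ θ w A → Tw (θ + w) A ≡ Tw θ A · Tw w (sh θ A)
  Tw-split zero w A = sym (ℤₚ.*-identityˡ _)
  Tw-split (suc θ) w A = trans (cong (sgn (A % 2) ·_) (Tw-split θ w (A / 2))) (sym (ℤₚ.*-assoc (sgn (A % 2)) (Tw θ (A / 2)) (Tw w (sh θ (A / 2)))))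

  Tw-0 : ∀ w → Tw w 0 ≡ 1ℤ
  Tw-0 zero = refl
  Tw-0 (suc w) = trans (ℤₚ.*-identityˡ (Tw w 0)) (Tw-0 w)

  Tw-sq : ∀ w A → Tw w A · Tw w A ≡ 1ℤ
  Tw-sq zero A = refl
  Tw-sq (suc w) A = trans (ring₅ (sgn (A % 2)) (Tw w (A / 2))) (cong₂ _·_ (sgn-sq (A % 2)) (Tw-sq w (A / 2)))

  Tw-extend : ∀ w v A → A < 2 ^ w → Tw (w + v) A ≡ Tw w A
  Tw-extend w v A A< = trans (Tw-split w v A) (trans (cong (λ z → Tw w A · Tw v z) (sh-small w A A<)) (trans (cong (Tw w A ·_) (Tw-0 v)) (ℤₚ.*-identityʳ _)))

  Tw≡T : ∀ w A → A < 2 ^ w → Tw w A ≡ T A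
  Tw≡T w A A< = trans (sym (Tw-extend w A A A<)) (trans (cong (λ z → Tw z A) (+-comm w A)) (trans (Tw-extend A w A (n<2^n A)) (sym (T-def A))))

  sh≤ : ∀ θ A → sh θ A ≤ A
  sh≤ θ A = ≤-trans (m≤n*m (sh θ A) (2 ^ θ) {{m^n≢0 2 θ}}) (2^θ*sh≤ θ A)

  T-split : ∀ θ A → T A ≡ Tw θ A · T (sh θ A)
  T-split θ A = begin
    T A ≡⟨ sym (Tw≡T (θ + A) A (<-≤-trans (n<2^n A) (^-monoʳ-≤ 2 (m≤n+m A θ)))) ⟩
    Tw (θ + A) A ≡⟨ Tw-split θ A A ⟩
    Tw θ A · Tw A (sh θ A) ≡⟨ cong (Tw θ A ·_) (Tw≡T A (sh θ A) (≤-<-trans (sh≤ θ A) (n<2^n A))) ⟩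
    Tw θ A · T (sh θ A) ∎
    where open ≡-Reasoning

  T-join : ∀ θ r q → r < 2 ^ θ → T (r + 2 ^ θ * q) ≡ T r · T q
  T-join θ r q r< = trans (T-split θ (r + 2 ^ θ * q)) (cong₂ _·_ (trans (Tw-+ θ r q) (Tw≡T θ r r<)) (cong T (sh-unique θ r q r<)))

  T-sq : ∀ A → T A · T A ≡ 1ℤ
  T-sq A = trans (cong₂ _·_ (T-def A) (T-def A)) (Tw-sq A A)

  T-double : ∀ A → T (2 * A) ≡ T A
  T-double A = trans (T-join 1 0 A (s≤s z≤n)) (trans (cong (_· T A) T-0) (ℤₚ.*-identityˡ (T A)))

  T-double+1 : ∀ A → T (1 + 2 * A) ≡ neg (T A)
  T-double+1 A = trans (T-join 1 1 A (s≤s (s≤s z≤n))) (trans (cong (_· T A) T-1) (ℤₚ.-1*i≡-i (T A)))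

  T-2^ : ∀ i A → T (2 ^ i * A) ≡ T A
  T-2^ i A = trans (T-join i 0 A (m^n>0 2 i)) (trans (cong (_· T A) T-0) (ℤₚ.*-identityˡ (T A)))

  abs-of-sq : ∀ z → z · z ≡ 1ℤ → abs z ≡ 1ℤ
  abs-of-sq z eq = ℤₚ.≤-antisym (sq-cancel-≤ (nneg 1) (ℤₚ.≤-reflexive (trans (abs-sq z) eq))) (sq-cancel-≤ (abs-nonneg z) (ℤₚ.≤-reflexive (sym (trans (abs-sq z) eq))))

  abs-T : ∀ A → abs (T A) ≡ 1ℤ
  abs-T A = abs-of-sq (T A) (T-sq A)

  private
    Tw-s₂ : ∀ f n → Tw f n ≡ sgn (s₂-aux f n)
    Tw-s₂ zero n = refl
    Tw-s₂ (suc f) n = trans (cong (sgn (n % 2) ·_) (Tw-s₂ f (n / 2))) (sym (sgn-+ (n % 2) (s₂-aux f (n / 2))))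

    sgn-% : ∀ n → sgn n ≡ 1ℤ ℤ.- pos 2 · pos (n % 2)
    sgn-% n = trans (cong sgn (halves n)) (trans (sgn-+ (n % 2) (2 * (n / 2))) (trans (cong (sgn (n % 2) ·_) (even (n / 2))) (trans (ℤₚ.*-identityʳ _) (bit (n % 2) (m%n<n n 2)))))
      where
      even : ∀ m → sgn (2 * m) ≡ 1ℤ
      even m = trans (cong (λ z → sgn (m + z)) (+-identityʳ m)) (trans (sgn-+ m m) (sgn-sq m))
      bit : ∀ b → b < 2 → sgn b ≡ 1ℤ ℤ.- pos 2 · pos b
      bit 0 _ = refl
      bit 1 _ = refl
      bit (suc (suc b)) (s≤s (s≤s ()))

  T-t : ∀ n → T n ≡ 1ℤ ℤ.- pos 2 · pos (t n)
  T-t n = trans (trans (T-def n) (Tw-s₂ n n)) (sgn-% (s₂ n))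

-- Sign patterns of T(a z) T(b z).

module SignFlips where
  open import Data.Nat.DivMod
  open ℕ-Arithmetic
  open IntegerSums using (n<2^n)
  open ThueMorse

  private
    ring₁ : ∀ a b → (1 + 2 * a) * (1 + 2 * b) ≡ 1 + 2 * (a + b + 2 * (a * b))
    ring₁ = solve-∀

    ring₂ : ∀ x r u v → x · neg r · (u · v) · (x · u · (r · v)) ≡ neg (x · x · (r · r) · (u · u) · (v · v))
    ring₂ = ℤR.solve-∀

    ring₃ : ∀ a y X z → a * (y + X * z) ≡ a * y + X * (a * z)
    ring₃ = solve-∀

    ring₄ : ∀ r X z → r + X + X * z ≡ r + X * (1 + z)
    ring₄ = solve-∀

    ring₅ : ∀ x → x · neg 1ℤ ≡ neg x
    ring₅ = ℤR.solve-∀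

    ring₆ : ∀ w → 2 + 2 * (2 * w) ≡ 2 * (1 + 2 * w)
    ring₆ = solve-∀

    ring₇ : ∀ x y → x · y · (x · y) ≡ x · x · (y · y)
    ring₇ = ℤR.solve-∀

    ring₈ : ∀ a p z → a * (p * z) ≡ p * (a * z)
    ring₈ = solve-∀

    ring₉ : ∀ z → (1 + 2 * z) * (1 + 2 * z) ≡ 1 + 2 * (2 * (z * z + z))
    ring₉ = solve-∀

    ring₁₀ : ∀ a y b → a * y * b ≡ a * (b * y)
    ring₁₀ = solve-∀

  Odd : ℕ → Set
  Odd n = ∃ λ m → n ≡ 1 + 2 * m

  odd-* : ∀ {m n} → Odd m → Odd n → Odd (m * n)
  odd-* (x , refl) (y , refl) = x + y + 2 * (x * y) , ring₁ x y

  odd-part : ∀ d → NonZero d → ∃₂ λ i d′ → d ≡ 2 ^ i * d′ × Odd d′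
  odd-part = <-rec (λ d → NonZero d → ∃₂ λ i d′ → d ≡ 2 ^ i * d′ × Odd d′) step
    where
    step : ∀ d → (∀ {k} → k < d → NonZero k → ∃₂ λ i d′ → k ≡ 2 ^ i * d′ × Odd d′) → NonZero d → ∃₂ λ i d′ → d ≡ 2 ^ i * d′ × Odd d′
    step d rec d≢0 with d % 2 in eq | m%n<n d 2
    ... | 1 | _ = 0 , d , sym (*-identityˡ d) , d / 2 , trans (halves d) (cong (_+ 2 * (d / 2)) eq)
    ... | suc (suc _) | s≤s (s≤s ())
    ... | 0 | _ with rec {d / 2} (m/n<m d 2 {{d≢0}} (s≤s (s≤s z≤n))) d/2≢0
      where
      d≡ : d ≡ 2 * (d / 2)
      d≡ = trans (halves d) (cong (_+ 2 * (d / 2)) eq)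
      d/2≢0 : NonZero (d / 2)
      d/2≢0 = m*n≢0⇒n≢0 2 {{subst NonZero d≡ d≢0}}
    ...   | i , d′ , eq′ , od = suc i , d′ , trans (halves d) (trans (cong₂ (λ x y → x + 2 * y) eq eq′) (sym (*-assoc 2 (2 ^ i) d′))) , od

  sign-cases : ∀ z → z · z ≡ 1ℤ → z ≡ 1ℤ ⊎ z ≡ neg 1ℤ
  sign-cases z eq with z ℤ.≟ 1ℤ | z ℤ.≟ neg 1ℤ
  ... | yes p | _ = inj₁ p
  ... | no _ | yes p = inj₂ p
  ... | no p | no q with ℤₚ.i*j≡0⇒i≡0∨j≡0 (z ℤ.- 1ℤ) {z ℤ.+ 1ℤ} (trans (lem z) (cong (ℤ._- 1ℤ) eq))
    where
    lem : ∀ z → (z ℤ.- 1ℤ) · (z ℤ.+ 1ℤ) ≡ z · z ℤ.- 1ℤ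
    lem = ℤR.solve-∀
  ...   | inj₁ z-1≡0 = ⊥-elim (p (ℤₚ.i-j≡0⇒i≡j z 1ℤ z-1≡0))
  ...   | inj₂ z+1≡0 = ⊥-elim (q (ℤₚ.i-j≡0⇒i≡j z (neg 1ℤ) z+1≡0))

  -- Adding 2ᴷ b to y₀ leaves the digits of a y₀ alone but makes b y₀ carry into b², and b² ≡ 1 (mod 4).
  carry-product : ∀ a b K y₀ r w → a * y₀ < 2 ^ K → b * y₀ ≡ r + 2 ^ K → r < 2 ^ K → b * b ≡ 1 + 2 * (2 * w) →
    T (a * y₀) · T (b * y₀) · (T (a * b) · T (b * b)) · (T (a * (y₀ + 2 ^ K * b)) · T (b * (y₀ + 2 ^ K * b))) ≡ neg 1ℤ
  carry-product a b K y₀ r w ay₀< by₀≡ r< square = begin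
    T (a * y₀) · T (b * y₀) · (T (a * b) · T (b * b)) · (T (a * y₂) · T (b * y₂))
      ≡⟨ cong₂ (λ x y → T (a * y₀) · x · (T (a * b) · T (b * b)) · y) Tb₀ (cong₂ _·_ Ta₂ (trans Tb₂ (cong (T r ·_) no-carry))) ⟩
    T (a * y₀) · neg (T r) · (T (a * b) · T (b * b)) · (T (a * y₀) · T (a * b) · (T r · T (b * b)))
      ≡⟨ ring₂ (T (a * y₀)) (T r) (T (a * b)) (T (b * b)) ⟩
    neg (T (a * y₀) · T (a * y₀) · (T r · T r) · (T (a * b) · T (a * b)) · (T (b * b) · T (b * b)))
      ≡⟨ cong neg (cong₂ _·_ (cong₂ _·_ (cong₂ _·_ (T-sq (a * y₀)) (T-sq r)) (T-sq (a * b))) (T-sq (b * b))) ⟩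
    neg 1ℤ ∎
    where
    open ≡-Reasoning
    y₂ = y₀ + 2 ^ K * b
    Ta₂ : T (a * y₂) ≡ T (a * y₀) · T (a * b)
    Ta₂ = trans (cong T (ring₃ a y₀ (2 ^ K) b)) (T-join K (a * y₀) (a * b) ay₀<)
    Tb₀ : T (b * y₀) ≡ neg (T r)
    Tb₀ = trans (cong T (trans by₀≡ (cong (r +_) (sym (*-identityʳ (2 ^ K)))))) (trans (T-join K r 1 r<) (trans (cong (T r ·_) T-1) (ring₅ (T r))))
    Tb₂ : T (b * y₂) ≡ T r · T (1 + b * b)
    Tb₂ = trans (cong T (trans (ring₃ b y₀ (2 ^ K) b) (trans (cong (_+ 2 ^ K * (b * b)) by₀≡) (ring₄ r (2 ^ K) (b * b))))) (T-join K r (1 + b * b) r<)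
    -- The last two digits of b² are 01; adding 1 makes them 10, with the same digit sum.
    no-carry : T (1 + b * b) ≡ T (b * b)
    no-carry = begin
      T (1 + b * b) ≡⟨ cong T (trans (cong suc square) (ring₆ w)) ⟩
      T (2 * (1 + 2 * w)) ≡⟨ trans (T-double (1 + 2 * w)) (T-double+1 w) ⟩
      neg (T w) ≡⟨ sym (trans (T-double+1 (2 * w)) (cong neg (T-double w))) ⟩
      T (1 + 2 * (2 * w)) ≡⟨ cong T (sym square) ⟩
      T (b * b) ∎

  next-multiple : ∀ X b → .{{NonZero b}} → ∃₂ λ y r → b * y ≡ r + X × r ≤ b
  next-multiple X b = suc (X / b) , b ∸ X % b , eq , m∸n≤m b (X % b)
    where
    open ≡-Reasoning
    eq : b * suc (X / b) ≡ b ∸ X % b + X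
    eq = begin
      b * suc (X / b) ≡⟨ trans (*-suc b (X / b)) (cong (b +_) (*-comm b (X / b))) ⟩
      b + X / b * b ≡⟨ cong (_+ X / b * b) (sym (m∸n+n≡m (<⇒≤ (m%n<n X b)))) ⟩
      b ∸ X % b + X % b + X / b * b ≡⟨ +-assoc (b ∸ X % b) (X % b) (X / b * b) ⟩
      b ∸ X % b + (X % b + X / b * b) ≡⟨ cong (b ∸ X % b +_) (sym (m≡m%n+[m/n]*n X b)) ⟩
      b ∸ X % b + X ∎

  module _ (a b : ℕ) (a<b : a < b) (a>0 : 0 < a) (b-odd : Odd b) where

    φ : ℕ → ℤ
    φ z = T (a * z) · T (b * z)

    φ-sq : ∀ z → φ z · φ z ≡ 1ℤ
    φ-sq z = trans (ring₇ (T (a * z)) (T (b * z))) (cong₂ _·_ (T-sq (a * z)) (T-sq (b * z)))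

    φ-2^ : ∀ i z → φ (2 ^ i * z) ≡ φ z
    φ-2^ i z = cong₂ _·_ (trans (cong T (ring₈ a (2 ^ i) z)) (T-2^ i (a * z))) (trans (cong T (ring₈ b (2 ^ i) z)) (T-2^ i (b * z)))

    private
      -- A product of three values equal to -1 forces one of them to be -1, without telling which.
      -- Oddness of d makes b d odd, as the congruence for its square requires.
      minus-product : ∀ d → Odd d → ∃ λ y₀ → ∃ λ y₁ → ∃ λ y₂ → φ (d * y₀) · φ (d * y₁) · φ (d * y₂) ≡ neg 1ℤ
      minus-product d d-odd with odd-* b-odd d-odd
      ... | z , bd≡ = go (next-multiple (2 ^ K) b′ {{b′≢0}})
        where
        a′ = a * d
        b′ = b * d
        -- Then a′ b′ < 2ᴷ, which is exactly the slack needed for a′ y₀ < 2ᴷ although b′ y₀ already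
        -- exceeds 2ᴷ by up to b′.
        K = a′ * b′
        b′≢0 : NonZero b′
        b′≢0 = subst NonZero (sym bd≡) _
        d>0 : 0 < d
        d>0 = subst (0 <_) (sym (proj₂ d-odd)) (s≤s z≤n)
        a′<b′ : a′ < b′
        a′<b′ = *-monoˡ-< d {{>-nonZero d>0}} a<b
        b′<X : b′ < 2 ^ K
        b′<X = ≤-<-trans (m≤n*m b′ a′ {{>-nonZero (*-mono-< {0} {a} a>0 d>0)}}) (n<2^n K)
        square : b′ * b′ ≡ 1 + 2 * (2 * (z * z + z))
        square = trans (cong₂ _*_ bd≡ bd≡) (ring₉ z)
        regroup : ∀ y → φ (d * y) ≡ T (a′ * y) · T (b′ * y)
        regroup y = cong₂ (λ u v → T u · T v) (sym (*-assoc a d y)) (sym (*-assoc b d y))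
        go : (∃₂ λ y r → b′ * y ≡ r + 2 ^ K × r ≤ b′) → _
        go (y₀ , r , by₀≡ , r≤b′) = y₀ , b′ , y₀ + 2 ^ K * b′ ,
          trans (cong₂ _·_ (cong₂ _·_ (regroup y₀) (regroup b′)) (regroup (y₀ + 2 ^ K * b′)))
            (carry-product a′ b′ K y₀ r (z * z + z) a′y₀<X by₀≡ (≤-<-trans r≤b′ b′<X) square)
          where
          open ≤-Reasoning
          a′y₀<X : a′ * y₀ < 2 ^ K
          a′y₀<X = *-cancelʳ-< b′ (a′ * y₀) (2 ^ K) (begin-strict
            a′ * y₀ * b′ ≡⟨ ring₁₀ a′ y₀ b′ ⟩
            a′ * (b′ * y₀) ≤⟨ *-monoʳ-≤ a′ (≤-trans (≤-reflexive by₀≡) (+-monoˡ-≤ (2 ^ K) r≤b′)) ⟩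
            a′ * (b′ + 2 ^ K) ≡⟨ *-distribˡ-+ a′ b′ (2 ^ K) ⟩
            a′ * b′ + a′ * 2 ^ K <⟨ +-monoˡ-< (a′ * 2 ^ K) (n<2^n K) ⟩
            suc a′ * 2 ^ K ≤⟨ *-monoˡ-≤ (2 ^ K) a′<b′ ⟩
            b′ * 2 ^ K ≡⟨ *-comm b′ (2 ^ K) ⟩
            2 ^ K * b′ ∎)

      third-sign : ∀ x y z → x ≡ 1ℤ → y ≡ 1ℤ → x · y · z ≡ neg 1ℤ → z ≡ neg 1ℤ
      third-sign _ _ z refl refl eq = trans (sym (ℤₚ.*-identityˡ z)) eq

      -- φ is unchanged by factors 2, so only the odd part of d matters.
      minus-one : ∀ d → NonZero d → ∃ λ k → φ (d * k) ≡ neg 1ℤ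
      minus-one d d≢0 = go (odd-part d d≢0)
        where
        go : (∃₂ λ i d′ → d ≡ 2 ^ i * d′ × Odd d′) → ∃ λ k → φ (d * k) ≡ neg 1ℤ
        go (i , d′ , d≡ , d′-odd) = from (minus-product d′ d′-odd)
          where
          lift : ∀ y → φ (d′ * y) ≡ neg 1ℤ → ∃ λ k → φ (d * k) ≡ neg 1ℤ
          lift y h = y , (begin
            φ (d * y) ≡⟨ cong (λ z → φ (z * y)) d≡ ⟩
            φ (2 ^ i * d′ * y) ≡⟨ cong φ (*-assoc (2 ^ i) d′ y) ⟩
            φ (2 ^ i * (d′ * y)) ≡⟨ φ-2^ i (d′ * y) ⟩
            φ (d′ * y) ≡⟨ h ⟩
            neg 1ℤ ∎)
            where open ≡-Reasoning
          from : (∃ λ y₀ → ∃ λ y₁ → ∃ λ y₂ → φ (d′ * y₀) · φ (d′ * y₁) · φ (d′ * y₂) ≡ neg 1ℤ) → ∃ λ k → φ (d * k) ≡ neg 1ℤ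
          from (y₀ , y₁ , y₂ , eq) = pick (sign-cases (φ (d′ * y₀)) (φ-sq (d′ * y₀))) (sign-cases (φ (d′ * y₁)) (φ-sq (d′ * y₁)))
            where
            pick : φ (d′ * y₀) ≡ 1ℤ ⊎ φ (d′ * y₀) ≡ neg 1ℤ → φ (d′ * y₁) ≡ 1ℤ ⊎ φ (d′ * y₁) ≡ neg 1ℤ → ∃ λ k → φ (d * k) ≡ neg 1ℤ
            pick (inj₂ h) _ = lift y₀ h
            pick (inj₁ _) (inj₂ h) = lift y₁ h
            pick (inj₁ h₀) (inj₁ h₁) = lift y₂ (third-sign (φ (d′ * y₀)) (φ (d′ * y₁)) (φ (d′ * y₂)) h₀ h₁ eq)

    φ-0 : φ 0 ≡ 1ℤ
    φ-0 = cong₂ _·_ (trans (cong T (*-zeroʳ a)) T-0) (trans (cong T (*-zeroʳ b)) T-0)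

    plus-pair : ∀ d → φ d · φ (d + d) ≡ 1ℤ
    plus-pair d = begin
      φ d · φ (d + d) ≡⟨ cong (λ z → φ d · φ z) (cong (d +_) (sym (+-identityʳ d))) ⟩
      φ d · φ (2 * d) ≡⟨ cong (φ d ·_) (φ-2^ 1 d) ⟩
      φ d · φ d ≡⟨ φ-sq d ⟩
      1ℤ ∎
      where open ≡-Reasoning

    -- Along 0, d, 2d, ... the function φ starts with φ(0) = 1 and reaches -1, so it changes sign
    -- between two consecutive multiples.
    minus-pair : ∀ d → NonZero d → ∃ λ z → φ z · φ (z + d) ≡ neg 1ℤ
    minus-pair d d≢0 = let (k , eq) = minus-one d d≢0 in go k eq
      where
      absurd : ∀ {x} → x ≡ 1ℤ → ¬ (x ≡ neg 1ℤ)
      absurd refl ()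
      go : ∀ k → φ (d * k) ≡ neg 1ℤ → ∃ λ z → φ z · φ (z + d) ≡ neg 1ℤ
      go zero eq = ⊥-elim (absurd (trans (cong φ (*-zeroʳ d)) φ-0) eq)
      go (suc k) eq = step (sign-cases (φ (d * k)) (φ-sq (d * k)))
        where
        step : φ (d * k) ≡ 1ℤ ⊎ φ (d * k) ≡ neg 1ℤ → ∃ λ z → φ z · φ (z + d) ≡ neg 1ℤ
        step (inj₂ h) = go k h
        step (inj₁ h) = d * k , trans (cong₂ _·_ h (trans (cong φ (trans (+-comm (d * k) d) (sym (*-suc d k)))) eq)) refl

-- Products over eight corners, processed digit block by digit block with carries.

module CarryDigits where
  open ℕ-Arithmetic
  open IntegerSums
  open ThueMorse

  private
    ring₁ : ∀ a b x → (1ℤ ⊖ (a ⊕ b)) · x ≡ x ⊖ (a · x ⊕ b · x)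
    ring₁ = ℤR.solve-∀

    ring₂ : ∀ c P H G → c * (P + H * P + G * P) ≡ c * (1 + H + G) * P
    ring₂ = solve-∀

    ring₃ : ∀ J P → J * P + J ≡ (1 + P) * J
    ring₃ = solve-∀

    ring₄ : ∀ K y₀ B y₁ → K * (y₀ + B * y₁) ≡ K * y₀ + B * (K * y₁)
    ring₄ = solve-∀

    ring₅ : ∀ c U₀ U₁ a₀ a₁ b₀ b₁ B → c * (U₀ + B * U₁ + (a₀ + B * a₁) + (b₀ + B * b₁)) ≡ c * (U₀ + a₀ + b₀) + B * (c * (U₁ + a₁ + b₁))
    ring₅ = solve-∀

    ring₆ : ∀ a b c → a + b + c ≡ a + c + b
    ring₆ = solve-∀

    ring₇ : ∀ X v a b → 1ℤ ⊖ X · (v · (a ⊕ b)) ≡ 1ℤ ⊖ (a · (X · v) ⊕ b · (X · v))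
    ring₇ = ℤR.solve-∀

    ring₈ : ∀ n X v → n · 1ℤ ⊖ (X · v ⊕ X · v) ≡ n ⊖ v · (pos 2 · X)
    ring₈ = ℤR.solve-∀

    ring₉ : ∀ u → 1ℤ ⊖ u ≡ 1ℤ ⊖ 1ℤ · (1ℤ · u)
    ring₉ = ℤR.solve-∀

    ring₁₀ : ∀ a b c → a · (b · c) ≡ b · (c · a)
    ring₁₀ = ℤR.solve-∀

    ring₁₁ : ∀ a b c → a * b * c ≡ b * c * a
    ring₁₁ = solve-∀

    ring₁₂ : ∀ v₀ B v₁ P v′ → v₀ + B * v₁ + B * P * v′ ≡ v₀ + B * (v₁ + P * v′)
    ring₁₂ = solve-∀

    ring₁₃ : ∀ a b c → a · b · c ≡ a · (c · b)
    ring₁₃ = ℤR.solve-∀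

  -- The arguments select the coefficient, the shift of e (ρ) and the shift of h (σ). The bracketing
  -- makes innermost pairs differ in ρ, the pairs in which high digits cancel.
  cube : (Bool → Bool → Bool → ℤ) → ℤ
  cube F = ((F false false false · F false true false) · (F false false true · F false true true))
         · ((F true false false · F true true false) · (F true false true · F true true true))

  cube-cong : ∀ {F G : Bool → Bool → Bool → ℤ} → (∀ c ρ σ → F c ρ σ ≡ G c ρ σ) → cube F ≡ cube G
  cube-cong h = cong₂ _·_ (cong₂ _·_ (cong₂ _·_ (h false false false) (h false true false)) (cong₂ _·_ (h false false true) (h false true true)))
    (cong₂ _·_ (cong₂ _·_ (h true false false) (h true true false)) (cong₂ _·_ (h true false true) (h true true true)))

  ·-interchange : ∀ a b c d → (a · b) · (c · d) ≡ (a · c) · (b · d)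
  ·-interchange = ℤR.solve-∀

  cube-· : ∀ (F G : Bool → Bool → Bool → ℤ) → cube (λ c ρ σ → F c ρ σ · G c ρ σ) ≡ cube F · cube G
  cube-· F G = trans (cong₂ _·_ (quad false) (quad true)) (·-interchange (face F false) (face G false) (face F true) (face G true))
    where
    face : (Bool → Bool → Bool → ℤ) → Bool → ℤ
    face F c = (F c false false · F c true false) · (F c false true · F c true true)
    quad : ∀ c → ((F c false false · G c false false) · (F c true false · G c true false)) · ((F c false true · G c false true) · (F c true true · G c true true))
      ≡ ((F c false false · F c true false) · (F c false true · F c true true)) · ((G c false false · G c true false) · (G c false true · G c true true))
    quad c = trans (cong₂ _·_ (·-interchange (F c false false) (G c false false) (F c true false) (G c true false)) (·-interchange (F c false true) (G c false true) (F c true true) (G c true true)))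
      (·-interchange (F c false false · F c true false) (G c false false · G c true false) (F c false true · F c true true) (G c false true · G c true true))

  cube-sq : ∀ (F : Bool → Bool → Bool → ℤ) → (∀ c ρ σ → F c ρ σ · F c ρ σ ≡ 1ℤ) → cube F · cube F ≡ 1ℤ
  cube-sq F h = trans (sym (cube-· F F)) (cube-cong h)

  sel : Bool → ℕ → ℕ
  sel b n = if b then n else 0

  -- The carries arriving at the current digit position, one for each corner.
  State : Set
  State = Bool → Bool → Bool → ℕ

  Σ-cancel-pair : ∀ n (f : ℕ → ℤ) y₁ y₂ → y₁ < n → y₂ < n → ¬ y₁ ≡ y₂ → f y₁ ≡ neg (f y₂) →
    abs (Σ n f) ≼ Σ n (λ i → (1ℤ ⊖ (𝟙 (i ℕ.≟ y₁) ⊕ 𝟙 (i ℕ.≟ y₂))) · abs (f i))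
  Σ-cancel-pair n f y₁ y₂ y₁<n y₂<n y₁≢y₂ opp = begin
    abs (Σ n f) ≡⟨ cong abs (sym reduced) ⟩
    abs (Σ n (λ i → κ i · f i)) ≤⟨ Σ-abs n (λ i → κ i · f i) ⟩
    Σ n (λ i → abs (κ i · f i)) ≡⟨ Σ-cong n (λ i → trans (abs-mul (κ i) (f i)) (cong (_· abs (f i)) (abs-of-nonneg (κ≥0 i)))) ⟩
    Σ n (λ i → κ i · abs (f i)) ∎
    where
    open ℤₚ.≤-Reasoning
    κ : ℕ → ℤ
    κ i = 1ℤ ⊖ (𝟙 (i ℕ.≟ y₁) ⊕ 𝟙 (i ℕ.≟ y₂))
    κ≥0 : ∀ i → 0ℤ ≼ κ i
    κ≥0 i = go (i ℕ.≟ y₁) (i ℕ.≟ y₂)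
      where
      go : (d : Dec (i ≡ y₁)) (e : Dec (i ≡ y₂)) → 0ℤ ≼ 1ℤ ⊖ (𝟙 d ⊕ 𝟙 e)
      go (yes p) (yes q) = ⊥-elim (y₁≢y₂ (trans (sym p) q))
      go (yes _) (no _) = nneg 0
      go (no _) (yes _) = nneg 0
      go (no _) (no _) = nneg 1
    reduced : Σ n (λ i → κ i · f i) ≡ Σ n f
    reduced = begin-equality
      Σ n (λ i → κ i · f i) ≡⟨ Σ-cong n (λ i → ring₁ (𝟙 (i ℕ.≟ y₁)) (𝟙 (i ℕ.≟ y₂)) (f i)) ⟩
      Σ n (λ i → f i ⊖ (𝟙 (i ℕ.≟ y₁) · f i ⊕ 𝟙 (i ℕ.≟ y₂) · f i)) ≡⟨ Σ-minus n f (λ i → 𝟙 (i ℕ.≟ y₁) · f i ⊕ 𝟙 (i ℕ.≟ y₂) · f i) ⟩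
      Σ n f ⊖ Σ n (λ i → 𝟙 (i ℕ.≟ y₁) · f i ⊕ 𝟙 (i ℕ.≟ y₂) · f i) ≡⟨ cong (λ z → Σ n f ⊖ z) (trans (Σ-+ n (λ i → 𝟙 (i ℕ.≟ y₁) · f i) (λ i → 𝟙 (i ℕ.≟ y₂) · f i)) (cong₂ _⊕_ (Σ-pick n y₁ f y₁<n) (Σ-pick n y₂ f y₂<n))) ⟩
      Σ n f ⊖ (f y₁ ⊕ f y₂) ≡⟨ cong (λ z → Σ n f ⊖ z) (trans (cong (_⊕ f y₂) opp) (ℤₚ.+-inverseˡ (f y₂))) ⟩
      Σ n f ⊖ 0ℤ ≡⟨ ℤₚ.+-identityʳ (Σ n f) ⟩
      Σ n f ∎

  width : ℕ → ℕ → ℕ → ℕ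
  width θ zero w = w
  width θ (suc m) w = θ + width θ m w

  ≤-width : ∀ θ m w → w ≤ width θ m w
  ≤-width θ zero w = ≤-refl
  ≤-width θ (suc m) w = ≤-trans (≤-width θ m w) (m≤n+m (width θ m w) θ)

  -- The eight arguments are linear in U, x and v. Writing these in base 2^θ turns Ψ into an
  -- automaton (`Ψ-step`): one block gives a sign, passes on new carries, and the rest is of the
  -- same form.
  module Digits (coef : Bool → ℕ) (H G J θ : ℕ) (coef≤J : ∀ c → coef c * (1 + H + G) ≤ J) where

    B : ℕ
    B = 2 ^ θ

    L : Bool → Bool → Bool → ℕ → ℕ → ℕ → ℕ
    L c ρ σ U x v = coef c * (U + sel σ (H * x) + sel ρ (G * v))

    Ψ : ℕ → State → ℕ → ℕ → ℕ → ℤ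
    Ψ w j U x v = cube (λ c ρ σ → Tw w (L c ρ σ U x v + j c ρ σ))

    Ψ-sq : ∀ w j U x v → Ψ w j U x v · Ψ w j U x v ≡ 1ℤ
    Ψ-sq w j U x v = cube-sq (λ c ρ σ → Tw w (L c ρ σ U x v + j c ρ σ)) (λ c ρ σ → Tw-sq w (L c ρ σ U x v + j c ρ σ))

    abs-Ψ : ∀ w j U x v → abs (Ψ w j U x v) ≡ 1ℤ
    abs-Ψ w j U x v = abs-of-sq (Ψ w j U x v) (Ψ-sq w j U x v)

    Bounded : State → Set
    Bounded j = ∀ c ρ σ → j c ρ σ ≤ J

    next : State → ℕ → ℕ → ℕ → State
    next j U x v c ρ σ = sh θ (L c ρ σ U x v + j c ρ σ)

    sel≤ : ∀ b n → sel b n ≤ n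
    sel≤ true n = ≤-refl
    sel≤ false n = z≤n

    -- The bound J reproduces itself: B times the new carry is at most coef (1 + H + G) (B - 1) + J
    -- ≤ J B.
    next-bounded : ∀ j U x v → Bounded j → U < B → x < B → v < B → Bounded (next j U x v)
    next-bounded j U x v jb U< x< v< c ρ σ = *-cancelˡ-≤ B {{m^n≢0 2 θ}} (begin
      B * sh θ (L c ρ σ U x v + j c ρ σ) ≤⟨ 2^θ*sh≤ θ (L c ρ σ U x v + j c ρ σ) ⟩
      L c ρ σ U x v + j c ρ σ ≤⟨ +-mono-≤ (*-monoʳ-≤ (coef c) (+-mono-≤ (+-mono-≤ U≤ (≤-trans (sel≤ σ (H * x)) (*-monoʳ-≤ H x≤))) (≤-trans (sel≤ ρ (G * v)) (*-monoʳ-≤ G v≤)))) (jb c ρ σ) ⟩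
      coef c * (P + H * P + G * P) + J ≡⟨ cong (_+ J) (ring₂ (coef c) P H G) ⟩
      coef c * (1 + H + G) * P + J ≤⟨ +-monoˡ-≤ J (*-monoˡ-≤ P (coef≤J c)) ⟩
      J * P + J ≡⟨ ring₃ J P ⟩
      suc P * J ≡⟨ cong (_* J) (suc-pred B {{m^n≢0 2 θ}}) ⟩
      B * J ∎)
      where
      open ≤-Reasoning
      P = pred B
      down : ∀ {n} → n < B → n ≤ P
      down n< = s≤s⁻¹ (≤-trans n< (≤-reflexive (sym (suc-pred B {{m^n≢0 2 θ}}))))
      U≤ = down U<
      x≤ = down x<
      v≤ = down v<

    sel-+ : ∀ b m n → sel b (m + n) ≡ sel b m + sel b n
    sel-+ true m n = refl
    sel-+ false m n = refl

    sel-* : ∀ b k n → sel b (k * n) ≡ k * sel b n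
    sel-* true k n = refl
    sel-* false k n = sym (*-zeroʳ k)

    L-split : ∀ c ρ σ U₀ U₁ x₀ x₁ v₀ v₁ → L c ρ σ (U₀ + B * U₁) (x₀ + B * x₁) (v₀ + B * v₁) ≡ L c ρ σ U₀ x₀ v₀ + B * L c ρ σ U₁ x₁ v₁
    L-split c ρ σ U₀ U₁ x₀ x₁ v₀ v₁ = trans (cong₂ (λ p q → coef c * (U₀ + B * U₁ + p + q)) (part σ H x₀ x₁) (part ρ G v₀ v₁))
      (ring₅ (coef c) U₀ U₁ (sel σ (H * x₀)) (sel σ (H * x₁)) (sel ρ (G * v₀)) (sel ρ (G * v₁)) B)
      where
      part : ∀ b K y₀ y₁ → sel b (K * (y₀ + B * y₁)) ≡ sel b (K * y₀) + B * sel b (K * y₁)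
      part b K y₀ y₁ = trans (cong (sel b) (ring₄ K y₀ B y₁)) (trans (sel-+ b (K * y₀) (B * (K * y₁))) (cong (sel b (K * y₀) +_) (sel-* b B (K * y₁))))

    Ψ-step : ∀ w j U₀ U₁ x₀ x₁ v₀ v₁ → Ψ (θ + w) j (U₀ + B * U₁) (x₀ + B * x₁) (v₀ + B * v₁) ≡ Ψ θ j U₀ x₀ v₀ · Ψ w (next j U₀ x₀ v₀) U₁ x₁ v₁
    Ψ-step w j U₀ U₁ x₀ x₁ v₀ v₁ = trans (cube-cong factor) (cube-· (λ c ρ σ → Tw θ (L c ρ σ U₀ x₀ v₀ + j c ρ σ)) (λ c ρ σ → Tw w (L c ρ σ U₁ x₁ v₁ + next j U₀ x₀ v₀ c ρ σ)))
      where
      factor : ∀ c ρ σ → Tw (θ + w) (L c ρ σ (U₀ + B * U₁) (x₀ + B * x₁) (v₀ + B * v₁) + j c ρ σ) ≡ Tw θ (L c ρ σ U₀ x₀ v₀ + j c ρ σ) · Tw w (L c ρ σ U₁ x₁ v₁ + next j U₀ x₀ v₀ c ρ σ)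
      factor c ρ σ = begin
        Tw (θ + w) (L c ρ σ (U₀ + B * U₁) (x₀ + B * x₁) (v₀ + B * v₁) + j′) ≡⟨ cong (λ z → Tw (θ + w) (z + j′)) (L-split c ρ σ U₀ U₁ x₀ x₁ v₀ v₁) ⟩
        Tw (θ + w) (A₀ + B * A₁ + j′) ≡⟨ cong (Tw (θ + w)) (ring₆ A₀ (B * A₁) j′) ⟩
        Tw (θ + w) (A₀ + j′ + B * A₁) ≡⟨ Tw-split θ w (A₀ + j′ + B * A₁) ⟩
        Tw θ (A₀ + j′ + B * A₁) · Tw w (sh θ (A₀ + j′ + B * A₁)) ≡⟨ cong₂ (λ p q → p · Tw w q) (Tw-+ θ (A₀ + j′) A₁) (trans (sh-+ θ (A₀ + j′) A₁) (+-comm (sh θ (A₀ + j′)) A₁)) ⟩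
        Tw θ (A₀ + j′) · Tw w (A₁ + sh θ (A₀ + j′)) ∎
        where
        open ≡-Reasoning
        j′ = j c ρ σ
        A₀ = L c ρ σ U₀ x₀ v₀
        A₁ = L c ρ σ U₁ x₁ v₁

    -- A block of θ digits whose two completions y₁, y₂ of U reach the same carries with opposite signs.
    record FlipBlock : Set where
      field
        x* v* y₁ y₂ : ℕ
        v*< : v* < B
        y₁< : y₁ < B
        y₂< : y₂ < B
        y₁≢y₂ : ¬ y₁ ≡ y₂
        reset₁ : ∀ j → Bounded j → ∀ c ρ σ → next j y₁ x* v* c ρ σ ≡ 0
        reset₂ : ∀ j → Bounded j → ∀ c ρ σ → next j y₂ x* v* c ρ σ ≡ 0
        flips : ∀ j → Bounded j → Ψ θ j y₁ x* v* ≡ neg (Ψ θ j y₂ x* v*)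

    module Contraction (block : FlipBlock) (x*< : FlipBlock.x* block < B) where
      open FlipBlock block

      C : ℤ
      C = pos B · pos B

      -- For each of m digit blocks of x, the number of block pairs (v₀, U₀) that survive: B², less
      -- 2 when the block is x*.
      wt : ℕ → ℕ → ℤ
      wt zero x = 1ℤ
      wt (suc m) x = wt m (sh θ x) · (C ⊖ pos 2 · 𝟙 (low θ x ℕ.≟ x*))

      -- Marks the surviving terms: at x* and v* the blocks y₁ and y₂ of U cancel each other.
      κ : ℕ → ℕ → ℕ → ℤ
      κ x₀ v₀ U₀ = 1ℤ ⊖ 𝟙 (x₀ ℕ.≟ x*) · (𝟙 (v₀ ℕ.≟ v*) · (𝟙 (U₀ ℕ.≟ y₁) ⊕ 𝟙 (U₀ ℕ.≟ y₂)))

      κ≥0 : ∀ x₀ v₀ U₀ → 0ℤ ≼ κ x₀ v₀ U₀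
      κ≥0 x₀ v₀ U₀ = go (x₀ ℕ.≟ x*) (v₀ ℕ.≟ v*) (U₀ ℕ.≟ y₁) (U₀ ℕ.≟ y₂)
        where
        go : (a : Dec (x₀ ≡ x*)) (b : Dec (v₀ ≡ v*)) (d : Dec (U₀ ≡ y₁)) (e : Dec (U₀ ≡ y₂)) → 0ℤ ≼ 1ℤ ⊖ 𝟙 a · (𝟙 b · (𝟙 d ⊕ 𝟙 e))
        go (no _) _ _ _ = nneg 1
        go (yes _) (no _) _ _ = nneg 1
        go (yes _) (yes _) (yes p) (yes q) = ⊥-elim (y₁≢y₂ (trans (sym p) q))
        go (yes _) (yes _) (yes _) (no _) = nneg 0
        go (yes _) (yes _) (no _) (yes _) = nneg 0
        go (yes _) (yes _) (no _) (no _) = nneg 1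

      Σκ : ∀ x₀ → Σ B (λ v₀ → Σ B (λ U₀ → κ x₀ v₀ U₀)) ≡ C ⊖ pos 2 · 𝟙 (x₀ ℕ.≟ x*)
      Σκ x₀ = begin
        Σ B (λ v₀ → Σ B (λ U₀ → κ x₀ v₀ U₀)) ≡⟨ Σ-cong B inner ⟩
        Σ B (λ v₀ → pos B ⊖ 𝟙 (v₀ ℕ.≟ v*) · (pos 2 · X)) ≡⟨ Σ-minus B (λ _ → pos B) (λ v₀ → 𝟙 (v₀ ℕ.≟ v*) · (pos 2 · X)) ⟩
        Σ B (λ _ → pos B) ⊖ Σ B (λ v₀ → 𝟙 (v₀ ℕ.≟ v*) · (pos 2 · X)) ≡⟨ cong₂ _⊖_ (Σ-const B (pos B)) (Σ-pick B v* (λ _ → pos 2 · X) v*<) ⟩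
        C ⊖ pos 2 · X ∎
        where
        open ≡-Reasoning
        X = 𝟙 (x₀ ℕ.≟ x*)
        inner : ∀ v₀ → Σ B (λ U₀ → κ x₀ v₀ U₀) ≡ pos B ⊖ 𝟙 (v₀ ℕ.≟ v*) · (pos 2 · X)
        inner v₀ = begin
          Σ B (λ U₀ → κ x₀ v₀ U₀) ≡⟨ Σ-cong B (λ U₀ → ring₇ X V (𝟙 (U₀ ℕ.≟ y₁)) (𝟙 (U₀ ℕ.≟ y₂))) ⟩
          Σ B (λ U₀ → 1ℤ ⊖ (𝟙 (U₀ ℕ.≟ y₁) · (X · V) ⊕ 𝟙 (U₀ ℕ.≟ y₂) · (X · V))) ≡⟨ Σ-minus B (λ _ → 1ℤ) (λ U₀ → 𝟙 (U₀ ℕ.≟ y₁) · (X · V) ⊕ 𝟙 (U₀ ℕ.≟ y₂) · (X · V)) ⟩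
          Σ B (λ _ → 1ℤ) ⊖ Σ B (λ U₀ → 𝟙 (U₀ ℕ.≟ y₁) · (X · V) ⊕ 𝟙 (U₀ ℕ.≟ y₂) · (X · V))
            ≡⟨ cong₂ _⊖_ (Σ-const B 1ℤ) (trans (Σ-+ B (λ U₀ → 𝟙 (U₀ ℕ.≟ y₁) · (X · V)) (λ U₀ → 𝟙 (U₀ ℕ.≟ y₂) · (X · V))) (cong₂ _⊕_ (Σ-pick B y₁ (λ _ → X · V) y₁<) (Σ-pick B y₂ (λ _ → X · V) y₂<))) ⟩
          pos B · 1ℤ ⊖ (X · V ⊕ X · V) ≡⟨ ring₈ (pos B) X V ⟩
          pos B ⊖ V · (pos 2 · X) ∎
          where V = 𝟙 (v₀ ℕ.≟ v*)

      -- Both y₁ and y₂ leave all carries 0, so the later digits contribute the same factor Z to two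
      -- terms of opposite sign. States are functions compared pointwise, hence the congruence asked
      -- of Z.
      block-sum : ∀ x₀ v₀ j → Bounded j → x₀ < B → v₀ < B → (Z : State → ℤ) → (∀ {i i′} → (∀ c ρ σ → i c ρ σ ≡ i′ c ρ σ) → Z i ≡ Z i′) →
        abs (Σ B (λ U₀ → Ψ θ j U₀ x₀ v₀ · Z (next j U₀ x₀ v₀))) ≼ Σ B (λ U₀ → κ x₀ v₀ U₀ · abs (Z (next j U₀ x₀ v₀)))
      block-sum x₀ v₀ j jb x₀< v₀< Z Z-cong = go (x₀ ℕ.≟ x*) (v₀ ℕ.≟ v*)
        where
        open ℤₚ.≤-Reasoning
        f : ℕ → ℤ
        f U₀ = Ψ θ j U₀ x₀ v₀ · Z (next j U₀ x₀ v₀)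
        z : ℕ → ℤ
        z U₀ = abs (Z (next j U₀ x₀ v₀))
        abs-f : ∀ U₀ → abs (f U₀) ≡ z U₀
        abs-f U₀ = trans (abs-mul (Ψ θ j U₀ x₀ v₀) (Z (next j U₀ x₀ v₀))) (trans (cong (_· z U₀) (abs-Ψ θ j U₀ x₀ v₀)) (ℤₚ.*-identityˡ (z U₀)))
        trivial : (∀ U₀ → κ x₀ v₀ U₀ ≡ 1ℤ) → abs (Σ B f) ≼ Σ B (λ U₀ → κ x₀ v₀ U₀ · z U₀)
        trivial κ≡1 = begin
          abs (Σ B f) ≤⟨ Σ-abs B f ⟩
          Σ B (λ U₀ → abs (f U₀)) ≡⟨ Σ-cong B (λ U₀ → trans (abs-f U₀) (trans (sym (ℤₚ.*-identityˡ (z U₀))) (cong (_· z U₀) (sym (κ≡1 U₀))))) ⟩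
          Σ B (λ U₀ → κ x₀ v₀ U₀ · z U₀) ∎
        opposite-terms : x₀ ≡ x* → v₀ ≡ v* → f y₁ ≡ neg (f y₂)
        opposite-terms refl refl = begin-equality
          f y₁ ≡⟨ cong₂ _·_ (flips j jb) (Z-cong (λ c ρ σ → trans (reset₁ j jb c ρ σ) (sym (reset₂ j jb c ρ σ)))) ⟩
          neg (Ψ θ j y₂ x* v*) · Z (next j y₂ x* v*) ≡⟨ sym (ℤₚ.neg-distribˡ-* (Ψ θ j y₂ x* v*) (Z (next j y₂ x* v*))) ⟩
          neg (f y₂) ∎
        κ-good : x₀ ≡ x* → v₀ ≡ v* → ∀ U₀ → 1ℤ ⊖ (𝟙 (U₀ ℕ.≟ y₁) ⊕ 𝟙 (U₀ ℕ.≟ y₂)) ≡ κ x₀ v₀ U₀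
        κ-good p q U₀ = begin-equality
          1ℤ ⊖ u ≡⟨ ring₉ u ⟩
          1ℤ ⊖ 1ℤ · (1ℤ · u) ≡⟨ cong₂ (λ a b → 1ℤ ⊖ a · (b · u)) (sym (𝟙-yes (x₀ ℕ.≟ x*) p)) (sym (𝟙-yes (v₀ ℕ.≟ v*) q)) ⟩
          κ x₀ v₀ U₀ ∎
          where
          u = 𝟙 (U₀ ℕ.≟ y₁) ⊕ 𝟙 (U₀ ℕ.≟ y₂)
        go : Dec (x₀ ≡ x*) → Dec (v₀ ≡ v*) → abs (Σ B f) ≼ Σ B (λ U₀ → κ x₀ v₀ U₀ · z U₀)
        go (yes p) (yes q) = begin
          abs (Σ B f) ≤⟨ Σ-cancel-pair B f y₁ y₂ y₁< y₂< y₁≢y₂ (opposite-terms p q) ⟩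
          Σ B (λ U₀ → (1ℤ ⊖ (𝟙 (U₀ ℕ.≟ y₁) ⊕ 𝟙 (U₀ ℕ.≟ y₂))) · abs (f U₀)) ≡⟨ Σ-cong B (λ U₀ → cong₂ _·_ (κ-good p q U₀) (abs-f U₀)) ⟩
          Σ B (λ U₀ → κ x₀ v₀ U₀ · z U₀) ∎
        go (no p) _ = trivial (λ U₀ → cong (λ a → 1ℤ ⊖ a · (𝟙 (v₀ ℕ.≟ v*) · (𝟙 (U₀ ℕ.≟ y₁) ⊕ 𝟙 (U₀ ℕ.≟ y₂)))) (𝟙-no (x₀ ℕ.≟ x*) p))
        go (yes _) (no q) = trivial (λ U₀ → trans (cong (λ b → 1ℤ ⊖ 𝟙 (x₀ ℕ.≟ x*) · (b · (𝟙 (U₀ ℕ.≟ y₁) ⊕ 𝟙 (U₀ ℕ.≟ y₂)))) (𝟙-no (v₀ ℕ.≟ v*) q)) (cong (λ a → 1ℤ ⊖ a) (ℤₚ.*-zeroʳ (𝟙 (x₀ ℕ.≟ x*)))))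

      wt-2≥0 : ∀ x → 0ℤ ≼ C ⊖ pos 2 · 𝟙 (x ℕ.≟ x*)
      wt-2≥0 x = subst (0ℤ ≼_) (Σκ x) (Σ-nonneg B (λ v₀ → Σ-nonneg B (λ U₀ → κ≥0 x v₀ U₀)))

      -- Cancellation comes from U alone, so v is summed outside the absolute value; averaging over
      -- v only makes the block v* occur. The digits v′ of v above the summed ones are arbitrary, as
      -- is the incoming bounded state.
      contraction : ∀ m w j x v′ → Bounded j →
        Σ (B ^ m) (λ v → abs (Σ (B ^ m * 2 ^ w) (λ U → Ψ (width θ m w) j U x (v + B ^ m * v′)))) ≼ pos (2 ^ w) · wt m x
      contraction zero w j x v′ jb = begin
        0ℤ ⊕ abs (Σ (1 * 2 ^ w) (λ U → Ψ w j U x (0 + 1 * v′))) ≡⟨ ℤₚ.+-identityˡ _ ⟩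
        abs (Σ (1 * 2 ^ w) (λ U → Ψ w j U x (0 + 1 * v′))) ≤⟨ Σ-abs-≤ (1 * 2 ^ w) (λ U → Ψ w j U x (0 + 1 * v′)) (λ U → ℤₚ.≤-reflexive (abs-Ψ w j U x (0 + 1 * v′))) ⟩
        pos (1 * 2 ^ w) ≡⟨ trans (cong pos (*-identityˡ (2 ^ w))) (sym (ℤₚ.*-identityʳ (pos (2 ^ w)))) ⟩
        pos (2 ^ w) · 1ℤ ∎
        where open ℤₚ.≤-Reasoning
      contraction (suc m) w j x v′ jb = begin
        Σ (B * B ^ m) (λ v → abs (Σ (B * B ^ m * 2 ^ w) (λ U → Ψ (θ + width θ m w) j U x (v + B * B ^ m * v′))))
          ≡⟨ trans (cong (λ n → Σ n outer) (*-comm B (B ^ m))) (Σ-block (B ^ m) B outer) ⟩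
        Σ (B ^ m) (λ v₁ → Σ B (λ v₀ → outer (v₀ + B * v₁))) ≤⟨ Σ-mono (B ^ m) (λ v₁ → Σ-mono< B (λ v₀ v₀< → each v₀ v₁ v₀<)) ⟩
        Σ (B ^ m) (λ v₁ → Σ B (λ v₀ → Σ B (λ U₀ → κ x₀ v₀ U₀ · abs (Z v₁ (next j U₀ x₀ v₀)))))
          ≡⟨ trans (Σ-swap (B ^ m) B (λ v₁ v₀ → Σ B (λ U₀ → κ x₀ v₀ U₀ · abs (Z v₁ (next j U₀ x₀ v₀)))))
               (Σ-cong B (λ v₀ → trans (Σ-swap (B ^ m) B (λ v₁ U₀ → κ x₀ v₀ U₀ · abs (Z v₁ (next j U₀ x₀ v₀))))
                 (Σ-cong B (λ U₀ → Σ-*ˡ (B ^ m) (κ x₀ v₀ U₀) (λ v₁ → abs (Z v₁ (next j U₀ x₀ v₀))))))) ⟩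
        Σ B (λ v₀ → Σ B (λ U₀ → κ x₀ v₀ U₀ · Σ (B ^ m) (λ v₁ → abs (Z v₁ (next j U₀ x₀ v₀)))))
          ≤⟨ Σ-mono< B (λ v₀ v₀< → Σ-mono< B (λ U₀ U₀< → *-monoˡ (κ x₀ v₀ U₀) (κ≥0 x₀ v₀ U₀)
               (contraction m w (next j U₀ x₀ v₀) x₁ v′ (next-bounded j U₀ x₀ v₀ jb U₀< x₀< v₀<)))) ⟩
        Σ B (λ v₀ → Σ B (λ U₀ → κ x₀ v₀ U₀ · R)) ≡⟨ trans (Σ-cong B (λ v₀ → Σ-*ʳ B R (κ x₀ v₀))) (Σ-*ʳ B R (λ v₀ → Σ B (κ x₀ v₀))) ⟩
        Σ B (λ v₀ → Σ B (κ x₀ v₀)) · R ≡⟨ cong (_· R) (Σκ x₀) ⟩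
        (C ⊖ pos 2 · 𝟙 (x₀ ℕ.≟ x*)) · R ≡⟨ ring₁₀ (C ⊖ pos 2 · 𝟙 (x₀ ℕ.≟ x*)) (pos (2 ^ w)) (wt m x₁) ⟩
        pos (2 ^ w) · (wt m x₁ · (C ⊖ pos 2 · 𝟙 (x₀ ℕ.≟ x*))) ∎
        where
        open ℤₚ.≤-Reasoning
        x₀ = low θ x
        x₁ = sh θ x
        x₀< = low< θ x
        n₁ = B ^ m * 2 ^ w
        R = pos (2 ^ w) · wt m x₁
        outer : ℕ → ℤ
        outer v = abs (Σ (B * B ^ m * 2 ^ w) (λ U → Ψ (θ + width θ m w) j U x (v + B * B ^ m * v′)))
        Z : ℕ → State → ℤ
        Z v₁ i = Σ n₁ (λ U₁ → Ψ (width θ m w) i U₁ x₁ (v₁ + B ^ m * v′))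
        Z-cong : ∀ v₁ {i i′ : State} → (∀ c ρ σ → i c ρ σ ≡ i′ c ρ σ) → Z v₁ i ≡ Z v₁ i′
        Z-cong v₁ h = Σ-cong n₁ (λ U₁ → cube-cong (λ c ρ σ → cong (λ k → Tw (width θ m w) (L c ρ σ U₁ x₁ (v₁ + B ^ m * v′) + k)) (h c ρ σ)))
        size : B * B ^ m * 2 ^ w ≡ n₁ * B
        size = ring₁₁ B (B ^ m) (2 ^ w)
        inner-eq : ∀ v₀ v₁ → Σ (B * B ^ m * 2 ^ w) (λ U → Ψ (θ + width θ m w) j U x (v₀ + B * v₁ + B * B ^ m * v′)) ≡ Σ B (λ U₀ → Ψ θ j U₀ x₀ v₀ · Z v₁ (next j U₀ x₀ v₀))
        inner-eq v₀ v₁ = begin-equality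
          Σ (B * B ^ m * 2 ^ w) g ≡⟨ trans (cong (λ n → Σ n g) size) (Σ-block n₁ B g) ⟩
          Σ n₁ (λ U₁ → Σ B (λ U₀ → g (U₀ + B * U₁))) ≡⟨ Σ-swap n₁ B (λ U₁ U₀ → g (U₀ + B * U₁)) ⟩
          Σ B (λ U₀ → Σ n₁ (λ U₁ → g (U₀ + B * U₁))) ≡⟨ Σ-cong B (λ U₀ → Σ-cong n₁ (λ U₁ → trans
              (cong₂ (λ p q → Ψ (θ + width θ m w) j (U₀ + B * U₁) p q) (low-sh θ x) (ring₁₂ v₀ B v₁ (B ^ m) v′))
              (Ψ-step (width θ m w) j U₀ U₁ x₀ x₁ v₀ (v₁ + B ^ m * v′)))) ⟩
          Σ B (λ U₀ → Σ n₁ (λ U₁ → Ψ θ j U₀ x₀ v₀ · Ψ (width θ m w) (next j U₀ x₀ v₀) U₁ x₁ (v₁ + B ^ m * v′))) ≡⟨ Σ-cong B (λ U₀ → Σ-*ˡ n₁ (Ψ θ j U₀ x₀ v₀) (λ U₁ → Ψ (width θ m w) (next j U₀ x₀ v₀) U₁ x₁ (v₁ + B ^ m * v′))) ⟩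
          Σ B (λ U₀ → Ψ θ j U₀ x₀ v₀ · Z v₁ (next j U₀ x₀ v₀)) ∎
          where
          g : ℕ → ℤ
          g U = Ψ (θ + width θ m w) j U x (v₀ + B * v₁ + B * B ^ m * v′)
        each : ∀ v₀ v₁ → v₀ < B → outer (v₀ + B * v₁) ≼ Σ B (λ U₀ → κ x₀ v₀ U₀ · abs (Z v₁ (next j U₀ x₀ v₀)))
        each v₀ v₁ v₀< = ℤₚ.≤-trans (ℤₚ.≤-reflexive (cong abs (inner-eq v₀ v₁))) (block-sum x₀ v₀ j jb x₀< v₀< (Z v₁) (Z-cong v₁))

      -- The weights multiply over blocks, and each block of x averages to B³ - 2 in place of B³:
      -- the fixed proportion lost per block.
      Σ-wt : ∀ m n → Σ (B ^ m * n) (wt m) ≡ pos n · (pos B · C ⊖ pos 2) ℤ.^ m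
      Σ-wt zero n = trans (cong (λ k → Σ k (λ _ → 1ℤ)) (*-identityˡ n)) (Σ-const n 1ℤ)
      Σ-wt (suc m) n = begin
        Σ (B * B ^ m * n) (wt (suc m)) ≡⟨ trans (cong (λ k → Σ k (wt (suc m))) (ring₁₁ B (B ^ m) n)) (Σ-block (B ^ m * n) B (wt (suc m))) ⟩
        Σ (B ^ m * n) (λ x₁ → Σ B (λ x₀ → wt (suc m) (x₀ + B * x₁))) ≡⟨ Σ-cong (B ^ m * n) (λ x₁ → Σ-cong< B (λ x₀ x₀< → cong₂ (λ p q → wt m p · (C ⊖ pos 2 · 𝟙 (q ℕ.≟ x*))) (sh-unique θ x₀ x₁ x₀<) (low-unique θ x₀ x₁ x₀<))) ⟩
        Σ (B ^ m * n) (λ x₁ → Σ B (λ x₀ → wt m x₁ · (C ⊖ pos 2 · 𝟙 (x₀ ℕ.≟ x*)))) ≡⟨ Σ-cong (B ^ m * n) (λ x₁ → trans (Σ-*ˡ B (wt m x₁) (λ x₀ → C ⊖ pos 2 · 𝟙 (x₀ ℕ.≟ x*))) (cong (wt m x₁ ·_) one-block)) ⟩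
        Σ (B ^ m * n) (λ x₁ → wt m x₁ · D) ≡⟨ Σ-*ʳ (B ^ m * n) D (wt m) ⟩
        Σ (B ^ m * n) (wt m) · D ≡⟨ cong (_· D) (Σ-wt m n) ⟩
        pos n · D ℤ.^ m · D ≡⟨ ring₁₃ (pos n) (D ℤ.^ m) D ⟩
        pos n · (D · D ℤ.^ m) ∎
        where
        open ≡-Reasoning
        D = pos B · C ⊖ pos 2
        one-block : Σ B (λ x₀ → C ⊖ pos 2 · 𝟙 (x₀ ℕ.≟ x*)) ≡ D
        one-block = begin
          Σ B (λ x₀ → C ⊖ pos 2 · 𝟙 (x₀ ℕ.≟ x*)) ≡⟨ Σ-minus B (λ _ → C) (λ x₀ → pos 2 · 𝟙 (x₀ ℕ.≟ x*)) ⟩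
          Σ B (λ _ → C) ⊖ Σ B (λ x₀ → pos 2 · 𝟙 (x₀ ℕ.≟ x*)) ≡⟨ cong₂ _⊖_ (Σ-const B C) (trans (Σ-cong B (λ x₀ → ℤₚ.*-comm (pos 2) (𝟙 (x₀ ℕ.≟ x*)))) (Σ-pick B x* (λ _ → pos 2) x*<)) ⟩
          D ∎

-- Construction of a block with opposite signs.

module FlipBlocks where
  open ℕ-Arithmetic
  open IntegerSums using (n<2^n)
  open ThueMorse
  open SignFlips
  open CarryDigits

  private
    ring₁ : ∀ c Y → c * (Y + 0 + 0) ≡ c * Y
    ring₁ = solve-∀

    ring₂ : ∀ c Y d → c * (Y + 0 + d) ≡ c * (Y + d)
    ring₂ = solve-∀

    ring₃ : ∀ c Y d → c * (Y + d + 0) ≡ c * (Y + d)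
    ring₃ = solve-∀

    ring₄ : ∀ x y z → (x · y) · (y · z) ≡ (y · y) · (x · z)
    ring₄ = ℤR.solve-∀

    ring₅ : ∀ x → neg (x · neg 1ℤ) ≡ x · 1ℤ
    ring₅ = ℤR.solve-∀

    ring₆ : ∀ E x P y → E * x * (P * y) ≡ P * (E * (x * y))
    ring₆ = solve-∀

    ring₇ : ∀ c P Y u v → c * (P * Y + P * u + P * v) ≡ P * (c * (Y + u + v))
    ring₇ = solve-∀

  module _ (a b : ℕ) (a<b : a < b) (a>0 : 0 < a) (b-odd : Odd b)
    (E Δe Δh J : ℕ) (E≢0 : NonZero E) (Δe≢0 : NonZero Δe) (Δh≢0 : NonZero Δh) where

    coef : Bool → ℕ
    coef c = if c then b else a

    private
      φ′ = φ a b a<b a>0 b-odd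
      d₀ = E * (Δh * Δe)
      d = d₀ + d₀
      d₀≢0 : NonZero d₀
      d₀≢0 = m*n≢0 E (Δh * Δe) {{E≢0}} {{m*n≢0 Δh Δe {{Δh≢0}} {{Δe≢0}}}}
      d≢0 : NonZero d
      d≢0 = >-nonZero (≤-trans (>-nonZero⁻¹ d₀ {{d₀≢0}}) (m≤m+n d₀ d₀))
      Y₁ = d
      Y₂ = proj₁ (minus-pair a b a<b a>0 b-odd d d≢0)
      P = 2 ^ J

    size : ℕ
    size = b * (Y₁ + Y₂ + d + Δe + Δh)

    private

      q : ℕ → Bool → Bool → Bool → ℕ
      q Y c ρ σ = coef c * (Y + sel σ d₀ + sel ρ d₀)

      -- With equal shifts d₀ in both directions, the two corners shifted exactly once coincide and
      -- their signs cancel. What remains is Y and Y + 2 d₀ for each coefficient.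
      cube-q : ∀ Y → cube (λ c ρ σ → T (q Y c ρ σ)) ≡ φ′ Y · φ′ (Y + d)
      cube-q Y = begin
        cube (λ c ρ σ → T (q Y c ρ σ)) ≡⟨ cong₂ _·_ (face a) (face b) ⟩
        (T (a * Y) · T (a * (Y + d))) · (T (b * Y) · T (b * (Y + d))) ≡⟨ ·-interchange (T (a * Y)) (T (a * (Y + d))) (T (b * Y)) (T (b * (Y + d))) ⟩
        φ′ Y · φ′ (Y + d) ∎
        where
        open ≡-Reasoning
        face : ∀ c → (T (c * (Y + 0 + 0)) · T (c * (Y + 0 + d₀))) · (T (c * (Y + d₀ + 0)) · T (c * (Y + d₀ + d₀))) ≡ T (c * Y) · T (c * (Y + d))
        face c = begin
          (T (c * (Y + 0 + 0)) · T (c * (Y + 0 + d₀))) · (T (c * (Y + d₀ + 0)) · T (c * (Y + d₀ + d₀)))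
            ≡⟨ cong₂ _·_ (cong₂ (λ u v → T u · T v) (ring₁ c Y) (ring₂ c Y d₀)) (cong₂ (λ u v → T u · T v) (ring₃ c Y d₀) (cong (c *_) (+-assoc Y d₀ d₀))) ⟩
          (T (c * Y) · T (c * (Y + d₀))) · (T (c * (Y + d₀)) · T (c * (Y + d))) ≡⟨ ring₄ (T (c * Y)) (T (c * (Y + d₀))) (T (c * (Y + d))) ⟩
          (T (c * (Y + d₀)) · T (c * (Y + d₀))) · (T (c * Y) · T (c * (Y + d))) ≡⟨ cong (_· (T (c * Y) · T (c * (Y + d)))) (T-sq (c * (Y + d₀))) ⟩
          1ℤ · (T (c * Y) · T (c * (Y + d))) ≡⟨ ℤₚ.*-identityˡ _ ⟩
          T (c * Y) · T (c * (Y + d)) ∎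

      sel≤d₀ : ∀ s → sel s d₀ ≤ d₀
      sel≤d₀ true = ≤-refl
      sel≤d₀ false = z≤n

      coef≤b : ∀ c → coef c ≤ b
      coef≤b true = ≤-refl
      coef≤b false = <⇒≤ a<b

      q≤size : ∀ Y → Y ≤ Y₁ + Y₂ → ∀ c ρ σ → q Y c ρ σ ≤ size
      q≤size Y Y≤ c ρ σ = *-mono-≤ (coef≤b c) (begin
        Y + sel σ d₀ + sel ρ d₀ ≤⟨ +-mono-≤ (+-mono-≤ Y≤ (sel≤d₀ σ)) (sel≤d₀ ρ) ⟩
        Y₁ + Y₂ + d₀ + d₀ ≡⟨ +-assoc (Y₁ + Y₂) d₀ d₀ ⟩
        Y₁ + Y₂ + d ≤⟨ ≤-trans (m≤m+n (Y₁ + Y₂ + d) Δe) (m≤m+n (Y₁ + Y₂ + d + Δe) Δh) ⟩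
        Y₁ + Y₂ + d + Δe + Δh ∎)
        where open ≤-Reasoning

      n≤size : ∀ n → n ≤ Y₁ + Y₂ + d + Δe + Δh → n ≤ size
      n≤size n n≤ = ≤-trans n≤ (m≤n*m _ b {{>-nonZero (≤-trans a>0 (<⇒≤ a<b))}})

    module _ (S : ℕ) (size≤S : size ≤ S) where

      θ : ℕ
      θ = J + S

      private
        below : ∀ r n → r < P → n ≤ size → r + P * n < 2 ^ θ
        below r n r< n≤ = begin-strict
          r + P * n <⟨ +-monoˡ-< (P * n) r< ⟩
          P + P * n ≡⟨ sym (*-suc P n) ⟩
          P * suc n ≤⟨ *-monoʳ-≤ P (≤-trans (s≤s (≤-trans n≤ size≤S)) (n<2^n S)) ⟩
          P * 2 ^ S ≡⟨ sym (^-distribˡ-+-* 2 J S) ⟩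
          2 ^ θ ∎
          where open ≤-Reasoning

        small : ∀ n → n ≤ Y₁ + Y₂ + d + Δe + Δh → P * n < 2 ^ θ
        small n n≤ = below 0 n (m^n>0 2 J) (n≤size n n≤)

      -- The choice x* = 2ᴶ Δe, v* = 2ᴶ Δh equalises the shifts: E Δh x* = E Δe v* = 2ᴶ d₀. The
      -- factor 2ᴶ lifts them above the incoming carries, which are at most J < 2ᴶ, so the sign
      -- splits into one of the carries and φ(Y) φ(Y + d). This is +1 at Y₁ = d by `plus-pair` and
      -- -1 at Y₂ by `minus-pair`. The S further digits hold every number involved, so nothing is
      -- carried out.
      flip-block : (coef≤J : ∀ c → coef c * (1 + E * Δh + E * Δe) ≤ J) →
        ∃ λ (bl : Digits.FlipBlock coef (E * Δh) (E * Δe) J θ coef≤J) → Digits.FlipBlock.x* {coef} {E * Δh} {E * Δe} {J} {θ} {coef≤J} bl < 2 ^ θ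
      flip-block coef≤J = record
        { x* = P * Δe ; v* = P * Δh ; y₁ = P * Y₁ ; y₂ = P * Y₂
        ; v*< = small Δh (m≤n+m Δh (Y₁ + Y₂ + d + Δe))
        ; y₁< = small Y₁ (≤-trans Y₁≤ Y₁+Y₂≤)
        ; y₂< = small Y₂ (≤-trans Y₂≤ Y₁+Y₂≤)
        ; y₁≢y₂ = λ eq → distinct (*-cancelˡ-≡ Y₁ Y₂ P {{m^n≢0 2 J}} eq)
        ; reset₁ = λ j jb → reset Y₁ Y₁≤ j jb
        ; reset₂ = λ j jb → reset Y₂ Y₂≤ j jb
        ; flips = λ j jb → trans (sign Y₁ Y₁≤ j jb) (trans (cong (λ z → cube (λ c ρ σ → T (j c ρ σ)) · z) (plus-pair a b a<b a>0 b-odd d))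
            (sym (trans (cong neg (trans (sign Y₂ Y₂≤ j jb) (cong (λ z → cube (λ c ρ σ → T (j c ρ σ)) · z) minus))) (ring₅ (cube (λ c ρ σ → T (j c ρ σ)))))))
        } , small Δe (≤-trans (m≤n+m Δe (Y₁ + Y₂ + d)) (m≤m+n (Y₁ + Y₂ + d + Δe) Δh))
        where
        open Digits coef (E * Δh) (E * Δe) J θ coef≤J
        minus : φ′ Y₂ · φ′ (Y₂ + d) ≡ neg 1ℤ
        minus = proj₂ (minus-pair a b a<b a>0 b-odd d d≢0)
        distinct : ¬ Y₁ ≡ Y₂
        distinct eq = absurd (trans (sym (plus-pair a b a<b a>0 b-odd d)) (trans (cong (λ z → φ′ z · φ′ (z + d)) eq) minus))
          where
          absurd : ¬ (1ℤ ≡ neg 1ℤ)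
          absurd ()
        Y₁≤ : Y₁ ≤ Y₁ + Y₂
        Y₁≤ = m≤m+n Y₁ Y₂
        Y₂≤ : Y₂ ≤ Y₁ + Y₂
        Y₂≤ = m≤n+m Y₂ Y₁
        Y₁+Y₂≤ : Y₁ + Y₂ ≤ Y₁ + Y₂ + d + Δe + Δh
        Y₁+Y₂≤ = ≤-trans (m≤m+n (Y₁ + Y₂) d) (≤-trans (m≤m+n (Y₁ + Y₂ + d) Δe) (m≤m+n (Y₁ + Y₂ + d + Δe) Δh))
        value : ∀ Y j c ρ σ → L c ρ σ (P * Y) (P * Δe) (P * Δh) + j c ρ σ ≡ j c ρ σ + P * q Y c ρ σ
        value Y j c ρ σ = trans (+-comm _ (j c ρ σ)) (cong (j c ρ σ +_) (trans (cong₂ (λ u v → coef c * (P * Y + u + v)) (part σ Δh Δe refl) (part ρ Δe Δh (*-comm Δe Δh)))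
            (ring₇ (coef c) P Y (sel σ d₀) (sel ρ d₀))))
          where
          part : ∀ s x y → x * y ≡ Δh * Δe → sel s (E * x * (P * y)) ≡ P * sel s d₀
          part s x y eq = trans (cong (sel s) (trans (ring₆ E x P y) (cong (λ z → P * (E * z)) eq))) (sel-* s P d₀)
        j<P : ∀ {n} → n ≤ J → n < P
        j<P n≤J = ≤-<-trans n≤J (n<2^n J)
        reset : ∀ Y → Y ≤ Y₁ + Y₂ → ∀ j → Bounded j → ∀ c ρ σ → next j (P * Y) (P * Δe) (P * Δh) c ρ σ ≡ 0
        reset Y Y≤ j jb c ρ σ = trans (cong (sh θ) (value Y j c ρ σ)) (sh-small θ _ (below (j c ρ σ) (q Y c ρ σ) (j<P (jb c ρ σ)) (q≤size Y Y≤ c ρ σ)))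
        sign : ∀ Y → Y ≤ Y₁ + Y₂ → ∀ j → Bounded j → Ψ θ j (P * Y) (P * Δe) (P * Δh) ≡ cube (λ c ρ σ → T (j c ρ σ)) · (φ′ Y · φ′ (Y + d))
        sign Y Y≤ j jb = trans (cube-cong factor) (trans (cube-· (λ c ρ σ → T (j c ρ σ)) (λ c ρ σ → T (q Y c ρ σ))) (cong (cube (λ c ρ σ → T (j c ρ σ)) ·_) (cube-q Y)))
          where
          factor : ∀ c ρ σ → Tw θ (L c ρ σ (P * Y) (P * Δe) (P * Δh) + j c ρ σ) ≡ T (j c ρ σ) · T (q Y c ρ σ)
          factor c ρ σ = trans (cong (Tw θ) (value Y j c ρ σ)) (trans (Tw≡T θ _ (below (j c ρ σ) (q Y c ρ σ) (j<P (jb c ρ σ)) (q≤size Y Y≤ c ρ σ)))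
            (T-join J (j c ρ σ) (q Y c ρ σ) (j<P (jb c ρ σ))))

-- Odd multipliers, truncation to a window, and moving x.

module OrbitSteps where
  open import Data.Nat.DivMod using (_/_; _%_; m%n<n)
  open ℕ-Arithmetic
  open IntegerSums hiding (*-mono-≤)
  open ThueMorse
  open SignFlips using (Odd)
  open CarryDigits

  private
    ring₁ : ∀ c z j → c * (2 * z) + j ≡ j + 2 * (c * z)
    ring₁ = solve-∀

    ring₂ : ∀ m z j → (1 + 2 * m) * (1 + 2 * z) + j ≡ 1 + j + 2 * (m + z + 2 * (m * z))
    ring₂ = solve-∀

    ring₃ : ∀ m z k → k + (m + z + 2 * (m * z)) ≡ (1 + 2 * m) * z + (k + m)
    ring₃ = solve-∀

    ring₄ : ∀ a x → x ≡ neg a ⊕ (a ⊕ x)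
    ring₄ = ℤR.solve-∀

    ring₅ : ∀ x y z → x + y + z ≡ x + z + y
    ring₅ = solve-∀

    ring₆ : ∀ r x p y → r + 2 * (x + p * y) ≡ r + 2 * x + 2 * p * y
    ring₆ = solve-∀

    ring₇ : ∀ a b → a * b * 2 ≡ a * (2 * b)
    ring₇ = solve-∀

    ring₈ : ∀ p a E → 2 * p * (a * (2 * E)) ≡ p * (a * E * 2 * 2)
    ring₈ = solve-∀

    ring₉ : ∀ a b c → a * (b * c) ≡ b * (c * a)
    ring₉ = solve-∀

    ring₁₀ : ∀ E g a b e → 2 * E * (g + a * b) + e ≡ 2 * E * g + e + a * (2 * E) * b
    ring₁₀ = solve-∀

    ring₁₁ : ∀ c E x t y e → c * ((2 * E * (x + t * y) + e) * (2 * E * (x + t * y) + e)) ≡ c * ((2 * E * x + e) * (2 * E * x + e)) + c * (2 * (t * (2 * E)) * ((2 * E * x + e) * y)) + c * (t * (2 * E) * (t * (2 * E)) * (y * y))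
    ring₁₁ = solve-∀

    ring₁₂ : ∀ S c p q a W K y L t → S + c * (2 * p * ((q + a * (1 + W * K)) * y)) + c * (L * (W * t) * (y * y)) ≡ S + c * (2 * p * (q * y)) + (2 * p * a * (c * y + W * (c * (K * y))) + L * (W * (c * (t * (y * y)))))
    ring₁₂ = solve-∀

    ring₁₃ : ∀ S L c y W K t → S + (L * (c * y + W * (c * (K * y))) + L * (W * (c * (t * (y * y))))) ≡ S + L * (c * y + W * (c * (K * y + t * (y * y))))
    ring₁₃ = solve-∀

    ring₁₄ : ∀ a b → a + a * b + a ≡ a * (2 + b)
    ring₁₄ = solve-∀

  -- Multiplication by an odd number is invertible modulo 2ˢ. The induction strips the lowest digit:
  -- even and odd z give the two different lowest digits, and on the remaining digits the same
  -- multiplier acts with a new offset, so no inverse has to be named.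
  odd-permutes : ∀ s {c} → Odd c → ∀ j (F : ℕ → ℤ) → Σ (2 ^ s) (λ z → F (low s (c * z + j))) ≡ Σ (2 ^ s) F
  odd-permutes zero _ j F = refl
  odd-permutes (suc s) {c} (m , refl) j F = begin
    Σ (2 * 2 ^ s) (λ z → F (low (suc s) (c * z + j))) ≡⟨ blocks (λ z → F (low (suc s) (c * z + j))) ⟩
    Σ (2 ^ s) (λ z → F (low (suc s) (c * (2 * z) + j)) ⊕ F (low (suc s) (c * (1 + 2 * z) + j)))
      ≡⟨ Σ-cong (2 ^ s) (λ z → cong₂ _⊕_ (cong F (low-double j (c * z) (ring₁ c z j))) (cong F (low-double (1 + j) (m + z + 2 * (m * z)) (ring₂ m z j)))) ⟩
    Σ (2 ^ s) (λ z → F (j % 2 + 2 * low s (j / 2 + c * z)) ⊕ F ((1 + j) % 2 + 2 * low s ((1 + j) / 2 + (m + z + 2 * (m * z)))))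
      ≡⟨ Σ-+ (2 ^ s) (λ z → F (j % 2 + 2 * low s (j / 2 + c * z))) (λ z → F ((1 + j) % 2 + 2 * low s ((1 + j) / 2 + (m + z + 2 * (m * z))))) ⟩
    Σ (2 ^ s) (λ z → F (j % 2 + 2 * low s (j / 2 + c * z))) ⊕ Σ (2 ^ s) (λ z → F ((1 + j) % 2 + 2 * low s ((1 + j) / 2 + (m + z + 2 * (m * z)))))
      ≡⟨ cong₂ _⊕_
          (trans (Σ-cong (2 ^ s) (λ z → cong (λ k → F (j % 2 + 2 * low s k)) (+-comm (j / 2) (c * z)))) (odd-permutes s (m , refl) (j / 2) (λ z → F (j % 2 + 2 * z))))
          (trans (Σ-cong (2 ^ s) (λ z → cong (λ k → F ((1 + j) % 2 + 2 * low s k)) (ring₃ m z ((1 + j) / 2)))) (odd-permutes s (m , refl) ((1 + j) / 2 + m) (λ z → F ((1 + j) % 2 + 2 * z)))) ⟩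
    Σ (2 ^ s) (λ z → F (j % 2 + 2 * z)) ⊕ Σ (2 ^ s) (λ z → F ((1 + j) % 2 + 2 * z)) ≡⟨ residues (j % 2) (m%n<n j 2) refl ⟩
    Σ (2 ^ s) (λ z → F (2 * z)) ⊕ Σ (2 ^ s) (λ z → F (1 + 2 * z)) ≡⟨ sym (Σ-+ (2 ^ s) (λ z → F (2 * z)) (λ z → F (1 + 2 * z))) ⟩
    Σ (2 ^ s) (λ z → F (2 * z) ⊕ F (1 + 2 * z)) ≡⟨ sym (blocks F) ⟩
    Σ (2 * 2 ^ s) F ∎
    where
    open ≡-Reasoning
    blocks : ∀ (f : ℕ → ℤ) → Σ (2 * 2 ^ s) f ≡ Σ (2 ^ s) (λ z → f (2 * z) ⊕ f (1 + 2 * z))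
    blocks f = trans (cong (λ n → Σ n f) (*-comm 2 (2 ^ s))) (trans (Σ-block (2 ^ s) 2 f) (Σ-cong (2 ^ s) (λ z → cong (_⊕ f (1 + 2 * z)) (ℤₚ.+-identityˡ (f (2 * z))))))
    low-double : ∀ k X {n} → n ≡ k + 2 * X → low (suc s) n ≡ k % 2 + 2 * low s (k / 2 + X)
    low-double k X refl = cong₂ (λ p q → p + 2 * low s q) (parity-+ k X) (half-+ k X)
    succ-parity : ∀ r → j % 2 ≡ r → (1 + j) % 2 ≡ (1 + r) % 2
    succ-parity r eq = trans (cong (λ k → (1 + k) % 2) (trans (halves j) (cong (_+ 2 * (j / 2)) eq))) (parity-+ (1 + r) (j / 2))
    residues : ∀ r → r < 2 → j % 2 ≡ r → Σ (2 ^ s) (λ z → F (j % 2 + 2 * z)) ⊕ Σ (2 ^ s) (λ z → F ((1 + j) % 2 + 2 * z)) ≡ Σ (2 ^ s) (λ z → F (2 * z)) ⊕ Σ (2 ^ s) (λ z → F (1 + 2 * z))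
    residues 0 _ eq = cong₂ (λ p q → Σ (2 ^ s) (λ z → F (p + 2 * z)) ⊕ Σ (2 ^ s) (λ z → F (q + 2 * z))) eq (succ-parity 0 eq)
    residues 1 _ eq = trans (cong₂ (λ p q → Σ (2 ^ s) (λ z → F (p + 2 * z)) ⊕ Σ (2 ^ s) (λ z → F (q + 2 * z))) eq (succ-parity 1 eq)) (ℤₚ.+-comm (Σ (2 ^ s) (λ z → F (1 + 2 * z))) (Σ (2 ^ s) (λ z → F (2 * z))))
    residues (suc (suc _)) (s≤s (s≤s ())) _

  ⊕-cancelˡ : ∀ a x y → a ⊕ x ≡ a ⊕ y → x ≡ y
  ⊕-cancelˡ a x y eq = trans (ring₄ a x) (trans (cong (neg a ⊕_) eq) (sym (ring₄ a y)))

  Σ-periodic : ∀ N (f : ℕ → ℤ) → (∀ u → f (u + N) ≡ f u) → ∀ U → Σ N (λ y → f (U + y)) ≡ Σ N f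
  Σ-periodic N f per zero = refl
  Σ-periodic N f per (suc U) = ⊕-cancelˡ (f U) (Σ N (λ y → f (suc U + y))) (Σ N f) (begin
    f U ⊕ Σ N (λ y → f (suc U + y)) ≡⟨ cong₂ _⊕_ (cong f (sym (+-identityʳ U))) (Σ-cong N (λ y → cong f (sym (+-suc U y)))) ⟩
    f (U + 0) ⊕ Σ N (λ y → f (U + suc y)) ≡⟨ sym (Σ-head N (λ y → f (U + y))) ⟩
    Σ N (λ y → f (U + y)) ⊕ f (U + N) ≡⟨ cong₂ _⊕_ (Σ-periodic N f per U) (per U) ⟩
    Σ N f ⊕ f U ≡⟨ ℤₚ.+-comm (Σ N f) (f U) ⟩
    f U ⊕ Σ N f ∎)
    where open ≡-Reasoning

  Σ-top-slice : ∀ N K → Σ N (λ z → 𝟙 (N ℕ.<? z + K)) ≼ pos K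
  Σ-top-slice N K with ≤-total K N
  ... | inj₂ N≤K = begin
    Σ N (λ z → 𝟙 (N ℕ.<? z + K)) ≤⟨ Σ-≤-const N 1ℤ (λ z _ → 𝟙-≤1 (N ℕ.<? z + K)) ⟩
    pos N · 1ℤ ≡⟨ ℤₚ.*-identityʳ (pos N) ⟩
    pos N ≤⟨ ℤ.+≤+ N≤K ⟩
    pos K ∎
    where open ℤₚ.≤-Reasoning
  ... | inj₁ K≤N = begin
    Σ N f ≡⟨ trans (cong (λ n → Σ n f) (sym (m∸n+n≡m K≤N))) (Σ-split M K f) ⟩
    Σ M f ⊕ Σ K (λ i → f (M + i)) ≡⟨ cong (_⊕ Σ K (λ i → f (M + i))) (trans (Σ-cong< M (λ z z<M → 𝟙-no (N ℕ.<? z + K) (λ N< → <-asym N< (<-≤-trans (+-monoˡ-< K z<M) (≤-reflexive (m∸n+n≡m K≤N)))))) (Σ-zero M)) ⟩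
    0ℤ ⊕ Σ K (λ i → f (M + i)) ≡⟨ ℤₚ.+-identityˡ _ ⟩
    Σ K (λ i → f (M + i)) ≤⟨ Σ-≤-const K 1ℤ (λ i _ → 𝟙-≤1 (N ℕ.<? M + i + K)) ⟩
    pos K · 1ℤ ≡⟨ ℤₚ.*-identityʳ (pos K) ⟩
    pos K ∎
    where
    open ℤₚ.≤-Reasoning
    M = N ∸ K
    f : ℕ → ℤ
    f z = 𝟙 (N ℕ.<? z + K)

  -- If adding δ does not carry out of the window, the two numbers have the same digits above it,
  -- and their common sign squares to 1.
  T-pair-truncate : ∀ w A δ → low w A + δ < 2 ^ w → T A · T (A + δ) ≡ Tw w A · Tw w (A + δ)
  T-pair-truncate w A δ no-carry = begin
    T A · T (A + δ) ≡⟨ cong₂ _·_ (T-split w A) (trans (T-split w (A + δ)) (cong (λ z → Tw w (A + δ) · T z) same)) ⟩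
    (Tw w A · T q) · (Tw w (A + δ) · T q) ≡⟨ ·-interchange (Tw w A) (T q) (Tw w (A + δ)) (T q) ⟩
    (Tw w A · Tw w (A + δ)) · (T q · T q) ≡⟨ cong (Tw w A · Tw w (A + δ) ·_) (T-sq q) ⟩
    (Tw w A · Tw w (A + δ)) · 1ℤ ≡⟨ ℤₚ.*-identityʳ _ ⟩
    Tw w A · Tw w (A + δ) ∎
    where
    open ≡-Reasoning
    q = sh w A
    same : sh w (A + δ) ≡ q
    same = trans (cong (sh w) (trans (cong (_+ δ) (low-sh w A)) (ring₅ (low w A) (2 ^ w * q) δ))) (sh-unique w (low w A + δ) q no-carry)

  low-join : ∀ u s A → low (u + s) A ≡ low u A + 2 ^ u * low s (sh u A)
  low-join zero s A = sym (+-identityʳ (low s A))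
  low-join (suc u) s A = trans (cong (λ z → A % 2 + 2 * z) (low-join u s (A / 2))) (ring₆ (A % 2) (low u (A / 2)) (2 ^ u) (low s (sh u (A / 2))))

  -- Numbers n = 2(e + E x + 2ˡ(h + E v)) + 1 at the corners e ∈ {e₁, e₁ + Δe}, h ∈ {h₁, h₁ + Δh}.
  module Corners (coef : Bool → ℕ) (ε l e₁ h₁ Δe Δh : ℕ) where

    E = 2 ^ ε
    -- A point is Y + 2^(l+1) V, so the cross term 2 Y · 2^(l+1) V of its square starts at position
    -- l + 2.
    Λ = l + 2

    ê : Bool → ℕ
    ê ρ = 2 * (e₁ + sel ρ Δe) + 1

    Y : Bool → ℕ → ℕ
    Y ρ x = 2 * E * x + ê ρ

    V : Bool → ℕ → ℕ
    V σ v = h₁ + sel σ Δh + E * v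

    point : Bool → Bool → ℕ → ℕ → ℕ
    point ρ σ x v = 2 * (e₁ + sel ρ Δe + E * x + 2 ^ l * V σ v) + 1

    -- The part of c Y² that reaches position Λ; below Λ the square does not see V.
    κ : Bool → Bool → ℕ → ℕ
    κ c ρ x = sh Λ (coef c * (Y ρ x * Y ρ x))

    A : Bool → Bool → Bool → ℕ → ℕ → ℕ
    A c ρ σ x v = κ c ρ x + coef c * (Y ρ x * V σ v + 2 ^ l * (V σ v * V σ v))

    2^Λ : 2 ^ Λ ≡ 4 * 2 ^ l
    2^Λ = trans (^-distribˡ-+-* 2 l 2) (*-comm (2 ^ l) 4)

    D : ℕ → ℕ → ℤ
    D x v = cube (λ c ρ σ → T (A c ρ σ x v))

    private
      square : ∀ c ρ σ x v → coef c * (point ρ σ x v * point ρ σ x v) ≡ coef c * (Y ρ x * Y ρ x) + 2 ^ Λ * (coef c * (Y ρ x * V σ v + 2 ^ l * (V σ v * V σ v)))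
      square c ρ σ x v = trans (lem (coef c) (e₁ + sel ρ Δe) E x (2 ^ l) (V σ v)) (cong (λ z → coef c * (Y ρ x * Y ρ x) + z * (coef c * (Y ρ x * V σ v + 2 ^ l * (V σ v * V σ v)))) (sym 2^Λ))
        where
        lem : ∀ c e E x L V → c * ((2 * (e + E * x + L * V) + 1) * (2 * (e + E * x + L * V) + 1)) ≡
          c * ((2 * E * x + (2 * e + 1)) * (2 * E * x + (2 * e + 1))) + 4 * L * (c * ((2 * E * x + (2 * e + 1)) * V + L * (V * V)))
        lem = solve-∀

    -- The digits below position Λ do not depend on σ, so they cancel in the product over the corners.
    D-points : ∀ x v → cube (λ c ρ σ → T (coef c * (point ρ σ x v * point ρ σ x v))) ≡ D x v
    D-points x v = begin
      cube (λ c ρ σ → T (coef c * (point ρ σ x v * point ρ σ x v))) ≡⟨ cube-cong factor ⟩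
      cube (λ c ρ σ → f c ρ · T (A c ρ σ x v)) ≡⟨ cube-· (λ c ρ σ → f c ρ) (λ c ρ σ → T (A c ρ σ x v)) ⟩
      cube (λ c ρ σ → f c ρ) · D x v ≡⟨ cong (_· D x v) (cong₂ _·_ (face false) (face true)) ⟩
      1ℤ · D x v ≡⟨ ℤₚ.*-identityˡ (D x v) ⟩
      D x v ∎
      where
      open ≡-Reasoning
      f : Bool → Bool → ℤ
      f c ρ = Tw Λ (coef c * (Y ρ x * Y ρ x))
      factor : ∀ c ρ σ → T (coef c * (point ρ σ x v * point ρ σ x v)) ≡ f c ρ · T (A c ρ σ x v)
      factor c ρ σ = trans (cong T (square c ρ σ x v)) (trans (T-split Λ (y + 2 ^ Λ * z)) (cong₂ _·_ (Tw-+ Λ y z) (cong T (sh-+ Λ y z))))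
        where
        y = coef c * (Y ρ x * Y ρ x)
        z = coef c * (Y ρ x * V σ v + 2 ^ l * (V σ v * V σ v))
      face : ∀ c → (f c false · f c true) · (f c false · f c true) ≡ 1ℤ
      face c = trans (·-interchange (f c false) (f c true) (f c false) (f c true)) (cong₂ _·_ (Tw-sq Λ (coef c * (Y false x * Y false x))) (Tw-sq Λ (coef c * (Y true x * Y true x))))

    Dw : ℕ → ℕ → ℕ → ℤ
    Dw w x v = cube (λ c ρ σ → Tw w (A c ρ σ x v))

    truncate : ∀ w K x v (δ : Bool → Bool → ℕ) → (∀ c σ → A c true σ x v ≡ A c false σ x v + δ c σ) → (∀ c σ → δ c σ < K) →
      (∀ c σ → low w (A c false σ x v) + K ≤ 2 ^ w) → D x v ≡ Dw w x v
    truncate w K x v δ A≡ δ<K room = cong₂ _·_ (cong₂ _·_ (pair false false) (pair false true)) (cong₂ _·_ (pair true false) (pair true true))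
      where
      pair : ∀ c σ → T (A c false σ x v) · T (A c true σ x v) ≡ Tw w (A c false σ x v) · Tw w (A c true σ x v)
      pair c σ = subst (λ z → T (A c false σ x v) · T z ≡ Tw w (A c false σ x v) · Tw w z) (sym (A≡ c σ))
        (T-pair-truncate w (A c false σ x v) (δ c σ) (<-≤-trans (+-monoʳ-< (low w (A c false σ x v)) (δ<K c σ)) (room c σ)))

    -- The increment of coef c · Y² below position Λ is at most 2ᵘ, so it cannot carry past the digits u, …, u + s − 1, which are not all ones.
    orbit-κ : ∀ (w s u τ t₂ π g K x₀ y : ℕ) c ρ → u + s ≡ Λ → τ + ε + 1 + (π + ε + 1 + 1) ≡ Λ → t₂ + (Λ + w) ≡ 2 * (τ + ε + 1) →
      x₀ ≡ g + 2 ^ π * (1 + 2 ^ w * K) → suc (low s (sh u (coef c * (Y ρ x₀ * Y ρ x₀)))) < 2 ^ s → coef c * (2 ^ (τ + ε + 2) * ((2 * E * g + ê ρ) * y)) ≤ 2 ^ u →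
      κ c ρ (x₀ + 2 ^ τ * y) ≡ κ c ρ x₀ + coef c * y + 2 ^ w * (coef c * (K * y + 2 ^ t₂ * (y * y)))
    orbit-κ w s u τ t₂ π g K x₀ y c ρ us≡ Λ≡ t₂≡ x₀≡ good tiny = begin
      sh Λ (coef c * (Y ρ (x₀ + 2 ^ τ * y) * Y ρ (x₀ + 2 ^ τ * y))) ≡⟨ cong (sh Λ) expand ⟩
      sh Λ (S + R + 2 ^ Λ * Z) ≡⟨ sh-+ Λ (S + R) Z ⟩
      sh Λ (S + R) + Z ≡⟨ cong (_+ Z) no-carry ⟩
      κ c ρ x₀ + (coef c * y + 2 ^ w * (coef c * (K * y + 2 ^ t₂ * (y * y)))) ≡⟨ sym (+-assoc (κ c ρ x₀) _ _) ⟩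
      κ c ρ x₀ + coef c * y + 2 ^ w * (coef c * (K * y + 2 ^ t₂ * (y * y))) ∎
      where
      open ≡-Reasoning
      q = 2 * E * g + ê ρ
      S = coef c * (Y ρ x₀ * Y ρ x₀)
      R = coef c * (2 ^ (τ + ε + 2) * (q * y))
      Z = coef c * y + 2 ^ w * (coef c * (K * y + 2 ^ t₂ * (y * y)))
      -- Moving x by 2^τ y adds p y to Y. In the cross term the isolated one 2^π of x₀ contributes 2
      -- p · 2^π · 2E · y = 2^Λ y, which moves κ by c y, and p² is a multiple of 2^(Λ + w).
      p = 2 ^ τ * (2 * E)
      p≡ : p ≡ 2 ^ (τ + ε + 1)
      p≡ = sym (trans (^-distribˡ-+-* 2 (τ + ε) 1) (trans (cong (_* 2) (^-distribˡ-+-* 2 τ ε)) (ring₇ (2 ^ τ) E)))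
      2p≡ : 2 ^ (τ + ε + 2) ≡ 2 * p
      2p≡ = trans (cong (2 ^_) (+-suc (τ + ε) 1)) (cong (2 *_) (sym p≡))
      2pπ : 2 * p * (2 ^ π * (2 * E)) ≡ 2 ^ Λ
      2pπ = trans (ring₈ p (2 ^ π) E) (trans (cong₂ _*_ p≡ (sym π≡)) (trans (sym (^-distribˡ-+-* 2 (τ + ε + 1) (π + ε + 1 + 1))) (cong (2 ^_) Λ≡)))
        where
        π≡ : 2 ^ (π + ε + 1 + 1) ≡ 2 ^ π * E * 2 * 2
        π≡ = trans (^-distribˡ-+-* 2 (π + ε + 1) 1) (cong (_* 2) (trans (^-distribˡ-+-* 2 (π + ε) 1) (cong (_* 2) (^-distribˡ-+-* 2 π ε))))
      p² : p * p ≡ 2 ^ Λ * (2 ^ w * 2 ^ t₂)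
      p² = trans (cong₂ _*_ p≡ p≡) (trans (sym (^-distribˡ-+-* 2 (τ + ε + 1) (τ + ε + 1))) (trans (cong (2 ^_) (trans (cong (τ + ε + 1 +_) (sym (+-identityʳ (τ + ε + 1)))) (sym t₂≡)))
        (trans (^-distribˡ-+-* 2 t₂ (Λ + w)) (trans (cong (2 ^ t₂ *_) (^-distribˡ-+-* 2 Λ w)) (ring₉ (2 ^ t₂) (2 ^ Λ) (2 ^ w))))))
      Y≡ : Y ρ x₀ ≡ q + 2 ^ π * (2 * E) * (1 + 2 ^ w * K)
      Y≡ = trans (cong (λ z → 2 * E * z + ê ρ) x₀≡) (ring₁₀ E g (2 ^ π) (1 + 2 ^ w * K) (ê ρ))
      expand : coef c * (Y ρ (x₀ + 2 ^ τ * y) * Y ρ (x₀ + 2 ^ τ * y)) ≡ S + R + 2 ^ Λ * Z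
      expand = begin
        coef c * (Y ρ (x₀ + 2 ^ τ * y) * Y ρ (x₀ + 2 ^ τ * y)) ≡⟨ ring₁₁ (coef c) E x₀ (2 ^ τ) y (ê ρ) ⟩
        S + coef c * (2 * p * (Y ρ x₀ * y)) + coef c * (p * p * (y * y)) ≡⟨ cong₂ (λ a b → S + coef c * (2 * p * (a * y)) + coef c * (b * (y * y))) Y≡ p² ⟩
        S + coef c * (2 * p * ((q + 2 ^ π * (2 * E) * (1 + 2 ^ w * K)) * y)) + coef c * (2 ^ Λ * (2 ^ w * 2 ^ t₂) * (y * y)) ≡⟨ ring₁₂ S (coef c) p q (2 ^ π * (2 * E)) (2 ^ w) K y (2 ^ Λ) (2 ^ t₂) ⟩
        S + coef c * (2 * p * (q * y)) + (2 * p * (2 ^ π * (2 * E)) * (coef c * y + 2 ^ w * (coef c * (K * y))) + 2 ^ Λ * (2 ^ w * (coef c * (2 ^ t₂ * (y * y)))))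
          ≡⟨ cong₂ (λ a b → S + coef c * (a * (q * y)) + (b * (coef c * y + 2 ^ w * (coef c * (K * y))) + 2 ^ Λ * (2 ^ w * (coef c * (2 ^ t₂ * (y * y)))))) (sym 2p≡) 2pπ ⟩
        S + R + (2 ^ Λ * (coef c * y + 2 ^ w * (coef c * (K * y))) + 2 ^ Λ * (2 ^ w * (coef c * (2 ^ t₂ * (y * y))))) ≡⟨ ring₁₃ (S + R) (2 ^ Λ) (coef c) y (2 ^ w) K (2 ^ t₂) ⟩
        S + R + 2 ^ Λ * Z ∎
      low-room : low Λ S + R < 2 ^ Λ
      low-room = ≤-<-trans (+-monoʳ-≤ (low Λ S) tiny) (subst₂ (λ a b → a + 2 ^ u < b) (sym low-eq) (trans (sym (^-distribˡ-+-* 2 u s)) (cong (2 ^_) us≡)) room)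
        where
        low-eq : low Λ S ≡ low u S + 2 ^ u * low s (sh u S)
        low-eq = trans (cong (λ z → low z S) (sym us≡)) (low-join u s S)
        room : low u S + 2 ^ u * low s (sh u S) + 2 ^ u < 2 ^ u * 2 ^ s
        room = ≤-trans (+-monoˡ-< (2 ^ u) (+-monoˡ-< (2 ^ u * low s (sh u S)) (low< u S))) (≤-trans (≤-reflexive (ring₁₄ (2 ^ u) (low s (sh u S)))) (*-monoʳ-≤ (2 ^ u) good))
      no-carry : sh Λ (S + R) ≡ κ c ρ x₀
      no-carry = trans (cong (sh Λ) (trans (cong (_+ R) (low-sh Λ S)) (ring₅ (low Λ S) (2 ^ Λ * sh Λ S) R))) (sh-unique Λ (low Λ S + R) (sh Λ S) low-room)

-- Normal form of the corner arguments and the count of bad positions.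

module OrbitForms where
  open ℕ-Arithmetic
  open IntegerSums hiding (*-mono-≤)
  open ThueMorse
  open SignFlips using (Odd; odd-*)
  open CarryDigits
  open OrbitSteps

  private
    ring₁ : ∀ a b c d → (a ⊕ b) ⊕ (c ⊕ d) ⊖ a ≡ b ⊕ c ⊕ d
    ring₁ = ℤR.solve-∀

    ring₂ : ∀ a b c d → (a ⊕ b) ⊕ (c ⊕ d) ⊖ b ≡ a ⊕ c ⊕ d
    ring₂ = ℤR.solve-∀

    ring₃ : ∀ a b c d → (a ⊕ b) ⊕ (c ⊕ d) ⊖ c ≡ a ⊕ b ⊕ d
    ring₃ = ℤR.solve-∀

    ring₄ : ∀ a b c d → (a ⊕ b) ⊕ (c ⊕ d) ⊖ d ≡ a ⊕ b ⊕ c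
    ring₄ = ℤR.solve-∀

    ring₅ : ∀ E x e s → 2 * E * x + (2 * (e + s) + 1) ≡ 2 * E * x + (2 * (e + 0) + 1) + 2 * s
    ring₅ = solve-∀

    ring₆ : ∀ a b c → a * (b * c) ≡ b * (a * c)
    ring₆ = solve-∀

    ring₇ : ∀ y s → (y + 2 * s) * (y + 2 * s) ≡ y * y + (4 * s * y + 4 * (s * s))
    ring₇ = solve-∀

    ring₈ : ∀ c L u s → c * (4 * L * (1 + u) + (4 * s * (2 * L) + 4 * L)) ≡ 4 * L * (c * u + c * (2 + 2 * s))
    ring₈ = solve-∀

    ring₉ : ∀ k d c y D V W → k + d + c * ((y + 2 * D) * V + W) ≡ k + c * (y * V + W) + (d + c * (2 * D * V))
    ring₉ = solve-∀

    ring₁₀ : ∀ E x e → 2 * E * x + (2 * e + 1) ≡ 1 + 2 * (E * x + e)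
    ring₁₀ = solve-∀

    ring₁₁ : ∀ a b → 2 * (a * (2 * b)) ≡ a * b * 4
    ring₁₁ = solve-∀

    ring₁₂ : ∀ a b → a * (2 * b) ≡ a * b * 2
    ring₁₂ = solve-∀

    ring₁₃ : ∀ c E x t z e → c * ((2 * E * (x + t * z) + e) * (2 * E * (x + t * z) + e)) ≡ c * ((2 * E * x + e) * (2 * E * x + e)) + 2 * (t * (2 * E)) * (c * (2 * E * x + e) * z) + t * (2 * E) * (t * (2 * E) * (c * (z * z)))
    ring₁₃ = solve-∀

    ring₁₄ : ∀ S p q a b w → S + 2 * p * q + a * (b * 2) * (p * w) ≡ S + 2 * p * (q + a * (b * w))
    ring₁₄ = solve-∀

    ring₁₅ : ∀ a b c → a + (b + c) ≡ b + a + c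
    ring₁₅ = solve-∀

  sh-≥ : ∀ θ A q → 2 ^ θ * q ≤ A → q ≤ sh θ A
  sh-≥ θ A q h = s≤s⁻¹ (*-cancelˡ-< (2 ^ θ) q (suc (sh θ A)) (begin-strict
    2 ^ θ * q ≤⟨ h ⟩
    A ≡⟨ low-sh θ A ⟩
    low θ A + 2 ^ θ * sh θ A <⟨ +-monoˡ-< (2 ^ θ * sh θ A) (low< θ A) ⟩
    2 ^ θ + 2 ^ θ * sh θ A ≡⟨ sym (*-suc (2 ^ θ) (sh θ A)) ⟩
    2 ^ θ * suc (sh θ A) ∎))
    where open ≤-Reasoning

  sh-≤ : ∀ θ A q → A ≤ 2 ^ θ * q → sh θ A ≤ q
  sh-≤ θ A q h = *-cancelˡ-≤ (2 ^ θ) {{m^n≢0 2 θ}} (≤-trans (2^θ*sh≤ θ A) h)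

  sh-mono : ∀ θ {A A′} → A ≤ A′ → sh θ A ≤ sh θ A′
  sh-mono θ {A} h = sh-≥ θ _ (sh θ A) (≤-trans (2^θ*sh≤ θ A) h)

  cube₄ : (Bool → Bool → ℤ) → ℤ
  cube₄ f = (f false false ⊕ f false true) ⊕ (f true false ⊕ f true true)

  cube₄-zero : ∀ (f : Bool → Bool → ℤ) → (∀ c σ → 0ℤ ≼ f c σ) → cube₄ f ≡ 0ℤ → ∀ c σ → f c σ ≡ 0ℤ
  cube₄-zero f f≥0 eq c σ = ℤₚ.≤-antisym (ℤₚ.≤-trans (term≤ c σ) (ℤₚ.≤-reflexive eq)) (f≥0 c σ)
    where
    x₀₀ = f≥0 false false
    x₀₁ = f≥0 false true
    x₁₀ = f≥0 true false
    x₁₁ = f≥0 true true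
    term≤ : ∀ c σ → f c σ ≼ cube₄ f
    term≤ false false = cert (x₀₁ ⊞ x₁₀ ⊞ x₁₁) (ring₁ (f false false) (f false true) (f true false) (f true true))
    term≤ false true = cert (x₀₀ ⊞ x₁₀ ⊞ x₁₁) (ring₂ (f false false) (f false true) (f true false) (f true true))
    term≤ true false = cert (x₀₀ ⊞ x₀₁ ⊞ x₁₁) (ring₃ (f false false) (f false true) (f true false) (f true true))
    term≤ true true = cert (x₀₀ ⊞ x₀₁ ⊞ x₁₀) (ring₄ (f false false) (f false true) (f true false) (f true true))

  cube₄-nonneg : ∀ (f : Bool → Bool → ℤ) → (∀ c σ → 0ℤ ≼ f c σ) → 0ℤ ≼ cube₄ f
  cube₄-nonneg f f≥0 = (f≥0 false false ⊞ f≥0 false true) ⊞ (f≥0 true false ⊞ f≥0 true true)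

  Σ-cube₄ : ∀ n (f : ℕ → Bool → Bool → ℤ) → Σ n (λ y → cube₄ (f y)) ≡ cube₄ (λ c σ → Σ n (λ y → f y c σ))
  Σ-cube₄ n f = trans (Σ-+ n (λ y → f y false false ⊕ f y false true) (λ y → f y true false ⊕ f y true true))
    (cong₂ _⊕_ (Σ-+ n (λ y → f y false false) (λ y → f y false true)) (Σ-+ n (λ y → f y true false) (λ y → f y true true)))

  cube₄-≤ : ∀ (f : Bool → Bool → ℤ) b → (∀ c σ → f c σ ≼ b) → cube₄ f ≼ (b ⊕ b) ⊕ (b ⊕ b)
  cube₄-≤ f b h = ℤₚ.+-mono-≤ (ℤₚ.+-mono-≤ (h false false) (h false true)) (ℤₚ.+-mono-≤ (h true false) (h true true))

  cube₄-indicator : ∀ (f : Bool → Bool → ℤ) → (∀ c σ → f c σ ≡ 0ℤ ⊎ f c σ ≡ 1ℤ) → ¬ cube₄ f ≡ 0ℤ → 1ℤ ≼ cube₄ f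
  cube₄-indicator f h nz = ℤₚ.i<j⇒suc[i]≤j (ℤₚ.≤∧≢⇒< (cube₄-nonneg f nn) (λ eq → nz (sym eq)))
    where
    nn : ∀ c σ → 0ℤ ≼ f c σ
    nn c σ with h c σ
    ... | inj₁ eq = ℤₚ.≤-reflexive (sym eq)
    ... | inj₂ eq = ℤₚ.≤-trans (nneg 1) (ℤₚ.≤-reflexive (sym eq))

  𝟙-01 : ∀ {p} {P : Set p} (d : Dec P) → 𝟙 d ≡ 0ℤ ⊎ 𝟙 d ≡ 1ℤ
  𝟙-01 (yes _) = inj₂ refl
  𝟙-01 (no _) = inj₁ refl

  module Orbits (coef : Bool → ℕ) (coef-odd : ∀ c → Odd (coef c)) (b̄ : ℕ) (coef≤b̄ : ∀ c → coef c ≤ b̄) (ε l e₁ h₁ Δe Δh : ℕ) where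

    open Corners coef ε l e₁ h₁ Δe Δh public

    sel≤ : ∀ b n → sel b n ≤ n
    sel≤ true n = ≤-refl
    sel≤ false n = z≤n

    Y-step : ∀ ρ x → Y ρ x ≡ Y false x + 2 * sel ρ Δe
    Y-step ρ x = ring₅ E x e₁ (sel ρ Δe)

    -- The quantity κ without coefficient and without shift of e. Each κ c ρ x differs from coef c ·
    -- base x by a bounded amount, so the unbounded part can be shared by all corners inside U.
    base : ℕ → ℕ
    base x = sh Λ (Y false x * Y false x)

    κ-lower : ∀ c ρ x → coef c * base x ≤ κ c ρ x
    κ-lower c ρ x = sh-≥ Λ _ (coef c * base x) (begin
      2 ^ Λ * (coef c * base x) ≡⟨ ring₆ (2 ^ Λ) (coef c) (base x) ⟩
      coef c * (2 ^ Λ * base x) ≤⟨ *-monoʳ-≤ (coef c) (2^θ*sh≤ Λ (Y false x * Y false x)) ⟩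
      coef c * (Y false x * Y false x) ≤⟨ *-monoʳ-≤ (coef c) (*-mono-≤ Y≤ Y≤) ⟩
      coef c * (Y ρ x * Y ρ x) ∎)
      where
      open ≤-Reasoning
      Y≤ : Y false x ≤ Y ρ x
      Y≤ = subst (Y false x ≤_) (sym (Y-step ρ x)) (m≤m+n (Y false x) (2 * sel ρ Δe))

    κ-upper : ∀ c ρ x → Y false x ≤ 2 * 2 ^ l → Δe * Δe ≤ 2 ^ l → κ c ρ x ≤ coef c * base x + coef c * (2 + 2 * Δe)
    κ-upper c ρ x Y≤ Δ≤ = sh-≤ Λ _ _ (begin
      coef c * (Y ρ x * Y ρ x) ≡⟨ cong (λ z → coef c * (z * z)) (Y-step ρ x) ⟩
      coef c * ((y + 2 * s) * (y + 2 * s)) ≡⟨ cong (coef c *_) (ring₇ y s) ⟩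
      coef c * (y * y + (4 * s * y + 4 * (s * s))) ≤⟨ *-monoʳ-≤ (coef c) (+-mono-≤ y²≤ (+-mono-≤ (*-monoʳ-≤ (4 * s) Y≤) (*-monoʳ-≤ 4 (≤-trans (*-mono-≤ s≤ s≤) Δ≤)))) ⟩
      coef c * (2 ^ Λ * suc (base x) + (4 * s * (2 * 2 ^ l) + 4 * 2 ^ l)) ≡⟨ cong (λ z → coef c * (z * suc (base x) + (4 * s * (2 * 2 ^ l) + 4 * 2 ^ l))) 2^Λ ⟩
      coef c * (4 * 2 ^ l * suc (base x) + (4 * s * (2 * 2 ^ l) + 4 * 2 ^ l)) ≡⟨ ring₈ (coef c) (2 ^ l) (base x) s ⟩
      4 * 2 ^ l * (coef c * base x + coef c * (2 + 2 * s)) ≤⟨ *-monoʳ-≤ (4 * 2 ^ l) (+-monoʳ-≤ (coef c * base x) (*-monoʳ-≤ (coef c) (+-monoʳ-≤ 2 (*-monoʳ-≤ 2 s≤)))) ⟩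
      4 * 2 ^ l * (coef c * base x + coef c * (2 + 2 * Δe)) ≡⟨ cong (_* (coef c * base x + coef c * (2 + 2 * Δe))) (sym 2^Λ) ⟩
      2 ^ Λ * (coef c * base x + coef c * (2 + 2 * Δe)) ∎)
      where
      open ≤-Reasoning
      y = Y false x
      s = sel ρ Δe
      s≤ : s ≤ Δe
      s≤ = sel≤ ρ Δe
      y²≤ : y * y ≤ 2 ^ Λ * suc (base x)
      y²≤ = begin
        y * y ≡⟨ low-sh Λ (y * y) ⟩
        low Λ (y * y) + 2 ^ Λ * base x ≤⟨ +-monoˡ-≤ (2 ^ Λ * base x) (<⇒≤ (low< Λ (y * y))) ⟩
        2 ^ Λ + 2 ^ Λ * base x ≡⟨ sym (*-suc (2 ^ Λ) (base x)) ⟩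
        2 ^ Λ * suc (base x) ∎

    j : ℕ → State
    j x c ρ σ = κ c ρ x ∸ coef c * base x + coef c * (ê ρ * (h₁ + sel σ Δh))

    j-bound : ∀ x → Y false x ≤ 2 * 2 ^ l → Δe * Δe ≤ 2 ^ l → ∀ c ρ σ → j x c ρ σ ≤ b̄ * (2 + 2 * Δe) + b̄ * ((2 * (e₁ + Δe) + 1) * (h₁ + Δh))
    j-bound x Y≤ Δ≤ c ρ σ = +-mono-≤ (≤-trans (m≤n+o⇒m∸n≤o (κ c ρ x) (coef c * base x) (κ-upper c ρ x Y≤ Δ≤)) (*-monoˡ-≤ (2 + 2 * Δe) (coef≤b̄ c)))
      (*-mono-≤ (coef≤b̄ c) (*-mono-≤ (+-monoˡ-≤ 1 (*-monoʳ-≤ 2 (+-monoʳ-≤ e₁ (sel≤ ρ Δe)))) (+-monoʳ-≤ h₁ (sel≤ σ Δh))))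

    U : ℕ → ℕ → ℕ
    U x v = base x + 2 * E * x * h₁ + 2 * E * x * (E * v) + (2 * e₁ + 1) * (E * v)

    -- Sorted by dependence on the corner: the common part is U, the shifts of h and e are linear
    -- with slopes 2EΔh in x and 2EΔe in v, and the bounded rest is the initial carry j. The
    -- remaining quadratic term is a multiple of 2ˡ and so invisible in a window of w ≤ l digits.
    A-form : ∀ c ρ σ x v → A c ρ σ x v ≡ coef c * (U x v + sel σ (2 * E * Δh * x) + sel ρ (2 * E * Δe * v)) + j x c ρ σ + 2 ^ l * (coef c * (V σ v * V σ v))
    A-form c ρ σ x v = begin
      κ c ρ x + coef c * (Y ρ x * V σ v + 2 ^ l * (V σ v * V σ v)) ≡⟨ cong (_+ coef c * (Y ρ x * V σ v + 2 ^ l * (V σ v * V σ v))) (sym (m+[n∸m]≡n (κ-lower c ρ x))) ⟩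
      coef c * base x + d + coef c * (Y ρ x * V σ v + 2 ^ l * (V σ v * V σ v)) ≡⟨ lem (coef c) (base x) d E x e₁ (sel ρ Δe) h₁ (sel σ Δh) v (2 ^ l) (V σ v * V σ v) ⟩
      coef c * (U x v + 2 * E * sel σ Δh * x + 2 * E * sel ρ Δe * v) + (d + coef c * (ê ρ * (h₁ + sel σ Δh))) + 2 ^ l * (coef c * (V σ v * V σ v))
        ≡⟨ cong₂ (λ p q → coef c * (U x v + p + q) + j x c ρ σ + 2 ^ l * (coef c * (V σ v * V σ v))) (move σ Δh x) (move ρ Δe v) ⟩
      coef c * (U x v + sel σ (2 * E * Δh * x) + sel ρ (2 * E * Δe * v)) + j x c ρ σ + 2 ^ l * (coef c * (V σ v * V σ v)) ∎
      where
      open ≡-Reasoning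
      d = κ c ρ x ∸ coef c * base x
      move : ∀ s Δ y → 2 * E * sel s Δ * y ≡ sel s (2 * E * Δ * y)
      move true Δ y = refl
      move false Δ y = cong (_* y) (*-zeroʳ (2 * E))
      lem : ∀ c u d E x e s h g v L W → c * u + d + c * ((2 * E * x + (2 * (e + s) + 1)) * (h + g + E * v) + L * W) ≡
        c * (u + 2 * E * x * h + 2 * E * x * (E * v) + (2 * e + 1) * (E * v) + 2 * E * g * x + 2 * E * s * v) + (d + c * ((2 * (e + s) + 1) * (h + g))) + L * (c * W)
      lem = solve-∀

    -- The change caused by shifting e. Its first part is bounded once Y ≤ 2 · 2ˡ; the second grows
    -- with V σ v, which is why v has to stay in a bounded range.
    δ : ℕ → ℕ → Bool → Bool → ℕ
    δ x v c σ = κ c true x ∸ κ c false x + coef c * (2 * Δe * V σ v)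

    A-step : ∀ x v c σ → A c true σ x v ≡ A c false σ x v + δ x v c σ
    A-step x v c σ = begin
      κ c true x + coef c * (Y true x * V σ v + W) ≡⟨ cong₂ (λ p q → p + coef c * (q * V σ v + W)) (sym (m+[n∸m]≡n κ≤)) (Y-step true x) ⟩
      κ c false x + d + coef c * ((Y false x + 2 * Δe) * V σ v + W) ≡⟨ ring₉ (κ c false x) d (coef c) (Y false x) Δe (V σ v) W ⟩
      κ c false x + coef c * (Y false x * V σ v + W) + (d + coef c * (2 * Δe * V σ v)) ∎
      where
      open ≡-Reasoning
      W = 2 ^ l * (V σ v * V σ v)
      d = κ c true x ∸ κ c false x
      Y≤ : Y false x ≤ Y true x
      Y≤ = subst (Y false x ≤_) (sym (Y-step true x)) (m≤m+n (Y false x) (2 * Δe))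
      κ≤ : κ c false x ≤ κ c true x
      κ≤ = sh-mono Λ (*-monoʳ-≤ (coef c) (*-mono-≤ Y≤ Y≤))

    δ-bound : ∀ K Vm x v → Y false x ≤ 2 * 2 ^ l → Δe * Δe ≤ 2 ^ l → (∀ σ → V σ v ≤ Vm) → b̄ * (2 + 2 * Δe) + b̄ * (2 * Δe * Vm) < K → ∀ c σ → δ x v c σ < K
    δ-bound K Vm x v Y≤ Δ≤ V≤ h c σ = ≤-<-trans (+-mono-≤ (≤-trans (m≤n+o⇒m∸n≤o (κ c true x) (κ c false x) (≤-trans (κ-upper c true x Y≤ Δ≤) (+-monoˡ-≤ (coef c * (2 + 2 * Δe)) (κ-lower c false x)))) (*-monoˡ-≤ (2 + 2 * Δe) (coef≤b̄ c)))
      (*-mono-≤ (coef≤b̄ c) (*-monoʳ-≤ (2 * Δe) (V≤ σ)))) h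

    -- Detects that the digits u, ..., u + s - 1 of c Y² are all ones, the only case in which an
    -- increment of at most 2ᵘ can carry past them.
    bad : (u s : ℕ) → Bool → Bool → ℕ → ℤ
    bad u s c ρ x = 𝟙 (suc (low s (sh u (coef c * (Y ρ x * Y ρ x)))) ℕ.≟ 2 ^ s)

    Y-odd : ∀ ρ x → Odd (Y ρ x)
    Y-odd ρ x = E * x + (e₁ + sel ρ Δe) , ring₁₀ E x (e₁ + sel ρ Δe)

    -- For odd Y, the top s of the lowest Λ digits of c (Y + 2^{u−1} z)² run through all values with z.
    bad-count : ∀ u s τ r c ρ → u ≡ τ + ε + 2 → τ + ε ≡ s + r → Σ (2 ^ s * 2 ^ τ) (bad u s c ρ) ≡ pos (2 ^ τ)
    bad-count u s τ r c ρ u≡ τε≡ = begin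
      Σ (2 ^ s * 2 ^ τ) (bad u s c ρ) ≡⟨ Σ-block (2 ^ s) (2 ^ τ) (bad u s c ρ) ⟩
      Σ (2 ^ s) (λ z → Σ (2 ^ τ) (λ x₀ → bad u s c ρ (x₀ + 2 ^ τ * z))) ≡⟨ Σ-swap (2 ^ s) (2 ^ τ) (λ z x₀ → bad u s c ρ (x₀ + 2 ^ τ * z)) ⟩
      Σ (2 ^ τ) (λ x₀ → Σ (2 ^ s) (λ z → bad u s c ρ (x₀ + 2 ^ τ * z))) ≡⟨ Σ-cong (2 ^ τ) fibre ⟩
      Σ (2 ^ τ) (λ _ → 1ℤ) ≡⟨ trans (Σ-const (2 ^ τ) 1ℤ) (ℤₚ.*-identityʳ (pos (2 ^ τ))) ⟩
      pos (2 ^ τ) ∎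
      where
      open ≡-Reasoning
      p = 2 ^ τ * (2 * E)
      2p≡ : 2 * p ≡ 2 ^ u
      2p≡ = trans (ring₁₁ (2 ^ τ) E) (trans (cong (_* 4) (sym (^-distribˡ-+-* 2 τ ε))) (trans (sym (^-distribˡ-+-* 2 (τ + ε) 2)) (cong (2 ^_) (sym u≡))))
      p≡ : p ≡ 2 ^ s * (2 ^ r * 2)
      p≡ = trans (ring₁₂ (2 ^ τ) E) (trans (cong (_* 2) (trans (sym (^-distribˡ-+-* 2 τ ε)) (trans (cong (2 ^_) τε≡) (^-distribˡ-+-* 2 s r)))) (*-assoc (2 ^ s) (2 ^ r) 2))
      low-value : ∀ x₀ z → low s (sh u (coef c * (Y ρ (x₀ + 2 ^ τ * z) * Y ρ (x₀ + 2 ^ τ * z)))) ≡ low s (coef c * Y ρ x₀ * z + sh u (coef c * (Y ρ x₀ * Y ρ x₀)))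
      low-value x₀ z = begin
        low s (sh u (coef c * (Y ρ (x₀ + 2 ^ τ * z) * Y ρ (x₀ + 2 ^ τ * z)))) ≡⟨ cong (λ q → low s (sh u q)) (ring₁₃ (coef c) E x₀ (2 ^ τ) z (ê ρ)) ⟩
        low s (sh u (S + 2 * p * (coef c * y * z) + p * (p * (coef c * (z * z))))) ≡⟨ cong (λ q → low s (sh u (S + 2 * p * (coef c * y * z) + q * (p * (coef c * (z * z)))))) p≡ ⟩
        low s (sh u (S + 2 * p * (coef c * y * z) + 2 ^ s * (2 ^ r * 2) * (p * (coef c * (z * z))))) ≡⟨ cong (λ q → low s (sh u q)) (ring₁₄ S p (coef c * y * z) (2 ^ s) (2 ^ r) (coef c * (z * z))) ⟩
        low s (sh u (S + 2 * p * (coef c * y * z + 2 ^ s * (2 ^ r * (coef c * (z * z)))))) ≡⟨ cong (λ q → low s (sh u (S + q * (coef c * y * z + 2 ^ s * (2 ^ r * (coef c * (z * z))))))) 2p≡ ⟩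
        low s (sh u (S + 2 ^ u * (coef c * y * z + 2 ^ s * (2 ^ r * (coef c * (z * z)))))) ≡⟨ cong (low s) (sh-+ u S _) ⟩
        low s (sh u S + (coef c * y * z + 2 ^ s * (2 ^ r * (coef c * (z * z))))) ≡⟨ cong (low s) (ring₁₅ (sh u S) (coef c * y * z) (2 ^ s * (2 ^ r * (coef c * (z * z))))) ⟩
        low s (coef c * y * z + sh u S + 2 ^ s * (2 ^ r * (coef c * (z * z)))) ≡⟨ low-+ s _ _ ⟩
        low s (coef c * y * z + sh u S) ∎
        where
        y = Y ρ x₀
        S = coef c * (y * y)
      fibre : ∀ x₀ → Σ (2 ^ s) (λ z → bad u s c ρ (x₀ + 2 ^ τ * z)) ≡ 1ℤ
      fibre x₀ = begin
        Σ (2 ^ s) (λ z → bad u s c ρ (x₀ + 2 ^ τ * z)) ≡⟨ Σ-cong (2 ^ s) (λ z → cong (λ q → 𝟙 (suc q ℕ.≟ 2 ^ s)) (low-value x₀ z)) ⟩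
        Σ (2 ^ s) (λ z → 𝟙 (suc (low s (coef c * Y ρ x₀ * z + sh u (coef c * (Y ρ x₀ * Y ρ x₀)))) ℕ.≟ 2 ^ s))
          ≡⟨ odd-permutes s (odd-* (coef-odd c) (Y-odd ρ x₀)) (sh u (coef c * (Y ρ x₀ * Y ρ x₀))) (λ q → 𝟙 (suc q ℕ.≟ 2 ^ s)) ⟩
        Σ (2 ^ s) (λ q → 𝟙 (suc q ℕ.≟ 2 ^ s)) ≡⟨ Σ-cong (2 ^ s) (λ q → trans (𝟙-cong (suc q ℕ.≟ 2 ^ s) (q ℕ.≟ pred (2 ^ s)) (λ eq → cong pred eq) (λ eq → trans (cong suc eq) (suc-pred (2 ^ s) {{m^n≢0 2 s}}))) (sym (ℤₚ.*-identityʳ _))) ⟩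
        Σ (2 ^ s) (λ q → 𝟙 (q ℕ.≟ pred (2 ^ s)) · 1ℤ) ≡⟨ Σ-pick (2 ^ s) (pred (2 ^ s)) (λ _ → 1ℤ) (≤-reflexive (suc-pred (2 ^ s) {{m^n≢0 2 s}})) ⟩
        1ℤ ∎

-- The sum over one orbit x₀ + 2^τ y.

module OrbitEstimate where
  open ℕ-Arithmetic
  open IntegerSums hiding (*-mono-≤)
  open ThueMorse
  open SignFlips using (Odd)
  open CarryDigits
  open OrbitSteps
  open OrbitForms

  private
    ring₁ : ∀ c U W p q i → c * (U + W + p + q) + i ≡ c * (U + p + q) + i + W * c
    ring₁ = solve-∀

    ring₂ : ∀ k c y z E x t e V Q → k + c * y + z + c * ((2 * E * (x + t * y) + e) * V + Q) ≡ k + c * ((2 * E * x + e) * V + Q) + c * y + (z + t * (c * (2 * E * y * V)))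
    ring₂ = solve-∀

    ring₃ : ∀ a W z t q → a + (W * z + W * t * q) ≡ a + W * (z + t * q)
    ring₃ = solve-∀

    ring₄ : ∀ c U p q j W t r y → c * (U + p + q) + j + W * t * r + c * y ≡ c * (U + y + p + q) + j + W * (t * r)
    ring₄ = solve-∀

    ring₅ : ∀ a b → a ≡ b ⊕ (a ⊖ b)
    ring₅ = ℤR.solve-∀

    ring₆ : ∀ k → pos 2 · ((k ⊕ k) ⊕ (k ⊕ k)) ≡ pos 8 · k
    ring₆ = ℤR.solve-∀

    ring₇ : ∀ a b → a ⊕ b ⊖ a ≡ b
    ring₇ = ℤR.solve-∀

    ring₈ : ∀ a b p q → a ⊕ b ⊕ p · q ⊖ p ≡ a ⊕ b ⊕ p · (q ⊖ 1ℤ)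
    ring₈ = ℤR.solve-∀

  module Estimate (coef : Bool → ℕ) (coef-odd : ∀ c → Odd (coef c)) (b̄ : ℕ) (coef≤b̄ : ∀ c → coef c ≤ b̄) (ε l e₁ h₁ Δe Δh : ℕ)
    (J θ : ℕ) (coef≤J : ∀ c → coef c * (1 + 2 * 2 ^ ε * Δh + 2 * 2 ^ ε * Δe) ≤ J)
    (block : Digits.FlipBlock coef (2 * 2 ^ ε * Δh) (2 * 2 ^ ε * Δe) J θ coef≤J)
    (x*< : Digits.FlipBlock.x* {coef} {2 * 2 ^ ε * Δh} {2 * 2 ^ ε * Δe} {J} {θ} {coef≤J} block < 2 ^ θ)
    (m w′ u s K Vm v₂ : ℕ)
    (J-large : b̄ * (2 + 2 * Δe) + b̄ * ((2 * (e₁ + Δe) + 1) * (h₁ + Δh)) ≤ J)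
    (K-large : b̄ * (2 + 2 * Δe) + b̄ * (2 * Δe * Vm) < K) (Δ≤ : Δe * Δe ≤ 2 ^ l) (us≡ : u + s ≡ l + 2)
    where

    open Orbits coef coef-odd b̄ coef≤b̄ ε l e₁ h₁ Δe Δh public
    open Digits coef (2 * 2 ^ ε * Δh) (2 * 2 ^ ε * Δe) J θ coef≤J using (B; L; Ψ; abs-Ψ; Bounded; module Contraction) public
    open Contraction block x*< public using (wt; contraction; Σ-wt; C)

    w : ℕ
    w = width θ m w′

    2^width : ∀ m w′ → 2 ^ width θ m w′ ≡ B ^ m * 2 ^ w′
    2^width zero w′ = sym (*-identityˡ (2 ^ w′))
    2^width (suc m) w′ = trans (^-distribˡ-+-* 2 θ (width θ m w′)) (trans (cong (B *_) (2^width m w′)) (sym (*-assoc B (B ^ m) (2 ^ w′))))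

    W : ℕ
    W = 2 ^ w

    v̄ : ℕ → ℕ
    v̄ v = v + B ^ m * v₂

    Ψ-periodic : ∀ i x v U → Ψ w i (U + W) x v ≡ Ψ w i U x v
    Ψ-periodic i x v U = cube-cong (λ c ρ σ → trans (cong (Tw w) (ring₁ (coef c) U W (sel σ (2 * 2 ^ ε * Δh * x)) (sel ρ (2 * 2 ^ ε * Δe * v)) (i c ρ σ))) (Tw-+ w (L c ρ σ U x v + i c ρ σ) (coef c)))

    abs-D : ∀ x v → abs (D x v) ≡ 1ℤ
    abs-D x v = abs-of-sq (D x v) (cube-sq (λ c ρ σ → T (A c ρ σ x v)) (λ c ρ σ → T-sq (A c ρ σ x v)))

    abs-Dw : ∀ n x v → abs (Dw n x v) ≡ 1ℤ
    abs-Dw n x v = abs-of-sq (Dw n x v) (cube-sq (λ c ρ σ → Tw n (A c ρ σ x v)) (λ c ρ σ → Tw-sq n (A c ρ σ x v)))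

    badΣ : ℕ → ℤ
    badΣ x = cube₄ (λ c ρ → bad u s c ρ x)

    module Orbit (x₀ τ t₂ π g Kx l₁ τ₁ : ℕ) (Λ≡ : τ + ε + 1 + (π + ε + 1 + 1) ≡ l + 2) (t₂≡ : t₂ + (l + 2 + w) ≡ 2 * (τ + ε + 1))
      (x₀≡ : x₀ ≡ g + 2 ^ π * (1 + 2 ^ w * Kx)) (tiny : b̄ * (2 ^ (τ + ε + 2) * ((2 * 2 ^ ε * g + (2 * (e₁ + Δe) + 1)) * W)) ≤ 2 ^ u)
      (Y≤ : ∀ y → y < W → Y false (x₀ + 2 ^ τ * y) ≤ 2 * 2 ^ l) (l≡ : l ≡ w + l₁) (τ≡ : τ ≡ w + τ₁) where

      2^l : 2 ^ l ≡ W * 2 ^ l₁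
      2^l = trans (cong (2 ^_) l≡) (^-distribˡ-+-* 2 w l₁)

      2^τ : 2 ^ τ ≡ W * 2 ^ τ₁
      2^τ = trans (cong (2 ^_) τ≡) (^-distribˡ-+-* 2 w τ₁)

      x : ℕ → ℕ
      x y = x₀ + 2 ^ τ * y

      module Good (good : ∀ c ρ → bad u s c ρ x₀ ≡ 0ℤ) (v : ℕ) (V≤ : ∀ σ → V σ v ≤ Vm) where

        not-top : ∀ c ρ → suc (low s (sh u (coef c * (Y ρ x₀ * Y ρ x₀)))) < 2 ^ s
        not-top c ρ = ≤∧≢⇒< (low< s (sh u (coef c * (Y ρ x₀ * Y ρ x₀)))) (λ eq → absurd (trans (sym (good c ρ)) (𝟙-yes (suc (low s (sh u (coef c * (Y ρ x₀ * Y ρ x₀)))) ℕ.≟ 2 ^ s) eq)))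
          where
          absurd : ¬ (0ℤ ≡ 1ℤ)
          absurd ()

        tiny′ : ∀ c ρ y → y < W → coef c * (2 ^ (τ + ε + 2) * ((2 * E * g + ê ρ) * y)) ≤ 2 ^ u
        tiny′ c ρ y y< = ≤-trans (*-mono-≤ (coef≤b̄ c) (*-monoʳ-≤ (2 ^ (τ + ε + 2)) (*-mono-≤ (+-monoʳ-≤ (2 * E * g) (+-monoˡ-≤ 1 (*-monoʳ-≤ 2 (+-monoʳ-≤ e₁ (sel≤ ρ Δe))))) (<⇒≤ y<)))) tiny

        -- Modulo W the move adds just c y: `orbit-κ` provides this for κ, and the change of Y V is
        -- a multiple of 2^τ, hence of W because τ ≥ w.
        A-orbit : ∀ c ρ σ y → y < W → ∃ λ Z → A c ρ σ (x y) v ≡ A c ρ σ x₀ v + coef c * y + W * Z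
        A-orbit c ρ σ y y< = Z₁ + 2 ^ τ₁ * (coef c * (2 * E * y * V σ v)) , (begin
          κ c ρ (x y) + coef c * (Y ρ (x y) * V σ v + 2 ^ l * (V σ v * V σ v))
            ≡⟨ cong (_+ coef c * (Y ρ (x y) * V σ v + 2 ^ l * (V σ v * V σ v))) (orbit-κ w s u τ t₂ π g Kx x₀ y c ρ us≡ Λ≡ t₂≡ x₀≡ (not-top c ρ) (tiny′ c ρ y y<)) ⟩
          κ c ρ x₀ + coef c * y + W * Z₁ + coef c * (Y ρ (x y) * V σ v + 2 ^ l * (V σ v * V σ v))
            ≡⟨ ring₂ (κ c ρ x₀) (coef c) y (W * Z₁) E x₀ (2 ^ τ) (ê ρ) (V σ v) (2 ^ l * (V σ v * V σ v)) ⟩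
          A c ρ σ x₀ v + coef c * y + (W * Z₁ + 2 ^ τ * (coef c * (2 * E * y * V σ v))) ≡⟨ cong (λ z → A c ρ σ x₀ v + coef c * y + (W * Z₁ + z * (coef c * (2 * E * y * V σ v)))) 2^τ ⟩
          A c ρ σ x₀ v + coef c * y + (W * Z₁ + W * 2 ^ τ₁ * (coef c * (2 * E * y * V σ v))) ≡⟨ ring₃ (A c ρ σ x₀ v + coef c * y) W Z₁ (2 ^ τ₁) (coef c * (2 * E * y * V σ v)) ⟩
          A c ρ σ x₀ v + coef c * y + W * (Z₁ + 2 ^ τ₁ * (coef c * (2 * E * y * V σ v))) ∎)
          where
          open ≡-Reasoning
          Z₁ = coef c * (Kx * y + 2 ^ t₂ * (y * y))

        Tw-orbit : ∀ c ρ σ y → y < W → Tw w (A c ρ σ (x y) v) ≡ Tw w (L c ρ σ (U x₀ v + y) x₀ v + j x₀ c ρ σ)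
        Tw-orbit c ρ σ y y< = begin
          Tw w (A c ρ σ (x y) v) ≡⟨ trans (cong (Tw w) (proj₂ (A-orbit c ρ σ y y<))) (Tw-+ w (A c ρ σ x₀ v + coef c * y) (proj₁ (A-orbit c ρ σ y y<))) ⟩
          Tw w (A c ρ σ x₀ v + coef c * y) ≡⟨ cong (λ z → Tw w (z + coef c * y)) (A-form c ρ σ x₀ v) ⟩
          Tw w (coef c * (U x₀ v + p + q) + j x₀ c ρ σ + 2 ^ l * r + coef c * y) ≡⟨ cong (λ z → Tw w (coef c * (U x₀ v + p + q) + j x₀ c ρ σ + z * r + coef c * y)) 2^l ⟩
          Tw w (coef c * (U x₀ v + p + q) + j x₀ c ρ σ + W * 2 ^ l₁ * r + coef c * y) ≡⟨ cong (Tw w) (ring₄ (coef c) (U x₀ v) p q (j x₀ c ρ σ) W (2 ^ l₁) r y) ⟩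
          Tw w (L c ρ σ (U x₀ v + y) x₀ v + j x₀ c ρ σ + W * (2 ^ l₁ * r)) ≡⟨ Tw-+ w (L c ρ σ (U x₀ v + y) x₀ v + j x₀ c ρ σ) (2 ^ l₁ * r) ⟩
          Tw w (L c ρ σ (U x₀ v + y) x₀ v + j x₀ c ρ σ) ∎
          where
          open ≡-Reasoning
          p = sel σ (2 * E * Δh * x₀)
          q = sel ρ (2 * E * Δe * v)
          r = coef c * (V σ v * V σ v)

        Dw-orbit : ∀ y → y < W → Dw w (x y) v ≡ Ψ w (j x₀) (U x₀ v + y) x₀ v
        Dw-orbit y y< = cube-cong (λ c ρ σ → Tw-orbit c ρ σ y y<)

        -- The window is so full that adding an increment below K may carry out of it, so that
        -- truncation can fail.
        crowded : ℕ → Bool → Bool → ℤ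
        crowded y c σ = 𝟙 (W ℕ.<? low w (A c false σ (x y) v) + K)

        pointwise : ∀ y → y < W → abs (D (x y) v ⊖ Dw w (x y) v) ≼ pos 2 · cube₄ (crowded y)
        pointwise y y< = go (cube₄ (crowded y) ℤ.≟ 0ℤ)
          where
          open ℤₚ.≤-Reasoning
          go : Dec (cube₄ (crowded y) ≡ 0ℤ) → abs (D (x y) v ⊖ Dw w (x y) v) ≼ pos 2 · cube₄ (crowded y)
          go (yes eq) = begin
            abs (D (x y) v ⊖ Dw w (x y) v) ≡⟨ cong (λ z → abs (z ⊖ Dw w (x y) v)) (truncate w K (x y) v (δ (x y) v) (λ c σ → A-step (x y) v c σ) (δ-bound K Vm (x y) v (Y≤ y y<) Δ≤ V≤ K-large) room) ⟩
            abs (Dw w (x y) v ⊖ Dw w (x y) v) ≡⟨ cong abs (ℤₚ.+-inverseʳ (Dw w (x y) v)) ⟩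
            0ℤ ≡⟨ sym (trans (cong (pos 2 ·_) eq) refl) ⟩
            pos 2 · cube₄ (crowded y) ∎
            where
            room : ∀ c σ → low w (A c false σ (x y) v) + K ≤ W
            room c σ = ≮⇒≥ (λ h → absurd (trans (sym (cube₄-zero (crowded y) (λ c σ → 𝟙-nonneg (W ℕ.<? low w (A c false σ (x y) v) + K)) eq c σ)) (𝟙-yes (W ℕ.<? low w (A c false σ (x y) v) + K) h)))
              where
              absurd : ¬ (0ℤ ≡ 1ℤ)
              absurd ()
          go (no nz) = begin
            abs (D (x y) v ⊖ Dw w (x y) v) ≤⟨ abs-+ (D (x y) v) (neg (Dw w (x y) v)) ⟩
            abs (D (x y) v) ⊕ abs (neg (Dw w (x y) v)) ≡⟨ cong₂ _⊕_ (abs-D (x y) v) (trans (abs-neg (Dw w (x y) v)) (abs-Dw w (x y) v)) ⟩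
            pos 2 · 1ℤ ≤⟨ *-monoˡ (pos 2) (nneg 2) (cube₄-indicator (crowded y) (λ c σ → 𝟙-01 (W ℕ.<? low w (A c false σ (x y) v) + K)) nz) ⟩
            pos 2 · cube₄ (crowded y) ∎

        -- Along the orbit the window runs through c y plus a constant modulo W, a permutation of
        -- all residues, and at most K residues lie near the top.
        crowded-sum : ∀ c σ → Σ W (λ y → crowded y c σ) ≼ pos K
        crowded-sum c σ = begin
          Σ W (λ y → crowded y c σ) ≡⟨ Σ-cong< W (λ y y< → cong (λ z → 𝟙 (W ℕ.<? z + K)) (low-orbit y y<)) ⟩
          Σ W (λ y → 𝟙 (W ℕ.<? low w (coef c * y + A c false σ x₀ v) + K)) ≡⟨ odd-permutes w (coef-odd c) (A c false σ x₀ v) (λ z → 𝟙 (W ℕ.<? z + K)) ⟩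
          Σ W (λ z → 𝟙 (W ℕ.<? z + K)) ≤⟨ Σ-top-slice W K ⟩
          pos K ∎
          where
          open ℤₚ.≤-Reasoning
          low-orbit : ∀ y → y < W → low w (A c false σ (x y) v) ≡ low w (coef c * y + A c false σ x₀ v)
          low-orbit y y< = trans (cong (low w) (proj₂ (A-orbit c false σ y y<))) (trans (low-+ w (A c false σ x₀ v + coef c * y) (proj₁ (A-orbit c false σ y y<))) (cong (low w) (+-comm (A c false σ x₀ v) (coef c * y))))

        -- Truncation costs at most 2 for each crowded place, with four pairs (c, σ) and K places
        -- each: 8 K. The sum over y is over a full period of Ψ in U, so its start can be moved to
        -- 0.
        orbit-sum : abs (Σ W (λ y → D (x y) v)) ≼ abs (Σ W (λ y → Ψ w (j x₀) y x₀ v)) ⊕ pos 8 · pos K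
        orbit-sum = begin
          abs (Σ W (λ y → D (x y) v)) ≡⟨ cong abs (trans (Σ-cong W (λ y → ring₅ (D (x y) v) (Dw w (x y) v))) (Σ-+ W (λ y → Dw w (x y) v) (λ y → D (x y) v ⊖ Dw w (x y) v))) ⟩
          abs (Σ W (λ y → Dw w (x y) v) ⊕ Σ W (λ y → D (x y) v ⊖ Dw w (x y) v)) ≤⟨ abs-+ (Σ W (λ y → Dw w (x y) v)) (Σ W (λ y → D (x y) v ⊖ Dw w (x y) v)) ⟩
          abs (Σ W (λ y → Dw w (x y) v)) ⊕ abs (Σ W (λ y → D (x y) v ⊖ Dw w (x y) v)) ≤⟨ ℤₚ.+-mono-≤ (ℤₚ.≤-reflexive (cong abs main)) error ⟩
          abs (Σ W (λ y → Ψ w (j x₀) y x₀ v)) ⊕ pos 8 · pos K ∎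
          where
          open ℤₚ.≤-Reasoning
          main : Σ W (λ y → Dw w (x y) v) ≡ Σ W (λ y → Ψ w (j x₀) y x₀ v)
          main = trans (Σ-cong< W Dw-orbit) (Σ-periodic W (λ y → Ψ w (j x₀) y x₀ v) (Ψ-periodic (j x₀) x₀ v) (U x₀ v))
          error : abs (Σ W (λ y → D (x y) v ⊖ Dw w (x y) v)) ≼ pos 8 · pos K
          error = begin
            abs (Σ W (λ y → D (x y) v ⊖ Dw w (x y) v)) ≤⟨ Σ-abs W (λ y → D (x y) v ⊖ Dw w (x y) v) ⟩
            Σ W (λ y → abs (D (x y) v ⊖ Dw w (x y) v)) ≤⟨ Σ-mono< W pointwise ⟩
            Σ W (λ y → pos 2 · cube₄ (crowded y)) ≡⟨ trans (Σ-*ˡ W (pos 2) (λ y → cube₄ (crowded y))) (cong (pos 2 ·_) (Σ-cube₄ W crowded)) ⟩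
            pos 2 · cube₄ (λ c σ → Σ W (λ y → crowded y c σ)) ≤⟨ *-monoˡ (pos 2) (nneg 2) (cube₄-≤ (λ c σ → Σ W (λ y → crowded y c σ)) (pos K) crowded-sum) ⟩
            pos 2 · ((pos K ⊕ pos K) ⊕ (pos K ⊕ pos K)) ≡⟨ ring₆ (pos K) ⟩
            pos 8 · pos K ∎

      estimate : (∀ v → v < B ^ m → ∀ σ → V σ (v̄ v) ≤ Vm) →
        Σ (B ^ m) (λ v → abs (Σ W (λ y → D (x y) (v̄ v)))) ≼ pos (2 ^ w′) · wt m x₀ ⊕ pos (B ^ m) · (pos 8 · pos K) ⊕ pos (B ^ m) · pos W · badΣ x₀
      estimate V≤ = go (badΣ x₀ ℤ.≟ 0ℤ)
        where
        open ℤₚ.≤-Reasoning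
        n = B ^ m
        bad≥0 : ∀ c ρ → 0ℤ ≼ bad u s c ρ x₀
        bad≥0 c ρ = 𝟙-nonneg (suc (low s (sh u (coef c * (Y ρ x₀ * Y ρ x₀)))) ℕ.≟ 2 ^ s)
        bounded : Bounded (j x₀)
        bounded c ρ σ = ≤-trans (j-bound x₀ (subst (λ z → Y false z ≤ 2 * 2 ^ l) (trans (cong (x₀ +_) (*-zeroʳ (2 ^ τ))) (+-identityʳ x₀)) (Y≤ 0 (m^n>0 2 w))) Δ≤ c ρ σ) J-large
        main : Σ n (λ v → abs (Σ W (λ y → Ψ w (j x₀) y x₀ (v̄ v)))) ≼ pos (2 ^ w′) · wt m x₀
        main = ℤₚ.≤-trans (ℤₚ.≤-reflexive (Σ-cong n (λ v → cong (λ k → abs (Σ k (λ y → Ψ w (j x₀) y x₀ (v̄ v)))) (2^width m w′)))) (contraction m w′ (j x₀) x₀ v₂ bounded)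
        wt-term≥0 : 0ℤ ≼ pos (2 ^ w′) · wt m x₀
        wt-term≥0 = ℤₚ.≤-trans (Σ-nonneg n (λ v → abs-nonneg (Σ W (λ y → Ψ w (j x₀) y x₀ (v̄ v))))) main
        go : Dec (badΣ x₀ ≡ 0ℤ) → _
        go (yes eq) = begin
          Σ n (λ v → abs (Σ W (λ y → D (x y) (v̄ v)))) ≤⟨ Σ-mono< n (λ v v< → Good.orbit-sum (cube₄-zero (λ c ρ → bad u s c ρ x₀) bad≥0 eq) (v̄ v) (V≤ v v<)) ⟩
          Σ n (λ v → abs (Σ W (λ y → Ψ w (j x₀) y x₀ (v̄ v))) ⊕ pos 8 · pos K) ≡⟨ trans (Σ-+ n (λ v → abs (Σ W (λ y → Ψ w (j x₀) y x₀ (v̄ v)))) (λ _ → pos 8 · pos K)) (cong (Σ n (λ v → abs (Σ W (λ y → Ψ w (j x₀) y x₀ (v̄ v)))) ⊕_) (Σ-const n (pos 8 · pos K))) ⟩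
          Σ n (λ v → abs (Σ W (λ y → Ψ w (j x₀) y x₀ (v̄ v)))) ⊕ pos n · (pos 8 · pos K) ≤⟨ ℤₚ.+-monoˡ-≤ (pos n · (pos 8 · pos K)) main ⟩
          pos (2 ^ w′) · wt m x₀ ⊕ pos n · (pos 8 · pos K) ≤⟨ cert (nneg n ⊠ nneg W ⊠ cube₄-nonneg (λ c ρ → bad u s c ρ x₀) bad≥0) (ring₇ (pos (2 ^ w′) · wt m x₀ ⊕ pos n · (pos 8 · pos K)) (pos n · pos W · badΣ x₀)) ⟩
          pos (2 ^ w′) · wt m x₀ ⊕ pos n · (pos 8 · pos K) ⊕ pos n · pos W · badΣ x₀ ∎
        go (no nz) = begin
          Σ n (λ v → abs (Σ W (λ y → D (x y) (v̄ v)))) ≤⟨ Σ-≤-const n (pos W) (λ v _ → Σ-abs-≤ W (λ y → D (x y) (v̄ v)) (λ y → ℤₚ.≤-reflexive (abs-D (x y) (v̄ v)))) ⟩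
          pos n · pos W ≤⟨ cert (wt-term≥0 ⊞ nneg n ⊠ (nneg 8 ⊠ nneg K) ⊞ nneg n ⊠ nneg W ⊠ gap (cube₄-indicator (λ c ρ → bad u s c ρ x₀) (λ c ρ → 𝟙-01 (suc (low s (sh u (coef c * (Y ρ x₀ * Y ρ x₀)))) ℕ.≟ 2 ^ s)) nz)) (ring₈ (pos (2 ^ w′) · wt m x₀) (pos n · (pos 8 · pos K)) (pos n · pos W) (badΣ x₀)) ⟩
          pos (2 ^ w′) · wt m x₀ ⊕ pos n · (pos 8 · pos K) ⊕ pos n · pos W · badΣ x₀ ∎

-- The sum over all x: searching for an isolated one.

module CornerEstimate where
  open ℕ-Arithmetic
  open IntegerSums hiding (*-mono-≤)
  open ThueMorse
  open SignFlips using (Odd)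
  open CarryDigits
  open OrbitSteps
  open OrbitForms
  open OrbitEstimate

  private
    ring₁ : ∀ a b → 1 + (a + b + 1) ≡ a + b + 2
    ring₁ = solve-∀

    ring₂ : ∀ a b c d → a + b + c + 1 + (d + c + 1 + 1) ≡ a + (b + (d + c + 1)) + c + 2
    ring₂ = solve-∀

    ring₃ : ∀ a b c d e → a + (b + (c + d)) + e + 2 ≡ a + (b + c + d) + e + 2
    ring₃ = solve-∀

    ring₄ : ∀ a b c d → a + b + 1 + (c + b + 1 + 1) + d ≡ a + b + 1 + (c + d + (b + 1) + 1)
    ring₄ = solve-∀

    ring₅ : ∀ a b c → a + c + b + 1 + (a + (b + 1) + c) ≡ 2 * (a + c + b + 1)
    ring₅ = solve-∀

    ring₆ : ∀ o p W z → o * (p + p * W * z) ≡ o * p * (1 + W * z)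
    ring₆ = solve-∀

    ring₇ : ∀ x → 2 * x + 2 ≡ 2 * (1 + x)
    ring₇ = solve-∀

    ring₈ : ∀ b t e o w s → b + ((t + e + 2) + (1 + e + o + w)) + s ≡ t + e + 1 + (o + (s + (w + b)) + e + 1 + 1)
    ring₈ = solve-∀

    ring₉ : ∀ lo L mid M y z → lo + L * (mid + M * (y + z)) ≡ lo + L * (mid + M * z) + L * M * y
    ring₉ = solve-∀

    ring₁₀ : ∀ g p W k t r → g + p * (1 + W * k) + p * W * t * r ≡ g + p * (1 + W * (k + t * r))
    ring₁₀ = solve-∀

    ring₁₁ : ∀ e → 2 * (e + 0) + 1 ≡ 2 * e + 1
    ring₁₁ = solve-∀

    ring₁₂ : ∀ e → 2 * e + 2 ≡ 2 * (1 + e)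
    ring₁₂ = solve-∀

    ring₁₃ : ∀ a b c d e → a + (b + (c + d)) + e ≡ a + (b + d + c) + e
    ring₁₃ = solve-∀

    ring₁₄ : ∀ a b c → a * b * c ≡ b * c * a
    ring₁₄ = solve-∀

    ring₁₅ : ∀ a b → a ⊕ b ⊖ a ≡ b
    ring₁₅ = ℤR.solve-∀

    ring₁₆ : ∀ a b c → a ⊕ b ⊕ c ⊖ c ≡ a ⊕ b
    ring₁₆ = ℤR.solve-∀

    ring₁₇ : ∀ s t e → s + t + e + 2 ≡ t + e + 2 + s
    ring₁₇ = solve-∀

    ring₁₈ : ∀ x → (x ⊕ x) ⊕ (x ⊕ x) ≡ pos 4 · x
    ring₁₈ = ℤR.solve-∀

    ring₁₉ : ∀ Q q w P F lam n K W t G X → Q · (q · (w · (P · F) ⊕ lam · (n · (pos 8 · K))) ⊕ n · W · (pos 4 · t) ⊕ n · G · (n · X)) ≡ q · w · P · (Q · F) ⊕ q · lam · n · (pos 8 · K · Q) ⊕ n · t · (pos 4 · Q · W) ⊕ n · n · X · (Q · G)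
    ring₁₉ = ℤR.solve-∀

    ring₂₀ : ∀ z → z ⊕ z ⊕ z ⊕ z ≡ pos 4 · z
    ring₂₀ = ℤR.solve-∀

    ring₂₁ : ∀ q w P n → q · w · P · (n · (n · n)) ≡ n · (n · P · (q · (n · w)))
    ring₂₁ = ℤR.solve-∀

    ring₂₂ : ∀ q a n W → q · a · n · W ≡ n · (a · (q · W))
    ring₂₂ = ℤR.solve-∀

    ring₂₃ : ∀ n t s → n · t · s ≡ n · (s · t)
    ring₂₃ = ℤR.solve-∀

    ring₂₄ : ∀ n X P → n · n · X · P ≡ n · (n · P · X)
    ring₂₄ = ℤR.solve-∀

  pos-^ : ∀ x n → pos (x ^ n) ≡ pos x ℤ.^ n
  pos-^ x zero = refl
  pos-^ x (suc n) = trans (ℤₚ.pos-* x (x ^ n)) (cong (pos x ·_) (pos-^ x n))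

  ^-distrib-· : ∀ x y n → (x · y) ℤ.^ n ≡ x ℤ.^ n · y ℤ.^ n
  ^-distrib-· x y zero = refl
  ^-distrib-· x y (suc n) = trans (cong (x · y ·_) (^-distrib-· x y n)) (·-interchange x y (x ℤ.^ n) (y ℤ.^ n))

  sh-sh : ∀ i k A → sh (i + k) A ≡ sh k (sh i A)
  sh-sh zero k A = refl
  sh-sh (suc i) k A = sh-sh i k (A / 2)

  module Pattern (β pat : ℕ) (pat< : pat < 2 ^ β) where

    P : ℕ
    P = 2 ^ β

    -- Indicator that none of the lowest m blocks of β digits is the pattern. The pattern is later a
    -- single one with zeros around it.
    np : ℕ → ℕ → ℤ
    np zero z = 1ℤ
    np (suc m) z = (1ℤ ⊖ 𝟙 (low β z ℕ.≟ pat)) · np m (sh β z)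

    np-nonneg : ∀ m z → 0ℤ ≼ np m z
    np-nonneg zero z = nneg 1
    np-nonneg (suc m) z = gap (𝟙-≤1 (low β z ℕ.≟ pat)) ⊠ np-nonneg m (sh β z)

    np-find : ∀ m z → np m z ≡ 1ℤ ⊎ ∃ λ r → r < m × low β (sh (r * β) z) ≡ pat
    np-find zero z = inj₁ refl
    np-find (suc m) z = go (low β z ℕ.≟ pat) (np-find m (sh β z))
      where
      go : (d : Dec (low β z ≡ pat)) → np m (sh β z) ≡ 1ℤ ⊎ (∃ λ r → r < m × low β (sh (r * β) (sh β z)) ≡ pat) →
        (1ℤ ⊖ 𝟙 d) · np m (sh β z) ≡ 1ℤ ⊎ ∃ λ r → r < suc m × low β (sh (r * β) z) ≡ pat
      go (yes eq) _ = inj₂ (0 , s≤s z≤n , eq)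
      go (no _) (inj₁ eq) = inj₁ (trans (ℤₚ.*-identityˡ _) eq)
      go (no _) (inj₂ (r , r<m , eq)) = inj₂ (suc r , s≤s r<m , trans (cong (low β) (sh-sh β (r * β) z)) eq)

    Σ-np : ∀ m → Σ (P ^ m) (np m) ≡ (pos P ⊖ 1ℤ) ℤ.^ m
    Σ-np zero = refl
    Σ-np (suc m) = begin
      Σ (P * P ^ m) (np (suc m)) ≡⟨ trans (cong (λ n → Σ n (np (suc m))) (*-comm P (P ^ m))) (Σ-block (P ^ m) P (np (suc m))) ⟩
      Σ (P ^ m) (λ z → Σ P (λ r → np (suc m) (r + P * z))) ≡⟨ Σ-cong (P ^ m) (λ z → Σ-cong< P (λ r r< → cong₂ (λ x y → (1ℤ ⊖ 𝟙 (x ℕ.≟ pat)) · np m y) (low-unique β r z r<) (sh-unique β r z r<))) ⟩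
      Σ (P ^ m) (λ z → Σ P (λ r → (1ℤ ⊖ 𝟙 (r ℕ.≟ pat)) · np m z)) ≡⟨ Σ-cong (P ^ m) (λ z → trans (Σ-*ʳ P (np m z) (λ r → 1ℤ ⊖ 𝟙 (r ℕ.≟ pat))) (cong (_· np m z) one)) ⟩
      Σ (P ^ m) (λ z → (pos P ⊖ 1ℤ) · np m z) ≡⟨ Σ-*ˡ (P ^ m) (pos P ⊖ 1ℤ) (np m) ⟩
      (pos P ⊖ 1ℤ) · Σ (P ^ m) (np m) ≡⟨ cong ((pos P ⊖ 1ℤ) ·_) (Σ-np m) ⟩
      (pos P ⊖ 1ℤ) · (pos P ⊖ 1ℤ) ℤ.^ m ∎
      where
      open ≡-Reasoning
      one : Σ P (λ r → 1ℤ ⊖ 𝟙 (r ℕ.≟ pat)) ≡ pos P ⊖ 1ℤ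
      one = trans (Σ-minus P (λ _ → 1ℤ) (λ r → 𝟙 (r ℕ.≟ pat))) (cong₂ _⊖_ (trans (Σ-const P 1ℤ) (ℤₚ.*-identityʳ (pos P)))
        (trans (Σ-cong P (λ r → sym (ℤₚ.*-identityʳ (𝟙 (r ℕ.≟ pat))))) (Σ-pick P pat (λ _ → 1ℤ) pat<)))

  below-join : ∀ i k {r z} → r < 2 ^ i → z < 2 ^ k → r + 2 ^ i * z < 2 ^ (i + k)
  below-join i k {r} {z} r< z< = begin-strict
    r + 2 ^ i * z <⟨ +-monoˡ-< (2 ^ i * z) r< ⟩
    2 ^ i + 2 ^ i * z ≡⟨ sym (*-suc (2 ^ i) z) ⟩
    2 ^ i * suc z ≤⟨ *-monoʳ-≤ (2 ^ i) z< ⟩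
    2 ^ i * 2 ^ k ≡⟨ sym (^-distribˡ-+-* 2 i k) ⟩
    2 ^ (i + k) ∎
    where open ≤-Reasoning

  -- Layout of the digits of x, from below: θ m digits that determine the weight `wt`; m′ blocks of
  -- β digits searched for 2^s′, that is, s′ zeros, a one and w - 1 zeros; and q + w digits x′ among
  -- which the moved window is placed. Together with the ε digits of e these make up the l digits
  -- below the position of h.
  module Assembly (coef : Bool → ℕ) (coef-odd : ∀ c → Odd (coef c)) (b̄ : ℕ) (coef≤b̄ : ∀ c → coef c ≤ b̄) (ε l e₁ h₁ Δe Δh : ℕ)
    (J θ : ℕ) (coef≤J : ∀ c → coef c * (1 + 2 * 2 ^ ε * Δh + 2 * 2 ^ ε * Δe) ≤ J)
    (block : Digits.FlipBlock coef (2 * 2 ^ ε * Δh) (2 * 2 ^ ε * Δe) J θ coef≤J)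
    (x*< : Digits.FlipBlock.x* {coef} {2 * 2 ^ ε * Δh} {2 * 2 ^ ε * Δe} {J} {θ} {coef≤J} block < 2 ^ θ)
    (m w′ u s K Vm v₂ : ℕ)
    (J-large : b̄ * (2 + 2 * Δe) + b̄ * ((2 * (e₁ + Δe) + 1) * (h₁ + Δh)) ≤ J)
    (K-large : b̄ * (2 + 2 * Δe) + b̄ * (2 * Δe * Vm) < K) (Δ≤ : Δe * Δe ≤ 2 ^ l) (us≡ : u + s ≡ l + 2)
    (m′ β s′ lam q : ℕ) (s′≡ : s′ ≡ s + (width θ m w′ + b̄)) (β≡ : β ≡ s′ + width θ m w′) (w≥1 : 1 ≤ width θ m w′) (lam≡ : lam ≡ θ * m + m′ * β)
    (l≡ : l ≡ lam + (q + width θ m w′) + ε) (q-large : lam + ε + 2 + width θ m w′ ≤ q) (e< : e₁ + Δe < 2 ^ ε)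
    (V≤ : ∀ v → v < (2 ^ θ) ^ m → ∀ σ → h₁ + sel σ Δh + 2 ^ ε * (v + (2 ^ θ) ^ m * v₂) ≤ Vm)
    where

    open Estimate coef coef-odd b̄ coef≤b̄ ε l e₁ h₁ Δe Δh J θ coef≤J block x*< m w′ u s K Vm v₂ J-large K-large Δ≤ us≡

    k₀ : ℕ
    k₀ = θ * m

    2^k₀ : 2 ^ k₀ ≡ B ^ m
    2^k₀ = sym (^-*-assoc 2 θ m)

    pat< : 2 ^ s′ < 2 ^ β
    pat< = ^-monoʳ-< 2 (s≤s (s≤s z≤n)) (subst (s′ <_) (sym β≡) (m<m+n s′ w≥1))

    open Pattern β (2 ^ s′) pat<

    X′ : ℕ
    X′ = 2 ^ q * W

    wt-low : ∀ m x y → wt m (x + B ^ m * y) ≡ wt m x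
    wt-low zero x y = refl
    wt-low (suc m) x y = cong₂ (λ p r → p · (C ⊖ pos 2 · 𝟙 (r ℕ.≟ _)))
      (trans (cong (λ z → wt m (sh θ (x + z))) (*-assoc B (B ^ m) y)) (trans (cong (wt m) (sh-+ θ x (B ^ m * y))) (wt-low m (sh θ x) y)))
      (trans (cong (λ z → low θ (x + z)) (*-assoc B (B ^ m) y)) (low-+ θ x (B ^ m * y)))

    wt≥0 : ∀ m x → 0ℤ ≼ wt m x
    wt≥0 zero x = nneg 1
    wt≥0 (suc m) x = wt≥0 m (sh θ x) ⊠ Digits.Contraction.wt-2≥0 coef (2 * 2 ^ ε * Δh) (2 * 2 ^ ε * Δe) J θ coef≤J block x*< (low θ x)

    bad≥0 : ∀ x → 0ℤ ≼ badΣ x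
    bad≥0 x = cube₄-nonneg (λ c ρ → bad u s c ρ x) (λ c ρ → 𝟙-nonneg (suc (low s (sh u (coef c * (Y ρ x * Y ρ x)))) ℕ.≟ 2 ^ s))

    S : ℕ → ℤ
    S lo = Σ (B ^ m) (λ v → abs (Σ X′ (λ x′ → D (lo + 2 ^ lam * x′) (v̄ v))))

    main : ℕ → ℤ
    main lo = pos (2 ^ w′) · wt m lo ⊕ pos (B ^ m) · (pos 8 · pos K)

    main≥0 : ∀ lo → 0ℤ ≼ main lo
    main≥0 lo = nneg (2 ^ w′) ⊠ wt≥0 m lo ⊞ nneg (B ^ m) ⊠ (nneg 8 ⊠ nneg K)

    module WithPattern (lo r : ℕ) (lo< : lo < 2 ^ lam) (r<m′ : r < m′) (found : low β (sh (r * β) (sh k₀ lo)) ≡ 2 ^ s′) where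

      o π : ℕ
      o = k₀ + r * β
      π = o + s′
      g = low o lo

      π+w≤lam : π + w ≤ lam
      π+w≤lam = begin
        k₀ + r * β + s′ + w ≡⟨ +-assoc (k₀ + r * β) s′ w ⟩
        k₀ + r * β + (s′ + w) ≡⟨ cong (k₀ + r * β +_) (sym β≡) ⟩
        k₀ + r * β + β ≡⟨ trans (+-assoc k₀ (r * β) β) (cong (k₀ +_) (+-comm (r * β) β)) ⟩
        k₀ + suc r * β ≤⟨ +-monoʳ-≤ k₀ (*-monoˡ-≤ β r<m′) ⟩
        k₀ + m′ * β ≡⟨ sym lam≡ ⟩
        lam ∎
        where open ≤-Reasoning

      w≤π : w ≤ π
      w≤π = ≤-trans (≤-trans (m≤m+n w b̄) (≤-trans (m≤n+m (w + b̄) s) (≤-reflexive (sym s′≡)))) (m≤n+m s′ o)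

      ν μ τ : ℕ
      -- The place π of the isolated one forces τ through τ + ε + 1 + (π + ε + 2) = l + 2. Of the
      -- digits of x′, μ lie below the moved window and ν above it.
      ν = π + ε + 1 ∸ w
      ν+w : ν + w ≡ π + ε + 1
      ν+w = m∸n+n≡m (≤-trans w≤π (≤-trans (m≤m+n π ε) (m≤m+n (π + ε) 1)))
      ν-bound : ν + (1 + w) ≤ q
      ν-bound = ≤-trans (≤-reflexive (trans (+-suc ν w) (cong suc ν+w))) (≤-trans (s≤s (+-monoˡ-≤ 1 (+-monoˡ-≤ ε (≤-trans (m≤m+n π w) π+w≤lam)))) (≤-trans (≤-reflexive (ring₁ lam ε)) (≤-trans (m≤m+n (lam + ε + 2) w) q-large)))
      μ = q ∸ ν
      μ+ν : μ + ν ≡ q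
      μ+ν = m∸n+n≡m (≤-trans (m≤m+n ν (1 + w)) ν-bound)
      μ-bound : 1 + w ≤ μ
      μ-bound = +-cancelˡ-≤ ν (1 + w) μ (≤-trans ν-bound (≤-reflexive (trans (sym μ+ν) (+-comm μ ν))))
      τ = lam + μ

      l+2≡ : τ + ε + 1 + (π + ε + 1 + 1) ≡ l + 2
      l+2≡ = trans (ring₂ lam μ ε π) (trans (cong (λ z → lam + (μ + z) + ε + 2) (sym ν+w)) (trans (ring₃ lam μ ν w ε) (trans (cong (λ z → lam + (z + w) + ε + 2) μ+ν) (cong (_+ 2) (sym l≡)))))

      t₂ : ℕ
      t₂ = 2 * (τ + ε + 1) ∸ (l + 2 + w)
      t₂≡ : t₂ + (l + 2 + w) ≡ 2 * (τ + ε + 1)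
      t₂≡ = m∸n+n≡m (begin
        l + 2 + w ≡⟨ cong (_+ w) (sym l+2≡) ⟩
        τ + ε + 1 + (π + ε + 1 + 1) + w ≡⟨ ring₄ τ ε π w ⟩
        τ + ε + 1 + (π + w + (ε + 1) + 1) ≤⟨ +-monoʳ-≤ (τ + ε + 1) (+-monoˡ-≤ 1 (+-monoˡ-≤ (ε + 1) π+w≤lam)) ⟩
        τ + ε + 1 + (lam + (ε + 1) + 1) ≤⟨ +-monoʳ-≤ (τ + ε + 1) (+-monoʳ-≤ (lam + (ε + 1)) (≤-trans (s≤s z≤n) μ-bound)) ⟩
        τ + ε + 1 + (lam + (ε + 1) + μ) ≡⟨ ring₅ lam ε μ ⟩
        2 * (lam + μ + ε + 1) ∎)
        where
        open ≤-Reasoning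

      τ₁ l₁ : ℕ
      τ₁ = τ ∸ w
      τ≡ : τ ≡ w + τ₁
      τ≡ = sym (m+[n∸m]≡n (≤-trans (≤-trans (n≤1+n w) μ-bound) (m≤n+m μ lam)))
      l₁ = l ∸ w
      l≡w+ : l ≡ w + l₁
      l≡w+ = sym (m+[n∸m]≡n (subst (w ≤_) (sym l≡) (≤-trans (m≤n+m w q) (≤-trans (m≤n+m (q + w) lam) (m≤m+n (lam + (q + w)) ε)))))

      lo≡ : lo ≡ g + 2 ^ π * (1 + W * sh β (sh o lo))
      lo≡ = trans (low-sh o lo) (cong (g +_) (trans (cong (2 ^ o *_) (trans (low-sh β (sh o lo)) (cong₂ (λ x y → x + y * sh β (sh o lo)) found′ 2^β)))
          (trans (ring₆ (2 ^ o) (2 ^ s′) W (sh β (sh o lo))) (cong (_* (1 + W * sh β (sh o lo))) (sym (^-distribˡ-+-* 2 o s′))))))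
        where
        found′ : low β (sh o lo) ≡ 2 ^ s′
        found′ = trans (cong (low β) (sh-sh k₀ (r * β) lo)) found
        2^β : 2 ^ β ≡ 2 ^ s′ * W
        2^β = trans (cong (2 ^_) β≡) (^-distribˡ-+-* 2 s′ w)

      -- The s′ = s + w + b̄ zeros below the isolated one are spent here: w on the size of y, b̄ on
      -- the coefficient, and s on the digits that must stop a carry.
      tiny : b̄ * (2 ^ (τ + ε + 2) * ((2 * 2 ^ ε * g + (2 * (e₁ + Δe) + 1)) * W)) ≤ 2 ^ u
      tiny = begin
        b̄ * (2 ^ (τ + ε + 2) * ((2 * 2 ^ ε * g + (2 * (e₁ + Δe) + 1)) * W)) ≤⟨ *-mono-≤ (<⇒≤ (n<2^n b̄)) (*-monoʳ-≤ (2 ^ (τ + ε + 2)) (*-monoˡ-≤ W inner)) ⟩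
        2 ^ b̄ * (2 ^ (τ + ε + 2) * (2 * 2 ^ ε * 2 ^ o * W)) ≡⟨ powers ⟩
        2 ^ u ∎
        where
        open ≤-Reasoning
        inner : 2 * 2 ^ ε * g + (2 * (e₁ + Δe) + 1) ≤ 2 * 2 ^ ε * 2 ^ o
        inner = begin
          2 * 2 ^ ε * g + (2 * (e₁ + Δe) + 1) ≤⟨ +-monoʳ-≤ (2 * 2 ^ ε * g) (≤-trans (+-monoʳ-≤ (2 * (e₁ + Δe)) (s≤s z≤n)) (≤-trans (≤-reflexive (ring₇ (e₁ + Δe))) (*-monoʳ-≤ 2 e<))) ⟩
          2 * 2 ^ ε * g + 2 * 2 ^ ε ≡⟨ trans (+-comm (2 * 2 ^ ε * g) (2 * 2 ^ ε)) (sym (*-suc (2 * 2 ^ ε) g)) ⟩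
          2 * 2 ^ ε * suc g ≤⟨ *-monoʳ-≤ (2 * 2 ^ ε) (low< o lo) ⟩
          2 * 2 ^ ε * 2 ^ o ∎
        exponent : b̄ + ((τ + ε + 2) + (suc ε + o + w)) ≡ u
        exponent = +-cancelʳ-≡ s (b̄ + ((τ + ε + 2) + (suc ε + o + w))) u (trans (ring₈ b̄ τ ε o w s) (trans (cong (λ z → τ + ε + 1 + (o + z + ε + 1 + 1)) (sym s′≡)) (trans l+2≡ (sym us≡))))
        powers : 2 ^ b̄ * (2 ^ (τ + ε + 2) * (2 * 2 ^ ε * 2 ^ o * W)) ≡ 2 ^ u
        powers = sym (trans (cong (2 ^_) (sym exponent)) (trans (^-distribˡ-+-* 2 b̄ _) (cong (2 ^ b̄ *_) (trans (^-distribˡ-+-* 2 (τ + ε + 2) _) (cong (2 ^ (τ + ε + 2) *_) (trans (^-distribˡ-+-* 2 (suc ε + o) w) (cong (_* W) (^-distribˡ-+-* 2 (suc ε) o))))))))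

      origin : ℕ → ℕ → ℕ
      origin mid top = lo + 2 ^ lam * (mid + 2 ^ μ * (W * top))

      position : ∀ mid y top → lo + 2 ^ lam * (mid + 2 ^ μ * (y + W * top)) ≡ origin mid top + 2 ^ τ * y
      position mid y top = trans (ring₉ lo (2 ^ lam) mid (2 ^ μ) y (W * top)) (cong (λ z → origin mid top + z * y) (sym (^-distribˡ-+-* 2 lam μ)))

      origin≡ : ∀ mid top → ∃ λ Kx → origin mid top ≡ g + 2 ^ π * (1 + W * Kx)
      origin≡ mid top = sh β (sh o lo) + 2 ^ (lam ∸ (π + w)) * rest , trans (cong₂ (λ a b → a + b * rest) lo≡ 2^lam) (ring₁₀ g (2 ^ π) W (sh β (sh o lo)) (2 ^ (lam ∸ (π + w))) rest)
        where
        rest = mid + 2 ^ μ * (W * top)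
        2^lam : 2 ^ lam ≡ 2 ^ π * W * 2 ^ (lam ∸ (π + w))
        2^lam = trans (cong (2 ^_) (sym (m+[n∸m]≡n π+w≤lam))) (trans (^-distribˡ-+-* 2 (π + w) _) (cong (_* 2 ^ (lam ∸ (π + w))) (^-distribˡ-+-* 2 π w)))

      Y≤ : ∀ mid top → mid < 2 ^ μ → top < 2 ^ ν → ∀ y → y < W → Y false (origin mid top + 2 ^ τ * y) ≤ 2 * 2 ^ l
      Y≤ mid top mid< top< y y< = begin
        2 * E * (origin mid top + 2 ^ τ * y) + (2 * (e₁ + 0) + 1) ≡⟨ cong (λ z → 2 * E * z + (2 * (e₁ + 0) + 1)) (sym (position mid y top)) ⟩
        2 * E * x + (2 * (e₁ + 0) + 1) ≤⟨ +-monoʳ-≤ (2 * E * x) (≤-trans (≤-reflexive (ring₁₁ e₁)) (≤-trans (+-monoʳ-≤ (2 * e₁) (s≤s z≤n)) (≤-trans (≤-reflexive (ring₁₂ e₁)) (*-monoʳ-≤ 2 (≤-<-trans (m≤m+n e₁ Δe) e<))))) ⟩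
        2 * E * x + 2 * E ≡⟨ trans (+-comm (2 * E * x) (2 * E)) (sym (*-suc (2 * E) x)) ⟩
        2 * E * suc x ≤⟨ *-monoʳ-≤ (2 * E) x< ⟩
        2 * E * 2 ^ (lam + (μ + (w + ν))) ≡⟨ trans (*-assoc 2 E _) (cong (2 *_) (trans (*-comm E _) (trans (sym (^-distribˡ-+-* 2 (lam + (μ + (w + ν))) ε)) (cong (2 ^_) exponent)))) ⟩
        2 * 2 ^ l ∎
        where
        open ≤-Reasoning
        x = lo + 2 ^ lam * (mid + 2 ^ μ * (y + W * top))
        x< : x < 2 ^ (lam + (μ + (w + ν)))
        x< = below-join lam (μ + (w + ν)) lo< (below-join μ (w + ν) mid< (below-join w ν y< top<))
        exponent : lam + (μ + (w + ν)) + ε ≡ l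
        exponent = trans (ring₁₃ lam μ w ν ε) (trans (cong (λ z → lam + (z + w) + ε) μ+ν) (sym l≡))

      X′≡ : X′ ≡ 2 ^ ν * W * 2 ^ μ
      X′≡ = trans (cong (λ z → 2 ^ z * W) (sym μ+ν)) (trans (cong (_* W) (^-distribˡ-+-* 2 μ ν)) (ring₁₄ (2 ^ μ) (2 ^ ν) W))

      regroup : ∀ (f : ℕ → ℤ) → Σ X′ f ≡ Σ (2 ^ ν) (λ top → Σ (2 ^ μ) (λ mid → Σ W (λ y → f (mid + 2 ^ μ * (y + W * top)))))
      regroup f = trans (cong (λ n → Σ n f) X′≡) (trans (Σ-block (2 ^ ν * W) (2 ^ μ) f) (trans (Σ-block (2 ^ ν) W (λ i → Σ (2 ^ μ) (λ mid → f (mid + 2 ^ μ * i))))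
        (Σ-cong (2 ^ ν) (λ top → Σ-swap W (2 ^ μ) (λ y mid → f (mid + 2 ^ μ * (y + W * top)))))))

      -- The weight reads only the lowest θ m digits, which no orbit moves.
      wt-origin : ∀ mid top → wt m (origin mid top) ≡ wt m lo
      wt-origin mid top = trans (cong (λ z → wt m (lo + z)) (trans (cong (_* (mid + 2 ^ μ * (W * top))) 2^lam) (*-assoc (B ^ m) (2 ^ (m′ * β)) _))) (wt-low m lo _)
        where
        2^lam : 2 ^ lam ≡ B ^ m * 2 ^ (m′ * β)
        2^lam = trans (cong (2 ^_) lam≡) (trans (^-distribˡ-+-* 2 k₀ (m′ * β)) (cong (_* 2 ^ (m′ * β)) 2^k₀))

      -- The origins are the points y = 0 of their orbits, so bad origins are majorised by all bad
      -- x. This wastes a factor W, which the choice of s repays.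
      badsum : Σ (2 ^ ν) (λ top → Σ (2 ^ μ) (λ mid → badΣ (origin mid top))) ≼ Σ X′ (λ x′ → badΣ (lo + 2 ^ lam * x′))
      badsum = ℤₚ.≤-trans (Σ-mono (2 ^ ν) (λ top → Σ-mono (2 ^ μ) (λ mid → first mid top))) (ℤₚ.≤-reflexive (sym (regroup (λ x′ → badΣ (lo + 2 ^ lam * x′)))))
        where
        first : ∀ mid top → badΣ (origin mid top) ≼ Σ W (λ y → badΣ (lo + 2 ^ lam * (mid + 2 ^ μ * (y + W * top))))
        first mid top = subst (λ n → badΣ (origin mid top) ≼ Σ n f) (suc-pred W {{m^n≢0 2 w}}) (subst (badΣ (origin mid top) ≼_) (sym (Σ-head (pred W) f))
            (cert (Σ-nonneg (pred W) (λ y → bad≥0 (lo + 2 ^ lam * (mid + 2 ^ μ * (suc y + W * top))))) (ring₁₅ (badΣ (origin mid top)) (Σ (pred W) (λ y → f (suc y))))))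
          where
          f : ℕ → ℤ
          f y = badΣ (lo + 2 ^ lam * (mid + 2 ^ μ * (y + W * top)))

      bound : S lo ≼ pos (2 ^ q) · main lo ⊕ pos (B ^ m) · pos W · Σ X′ (λ x′ → badΣ (lo + 2 ^ lam * x′))
      bound = begin
        Σ n (λ v → abs (Σ X′ (λ x′ → D (lo + 2 ^ lam * x′) (v̄ v)))) ≤⟨ Σ-mono n per-v ⟩
        Σ n (λ v → Σ (2 ^ ν) (λ top → Σ (2 ^ μ) (λ mid → orbit mid top v))) ≡⟨ trans (Σ-swap n (2 ^ ν) (λ v top → Σ (2 ^ μ) (λ mid → orbit mid top v))) (Σ-cong (2 ^ ν) (λ top → Σ-swap n (2 ^ μ) (λ v mid → orbit mid top v))) ⟩
        Σ (2 ^ ν) (λ top → Σ (2 ^ μ) (λ mid → Σ n (λ v → orbit mid top v))) ≤⟨ Σ-mono< (2 ^ ν) (λ top top< → Σ-mono< (2 ^ μ) (λ mid mid< → per-origin mid top mid< top<)) ⟩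
        Σ (2 ^ ν) (λ top → Σ (2 ^ μ) (λ mid → main lo ⊕ N · badΣ (origin mid top))) ≡⟨ Σ-cong (2 ^ ν) (λ top → trans (Σ-+ (2 ^ μ) (λ _ → main lo) (λ mid → N · badΣ (origin mid top))) (cong₂ _⊕_ (Σ-const (2 ^ μ) (main lo)) (Σ-*ˡ (2 ^ μ) N (λ mid → badΣ (origin mid top))))) ⟩
        Σ (2 ^ ν) (λ top → pos (2 ^ μ) · main lo ⊕ N · Σ (2 ^ μ) (λ mid → badΣ (origin mid top))) ≡⟨ trans (Σ-+ (2 ^ ν) (λ _ → pos (2 ^ μ) · main lo) (λ top → N · Σ (2 ^ μ) (λ mid → badΣ (origin mid top)))) (cong₂ _⊕_ (Σ-const (2 ^ ν) (pos (2 ^ μ) · main lo)) (Σ-*ˡ (2 ^ ν) N (λ top → Σ (2 ^ μ) (λ mid → badΣ (origin mid top))))) ⟩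
        pos (2 ^ ν) · (pos (2 ^ μ) · main lo) ⊕ N · Σ (2 ^ ν) (λ top → Σ (2 ^ μ) (λ mid → badΣ (origin mid top))) ≤⟨ ℤₚ.+-mono-≤ (ℤₚ.≤-reflexive sizes) (*-monoˡ N (nneg n ⊠ nneg W) badsum) ⟩
        pos (2 ^ q) · main lo ⊕ N · Σ X′ (λ x′ → badΣ (lo + 2 ^ lam * x′)) ∎
        where
        open ℤₚ.≤-Reasoning
        n = B ^ m
        N = pos n · pos W
        orbit : ℕ → ℕ → ℕ → ℤ
        orbit mid top v = abs (Σ W (λ y → D (origin mid top + 2 ^ τ * y) (v̄ v)))
        sizes : pos (2 ^ ν) · (pos (2 ^ μ) · main lo) ≡ pos (2 ^ q) · main lo
        sizes = trans (sym (ℤₚ.*-assoc (pos (2 ^ ν)) (pos (2 ^ μ)) (main lo))) (cong (_· main lo) (trans (sym (ℤₚ.pos-* (2 ^ ν) (2 ^ μ))) (cong pos (trans (sym (^-distribˡ-+-* 2 ν μ)) (cong (2 ^_) (trans (+-comm ν μ) μ+ν))))))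
        per-v : ∀ v → abs (Σ X′ (λ x′ → D (lo + 2 ^ lam * x′) (v̄ v))) ≼ Σ (2 ^ ν) (λ top → Σ (2 ^ μ) (λ mid → orbit mid top v))
        per-v v = begin
          abs (Σ X′ f) ≡⟨ cong abs (regroup f) ⟩
          abs (Σ (2 ^ ν) (λ top → Σ (2 ^ μ) (λ mid → Σ W (λ y → f (mid + 2 ^ μ * (y + W * top)))))) ≤⟨ Σ-abs (2 ^ ν) _ ⟩
          Σ (2 ^ ν) (λ top → abs (Σ (2 ^ μ) (λ mid → Σ W (λ y → f (mid + 2 ^ μ * (y + W * top)))))) ≤⟨ Σ-mono (2 ^ ν) (λ top → Σ-abs (2 ^ μ) (λ mid → Σ W (λ y → f (mid + 2 ^ μ * (y + W * top))))) ⟩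
          Σ (2 ^ ν) (λ top → Σ (2 ^ μ) (λ mid → abs (Σ W (λ y → f (mid + 2 ^ μ * (y + W * top)))))) ≡⟨ Σ-cong (2 ^ ν) (λ top → Σ-cong (2 ^ μ) (λ mid → cong abs (Σ-cong W (λ y → cong (λ z → D z (v̄ v)) (position mid y top))))) ⟩
          Σ (2 ^ ν) (λ top → Σ (2 ^ μ) (λ mid → orbit mid top v)) ∎
          where
          f : ℕ → ℤ
          f x′ = D (lo + 2 ^ lam * x′) (v̄ v)
        per-origin : ∀ mid top → mid < 2 ^ μ → top < 2 ^ ν → Σ n (λ v → orbit mid top v) ≼ main lo ⊕ N · badΣ (origin mid top)
        per-origin mid top mid< top< = subst (λ z → Σ n (λ v → orbit mid top v) ≼ pos (2 ^ w′) · z ⊕ pos n · (pos 8 · pos K) ⊕ N · badΣ (origin mid top)) (wt-origin mid top)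
          (Orbit.estimate (origin mid top) τ t₂ π g (proj₁ (origin≡ mid top)) l₁ τ₁ l+2≡ t₂≡ (proj₂ (origin≡ mid top)) tiny (Y≤ mid top mid< top<) l≡w+ τ≡ V≤)

    lo-estimate : ∀ lo → lo < 2 ^ lam → S lo ≼ pos (2 ^ q) · main lo ⊕ pos (B ^ m) · pos W · Σ X′ (λ x′ → badΣ (lo + 2 ^ lam * x′)) ⊕ np m′ (sh k₀ lo) · (pos (B ^ m) · pos X′)
    lo-estimate lo lo< = go (np-find m′ (sh k₀ lo))
      where
      open ℤₚ.≤-Reasoning
      n = B ^ m
      A₁ = pos (2 ^ q) · main lo
      A₂ = pos n · pos W · Σ X′ (λ x′ → badΣ (lo + 2 ^ lam * x′))
      A₃ = np m′ (sh k₀ lo) · (pos n · pos X′)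
      0≤A₁ : 0ℤ ≼ A₁
      0≤A₁ = nneg (2 ^ q) ⊠ main≥0 lo
      0≤A₂ : 0ℤ ≼ A₂
      0≤A₂ = nneg n ⊠ nneg W ⊠ Σ-nonneg X′ (λ x′ → bad≥0 (lo + 2 ^ lam * x′))
      0≤A₃ : 0ℤ ≼ A₃
      0≤A₃ = np-nonneg m′ (sh k₀ lo) ⊠ (nneg n ⊠ nneg X′)
      go : np m′ (sh k₀ lo) ≡ 1ℤ ⊎ (∃ λ r → r < m′ × low β (sh (r * β) (sh k₀ lo)) ≡ 2 ^ s′) → S lo ≼ A₁ ⊕ A₂ ⊕ A₃
      go (inj₂ (r , r< , found)) = begin
        S lo ≤⟨ WithPattern.bound lo r lo< r< found ⟩
        A₁ ⊕ A₂ ≤⟨ cert 0≤A₃ (ring₁₅ (A₁ ⊕ A₂) A₃) ⟩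
        A₁ ⊕ A₂ ⊕ A₃ ∎
      go (inj₁ eq) = begin
        S lo ≤⟨ Σ-≤-const n (pos X′) (λ v _ → Σ-abs-≤ X′ (λ x′ → D (lo + 2 ^ lam * x′) (v̄ v)) (λ x′ → ℤₚ.≤-reflexive (abs-D (lo + 2 ^ lam * x′) (v̄ v)))) ⟩
        pos n · pos X′ ≡⟨ sym (trans (cong (_· (pos n · pos X′)) eq) (ℤₚ.*-identityˡ (pos n · pos X′))) ⟩
        A₃ ≤⟨ cert (0≤A₁ ⊞ 0≤A₂) (ring₁₆ A₁ A₂ A₃) ⟩
        A₁ ⊕ A₂ ⊕ A₃ ∎

    private
      n = B ^ m
      Full = pos n · (pos (2 ^ lam) · pos X′)
      Pm = P ^ m′
      2^lam≡ : 2 ^ lam ≡ n * Pm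
      2^lam≡ = trans (cong (2 ^_) lam≡) (trans (^-distribˡ-+-* 2 k₀ (m′ * β)) (cong₂ _*_ 2^k₀ (trans (cong (2 ^_) (*-comm m′ β)) (sym (^-*-assoc 2 β m′)))))
      F = pos B · C ⊖ pos 2

    Σ-main : Σ (2 ^ lam) main ≡ pos (2 ^ w′) · (pos Pm · F ℤ.^ m) ⊕ pos (2 ^ lam) · (pos n · (pos 8 · pos K))
    Σ-main = trans (Σ-+ (2 ^ lam) (λ lo → pos (2 ^ w′) · wt m lo) (λ _ → pos n · (pos 8 · pos K))) (cong₂ _⊕_
      (trans (Σ-*ˡ (2 ^ lam) (pos (2 ^ w′)) (wt m)) (cong (pos (2 ^ w′) ·_) (trans (cong (λ k → Σ k (wt m)) 2^lam≡) (Σ-wt m Pm)))) (Σ-const (2 ^ lam) (pos n · (pos 8 · pos K))))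

    Σ-nopattern : Σ (2 ^ lam) (λ lo → np m′ (sh k₀ lo)) ≡ pos n · (pos P ⊖ 1ℤ) ℤ.^ m′
    Σ-nopattern = begin
      Σ (2 ^ lam) f ≡⟨ trans (cong (λ k → Σ k f) (trans 2^lam≡ (*-comm n Pm))) (Σ-block Pm n f) ⟩
      Σ Pm (λ z → Σ n (λ lo → f (lo + n * z))) ≡⟨ Σ-cong Pm (λ z → trans (Σ-cong< n (λ lo lo< → cong (np m′) (trans (cong (λ k → sh k₀ (lo + k * z)) (sym 2^k₀)) (sh-unique k₀ lo z (subst (lo <_) (sym 2^k₀) lo<))))) (Σ-const n (np m′ z))) ⟩
      Σ Pm (λ z → pos n · np m′ z) ≡⟨ trans (Σ-*ˡ Pm (pos n) (np m′)) (cong (pos n ·_) (Σ-np m′)) ⟩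
      pos n · (pos P ⊖ 1ℤ) ℤ.^ m′ ∎
      where
      open ≡-Reasoning
      f : ℕ → ℤ
      f lo = np m′ (sh k₀ lo)

    -- Four losses, each brought down to a fraction 1 / Q of the trivial bound: `H₁` the terms
    -- surviving the contraction, `H₂` truncation, `H₃` bad positions, `H₄` numbers without the
    -- pattern. Hence the 4 in `corner-bound`.
    module Final (τ′ r : ℕ) (τ′≡ : s + τ′ ≡ lam + (q + w)) (r≡ : τ′ + ε ≡ s + r) (Q : ℕ)
      (H₁ : pos Q · F ℤ.^ m ≼ (pos B · C) ℤ.^ m) (H₂ : pos 8 · pos K · pos Q ≼ pos W) (H₃ : pos 4 · pos Q · pos W ≼ pos (2 ^ s))
      (H₄ : pos Q · (pos P ⊖ 1ℤ) ℤ.^ m′ ≼ pos Pm) where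

      sizes : X′ * 2 ^ lam ≡ 2 ^ s * 2 ^ τ′
      sizes = trans (trans (cong (_* 2 ^ lam) (sym (^-distribˡ-+-* 2 q w))) (trans (sym (^-distribˡ-+-* 2 (q + w) lam)) (cong (2 ^_) (trans (+-comm (q + w) lam) (sym τ′≡))))) (^-distribˡ-+-* 2 s τ′)

      u≡ : u ≡ τ′ + ε + 2
      u≡ = +-cancelʳ-≡ s u (τ′ + ε + 2) (trans us≡ (trans (cong (_+ 2) l≡) (trans (cong (λ z → z + ε + 2) (sym τ′≡)) (ring₁₇ s τ′ ε))))

      Σ-bad : Σ (2 ^ lam) (λ lo → Σ X′ (λ x′ → badΣ (lo + 2 ^ lam * x′))) ≡ pos 4 · pos (2 ^ τ′)
      Σ-bad = begin
        Σ (2 ^ lam) (λ lo → Σ X′ (λ x′ → badΣ (lo + 2 ^ lam * x′))) ≡⟨ trans (Σ-swap (2 ^ lam) X′ (λ lo x′ → badΣ (lo + 2 ^ lam * x′))) (sym (Σ-block X′ (2 ^ lam) badΣ)) ⟩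
        Σ (X′ * 2 ^ lam) badΣ ≡⟨ cong (λ k → Σ k badΣ) sizes ⟩
        Σ (2 ^ s * 2 ^ τ′) badΣ ≡⟨ Σ-cube₄ (2 ^ s * 2 ^ τ′) (λ x c ρ → bad u s c ρ x) ⟩
        cube₄ (λ c ρ → Σ (2 ^ s * 2 ^ τ′) (bad u s c ρ)) ≡⟨ cong₂ _⊕_ (cong₂ _⊕_ (count false false) (count false true)) (cong₂ _⊕_ (count true false) (count true true)) ⟩
        (pos (2 ^ τ′) ⊕ pos (2 ^ τ′)) ⊕ (pos (2 ^ τ′) ⊕ pos (2 ^ τ′)) ≡⟨ ring₁₈ (pos (2 ^ τ′)) ⟩
        pos 4 · pos (2 ^ τ′) ∎
        where
        open ≡-Reasoning
        count : ∀ c ρ → Σ (2 ^ s * 2 ^ τ′) (bad u s c ρ) ≡ pos (2 ^ τ′)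
        count c ρ = bad-count u s τ′ r c ρ u≡ r≡

      total : Σ (2 ^ lam) S ≼ pos (2 ^ q) · (pos (2 ^ w′) · (pos Pm · F ℤ.^ m) ⊕ pos (2 ^ lam) · (pos n · (pos 8 · pos K)))
        ⊕ pos n · pos W · (pos 4 · pos (2 ^ τ′)) ⊕ pos n · (pos P ⊖ 1ℤ) ℤ.^ m′ · (pos n · pos X′)
      total = begin
        Σ (2 ^ lam) S ≤⟨ Σ-mono< (2 ^ lam) lo-estimate ⟩
        Σ (2 ^ lam) (λ lo → pos (2 ^ q) · main lo ⊕ N · bs lo ⊕ np m′ (sh k₀ lo) · M) ≡⟨ trans (Σ-+ (2 ^ lam) (λ lo → pos (2 ^ q) · main lo ⊕ N · bs lo) (λ lo → np m′ (sh k₀ lo) · M)) (cong₂ _⊕_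
            (trans (Σ-+ (2 ^ lam) (λ lo → pos (2 ^ q) · main lo) (λ lo → N · bs lo)) (cong₂ _⊕_ (trans (Σ-*ˡ (2 ^ lam) (pos (2 ^ q)) main) (cong (pos (2 ^ q) ·_) Σ-main)) (trans (Σ-*ˡ (2 ^ lam) N bs) (cong (N ·_) Σ-bad))))
            (trans (Σ-*ʳ (2 ^ lam) M (λ lo → np m′ (sh k₀ lo))) (cong (_· M) Σ-nopattern))) ⟩
        _ ∎
        where
        open ℤₚ.≤-Reasoning
        N = pos n · pos W
        M = pos n · pos X′
        bs : ℕ → ℤ
        bs lo = Σ X′ (λ x′ → badΣ (lo + 2 ^ lam * x′))

      +X′ : pos X′ ≡ pos (2 ^ q) · pos W
      +X′ = ℤₚ.pos-* (2 ^ q) W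
      +W : pos W ≡ pos n · pos (2 ^ w′)
      +W = trans (cong pos (2^width m w′)) (ℤₚ.pos-* n (2 ^ w′))
      +lam : pos (2 ^ lam) ≡ pos n · pos Pm
      +lam = trans (cong pos 2^lam≡) (ℤₚ.pos-* n Pm)
      cubic : (pos B · C) ℤ.^ m ≡ pos n · (pos n · pos n)
      cubic = trans (^-distrib-· (pos B) C m) (cong₂ _·_ (sym (pos-^ B m)) (trans (^-distrib-· (pos B) (pos B) m) (cong₂ _·_ (sym (pos-^ B m)) (sym (pos-^ B m)))))

      combine : ∀ Q q w′ W P F lam n K s t X G →
        X ≡ q · W → W ≡ n · w′ → lam ≡ n · P → X · lam ≡ s · t → 0ℤ ≼ q → 0ℤ ≼ w′ → 0ℤ ≼ P → 0ℤ ≼ lam → 0ℤ ≼ n → 0ℤ ≼ t → 0ℤ ≼ X →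
        Q · F ≼ n · (n · n) → pos 8 · K · Q ≼ W → pos 4 · Q · W ≼ s → Q · G ≼ P →
        Q · (q · (w′ · (P · F) ⊕ lam · (n · (pos 8 · K))) ⊕ n · W · (pos 4 · t) ⊕ n · G · (n · X)) ≼ pos 4 · (n · (lam · X))
      combine Q q w′ W P F lam n K s t X G X≡ W≡ lam≡′ st 0≤q 0≤w′ 0≤P 0≤lam 0≤n 0≤t 0≤X h₁ h₂ h₃ h₄ = begin
        Q · (q · (w′ · (P · F) ⊕ lam · (n · (pos 8 · K))) ⊕ n · W · (pos 4 · t) ⊕ n · G · (n · X)) ≡⟨ ring₁₉ Q q w′ P F lam n K W t G X ⟩
        q · w′ · P · (Q · F) ⊕ q · lam · n · (pos 8 · K · Q) ⊕ n · t · (pos 4 · Q · W) ⊕ n · n · X · (Q · G)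
          ≤⟨ ℤₚ.+-mono-≤ (ℤₚ.+-mono-≤ (ℤₚ.+-mono-≤ (*-monoˡ (q · w′ · P) (0≤q ⊠ 0≤w′ ⊠ 0≤P) h₁) (*-monoˡ (q · lam · n) (0≤q ⊠ 0≤lam ⊠ 0≤n) h₂)) (*-monoˡ (n · t) (0≤n ⊠ 0≤t) h₃)) (*-monoˡ (n · n · X) (0≤n ⊠ 0≤n ⊠ 0≤X) h₄) ⟩
        q · w′ · P · (n · (n · n)) ⊕ q · lam · n · W ⊕ n · t · s ⊕ n · n · X · P ≡⟨ cong₂ _⊕_ (cong₂ _⊕_ (cong₂ _⊕_ e₁′ e₂′) e₃′) e₄′ ⟩
        Z ⊕ Z ⊕ Z ⊕ Z ≡⟨ ring₂₀ Z ⟩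
        pos 4 · Z ∎
        where
        open ℤₚ.≤-Reasoning
        Z = n · (lam · X)
        e₁′ : q · w′ · P · (n · (n · n)) ≡ Z
        e₁′ = trans (ring₂₁ q w′ P n) (cong₂ (λ a b → n · (a · b)) (sym lam≡′) (sym (trans X≡ (cong (q ·_) W≡))))
        e₂′ : q · lam · n · W ≡ Z
        e₂′ = trans (ring₂₂ q lam n W) (cong (λ a → n · (lam · a)) (sym X≡))
        e₃′ : n · t · s ≡ Z
        e₃′ = trans (ring₂₃ n t s) (trans (cong (n ·_) (sym st)) (cong (n ·_) (ℤₚ.*-comm X lam)))
        e₄′ : n · n · X · P ≡ Z
        e₄′ = trans (ring₂₄ n X P) (cong (λ a → n · (a · X)) (sym lam≡′))

      corner-bound : pos Q · abs (Σ n (λ v → Σ (X′ * 2 ^ lam) (λ x → D x (v̄ v)))) ≼ pos 4 · Full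
      corner-bound = begin
        pos Q · abs (Σ n (λ v → Σ (X′ * 2 ^ lam) (λ x → D x (v̄ v)))) ≤⟨ *-monoˡ (pos Q) (nneg Q) triangle ⟩
        pos Q · Σ (2 ^ lam) S ≤⟨ *-monoˡ (pos Q) (nneg Q) total ⟩
        _ ≤⟨ combine (pos Q) (pos (2 ^ q)) (pos (2 ^ w′)) (pos W) (pos Pm) (F ℤ.^ m) (pos (2 ^ lam)) (pos n) (pos K) (pos (2 ^ s)) (pos (2 ^ τ′)) (pos X′) ((pos P ⊖ 1ℤ) ℤ.^ m′)
             +X′ +W +lam (trans (sym (ℤₚ.pos-* X′ (2 ^ lam))) (trans (cong pos sizes) (ℤₚ.pos-* (2 ^ s) (2 ^ τ′))))
             (nneg (2 ^ q)) (nneg (2 ^ w′)) (nneg Pm) (nneg (2 ^ lam)) (nneg n) (nneg (2 ^ τ′)) (nneg X′) (subst (pos Q · F ℤ.^ m ≼_) cubic H₁) H₂ H₃ H₄ ⟩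
        pos 4 · Full ∎
        where
        open ℤₚ.≤-Reasoning
        triangle : abs (Σ n (λ v → Σ (X′ * 2 ^ lam) (λ x → D x (v̄ v)))) ≼ Σ (2 ^ lam) S
        triangle = begin
          abs (Σ n (λ v → Σ (X′ * 2 ^ lam) (λ x → D x (v̄ v)))) ≤⟨ Σ-abs n (λ v → Σ (X′ * 2 ^ lam) (λ x → D x (v̄ v))) ⟩
          Σ n (λ v → abs (Σ (X′ * 2 ^ lam) (λ x → D x (v̄ v)))) ≤⟨ Σ-mono n per-v ⟩
          Σ n (λ v → Σ (2 ^ lam) (λ lo → abs (Σ X′ (λ x′ → D (lo + 2 ^ lam * x′) (v̄ v))))) ≡⟨ Σ-swap n (2 ^ lam) (λ v lo → abs (Σ X′ (λ x′ → D (lo + 2 ^ lam * x′) (v̄ v)))) ⟩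
          Σ (2 ^ lam) S ∎
          where
          per-v : ∀ v → abs (Σ (X′ * 2 ^ lam) (λ x → D x (v̄ v))) ≼ Σ (2 ^ lam) (λ lo → abs (Σ X′ (λ x′ → D (lo + 2 ^ lam * x′) (v̄ v))))
          per-v v = ℤₚ.≤-trans (ℤₚ.≤-reflexive (cong abs (trans (Σ-block X′ (2 ^ lam) (λ x → D x (v̄ v))) (Σ-swap X′ (2 ^ lam) (λ x′ lo → D (lo + 2 ^ lam * x′) (v̄ v))))))
            (Σ-abs (2 ^ lam) (λ lo → Σ X′ (λ x′ → D (lo + 2 ^ lam * x′) (v̄ v))))

-- Uniform bounds for sums of corner products.

module CornerSums where
  open ℕ-Arithmetic
  open IntegerSums hiding (*-mono-≤)
  open ThueMorse
  open SignFlips using (Odd)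
  open CarryDigits
  open OrbitSteps
  open CornerEstimate

  private
    ring₁ : ∀ Q p y → Q * p * y ≡ p * (Q * y)
    ring₁ = solve-∀

    ring₂ : ∀ y p m → y * p * (y + (1 + m)) + p * m ≡ (1 + y) * (p * (y + m))
    ring₂ = solve-∀

    ring₃ : ∀ ε lam w s q → ε + (lam + (lam + 2 + w + 2 * s + q + w)) ≡ lam + (lam + ε + 2 + w + 2 * s + q + w)
    ring₃ = solve-∀

    ring₄ : ∀ lam ε w s q → lam + (lam + ε + 2 + w + s + q + w) + ε + 2 + s ≡ lam + (lam + ε + 2 + w + 2 * s + q + w) + ε + 2
    ring₄ = solve-∀

    ring₅ : ∀ lam ε w s q → s + (lam + (lam + ε + 2 + w + s + q + w)) ≡ lam + (lam + ε + 2 + w + 2 * s + q + w)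
    ring₅ = solve-∀

    ring₆ : ∀ lam ε w s q → lam + (lam + ε + 2 + w + s + q + w) + ε ≡ s + (lam + (lam + ε + 2 + w + q + w) + ε)
    ring₆ = solve-∀

    ring₇ : ∀ lam ε w s q → lam + (lam + ε + 2 + w + 2 * s + w) + q ≡ lam + (lam + ε + 2 + w + 2 * s + q + w)
    ring₇ = solve-∀

  -- Bernoulli's inequality (1 + 1/y)ᵐ ≥ 1 + m / y at m = Q y.
  geometric-gap : ∀ Q y → ∃ λ m → Q * y ^ m ≤ (1 + y) ^ m
  geometric-gap Q zero = 1 , ≤-trans (≤-reflexive (*-zeroʳ Q)) z≤n
  geometric-gap Q y@(suc _) = Q * y , *-cancelʳ-≤ (Q * y ^ (Q * y)) ((1 + y) ^ (Q * y)) y (begin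
    Q * y ^ (Q * y) * y ≡⟨ ring₁ Q (y ^ (Q * y)) y ⟩
    y ^ (Q * y) * (Q * y) ≤⟨ *-monoʳ-≤ (y ^ (Q * y)) (m≤n+m (Q * y) y) ⟩
    y ^ (Q * y) * (y + Q * y) ≤⟨ bernoulli (Q * y) ⟩
    (1 + y) ^ (Q * y) * y ∎)
    where
    open ≤-Reasoning
    bernoulli : ∀ m → y ^ m * (y + m) ≤ (1 + y) ^ m * y
    bernoulli zero = ≤-reflexive (cong (λ z → 1 * z) (+-identityʳ y))
    bernoulli (suc m) = begin
      y * y ^ m * (y + suc m) ≤⟨ m≤m+n _ (y ^ m * m) ⟩
      y * y ^ m * (y + suc m) + y ^ m * m ≡⟨ ring₂ y (y ^ m) m ⟩
      (1 + y) * (y ^ m * (y + m)) ≤⟨ *-monoʳ-≤ (1 + y) (bernoulli m) ⟩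
      (1 + y) * ((1 + y) ^ m * y) ≡⟨ sym (*-assoc (1 + y) ((1 + y) ^ m) y) ⟩
      (1 + y) * (1 + y) ^ m * y ∎

  total : ℕ → (ℕ → ℕ) → ℕ
  total zero f = 0
  total (suc n) f = f n + total n f

  ≤-total-of : ∀ n f {i} → i < n → f i ≤ total n f
  ≤-total-of (suc n) f {i} (s≤s i≤n) with m≤n⇒m<n∨m≡n i≤n
  ... | _⊎_.inj₁ i<n = ≤-trans (≤-total-of n f i<n) (m≤n+m (total n f) (f n))
  ... | _⊎_.inj₂ refl = m≤m+n (f n) (total n f)

  module _ (a b : ℕ) (a<b : a < b) (a-odd : Odd a) (b-odd : Odd b) where

    coef : Bool → ℕ
    coef c = if c then b else a

    private
      a>0 : 0 < a
      a>0 = subst (0 <_) (sym (proj₂ a-odd)) (s≤s z≤n)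

      coef-odd : ∀ c → Odd (coef c)
      coef-odd true = b-odd
      coef-odd false = a-odd

      coef≤b : ∀ c → coef c ≤ b
      coef≤b true = ≤-refl
      coef≤b false = <⇒≤ a<b

    cornerProduct : ℕ → ℕ → ℕ → ℕ → ℕ → ℕ → ℕ → ℕ → ℤ
    cornerProduct ε l e₁ h₁ Δe Δh x v = cube (λ c ρ σ → T (coef c * (point ρ σ * point ρ σ)))
      where
      point : Bool → Bool → ℕ
      point ρ σ = Corners.point coef ε l e₁ h₁ Δe Δh ρ σ x v

    module _ (ε V : ℕ) where

      private
        E = 2 ^ ε
        base≢0 : NonZero (2 * E)
        base≢0 = m*n≢0 2 E {{_}} {{m^n≢0 2 ε}}

      -- Uniform in both shifts and in the block v₂ < V of v. The bounded number V of blocks is what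
      -- a later cutting of the interval into few dyadic blocks requires.
      CornerBound : ℕ → ℕ → Set
      CornerBound ν χ = ∀ v₂ e₁ δe h₁ δh → v₂ < V → e₁ + suc δe < 2 ^ ε → h₁ + suc δh < 2 ^ ε →
        pos (2 ^ ε) · abs (Σ (2 ^ ν) (λ v → Σ (2 ^ χ) (λ x → cornerProduct ε (χ + ε) e₁ h₁ (suc δe) (suc δh) x (v + 2 ^ ν * v₂)))) ≼ pos 4 · (pos (2 ^ ν) · pos (2 ^ χ))

      Block′ : ∀ J θ δe δh → (∀ c → coef c * (1 + 2 * E * suc δh + 2 * E * suc δe) ≤ J) → Set
      Block′ J θ δe δh coef≤J = ∃ λ (block : Digits.FlipBlock coef (2 * E * suc δh) (2 * E * suc δe) J θ coef≤J) → Digits.FlipBlock.x* {coef} {2 * E * suc δh} {2 * E * suc δe} {J} {θ} {coef≤J} block < 2 ^ θ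

      Blocks : ℕ → ℕ → Set
      Blocks J θ = ∀ δe δh → δe < E → δh < E → (coef≤J : ∀ c → coef c * (1 + 2 * E * suc δh + 2 * E * suc δe) ≤ J) → Block′ J θ δe δh coef≤J

      abstract
        blockSize : ℕ → ℕ → ℕ → ℕ
        blockSize J i j = FlipBlocks.size a b a<b a>0 b-odd (2 * E) (suc i) (suc j) J base≢0 (record { nonZero = _ }) (record { nonZero = _ })

        blockSize-suffices : ∀ J S δe δh → blockSize J δe δh ≤ S → (coef≤J : ∀ c → coef c * (1 + 2 * E * suc δh + 2 * E * suc δe) ≤ J) → Block′ J (J + S) δe δh coef≤J
        blockSize-suffices J S δe δh size≤S coef≤J = FlipBlocks.flip-block a b a<b a>0 b-odd (2 * E) (suc δe) (suc δh) J base≢0 (record { nonZero = _ }) (record { nonZero = _ }) S size≤S coef≤J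

      -- The length of a flip block depends on the shifts, but there are finitely many pairs; the
      -- sum of all sizes serves every pair, so that θ can be fixed before the shifts.
      uniform-blocks : ∀ J → ∃ λ S → Blocks J (J + S)
      uniform-blocks J = S , λ δe δh δe< δh< → blockSize-suffices J S δe δh (≤-trans (≤-total-of E (blockSize J δe) δh<) (≤-total-of E (λ i → total E (blockSize J i)) δe<))
        where
        S = total E (λ i → total E (blockSize J i))

      module WithBlocks (J θ : ℕ) (J≥₁ : b * (1 + 2 * E * E + 2 * E * E) ≤ J) (J≥₂ : b * (2 + 2 * E) + b * ((2 * E + 1) * E) ≤ J) (J≤θ : J ≤ θ) (blocks : Blocks J θ) where

        private
          B = 2 ^ θ

        module Params (m w′ m′ : ℕ) (K w s β lam : ℕ) (K≡ : K ≡ 1 + (b * (2 + 2 * E) + b * (2 * E * (E + E * (B ^ m * V))))) (w≡ : w ≡ width θ m w′)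
          (KE≤ : 8 * K * E ≤ 2 ^ w′) (w′≥1 : 1 ≤ w′) (s≡ : s ≡ 2 + ε + w) (β≡ : β ≡ s + (w + b) + w) (lam≡ : lam ≡ θ * m + m′ * β)
          (gap₁ : pos E · (pos B · (pos B · pos B) ⊖ pos 2) ℤ.^ m ≼ (pos B · (pos B · pos B)) ℤ.^ m)
          (gap₂ : pos E · (pos (2 ^ β) ⊖ 1ℤ) ℤ.^ m′ ≼ pos ((2 ^ β) ^ m′))
          (q′ v₂ e₁ δe h₁ δh : ℕ) (v₂< : v₂ < V) (e< : e₁ + suc δe < E) (h< : h₁ + suc δh < E)
          (χ : ℕ) (χ≡ : χ ≡ lam + (lam + ε + 2 + w + 2 * s + q′ + w))
          where

          private
            Δe = suc δe
            Δh = suc δh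
            q = lam + ε + 2 + w + 2 * s + q′
            l = χ + ε
            Vm = E + E * (B ^ m * V)

            Δe≤E : Δe ≤ E
            Δe≤E = ≤-trans (m≤n+m Δe e₁) (<⇒≤ e<)
            Δh≤E : Δh ≤ E
            Δh≤E = ≤-trans (m≤n+m Δh h₁) (<⇒≤ h<)

            coef≤J : ∀ c → coef c * (1 + 2 * E * Δh + 2 * E * Δe) ≤ J
            coef≤J c = ≤-trans (*-mono-≤ (coef≤b c) (+-mono-≤ (+-monoʳ-≤ 1 (*-monoʳ-≤ (2 * E) Δh≤E)) (*-monoʳ-≤ (2 * E) Δe≤E))) J≥₁

            J-large : b * (2 + 2 * Δe) + b * ((2 * (e₁ + Δe) + 1) * (h₁ + Δh)) ≤ J
            J-large = ≤-trans (+-mono-≤ (*-monoʳ-≤ b (+-monoʳ-≤ 2 (*-monoʳ-≤ 2 Δe≤E))) (*-monoʳ-≤ b (*-mono-≤ (+-monoˡ-≤ 1 (*-monoʳ-≤ 2 (<⇒≤ e<))) (<⇒≤ h<)))) J≥₂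

            K-large : b * (2 + 2 * Δe) + b * (2 * Δe * Vm) < K
            K-large = subst (b * (2 + 2 * Δe) + b * (2 * Δe * Vm) <_) (sym K≡) (s≤s (+-mono-≤ (*-monoʳ-≤ b (+-monoʳ-≤ 2 (*-monoʳ-≤ 2 Δe≤E))) (*-monoʳ-≤ b (*-monoˡ-≤ Vm (*-monoʳ-≤ 2 Δe≤E)))))

            fb = blocks δe δh (<-≤-trans ≤-refl Δe≤E) (<-≤-trans ≤-refl Δh≤E) coef≤J

            Δ≤ : Δe * Δe ≤ 2 ^ l
            Δ≤ = ≤-trans (*-mono-≤ Δe≤E Δe≤E) (≤-trans (≤-reflexive (sym (^-distribˡ-+-* 2 ε ε))) (^-monoʳ-≤ 2 (+-monoˡ-≤ ε (subst (ε ≤_) (trans (ring₃ ε lam w s q′) (sym χ≡)) (m≤m+n ε _)))))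

            u τ′ r : ℕ
            u = lam + (lam + ε + 2 + w + s + q′ + w) + ε + 2
            us≡ : u + s ≡ l + 2
            us≡ = trans (ring₄ lam ε w s q′) (cong (λ z → z + ε + 2) (sym χ≡))
            τ′ = lam + (lam + ε + 2 + w + s + q′ + w)
            τ′≡ : s + τ′ ≡ lam + (q + w)
            τ′≡ = ring₅ lam ε w s q′
            r = lam + (lam + ε + 2 + w + q′ + w) + ε
            r≡ : τ′ + ε ≡ s + r
            r≡ = ring₆ lam ε w s q′

            V≤ : ∀ v → v < B ^ m → ∀ σ → h₁ + sel σ Δh + E * (v + B ^ m * v₂) ≤ Vm
            V≤ v v< σ = +-mono-≤ (≤-trans (+-monoʳ-≤ h₁ (sel≤ σ)) (<⇒≤ h<)) (*-monoʳ-≤ E (begin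
              v + B ^ m * v₂ ≤⟨ +-monoˡ-≤ (B ^ m * v₂) (<⇒≤ v<) ⟩
              B ^ m + B ^ m * v₂ ≡⟨ sym (*-suc (B ^ m) v₂) ⟩
              B ^ m * suc v₂ ≤⟨ *-monoʳ-≤ (B ^ m) v₂< ⟩
              B ^ m * V ∎))
              where
              open ≤-Reasoning
              sel≤ : ∀ σ → sel σ Δh ≤ Δh
              sel≤ true = ≤-refl
              sel≤ false = z≤n

            w≥1 : 1 ≤ w
            w≥1 = ≤-trans w′≥1 (subst (w′ ≤_) (sym w≡) (≤-width θ m w′))

            KE≤W : pos 8 · pos K · pos E ≼ pos (2 ^ w)
            KE≤W = ℤₚ.≤-trans (ℤₚ.≤-reflexive (sym (trans (ℤₚ.pos-* (8 * K) E) (cong (_· pos E) (ℤₚ.pos-* 8 K))))) (ℤ.+≤+ (≤-trans KE≤ (^-monoʳ-≤ 2 (subst (w′ ≤_) (sym w≡) (≤-width θ m w′)))))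

            W≤ : pos 4 · pos E · pos (2 ^ w) ≼ pos (2 ^ s)
            W≤ = ℤₚ.≤-reflexive (sym (trans (cong pos (trans (cong (2 ^_) s≡) (trans (^-distribˡ-+-* 2 (2 + ε) w) (cong (_* 2 ^ w) (^-distribˡ-+-* 2 2 ε))))) (trans (ℤₚ.pos-* (4 * E) (2 ^ w)) (cong (_· pos (2 ^ w)) (ℤₚ.pos-* 4 E)))))

            X′ = 2 ^ q * 2 ^ width θ m w′

            X≡ : 2 ^ χ ≡ X′ * 2 ^ lam
            X≡ = trans (cong (2 ^_) (trans χ≡ (trans (cong (λ z → lam + (q + z)) w≡) (+-comm lam _)))) (trans (^-distribˡ-+-* 2 (q + w″) lam) (cong (_* 2 ^ lam) (^-distribˡ-+-* 2 q w″)))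
              where
              w″ = width θ m w′

            ν≡ : 2 ^ (θ * m) ≡ B ^ m
            ν≡ = sym (^-*-assoc 2 θ m)

          result : pos E · abs (Σ (2 ^ (θ * m)) (λ v → Σ (2 ^ χ) (λ x → cornerProduct ε l e₁ h₁ Δe Δh x (v + 2 ^ (θ * m) * v₂)))) ≼ pos 4 · (pos (2 ^ (θ * m)) · pos (2 ^ χ))
          result = begin
            pos E · abs (Σ (2 ^ (θ * m)) (λ v → Σ (2 ^ χ) (λ x → cornerProduct ε l e₁ h₁ Δe Δh x (v + 2 ^ (θ * m) * v₂)))) ≡⟨ cong₂ (λ n X → pos E · abs (Σ n (λ v → Σ X (λ x → cornerProduct ε l e₁ h₁ Δe Δh x (v + n * v₂))))) ν≡ X≡ ⟩
            pos E · abs (Σ (B ^ m) (λ v → Σ (X′ * 2 ^ lam) (λ x → cornerProduct ε l e₁ h₁ Δe Δh x (v + B ^ m * v₂)))) ≡⟨ cong (λ z → pos E · abs z) (Σ-cong (B ^ m) (λ v → Σ-cong (X′ * 2 ^ lam) (λ x → Corners.D-points coef ε l e₁ h₁ Δe Δh x (v + B ^ m * v₂)))) ⟩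
            pos E · abs (Σ (B ^ m) (λ v → Σ (X′ * 2 ^ lam) (λ x → Corners.D coef ε l e₁ h₁ Δe Δh x (v + B ^ m * v₂)))) ≤⟨ Assembly.Final.corner-bound coef coef-odd b coef≤b ε l e₁ h₁ Δe Δh J θ coef≤J (proj₁ fb) (proj₂ fb) m w′ u s K Vm v₂ J-large K-large Δ≤ us≡ m′ β (s + (w + b)) lam q (cong (λ z → s + (z + b)) w≡) (trans β≡ (cong (s + (w + b) +_) w≡)) (subst (1 ≤_) w≡ w≥1) lam≡ (cong (_+ ε) (trans χ≡ (cong (λ z → lam + (q + z)) w≡))) (subst (λ z → lam + ε + 2 + z ≤ q) w≡ (≤-trans (m≤m+n (lam + ε + 2 + w) (2 * s)) (m≤m+n _ q′))) e< V≤ τ′ r (trans τ′≡ (cong (λ z → lam + (q + z)) w≡)) r≡ E gap₁ (subst (λ z → pos 8 · pos K · pos E ≼ pos (2 ^ z)) w≡ KE≤W) (subst (λ z → pos 4 · pos E · pos (2 ^ z) ≼ pos (2 ^ s)) w≡ W≤) gap₂ ⟩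
            pos 4 · (pos (B ^ m) · (pos (2 ^ lam) · pos X′)) ≡⟨ cong (λ z → pos 4 · (pos (B ^ m) · z)) (trans (ℤₚ.*-comm (pos (2 ^ lam)) (pos X′)) (sym (ℤₚ.pos-* X′ (2 ^ lam)))) ⟩
            pos 4 · (pos (B ^ m) · pos (X′ * 2 ^ lam)) ≡⟨ cong₂ (λ n X → pos 4 · (pos n · pos X)) (sym ν≡) (sym X≡) ⟩
            pos 4 · (pos (2 ^ (θ * m)) · pos (2 ^ χ)) ∎
            where open ℤₚ.≤-Reasoning

        private
          gap-ℤ : ∀ Q y m X → Q * y ^ m ≤ X → pos Q · pos y ℤ.^ m ≼ pos X
          gap-ℤ Q y m X p = ℤₚ.≤-trans (ℤₚ.≤-reflexive (trans (cong (pos Q ·_) (sym (pos-^ y m))) (sym (ℤₚ.pos-* Q (y ^ m))))) (ℤ.+≤+ p)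

          minus-1 : ∀ x → NonZero x → pos x ⊖ 1ℤ ≡ pos (pred x)
          minus-1 (suc x) _ = refl

          minus-2 : ∀ x → 2 ≤ x → pos x ⊖ pos 2 ≡ pos (x ∸ 2)
          minus-2 x 2≤x = ℤₚ.⊖-≥ 2≤x

          choose-m : ∀ x → 2 ≤ x → ∃ λ m → pos E · (pos x ⊖ pos 2) ℤ.^ m ≼ pos x ℤ.^ m
          choose-m x 2≤x with geometric-gap E (x ∸ 2)
          ... | m , p = m , subst₂ (λ y z → pos E · y ℤ.^ m ≼ z) (sym (minus-2 x 2≤x)) (pos-^ x m)
            (gap-ℤ E (x ∸ 2) m (x ^ m) (≤-trans p (^-monoˡ-≤ m (≤-trans (n≤1+n (1 + (x ∸ 2))) (≤-reflexive (m+[n∸m]≡n 2≤x))))))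

          choose-m′ : ∀ x → NonZero x → ∃ λ m → pos E · (pos x ⊖ 1ℤ) ℤ.^ m ≼ pos (x ^ m)
          choose-m′ x x≢0 with geometric-gap E (pred x)
          ... | m , p = m , subst (λ y → pos E · y ℤ.^ m ≼ pos (x ^ m)) (sym (minus-1 x x≢0)) (gap-ℤ E (pred x) m (x ^ m) (≤-trans p (≤-reflexive (cong (_^ m) (suc-pred x {{x≢0}})))))

          B≥2 : 2 ≤ B
          B≥2 = ^-monoʳ-≤ 2 {1} {θ} (≤-trans (≤-trans (≤-trans (≤-trans (s≤s z≤n) a<b) (m≤m*n b (1 + 2 * E * E + 2 * E * E))) J≥₁) J≤θ)

          B³ : ℕ
          B³ = B * (B * B)
          B³≥2 : 2 ≤ B³
          B³≥2 = ≤-trans B≥2 (m≤m*n B (B * B) {{m*n≢0 B B {{m^n≢0 2 θ}} {{m^n≢0 2 θ}}}})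
          pos-B³ : pos B³ ≡ pos B · (pos B · pos B)
          pos-B³ = trans (ℤₚ.pos-* B (B * B)) (cong (pos B ·_) (ℤₚ.pos-* B B))

        -- The order of choices is m, K, w, s, β, m′: K involves Bᵐ through the size of v, the
        -- window w must dominate K, s must dominate w, the pattern length β contains both, and the
        -- number m′ of blocks to search depends on β.
        corner-sums′ : ∃₂ λ ν χ₀ → ∀ q′ → CornerBound ν (χ₀ + q′)
        corner-sums′ = with-m (choose-m B³ B³≥2)
          where
          with-m : (∃ λ m → pos E · (pos B³ ⊖ pos 2) ℤ.^ m ≼ pos B³ ℤ.^ m) → ∃₂ λ ν χ₀ → ∀ q′ → CornerBound ν (χ₀ + q′)
          with-m (m , gap₁) = with-K (1 + (b * (2 + 2 * E) + b * (2 * E * (E + E * (B ^ m * V))))) refl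
            where
            with-K : ∀ K → K ≡ 1 + (b * (2 + 2 * E) + b * (2 * E * (E + E * (B ^ m * V)))) → ∃₂ λ ν χ₀ → ∀ q′ → CornerBound ν (χ₀ + q′)
            with-K K K≡ = with-s (width θ m w′) (2 + ε + width θ m w′) refl refl
              where
              w′ : ℕ
              w′ = 1 + 8 * K * E
              with-s : ∀ w s → w ≡ width θ m w′ → s ≡ 2 + ε + w → ∃₂ λ ν χ₀ → ∀ q′ → CornerBound ν (χ₀ + q′)
              with-s w s w≡ s≡ = with-β (s + (w + b) + w) refl (choose-m′ (2 ^ (s + (w + b) + w)) (m^n≢0 2 (s + (w + b) + w)))
                where
                with-β : ∀ β → β ≡ s + (w + b) + w → (∃ λ m′ → pos E · (pos (2 ^ β) ⊖ 1ℤ) ℤ.^ m′ ≼ pos ((2 ^ β) ^ m′)) → ∃₂ λ ν χ₀ → ∀ q′ → CornerBound ν (χ₀ + q′)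
                with-β β β≡ (m′ , gap₂) = θ * m , (lam + (lam + ε + 2 + w + 2 * s + w)) , λ q′ v₂ e₁ δe h₁ δh v₂< e< h< →
                  Params.result m w′ m′ K w s β lam K≡ w≡ (≤-trans (n≤1+n (8 * K * E)) (<⇒≤ (n<2^n w′))) (s≤s z≤n) s≡ β≡ refl
                    (subst₂ (λ y z → pos E · (y ⊖ pos 2) ℤ.^ m ≼ z ℤ.^ m) pos-B³ pos-B³ gap₁) gap₂ q′ v₂ e₁ δe h₁ δh v₂< e< h< (lam + (lam + ε + 2 + w + 2 * s + w) + q′) (ring₇ lam ε w s q′)
                  where
                  lam = θ * m + m′ * β

      corner-sums : ∃₂ λ ν χ₀ → ∀ q′ → CornerBound ν (χ₀ + q′)
      corner-sums = go J (m≤m+n _ _) (m≤n+m _ (b * (1 + 2 * E * E + 2 * E * E))) (uniform-blocks J)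
        where
        J = b * (1 + 2 * E * E + 2 * E * E) + (b * (2 + 2 * E) + b * ((2 * E + 1) * E))
        go : ∀ J → b * (1 + 2 * E * E + 2 * E * E) ≤ J → b * (2 + 2 * E) + b * ((2 * E + 1) * E) ≤ J → (∃ λ S → Blocks J (J + S)) → ∃₂ λ ν χ₀ → ∀ q′ → CornerBound ν (χ₀ + q′)
        go J p q (S , bl) = WithBlocks.corner-sums′ J (J + S) p q (m≤m+n J S) bl

-- Two applications of Cauchy-Schwarz.

module BoxNorm where
  open ℕ-Arithmetic
  open IntegerSums hiding (*-mono-≤)
  open ThueMorse
  open CarryDigits
  open OrbitSteps
  open CornerSums

  private
    ring₁ : ∀ n s → (n · s) · (n · s) ≡ (n · n) · (s · s)
    ring₁ = ℤR.solve-∀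

    ring₂ : ∀ a b c d → ((a · b) · (c · d)) · ((a · b) · (c · d)) ≡ ((a · a) · (b · b)) · ((c · c) · (d · d))
    ring₂ = ℤR.solve-∀

    ring₃ : ∀ m x i r → m ⊕ 1ℤ · x ⊕ i ⊖ r ≡ m ⊕ i ⊕ (x ⊖ r)
    ring₃ = ℤR.solve-∀

    ring₄ : ∀ m x r → m ⊕ 0ℤ · x ⊕ 1ℤ · x ⊖ r ≡ m ⊕ (x ⊖ r)
    ring₄ = ℤR.solve-∀

    ring₅ : ∀ m x r → m ⊕ 0ℤ · x ⊕ 0ℤ · x ⊖ r ≡ m ⊖ r
    ring₅ = ℤR.solve-∀

    ring₆ : ∀ E M i → E · (E · (pos 4 · M ⊕ i · (E · M)) ⊕ E · M) ≡ (E · (E · (pos 4 · M)) ⊕ E · (E · M)) ⊕ i · (E · (E · (E · M)))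
    ring₆ = ℤR.solve-∀

    ring₇ : ∀ E M → E · (E · (E · (E · (pos 4 · M)) ⊕ E · (E · M)) ⊕ E · (E · (E · M))) ≡ pos 6 · (E · E · (E · E)) · M
    ring₇ = ℤR.solve-∀

    ring₈ : ∀ E n X F g → E · (n · (X · (F · g))) ≡ (n · (X · F)) · (E · g)
    ring₈ = ℤR.solve-∀

    ring₉ : ∀ n X E → (n · n · n · (X · X · X · (E · E · (E · E)))) · (pos 6 · (E · E · (E · E)) · (n · X)) ≡ pos 6 · ((n · X · (E · E) · (n · X · (E · E))) · (n · X · (E · E) · (n · X · (E · E))))
    ring₉ = ℤR.solve-∀

    ring₁₀ : ∀ k u → pos 6 · ((k · u · (k · u)) · (k · u · (k · u))) ≡ (pos 6 · (k · k · (k · k))) · ((u · u) · (u · u))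
    ring₁₀ = ℤR.solve-∀

  fourth : ℤ → ℤ
  fourth z = (z · z) · (z · z)

  fourth-≤ : ∀ {z w} → z · z ≼ w → fourth z ≼ w · w
  fourth-≤ {z} p = IntegerSums.*-mono-≤ (sq z) (sq z) p p

  Σ-fourth-≤ : ∀ n (f : ℕ → ℤ) → fourth (Σ n f) ≼ (pos n · pos n · pos n) · Σ n (λ i → fourth (f i))
  Σ-fourth-≤ n f = begin
    fourth (Σ n f) ≤⟨ fourth-≤ {Σ n f} (Σ-square-≤ n f) ⟩
    (pos n · S₂) · (pos n · S₂) ≡⟨ ring₁ (pos n) S₂ ⟩
    (pos n · pos n) · (S₂ · S₂) ≤⟨ *-monoˡ (pos n · pos n) (nneg n ⊠ nneg n) (Σ-square-≤ n (λ i → f i · f i)) ⟩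
    (pos n · pos n) · (pos n · Σ n (λ i → fourth (f i))) ≡⟨ sym (ℤₚ.*-assoc (pos n · pos n) (pos n) (Σ n (λ i → fourth (f i)))) ⟩
    (pos n · pos n · pos n) · Σ n (λ i → fourth (f i)) ∎
    where
    open ℤₚ.≤-Reasoning
    S₂ = Σ n (λ i → f i · f i)

  quad : (ℕ → ℕ → ℤ) → ℕ → ℕ → ℕ → ℕ → ℤ
  quad F e e′ h h′ = (F e h · F e′ h) · (F e h′ · F e′ h′)

  -- The first application duplicates e at fixed h, the second, over the pairs (e, e′), duplicates
  -- h. Squaring the cost E of the first and adding the cost E² of the second gives E⁴.
  box : ∀ E (F : ℕ → ℕ → ℤ) → fourth (Σ E (λ h → Σ E (λ e → F e h))) ≼
    (pos E · pos E · (pos E · pos E)) · Σ E (λ e → Σ E (λ e′ → Σ E (λ h → Σ E (λ h′ → quad F e e′ h h′))))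
  box E F = begin
    fourth s ≤⟨ fourth-≤ {s} s²≤ ⟩
    (pos E · Z) · (pos E · Z) ≡⟨ ring₁ (pos E) Z ⟩
    (pos E · pos E) · (Z · Z) ≤⟨ *-monoˡ (pos E · pos E) (nneg E ⊠ nneg E) Z²≤ ⟩
    (pos E · pos E) · ((pos E · pos E) · G) ≡⟨ sym (ℤₚ.*-assoc (pos E · pos E) (pos E · pos E) G) ⟩
    (pos E · pos E · (pos E · pos E)) · G ∎
    where
    open ℤₚ.≤-Reasoning
    s = Σ E (λ h → Σ E (λ e → F e h))
    P : ℕ → ℕ → ℤ
    P e e′ = Σ E (λ h → F e h · F e′ h)
    Z = Σ E (λ e → Σ E (λ e′ → P e e′))
    G = Σ E (λ e → Σ E (λ e′ → Σ E (λ h → Σ E (λ h′ → quad F e e′ h h′))))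
    s²≤ : s · s ≼ pos E · Z
    s²≤ = begin
      s · s ≤⟨ Σ-square-≤ E (λ h → Σ E (λ e → F e h)) ⟩
      pos E · Σ E (λ h → Σ E (λ e → F e h) · Σ E (λ e → F e h)) ≡⟨ cong (pos E ·_) (Σ-cong E (λ h → Σ-square E (λ e → F e h))) ⟩
      pos E · Σ E (λ h → Σ E (λ e → Σ E (λ e′ → F e h · F e′ h))) ≡⟨ cong (pos E ·_) (trans (Σ-swap E E (λ h e → Σ E (λ e′ → F e h · F e′ h))) (Σ-cong E (λ e → Σ-swap E E (λ h e′ → F e h · F e′ h)))) ⟩
      pos E · Z ∎
    Z²≤ : Z · Z ≼ (pos E · pos E) · G
    Z²≤ = begin
      Z · Z ≤⟨ Σ-square-≤ E (λ e → Σ E (λ e′ → P e e′)) ⟩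
      pos E · Σ E (λ e → Σ E (λ e′ → P e e′) · Σ E (λ e′ → P e e′)) ≤⟨ *-monoˡ (pos E) (nneg E) (Σ-mono E (λ e → Σ-square-≤ E (λ e′ → P e e′))) ⟩
      pos E · Σ E (λ e → pos E · Σ E (λ e′ → P e e′ · P e e′)) ≡⟨ cong (pos E ·_) (Σ-*ˡ E (pos E) (λ e → Σ E (λ e′ → P e e′ · P e e′))) ⟩
      pos E · (pos E · Σ E (λ e → Σ E (λ e′ → P e e′ · P e e′))) ≡⟨ sym (ℤₚ.*-assoc (pos E) (pos E) _) ⟩
      (pos E · pos E) · Σ E (λ e → Σ E (λ e′ → P e e′ · P e e′)) ≡⟨ cong ((pos E · pos E) ·_) (Σ-cong E (λ e → Σ-cong E (λ e′ → Σ-square E (λ h → F e h · F e′ h)))) ⟩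
      (pos E · pos E) · G ∎

  module Box (n X E : ℕ) (f : ℕ → ℕ → ℕ → ℕ → ℤ) (abs-f : ∀ v x e h → f v x e h · f v x e h ≡ 1ℤ) where

    R : ℕ → ℕ → ℕ → ℕ → ℤ
    R e e′ h h′ = Σ n (λ v → Σ X (λ x → quad (f v x) e e′ h h′))

    private
      M = pos n · pos X
      E⁴ = pos E · pos E · (pos E · pos E)

    module _ (off-diagonal : ∀ e δe h δh → e + suc δe < E → h + suc δh < E → pos E · abs (R e (e + suc δe) h (h + suc δh)) ≼ pos 4 · M) where

      private
        swap-e : ∀ e e′ h h′ → R e′ e h h′ ≡ R e e′ h h′
        swap-e e e′ h h′ = Σ-cong n (λ v → Σ-cong X (λ x → cong₂ _·_ (ℤₚ.*-comm (f v x e′ h) (f v x e h)) (ℤₚ.*-comm (f v x e′ h′) (f v x e h′))))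
        swap-h : ∀ e e′ h h′ → R e e′ h′ h ≡ R e e′ h h′
        swap-h e e′ h h′ = Σ-cong n (λ v → Σ-cong X (λ x → ℤₚ.*-comm (f v x e h′ · f v x e′ h′) (f v x e h · f v x e′ h)))

        Small : ℤ → Set
        Small z = pos E · z ≼ pos 4 · M

        increasing : ∀ {e e′ h h′} → e < e′ → h < h′ → e′ < E → h′ < E → Small (R e e′ h h′)
        increasing {e} {e′} {h} {h′} e<e′ h<h′ e′< h′< = begin
          pos E · R e e′ h h′ ≤⟨ *-monoˡ (pos E) (nneg E) (≤-abs (R e e′ h h′)) ⟩
          pos E · abs (R e e′ h h′) ≡⟨ cong₂ (λ p q → pos E · abs (R e p h q)) (sym e≡) (sym h≡) ⟩
          pos E · abs (R e (e + suc (e′ ∸ suc e)) h (h + suc (h′ ∸ suc h))) ≤⟨ off-diagonal e (e′ ∸ suc e) h (h′ ∸ suc h) (subst (_< E) (sym e≡) e′<) (subst (_< E) (sym h≡) h′<) ⟩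
          pos 4 · M ∎
          where
          open ℤₚ.≤-Reasoning
          e≡ : e + suc (e′ ∸ suc e) ≡ e′
          e≡ = trans (+-suc e (e′ ∸ suc e)) (m+[n∸m]≡n e<e′)
          h≡ : h + suc (h′ ∸ suc h) ≡ h′
          h≡ = trans (+-suc h (h′ ∸ suc h)) (m+[n∸m]≡n h<h′)

        ordered-h : ∀ {e e′ h h′} → e < e′ → ¬ h′ ≡ h → e′ < E → h < E → h′ < E → Small (R e e′ h h′)
        ordered-h {e} {e′} {h} {h′} e<e′ h≢ e′< h< h′< with <-cmp h h′
        ... | tri< h<h′ _ _ = increasing e<e′ h<h′ e′< h′<
        ... | tri≈ _ h≡ _ = ⊥-elim (h≢ (sym h≡))
        ... | tri> _ _ h′<h = subst Small (swap-h e e′ h h′) (increasing e<e′ h′<h e′< h<)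

        distinct : ∀ {e e′ h h′} → ¬ e′ ≡ e → ¬ h′ ≡ h → e < E → e′ < E → h < E → h′ < E → Small (R e e′ h h′)
        distinct {e} {e′} {h} {h′} e≢ h≢ e< e′< h< h′< with <-cmp e e′
        ... | tri< e<e′ _ _ = ordered-h e<e′ h≢ e′< h< h′<
        ... | tri≈ _ e≡ _ = ⊥-elim (e≢ (sym e≡))
        ... | tri> _ _ e′<e = subst Small (swap-e e e′ h h′) (ordered-h e′<e h≢ e< h< h′<)

        0≤M : 0ℤ ≼ M
        0≤M = nneg n ⊠ nneg X

        trivial : ∀ e e′ h h′ → R e e′ h h′ ≼ M
        trivial e e′ h h′ = Σ-≤-const n (pos X) (λ v _ → ℤₚ.≤-trans (≤-abs _) (Σ-abs-≤ X (λ x → quad (f v x) e e′ h h′) (λ x → ℤₚ.≤-reflexive (abs-of-sq (quad (f v x) e e′ h h′) (quad-sq v x)))))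
          where
          quad-sq : ∀ v x → quad (f v x) e e′ h h′ · quad (f v x) e e′ h h′ ≡ 1ℤ
          quad-sq v x = trans (ring₂ (f v x e h) (f v x e′ h) (f v x e h′) (f v x e′ h′))
            (cong₂ _·_ (cong₂ _·_ (abs-f v x e h) (abs-f v x e′ h)) (cong₂ _·_ (abs-f v x e h′) (abs-f v x e′ h′)))

        corner : ∀ e e′ h h′ → e < E → e′ < E → h < E → h′ < E →
          pos E · R e e′ h h′ ≼ pos 4 · M ⊕ 𝟙 (e′ ℕ.≟ e) · (pos E · M) ⊕ 𝟙 (h′ ℕ.≟ h) · (pos E · M)
        corner e e′ h h′ e< e′< h< h′< = go (e′ ℕ.≟ e) (h′ ℕ.≟ h)
          where
          all : pos E · R e e′ h h′ ≼ pos E · M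
          all = *-monoˡ (pos E) (nneg E) (trivial e e′ h h′)
          0≤EM : 0ℤ ≼ pos E · M
          0≤EM = nneg E ⊠ 0≤M
          go : (d₁ : Dec (e′ ≡ e)) (d₂ : Dec (h′ ≡ h)) → pos E · R e e′ h h′ ≼ pos 4 · M ⊕ 𝟙 d₁ · (pos E · M) ⊕ 𝟙 d₂ · (pos E · M)
          go (yes _) d₂ = cert ((nneg 4 ⊠ 0≤M) ⊞ (𝟙-nonneg d₂ ⊠ 0≤EM) ⊞ gap all) (ring₃ (pos 4 · M) (pos E · M) (𝟙 d₂ · (pos E · M)) (pos E · R e e′ h h′))
          go (no _) (yes _) = cert ((nneg 4 ⊠ 0≤M) ⊞ gap all) (ring₄ (pos 4 · M) (pos E · M) (pos E · R e e′ h h′))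
          go (no p) (no q) = cert (gap (distinct p q e< e′< h< h′<)) (ring₅ (pos 4 · M) (pos E · M) (pos E · R e e′ h h′))

        one : ∀ k → k < E → Σ E (λ i → 𝟙 (i ℕ.≟ k)) ≡ 1ℤ
        one k k< = trans (Σ-cong E (λ i → sym (ℤₚ.*-identityʳ (𝟙 (i ℕ.≟ k))))) (Σ-pick E k (λ _ → 1ℤ) k<)

        sum-h : ∀ e e′ → e < E → e′ < E → pos E · Σ E (λ h → Σ E (λ h′ → R e e′ h h′)) ≼
          pos E · (pos E · (pos 4 · M ⊕ 𝟙 (e′ ℕ.≟ e) · (pos E · M)) ⊕ pos E · M)
        sum-h e e′ e< e′< = begin
          pos E · Σ E (λ h → Σ E (λ h′ → R e e′ h h′)) ≡⟨ trans (sym (Σ-*ˡ E (pos E) _)) (Σ-cong E (λ h → sym (Σ-*ˡ E (pos E) (R e e′ h)))) ⟩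
          Σ E (λ h → Σ E (λ h′ → pos E · R e e′ h h′)) ≤⟨ Σ-mono< E (λ h h< → Σ-mono< E (λ h′ h′< → corner e e′ h h′ e< e′< h< h′<)) ⟩
          Σ E (λ h → Σ E (λ h′ → A ⊕ 𝟙 (h′ ℕ.≟ h) · (pos E · M))) ≡⟨ Σ-cong< E (λ h h< → trans (Σ-+ E (λ _ → A) (λ h′ → 𝟙 (h′ ℕ.≟ h) · (pos E · M)))
              (cong₂ _⊕_ (Σ-const E A) (trans (Σ-*ʳ E (pos E · M) (λ h′ → 𝟙 (h′ ℕ.≟ h))) (trans (cong (_· (pos E · M)) (one h h<)) (ℤₚ.*-identityˡ (pos E · M)))))) ⟩
          Σ E (λ h → pos E · A ⊕ pos E · M) ≡⟨ Σ-const E (pos E · A ⊕ pos E · M) ⟩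
          pos E · (pos E · A ⊕ pos E · M) ∎
          where
          open ℤₚ.≤-Reasoning
          A = pos 4 · M ⊕ 𝟙 (e′ ℕ.≟ e) · (pos E · M)

        sum-e : pos E · Σ E (λ e → Σ E (λ e′ → Σ E (λ h → Σ E (λ h′ → R e e′ h h′)))) ≼ pos 6 · E⁴ · M
        sum-e = begin
          pos E · Σ E (λ e → Σ E (λ e′ → r e e′)) ≡⟨ trans (sym (Σ-*ˡ E (pos E) _)) (Σ-cong E (λ e → sym (Σ-*ˡ E (pos E) (r e)))) ⟩
          Σ E (λ e → Σ E (λ e′ → pos E · r e e′)) ≤⟨ Σ-mono< E (λ e e< → Σ-mono< E (λ e′ e′< → sum-h e e′ e< e′<)) ⟩
          Σ E (λ e → Σ E (λ e′ → pos E · (pos E · (pos 4 · M ⊕ 𝟙 (e′ ℕ.≟ e) · (pos E · M)) ⊕ pos E · M))) ≡⟨ Σ-cong E (λ e → Σ-cong E (λ e′ → ring₆ (pos E) M (𝟙 (e′ ℕ.≟ e)))) ⟩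
          Σ E (λ e → Σ E (λ e′ → a₁ ⊕ 𝟙 (e′ ℕ.≟ e) · a₂)) ≡⟨ Σ-cong< E (λ e e< → trans (Σ-+ E (λ _ → a₁) (λ e′ → 𝟙 (e′ ℕ.≟ e) · a₂))
              (cong₂ _⊕_ (Σ-const E a₁) (trans (Σ-*ʳ E a₂ (λ e′ → 𝟙 (e′ ℕ.≟ e))) (trans (cong (_· a₂) (one e e<)) (ℤₚ.*-identityˡ a₂))))) ⟩
          Σ E (λ e → pos E · a₁ ⊕ a₂) ≡⟨ Σ-const E (pos E · a₁ ⊕ a₂) ⟩
          pos E · (pos E · a₁ ⊕ a₂) ≡⟨ ring₇ (pos E) M ⟩
          pos 6 · E⁴ · M ∎
          where
          open ℤₚ.≤-Reasoning
          r : ℕ → ℕ → ℤ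
          r e e′ = Σ E (λ h → Σ E (λ h′ → R e e′ h h′))
          a₁ = pos E · (pos E · (pos 4 · M)) ⊕ pos E · (pos E · M)
          a₂ = pos E · (pos E · (pos E · M))

        inward : ∀ (F : ℕ → ℕ → ℕ → ℤ) → Σ n (λ v → Σ X (λ x → Σ E (λ i → F v x i))) ≡ Σ E (λ i → Σ n (λ v → Σ X (λ x → F v x i)))
        inward F = trans (Σ-cong n (λ v → Σ-swap X E (λ x i → F v x i))) (Σ-swap n E (λ v i → Σ X (λ x → F v x i)))

      -- The constant is 4 + 1 + 1: the off-diagonal corners, and the diagonals e = e′ and h = h′,
      -- each a proportion 1 / E of all quadruples with the trivial bound.
      total-bound : pos E · fourth (Σ n (λ v → Σ X (λ x → Σ E (λ h → Σ E (λ e → f v x e h))))) ≼ pos 6 · fourth (M · (pos E · pos E))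
      total-bound = begin
        pos E · fourth (Σ n (λ v → Σ X (λ x → s v x))) ≤⟨ *-monoˡ (pos E) (nneg E) (Σ-fourth-≤ n (λ v → Σ X (λ x → s v x))) ⟩
        pos E · (n³ · Σ n (λ v → fourth (Σ X (s v)))) ≤⟨ *-monoˡ (pos E) (nneg E) (*-monoˡ n³ (nneg n ⊠ nneg n ⊠ nneg n) (Σ-mono n (λ v → Σ-fourth-≤ X (s v)))) ⟩
        pos E · (n³ · Σ n (λ v → X³ · Σ X (λ x → fourth (s v x)))) ≤⟨ *-monoˡ (pos E) (nneg E) (*-monoˡ n³ (nneg n ⊠ nneg n ⊠ nneg n) (Σ-mono n (λ v → *-monoˡ X³ (nneg X ⊠ nneg X ⊠ nneg X) (Σ-mono X (λ x → box E (f v x)))))) ⟩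
        pos E · (n³ · Σ n (λ v → X³ · Σ X (λ x → E⁴ · G v x))) ≡⟨ cong (λ z → pos E · (n³ · z)) (trans (Σ-*ˡ n X³ (λ v → Σ X (λ x → E⁴ · G v x))) (cong (X³ ·_) (trans (Σ-cong n (λ v → Σ-*ˡ X E⁴ (G v))) (Σ-*ˡ n E⁴ (λ v → Σ X (G v)))))) ⟩
        pos E · (n³ · (X³ · (E⁴ · Σ n (λ v → Σ X (G v))))) ≡⟨ ring₈ (pos E) n³ X³ E⁴ (Σ n (λ v → Σ X (G v))) ⟩
        (n³ · (X³ · E⁴)) · (pos E · Σ n (λ v → Σ X (G v))) ≡⟨ cong (λ z → (n³ · (X³ · E⁴)) · (pos E · z)) exchange ⟩
        (n³ · (X³ · E⁴)) · (pos E · Σ E (λ e → Σ E (λ e′ → Σ E (λ h → Σ E (λ h′ → R e e′ h h′))))) ≤⟨ *-monoˡ (n³ · (X³ · E⁴)) ((nneg n ⊠ nneg n ⊠ nneg n) ⊠ ((nneg X ⊠ nneg X ⊠ nneg X) ⊠ (nneg E ⊠ nneg E ⊠ (nneg E ⊠ nneg E)))) sum-e ⟩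
        (n³ · (X³ · E⁴)) · (pos 6 · E⁴ · M) ≡⟨ ring₉ (pos n) (pos X) (pos E) ⟩
        pos 6 · fourth (M · (pos E · pos E)) ∎
        where
        open ℤₚ.≤-Reasoning
        n³ = pos n · pos n · pos n
        X³ = pos X · pos X · pos X
        s : ℕ → ℕ → ℤ
        s v x = Σ E (λ h → Σ E (λ e → f v x e h))
        G : ℕ → ℕ → ℤ
        G v x = Σ E (λ e → Σ E (λ e′ → Σ E (λ h → Σ E (λ h′ → quad (f v x) e e′ h h′))))
        exchange : Σ n (λ v → Σ X (G v)) ≡ Σ E (λ e → Σ E (λ e′ → Σ E (λ h → Σ E (λ h′ → R e e′ h h′))))
        exchange = trans (inward (λ v x e → Σ E (λ e′ → Σ E (λ h → Σ E (λ h′ → quad (f v x) e e′ h h′))))) (Σ-cong E (λ e →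
          trans (inward (λ v x e′ → Σ E (λ h → Σ E (λ h′ → quad (f v x) e e′ h h′)))) (Σ-cong E (λ e′ →
          trans (inward (λ v x h → Σ E (λ h′ → quad (f v x) e e′ h h′))) (Σ-cong E (λ h →
          inward (λ v x h′ → quad (f v x) e e′ h h′)))))))

      box-bound : ∀ k → 6 * (k * k * (k * k)) ≤ E → pos k · abs (Σ n (λ v → Σ X (λ x → Σ E (λ h → Σ E (λ e → f v x e h))))) ≼ M · (pos E · pos E)
      box-bound k 6k⁴≤E = sq-cancel-≤ 0≤L (sq-cancel-≤ (0≤L ⊠ 0≤L) (*-cancelˡ (pos 6) (ℤ.+<+ (s≤s z≤n)) (begin
        pos 6 · fourth (pos k · abs U) ≡⟨ trans (ring₁₀ (pos k) (abs U)) (cong ((pos 6 · (pos k · pos k · (pos k · pos k))) ·_) (cong₂ _·_ (abs-sq U) (abs-sq U))) ⟩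
        (pos 6 · (pos k · pos k · (pos k · pos k))) · fourth U ≡⟨ cong (_· fourth U) (sym pos-k) ⟩
        pos (6 * (k * k * (k * k))) · fourth U ≤⟨ *-monoʳ (fourth U) (sq (U · U)) (ℤ.+≤+ 6k⁴≤E) ⟩
        pos E · fourth U ≤⟨ total-bound ⟩
        pos 6 · fourth L ∎)))
        where
        open ℤₚ.≤-Reasoning
        U = Σ n (λ v → Σ X (λ x → Σ E (λ h → Σ E (λ e → f v x e h))))
        L = M · (pos E · pos E)
        0≤L : 0ℤ ≼ L
        0≤L = 0≤M ⊠ (nneg E ⊠ nneg E)
        pos-k : pos (6 * (k * k * (k * k))) ≡ pos 6 · (pos k · pos k · (pos k · pos k))
        pos-k = trans (ℤₚ.pos-* 6 (k * k * (k * k))) (cong (pos 6 ·_) (trans (ℤₚ.pos-* (k * k) (k * k)) (cong₂ _·_ (ℤₚ.pos-* k k) (ℤₚ.pos-* k k))))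

-- Correlations of T(a n²) and T(b n²).

module Correlations where
  open import Data.Nat.DivMod
  open ℕ-Arithmetic
  open IntegerSums hiding (*-mono-≤)
  open ThueMorse
  open SignFlips using (Odd)
  open CarryDigits
  open OrbitSteps
  open CornerSums
  open BoxNorm

  private
    ring₁ : ∀ c n → c * (2 * n * (2 * n)) ≡ 2 * (2 * (c * (n * n)))
    ring₁ = solve-∀

    ring₂ : ∀ a₁ a₂ a₃ a₄ b₁ b₂ b₃ b₄ → ((a₁ · a₂) · (a₃ · a₄)) · ((b₁ · b₂) · (b₃ · b₄)) ≡ ((a₁ · b₁) · (a₂ · b₂)) · ((a₃ · b₃) · (a₄ · b₄))
    ring₂ = ℤR.solve-∀

    ring₃ : ∀ n E X → n · E · X · E ≡ n · X · (E · E)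
    ring₃ = ℤR.solve-∀

    ring₄ : ∀ e E x X h v n v₂ → e + E * (x + X * (h + E * v)) + n * E * X * E * v₂ ≡ e + E * x + X * E * (h + E * (v + n * v₂))
    ring₄ = solve-∀

    ring₅ : ∀ a b c d → a + b + c + b + d ≡ a + b + (c + d) + b
    ring₅ = solve-∀

    ring₆ : ∀ n → n ⊕ n ≡ pos 2 · n
    ring₆ = ℤR.solve-∀

    ring₇ : ∀ G L → G * (2 * L) ≡ L * (2 * G)
    ring₇ = solve-∀

    ring₈ : ∀ k s o m c → m ⊕ m ⊕ c ⊖ k · (s ⊕ o ⊕ 1ℤ) ≡ (m ⊕ c ⊖ k · s) ⊕ (m ⊖ (k · o ⊕ k))
    ring₈ = ℤR.solve-∀

    ring₉ : ∀ k o → pos 2 · (k · o ⊕ k) ≡ (pos 2 · k) · o ⊕ pos 2 · k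
    ring₉ = ℤR.solve-∀

    ring₁₀ : ∀ k → 2 * (2 * k) ≡ 4 * k
    ring₁₀ = solve-∀

  dyadic-scale : ∀ G N → 0 < G → G ≤ N → ∃ λ R → G * 2 ^ R ≤ N × N < G * 2 ^ suc R
  dyadic-scale G N 0<G G≤N = search N (<-≤-trans (n<2^n N) (m≤n*m (2 ^ N) G {{>-nonZero 0<G}}))
    where
    search : ∀ R → N < G * 2 ^ R → ∃ λ R → G * 2 ^ R ≤ N × N < G * 2 ^ suc R
    search zero N< = ⊥-elim (<⇒≱ N< (≤-trans (≤-reflexive (*-identityʳ G)) G≤N))
    search (suc R) N< with N ℕ.<? G * 2 ^ R
    ... | yes N<′ = search R N<′
    ... | no N≮ = R , ≮⇒≥ N≮ , N<

  module Correlation (a b : ℕ) (a<b : a < b) (a-odd : Odd a) (b-odd : Odd b) where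

    g : ℕ → ℤ
    g n = T (a * (n * n)) · T (b * (n * n))

    g-sq : ∀ n → g n · g n ≡ 1ℤ
    g-sq n = trans (·-interchange (T (a * (n * n))) (T (b * (n * n))) (T (a * (n * n))) (T (b * (n * n)))) (cong₂ _·_ (T-sq (a * (n * n))) (T-sq (b * (n * n))))

    abs-g : ∀ n → abs (g n) ≼ 1ℤ
    abs-g n = ℤₚ.≤-reflexive (abs-of-sq (g n) (g-sq n))

    g-double : ∀ n → g (2 * n) ≡ g n
    g-double n = cong₂ _·_ (one a) (one b)
      where
      one : ∀ c → T (c * (2 * n * (2 * n))) ≡ T (c * (n * n))
      one c = trans (cong T (ring₁ c n)) (trans (T-double (2 * (c * (n * n)))) (T-double (c * (n * n))))

    private
      F : ℕ → ℕ → ℕ → ℕ → ℕ → ℕ → ℤ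
      F ε l v x e h = g (2 * (e + 2 ^ ε * x + 2 ^ l * (h + 2 ^ ε * v)) + 1)

      corner≡ : ∀ ε l e h Δe Δh x v → cornerProduct a b a<b a-odd b-odd ε l e h Δe Δh x v ≡ quad (F ε l v x) e (e + Δe) h (h + Δh)
      corner≡ ε l e h Δe Δh x v = trans (ring₂ (t a false false) (t a true false) (t a false true) (t a true true) (t b false false) (t b true false) (t b false true) (t b true true))
        (cong₂ _·_ (cong₂ _·_ (cong₂ f (+-identityʳ e) (+-identityʳ h)) (cong (f (e + Δe)) (+-identityʳ h))) (cong (λ z → f z (h + Δh) · f (e + Δe) (h + Δh)) (+-identityʳ e)))
        where
        point : Bool → Bool → ℕ → ℕ → ℕ
        point = Corners.point (coef a b a<b a-odd b-odd) ε l e h Δe Δh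
        t : ℕ → Bool → Bool → ℤ
        t c ρ σ = T (c * (point ρ σ x v * point ρ σ x v))
        f : ℕ → ℕ → ℤ
        f = F ε l v x

      block-bound : ∀ k ε V ν χ → 6 * (k * k * (k * k)) ≤ 2 ^ ε → CornerBound a b a<b a-odd b-odd ε V ν χ → ∀ v₂ → v₂ < V →
        pos k · abs (Σ (2 ^ ν * 2 ^ ε * 2 ^ χ * 2 ^ ε) (λ i → g (2 * (i + 2 ^ ν * 2 ^ ε * 2 ^ χ * 2 ^ ε * v₂) + 1))) ≼ pos (2 ^ ν * 2 ^ ε * 2 ^ χ * 2 ^ ε)
      block-bound k ε V ν χ k-small corners v₂ v₂< = begin
        pos k · abs (Σ (n * E * X * E) f) ≡⟨ cong (λ z → pos k · abs z) regroup ⟩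
        pos k · abs (Σ n (λ v → Σ X (λ x → Σ E (λ h → Σ E (λ e → F ε (χ + ε) (v + n * v₂) x e h))))) ≤⟨ Box.box-bound n X E (λ v x e h → F ε (χ + ε) (v + n * v₂) x e h) (λ v x e h → g-sq (2 * (e + 2 ^ ε * x + 2 ^ (χ + ε) * (h + 2 ^ ε * (v + n * v₂))) + 1)) off k k-small ⟩
        pos n · pos X · (pos E · pos E) ≡⟨ sizes ⟩
        pos (n * E * X * E) ∎
        where
        open ℤₚ.≤-Reasoning
        n = 2 ^ ν
        E = 2 ^ ε
        X = 2 ^ χ
        f : ℕ → ℤ
        f i = g (2 * (i + n * E * X * E * v₂) + 1)
        off : ∀ e δe h δh → e + suc δe < E → h + suc δh < E →
          pos E · abs (Box.R n X E (λ v x e h → F ε (χ + ε) (v + n * v₂) x e h) (λ v x e h → g-sq (2 * (e + 2 ^ ε * x + 2 ^ (χ + ε) * (h + 2 ^ ε * (v + n * v₂))) + 1)) e (e + suc δe) h (h + suc δh)) ≼ pos 4 · (pos n · pos X)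
        off e δe h δh e< h< = subst (λ z → pos E · abs z ≼ pos 4 · (pos n · pos X)) (Σ-cong n (λ v → Σ-cong X (λ x → corner≡ ε (χ + ε) e h (suc δe) (suc δh) x (v + n * v₂)))) (corners v₂ e δe h δh v₂< e< h<)
        sizes : pos n · pos X · (pos E · pos E) ≡ pos (n * E * X * E)
        sizes = sym (trans (ℤₚ.pos-* (n * E * X) E) (trans (cong (_· pos E) (trans (ℤₚ.pos-* (n * E) X) (cong (_· pos X) (ℤₚ.pos-* n E)))) (ring₃ (pos n) (pos E) (pos X))))
        regroup : Σ (n * E * X * E) f ≡ Σ n (λ v → Σ X (λ x → Σ E (λ h → Σ E (λ e → F ε (χ + ε) (v + n * v₂) x e h))))
        regroup = trans (Σ-block (n * E * X) E f) (trans (Σ-block (n * E) X (λ i → Σ E (λ e → f (e + E * i)))) (trans (Σ-block n E (λ j → Σ X (λ x → Σ E (λ e → f (e + E * (x + X * j))))))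
          (Σ-cong n (λ v → trans (Σ-swap E X (λ h x → Σ E (λ e → f (e + E * (x + X * (h + E * v)))))) (Σ-cong X (λ x → Σ-cong E (λ h → Σ-cong E (λ e → cong (λ z → g (2 * z + 1)) (index e x h v)))))))))
          where
          index : ∀ e x h v → e + E * (x + X * (h + E * v)) + n * E * X * E * v₂ ≡ e + E * x + 2 ^ (χ + ε) * (h + E * (v + n * v₂))
          index e x h v = trans (ring₄ e E x X h v n v₂) (cong (λ z → e + E * x + z * (h + E * (v + n * v₂))) (sym (^-distribˡ-+-* 2 χ ε)))

    odd-blocks : ∀ k V → ∃ λ R₀ → ∀ R → R₀ ≤ R → ∀ v₂ → v₂ < V → pos k · abs (Σ (2 ^ R) (λ i → g (2 * (i + 2 ^ R * v₂) + 1))) ≼ pos (2 ^ R)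
    odd-blocks k V = go ε (<⇒≤ (n<2^n ε)) (corner-sums a b a<b a-odd b-odd ε V)
      where
      ε = 6 * (k * k * (k * k))
      go : ∀ ε → 6 * (k * k * (k * k)) ≤ 2 ^ ε → (∃₂ λ ν χ₀ → ∀ q′ → CornerBound a b a<b a-odd b-odd ε V ν (χ₀ + q′)) →
        ∃ λ R₀ → ∀ R → R₀ ≤ R → ∀ v₂ → v₂ < V → pos k · abs (Σ (2 ^ R) (λ i → g (2 * (i + 2 ^ R * v₂) + 1))) ≼ pos (2 ^ R)
      go ε k-small (ν , χ₀ , corners) = ν + ε + χ₀ + ε , λ R R₀≤ v₂ v₂< →
        subst (λ L → pos k · abs (Σ L (λ i → g (2 * (i + L * v₂) + 1))) ≼ pos L) (sym (size R R₀≤)) (block-bound k ε V ν (χ₀ + (R ∸ (ν + ε + χ₀ + ε))) k-small (corners (R ∸ (ν + ε + χ₀ + ε))) v₂ v₂<)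
        where
        size : ∀ R → ν + ε + χ₀ + ε ≤ R → 2 ^ R ≡ 2 ^ ν * 2 ^ ε * 2 ^ (χ₀ + (R ∸ (ν + ε + χ₀ + ε))) * 2 ^ ε
        size R R₀≤ = trans (cong (2 ^_) (trans (sym (m+[n∸m]≡n R₀≤)) (ring₅ ν ε χ₀ (R ∸ (ν + ε + χ₀ + ε)))))
          (trans (^-distribˡ-+-* 2 (ν + ε + (χ₀ + q′)) ε) (cong (_* 2 ^ ε) (trans (^-distribˡ-+-* 2 (ν + ε) (χ₀ + q′)) (cong (_* 2 ^ (χ₀ + q′)) (^-distribˡ-+-* 2 ν ε)))))
          where
          q′ = R ∸ (ν + ε + χ₀ + ε)

    odd-sum : ∀ k → ∃ λ N₀ → ∀ N → N₀ ≤ N → pos k · abs (Σ N (λ i → g (2 * i + 1))) ≼ pos N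
    odd-sum k = go (odd-blocks (2 * k) (2 * G))
      where
      -- The dyadic block length is taken with G 2ᴿ ≤ N < 2 G 2ᴿ: fewer than 2G full blocks arise,
      -- and the remainder, shorter than N / G, is negligible at level 2k.
      G = suc (2 * k)
      go : (∃ λ R₀ → ∀ R → R₀ ≤ R → ∀ v₂ → v₂ < 2 * G → pos (2 * k) · abs (Σ (2 ^ R) (λ i → g (2 * (i + 2 ^ R * v₂) + 1))) ≼ pos (2 ^ R)) →
        ∃ λ N₀ → ∀ N → N₀ ≤ N → pos k · abs (Σ N (λ i → g (2 * i + 1))) ≼ pos N
      go (R₀ , blocks) = G * 2 ^ R₀ , λ N N₀≤ → at N N₀≤ (dyadic-scale G N (s≤s z≤n) (≤-trans (m≤m*n G (2 ^ R₀) {{m^n≢0 2 R₀}}) N₀≤))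
        where
        at : ∀ N → G * 2 ^ R₀ ≤ N → (∃ λ R → G * 2 ^ R ≤ N × N < G * 2 ^ suc R) → pos k · abs (Σ N (λ i → g (2 * i + 1))) ≼ pos N
        at N N₀≤ (R , lower , upper) = *-cancelˡ (pos 2) (ℤ.+<+ (s≤s z≤n)) (begin
          pos 2 · (pos k · abs (Σ N f)) ≡⟨ trans (sym (ℤₚ.*-assoc (pos 2) (pos k) (abs (Σ N f)))) (cong (_· abs (Σ N f)) (sym (ℤₚ.pos-* 2 k))) ⟩
          pos (2 * k) · abs (Σ N f) ≡⟨ cong (λ z → pos (2 * k) · abs z) decompose ⟩
          pos (2 * k) · abs (full ⊕ rest) ≤⟨ *-monoˡ (pos (2 * k)) (nneg (2 * k)) (abs-+ full rest) ⟩
          pos (2 * k) · (abs full ⊕ abs rest) ≡⟨ ℤₚ.*-distribˡ-+ (pos (2 * k)) (abs full) (abs rest) ⟩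
          pos (2 * k) · abs full ⊕ pos (2 * k) · abs rest ≤⟨ ℤₚ.+-mono-≤ full≤ rest≤ ⟩
          pos N ⊕ pos N ≡⟨ ring₆ (pos N) ⟩
          pos 2 · pos N ∎)
          where
          open ℤₚ.≤-Reasoning
          L = 2 ^ R
          q = sh R N
          r = low R N
          f : ℕ → ℤ
          f i = g (2 * i + 1)
          full = Σ q (λ i → Σ L (λ j → f (j + L * i)))
          rest = Σ r (λ i → f (q * L + i))
          N≡ : N ≡ q * L + r
          N≡ = trans (low-sh R N) (trans (+-comm r (L * q)) (cong (_+ r) (*-comm L q)))
          decompose : Σ N f ≡ full ⊕ rest
          decompose = trans (cong (λ z → Σ z f) N≡) (trans (Σ-split (q * L) r f) (cong (_⊕ rest) (Σ-block q L f)))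
          R₀≤R : R₀ ≤ R
          R₀≤R = ≮⇒≥ (λ R<R₀ → <⇒≱ upper (≤-trans (*-monoʳ-≤ G (^-monoʳ-≤ 2 R<R₀)) N₀≤))
          q< : q < 2 * G
          q< = *-cancelˡ-< L q (2 * G) (≤-<-trans (2^θ*sh≤ R N) (<-≤-trans upper (≤-reflexive (ring₇ G L))))
          full≤ : pos (2 * k) · abs full ≼ pos N
          full≤ = begin
            pos (2 * k) · abs full ≤⟨ *-monoˡ (pos (2 * k)) (nneg (2 * k)) (Σ-abs q (λ i → Σ L (λ j → f (j + L * i)))) ⟩
            pos (2 * k) · Σ q (λ i → abs (Σ L (λ j → f (j + L * i)))) ≡⟨ sym (Σ-*ˡ q (pos (2 * k)) (λ i → abs (Σ L (λ j → f (j + L * i))))) ⟩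
            Σ q (λ i → pos (2 * k) · abs (Σ L (λ j → f (j + L * i)))) ≤⟨ Σ-≤-const q (pos L) (λ i i<q → blocks R R₀≤R i (<-trans i<q q<)) ⟩
            pos q · pos L ≡⟨ sym (ℤₚ.pos-* q L) ⟩
            pos (q * L) ≤⟨ ℤ.+≤+ (≤-trans (m≤m+n (q * L) r) (≤-reflexive (sym N≡))) ⟩
            pos N ∎
          rest≤ : pos (2 * k) · abs rest ≼ pos N
          rest≤ = begin
            pos (2 * k) · abs rest ≤⟨ *-monoˡ (pos (2 * k)) (nneg (2 * k)) (Σ-abs-≤ r (λ i → f (q * L + i)) (λ i → abs-g (2 * (q * L + i) + 1))) ⟩
            pos (2 * k) · pos r ≡⟨ sym (ℤₚ.pos-* (2 * k) r) ⟩
            pos (2 * k * r) ≤⟨ ℤ.+≤+ (≤-trans (*-mono-≤ (n≤1+n (2 * k)) (<⇒≤ (low< R N))) lower) ⟩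
            pos N ∎

    -- Since g(2n) = g(n), halving N replaces the full sum by one over odd numbers and a shorter full sum.
    correlation : ∀ k → ∃ λ N₀ → ∀ N → N₀ ≤ N → pos k · abs (Σ N g) ≼ pos N
    correlation k = go (odd-sum (4 * k))
      where
      go : (∃ λ N₀ → ∀ N → N₀ ≤ N → pos (4 * k) · abs (Σ N (λ i → g (2 * i + 1))) ≼ pos N) → ∃ λ N₀ → ∀ N → N₀ ≤ N → pos k · abs (Σ N g) ≼ pos N
      go (N₁ , odd) = C , λ N C≤N → *-cancelˡ (pos 2) (ℤ.+<+ (s≤s z≤n)) (begin
        pos 2 · (pos k · abs (Σ N g)) ≡⟨ trans (sym (ℤₚ.*-assoc (pos 2) (pos k) (abs (Σ N g)))) (cong (_· abs (Σ N g)) (sym (ℤₚ.pos-* 2 k))) ⟩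
        pos (2 * k) · abs (Σ N g) ≤⟨ bound N ⟩
        pos N ⊕ pos C ≤⟨ ℤₚ.+-monoʳ-≤ (pos N) (ℤ.+≤+ C≤N) ⟩
        pos N ⊕ pos N ≡⟨ ring₆ (pos N) ⟩
        pos 2 · pos N ∎)
        where
        open ℤₚ.≤-Reasoning
        N₂ = N₁ + 4 * k
        -- The trivial bound for N ≤ 2 N₂ + 1, the base of the induction.
        C = 2 * k * (2 * N₂ + 1)
        O : ℕ → ℤ
        O M = Σ M (λ i → g (2 * i + 1))
        -- The additive constant does not grow under halving: the shorter sum costs M + C, and the
        -- odd numbers with the last term cost at most another M.
        Good : ℕ → Set
        Good N = pos (2 * k) · abs (Σ N g) ≼ pos N ⊕ pos C
        halve : ∀ M → Σ (2 * M) g ≡ Σ M g ⊕ O M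
        halve M = trans (cong (λ z → Σ z g) (*-comm 2 M)) (trans (Σ-block M 2 g) (trans (Σ-cong M (λ i → cong₂ _⊕_ (trans (ℤₚ.+-identityˡ (g (2 * i))) (g-double i)) (cong g (+-comm 1 (2 * i))))) (Σ-+ M g (λ i → g (2 * i + 1)))))
        small : ∀ N → N ≤ 2 * N₂ + 1 → Good N
        small N N≤ = begin
          pos (2 * k) · abs (Σ N g) ≤⟨ *-monoˡ (pos (2 * k)) (nneg (2 * k)) (Σ-abs-≤ N g abs-g) ⟩
          pos (2 * k) · pos N ≡⟨ sym (ℤₚ.pos-* (2 * k) N) ⟩
          pos (2 * k * N) ≤⟨ ℤ.+≤+ (≤-trans (*-monoʳ-≤ (2 * k) N≤) (m≤n+m C N)) ⟩
          pos (N + C) ∎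
        large : ∀ M r → r < 2 → N₂ ≤ M → Good M → Good (2 * M + r)
        large M r r<2 N₂≤M ih = begin
          pos (2 * k) · abs (Σ (2 * M + r) g) ≡⟨ cong (λ z → pos (2 * k) · abs z) (trans (Σ-split (2 * M) r g) (cong (_⊕ rest) (halve M))) ⟩
          pos (2 * k) · abs (Σ M g ⊕ O M ⊕ rest) ≤⟨ *-monoˡ (pos (2 * k)) (nneg (2 * k)) (ℤₚ.≤-trans (abs-+ (Σ M g ⊕ O M) rest) (ℤₚ.+-mono-≤ (abs-+ (Σ M g) (O M)) rest≤1)) ⟩
          pos (2 * k) · (abs (Σ M g) ⊕ abs (O M) ⊕ 1ℤ) ≤⟨ cert (gap ih ⊞ gap tail) (ring₈ (pos (2 * k)) (abs (Σ M g)) (abs (O M)) (pos M) (pos C)) ⟩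
          pos M ⊕ pos M ⊕ pos C ≤⟨ ℤ.+≤+ (+-monoˡ-≤ C (≤-trans (≤-reflexive (cong (M +_) (sym (+-identityʳ M)))) (m≤m+n (2 * M) r))) ⟩
          pos (2 * M + r) ⊕ pos C ∎
          where
          rest = Σ r (λ i → g (2 * M + i))
          rest≤1 : abs rest ≼ 1ℤ
          rest≤1 = ℤₚ.≤-trans (Σ-abs-≤ r (λ i → g (2 * M + i)) (λ i → abs-g (2 * M + i))) (ℤ.+≤+ (s≤s⁻¹ r<2))
          tail : pos (2 * k) · abs (O M) ⊕ pos (2 * k) ≼ pos M
          tail = *-cancelˡ (pos 2) (ℤ.+<+ (s≤s z≤n)) (begin
            pos 2 · (pos (2 * k) · abs (O M) ⊕ pos (2 * k)) ≡⟨ trans (ring₉ (pos (2 * k)) (abs (O M))) (cong (λ z → z · abs (O M) ⊕ z) (trans (sym (ℤₚ.pos-* 2 (2 * k))) (cong pos (ring₁₀ k)))) ⟩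
            pos (4 * k) · abs (O M) ⊕ pos (4 * k) ≤⟨ ℤₚ.+-mono-≤ (odd M (≤-trans (m≤m+n N₁ (4 * k)) N₂≤M)) (ℤ.+≤+ (≤-trans (m≤n+m (4 * k) N₁) N₂≤M)) ⟩
            pos M ⊕ pos M ≡⟨ ring₆ (pos M) ⟩
            pos 2 · pos M ∎)
        bound : ∀ N → Good N
        bound = <-rec Good (λ N rec → step N rec (N ℕ.≤? 2 * N₂ + 1))
          where
          step : ∀ N → (∀ {M} → M < N → Good M) → Dec (N ≤ 2 * N₂ + 1) → Good N
          step N rec (yes p) = small N p
          step N rec (no p) = subst Good (sym N≡) (large (N / 2) (N % 2) (m%n<n N 2) N₂≤ (rec (m/n<m N 2 {{>-nonZero (≤-<-trans z≤n (≰⇒> p))}} (s≤s (s≤s z≤n)))))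
            where
            N≡ : N ≡ 2 * (N / 2) + N % 2
            N≡ = trans (halves N) (+-comm (N % 2) (2 * (N / 2)))
            N₂≤ : N₂ ≤ N / 2
            N₂≤ = ≮⇒≥ (λ N/2< → p (≤-trans (≤-reflexive N≡) (+-mono-≤ (*-monoʳ-≤ 2 (<⇒≤ N/2<)) (s≤s⁻¹ (m%n<n N 2)))))

-- Kátai's bilinear sum over one scale of primes.

module BilinearSums where
  open import Defs using (μ)
  open import Data.Nat.DivMod using (m≡m%n+[m/n]*n; m%n<n; m/n*n≤m)
  open import Data.Nat using (_⊓_)
  open ℤ-Arithmetic
  open IntegerSums
  open Moebius
  open Chebyshev using (scaleCount)
  open TuranKubilius
  open GoodScales
  open Twists
  open Counting using (Σ-single)
  open ScaleSums using (scaleSum-+; scaleSum-*ˡ; scaleSum-Σ; 𝟙-nonzero; *-nonzeroʳ)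

  private
    ring₁ : ∀ p q i j f g → p * (i * f) * (q * (j * g)) ≡ p * q * (i * j * (f * g))
    ring₁ = solve-∀

    ring₂ : ∀ p q c → p * q * c ≡ q * (p * c)
    ring₂ = solve-∀

    ring₃ : ∀ n p → + 2 * n - (n + p) ≡ n - p
    ring₃ = solve-∀

    ring₄ : ∀ k a w → k * (a * w) ≡ a * (k * w)
    ring₄ = solve-∀

    ring₅ : ∀ z k → z ≡ z + k * z * 0ℤ
    ring₅ = solve-∀

    ring₆ : ∀ z k → z + k * z * 1ℤ - k * z ≡ z
    ring₆ = solve-∀

    ring₇ : ∀ s z → s * (s * z + s * z) ≡ + 2 * z * (s * s)
    ring₇ = solve-∀

    ring₈ : ∀ p i u f → p * (i * (u * f)) ≡ u * (p * (i * f))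
    ring₈ = solve-∀

    ring₉ : ∀ u h → u * h * (u * h) ≡ u * u * (h * h)
    ring₉ = solve-∀

    ring₁₀ : ∀ k v → + 512 * (k * v * (k * v)) ≡ + 512 * (k * k) * (v * v)
    ring₁₀ = solve-∀

    ring₁₁ : ∀ k c h → k * (c * h) ≡ c * (k * h)
    ring₁₁ = solve-∀

    ring₁₂ : ∀ c s n z → c * (+ 2 * (+ 64 * s * (+ 2 * n)) * (z * z)) ≡ + 256 * n * (z * z) * (s * c)
    ring₁₂ = solve-∀

    ring₁₃ : ∀ n z → + 256 * n * (z * z) * (+ 2 * n) ≡ + 512 * (n * z * (n * z))
    ring₁₃ = solve-∀

  Σ-cutoff : ∀ {x C} (F : ℕ → ℤ) → x ℕ.≤ C → Σ C (λ m → 𝟙 (m ℕ.<? x) * F m) ≡ Σ x F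
  Σ-cutoff {x} {C} F x≤C = trans (Σ-extend (λ m → 𝟙 (m ℕ.<? x) * F m) x≤C (λ m x≤m → cong (_* F m) (𝟙-no (m ℕ.<? x) (ℕₚ.≤⇒≯ x≤m))))
    (Σ-cong< x (λ m m<x → trans (cong (_* F m) (𝟙-yes (m ℕ.<? x) m<x)) (*-identityˡ (F m))))

  𝟙-⊓ : ∀ m x y → 𝟙 (m ℕ.<? x) * 𝟙 (m ℕ.<? y) ≡ 𝟙 (m ℕ.<? (x ⊓ y))
  𝟙-⊓ m x y = go (m ℕ.<? x) (m ℕ.<? y)
    where
    go : (d₁ : Dec (m ℕ.< x)) (d₂ : Dec (m ℕ.< y)) → 𝟙 d₁ * 𝟙 d₂ ≡ 𝟙 (m ℕ.<? (x ⊓ y))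
    go (yes p) (yes q) = sym (𝟙-yes (m ℕ.<? (x ⊓ y)) (ℕₚ.⊓-glb p q))
    go (yes p) (no ¬q) = sym (𝟙-no (m ℕ.<? (x ⊓ y)) (λ r → ¬q (ℕₚ.≤-trans r (ℕₚ.m⊓n≤n x y))))
    go (no ¬p) _ = sym (𝟙-no (m ℕ.<? (x ⊓ y)) (λ r → ¬p (ℕₚ.≤-trans r (ℕₚ.m⊓n≤m x y))))

  InScale : ℕ → ℕ → Set
  InScale κ p = Prime p × 64 ℕ.^ κ ℕ.< p × p ℕ.≤ 64 ℕ.* 64 ℕ.^ κ

  scaleSum-≤ : ∀ κ {F G : ℕ → ℤ} → (∀ p → InScale κ p → F p ≤ G p) → scaleSum κ F ≤ scaleSum κ G
  scaleSum-≤ κ h = scaleSum-mono κ (λ p pp s<p p≤ → h p (pp , s<p , p≤))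

  scaleSum-cong : ∀ κ {F G : ℕ → ℤ} → (∀ p → InScale κ p → F p ≡ G p) → scaleSum κ F ≡ scaleSum κ G
  scaleSum-cong κ h = ≤-antisym (scaleSum-≤ κ (λ p ip → ≤-reflexive (h p ip))) (scaleSum-≤ κ (λ p ip → ≤-reflexive (sym (h p ip))))

  scaleSum-product : ∀ κ (F G : ℕ → ℤ) → scaleSum κ F * scaleSum κ G ≡ scaleSum κ (λ p → scaleSum κ (λ q → F p * G q))
  scaleSum-product κ F G = begin
    scaleSum κ F * scaleSum κ G ≡⟨ *-comm (scaleSum κ F) (scaleSum κ G) ⟩
    scaleSum κ G * scaleSum κ F ≡⟨ sym (scaleSum-*ˡ κ (scaleSum κ G) F) ⟩
    scaleSum κ (λ p → scaleSum κ G * F p) ≡⟨ scaleSum-cong κ (λ p _ → trans (*-comm (scaleSum κ G) (F p)) (sym (scaleSum-*ˡ κ (F p) G))) ⟩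
    scaleSum κ (λ p → scaleSum κ (λ q → F p * G q)) ∎
    where open ≡-Reasoning

  scaleSum-indicator : ∀ κ p → scaleSum κ (λ q → 𝟙 (q ℕ.≟ p)) ≤ 1ℤ
  scaleSum-indicator κ p = Σ-single (63 ℕ.* X) 1ℤ g (nneg 1) (λ i _ → *-mono-≤ (𝟙-nonneg (prime? (suc (X ℕ.+ i)))) (𝟙-nonneg (suc (X ℕ.+ i) ℕ.≟ p)) (𝟙-≤1 (prime? (suc (X ℕ.+ i)))) (𝟙-≤1 (suc (X ℕ.+ i) ℕ.≟ p)))
    (λ i j _ _ i≢ j≢ → ℕₚ.+-cancelˡ-≡ X i j (ℕₚ.suc-injective (trans (hit i i≢) (sym (hit j j≢)))))
    where
    X = 64 ℕ.^ κ
    g : ℕ → ℤ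
    g i = 𝟙 (prime? (suc (X ℕ.+ i))) * 𝟙 (suc (X ℕ.+ i) ℕ.≟ p)
    hit : ∀ i → ¬ g i ≡ 0ℤ → suc (X ℕ.+ i) ≡ p
    hit i nz = 𝟙-nonzero (suc (X ℕ.+ i) ℕ.≟ p) (*-nonzeroʳ (𝟙 (prime? (suc (X ℕ.+ i)))) (𝟙 (suc (X ℕ.+ i) ℕ.≟ p)) nz)

  scaleSum-abs : ∀ κ (F : ℕ → ℤ) → abs (scaleSum κ F) ≤ scaleSum κ (λ p → abs (F p))
  scaleSum-abs κ F = abs-≤ (scaleSum κ F) (scaleSum-≤ κ (λ p _ → ≤-abs (F p)))
    (≤-trans (≤-reflexive (trans (sym (-1*i≡-i (scaleSum κ F))) (sym (scaleSum-*ˡ κ (- 1ℤ) F)))) (scaleSum-≤ κ (λ p _ → ≤-trans (≤-reflexive (-1*i≡-i (F p))) (-≤-abs (F p)))))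

  -- Exchanging the sums gives Σ μ(m) h(m), and Cauchy-Schwarz removes μ. Pairs p ≠ q are
  -- correlations and gain a factor k; the diagonal is a proportion 1 / `scaleCount κ` of all pairs,
  -- at most 1 / k. The constant 512 collects 2 from these two parts, 2 · 64 from Z, and 2 from s C
  -- ≤ 2N.
  module Bilinear (f : ℕ → ℤ) (f≤1 : ∀ n → abs (f n) ≤ 1ℤ) (κ N N₁ k K : ℕ)
    (correlated : ∀ p q X → InScale κ p → InScale κ q → ¬ q ≡ p → N₁ ℕ.≤ X → + k * abs (Σ X (λ m → f (p ℕ.* m) * f (q ℕ.* m))) ≤ + X)
    (64sN₁≤N : 64 ℕ.* 64 ℕ.^ κ ℕ.* N₁ ℕ.≤ N) (64s≤N : 64 ℕ.* 64 ℕ.^ κ ℕ.≤ N) (k≤count : k ℕ.≤ scaleCount κ) (k≡ : + k ≡ + 512 * (+ K * + K)) where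

    private
      s : ℕ
      s = 64 ℕ.^ κ

      c : ℕ → ℕ
      c p = multiples p N

      instance
        s≢0 : NonZero s
        s≢0 = ℕₚ.m^n≢0 64 κ

      C : ℕ
      -- A common range for m: every prime of the scale exceeds s, so all cutoffs c p are at most C.
      C = suc (N ℕ./ s)

      Sc : ℤ
      Sc = + scaleCount κ

      nz : ∀ {p} → InScale κ p → NonZero p
      nz (pp , _) = prime⇒nonZero pp

      p≤N : ∀ {p} → InScale κ p → p ℕ.≤ N
      p≤N (_ , _ , p≤) = ℕₚ.≤-trans p≤ 64s≤N

      c≤C : ∀ p → InScale κ p → c p ℕ.≤ C
      c≤C p ip = ℕₚ.≮⇒≥ (λ C<c → ℕₚ.<⇒≱ (proj₂ (multiples-bounds p {{nz ip}} N)) (begin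
        N ℕ.+ p ≤⟨ ℕₚ.+-monoˡ-≤ p (ℕₚ.<⇒≤ N<) ⟩
        s ℕ.* C ℕ.+ p ≤⟨ ℕₚ.+-monoˡ-≤ p (ℕₚ.*-monoˡ-≤ C (ℕₚ.<⇒≤ (proj₁ (proj₂ ip)))) ⟩
        p ℕ.* C ℕ.+ p ≡⟨ trans (ℕₚ.+-comm (p ℕ.* C) p) (sym (ℕₚ.*-suc p C)) ⟩
        p ℕ.* suc C ≤⟨ ℕₚ.*-monoʳ-≤ p C<c ⟩
        p ℕ.* c p ∎))
        where
        open ℕₚ.≤-Reasoning
        N< : N ℕ.< s ℕ.* C
        N< = begin-strict
          N ≡⟨ m≡m%n+[m/n]*n N s ⟩
          N ℕ.% s ℕ.+ N ℕ./ s ℕ.* s <⟨ ℕₚ.+-monoˡ-< (N ℕ./ s ℕ.* s) (m%n<n N s) ⟩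
          s ℕ.+ N ℕ./ s ℕ.* s ≡⟨ ℕₚ.*-comm C s ⟩
          s ℕ.* C ∎

      sC≤2N : + s * + C ≤ + 2 * + N
      sC≤2N = ≤-trans (≤-reflexive (sym (pos-* s C))) (≤-trans (+≤+ (begin
        s ℕ.* C ≡⟨ ℕₚ.*-comm s C ⟩
        s ℕ.+ N ℕ./ s ℕ.* s ≤⟨ ℕₚ.+-mono-≤ (ℕₚ.≤-trans (ℕₚ.m≤n*m s 64) 64s≤N) (ℕₚ.≤-trans (m/n*n≤m N s) (ℕₚ.≤-reflexive (sym (ℕₚ.+-identityʳ N)))) ⟩
        2 ℕ.* N ∎)) (≤-reflexive (pos-* 2 N)))
        where open ℕₚ.≤-Reasoning

      N₁≤c : ∀ p → InScale κ p → N₁ ℕ.≤ c p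
      N₁≤c p ip = ℕₚ.*-cancelˡ-≤ p {{nz ip}} (ℕₚ.≤-trans (ℕₚ.*-monoˡ-≤ N₁ (proj₂ (proj₂ ip))) (ℕₚ.≤-trans 64sN₁≤N (proj₁ (multiples-bounds p {{nz ip}} N))))

      B : ℕ → ℤ
      B p = Σ (c p) (λ m → μ m * f (p ℕ.* m))

      term : ℕ → ℕ → ℤ
      term m p = + p * (𝟙 (m ℕ.<? c p) * f (p ℕ.* m))

      h : ℕ → ℤ
      h m = scaleSum κ (term m)

      Z : ℤ
      Z = + 64 * + s * (+ 2 * + N)

      0≤Z : 0ℤ ≤ Z
      0≤Z = nneg 64 ⊠ nneg s ⊠ (nneg 2 ⊠ nneg N)

      pair : ℕ → ℕ → ℤ
      pair p q = Σ C (λ m → term m p * term m q)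

      pair≡ : ∀ p q → InScale κ p → pair p q ≡ + p * + q * Σ (c p ⊓ c q) (λ m → f (p ℕ.* m) * f (q ℕ.* m))
      pair≡ p q ip = begin
        Σ C (λ m → term m p * term m q) ≡⟨ Σ-cong C (λ m → trans (ring₁ (+ p) (+ q) (𝟙 (m ℕ.<? c p)) (𝟙 (m ℕ.<? c q)) (f (p ℕ.* m)) (f (q ℕ.* m))) (cong (λ z → + p * + q * (z * (f (p ℕ.* m) * f (q ℕ.* m)))) (𝟙-⊓ m (c p) (c q)))) ⟩
        Σ C (λ m → + p * + q * (𝟙 (m ℕ.<? (c p ⊓ c q)) * (f (p ℕ.* m) * f (q ℕ.* m)))) ≡⟨ Σ-*ˡ C (+ p * + q) (λ m → 𝟙 (m ℕ.<? (c p ⊓ c q)) * (f (p ℕ.* m) * f (q ℕ.* m))) ⟩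
        + p * + q * Σ C (λ m → 𝟙 (m ℕ.<? (c p ⊓ c q)) * (f (p ℕ.* m) * f (q ℕ.* m))) ≡⟨ cong (+ p * + q *_) (Σ-cutoff (λ m → f (p ℕ.* m) * f (q ℕ.* m)) (ℕₚ.≤-trans (ℕₚ.m⊓n≤m (c p) (c q)) (c≤C p ip))) ⟩
        + p * + q * Σ (c p ⊓ c q) (λ m → f (p ℕ.* m) * f (q ℕ.* m)) ∎
        where
        open ≡-Reasoning

      pqX≤Z : ∀ p q → InScale κ p → InScale κ q → + p * + q * + (c p ⊓ c q) ≤ Z
      pqX≤Z p q ip iq = begin
        + p * + q * + (c p ⊓ c q) ≤⟨ *-monoˡ (+ p * + q) (nneg p ⊠ nneg q) (+≤+ (ℕₚ.m⊓n≤m (c p) (c q))) ⟩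
        + p * + q * + c p ≡⟨ ring₂ (+ p) (+ q) (+ c p) ⟩
        + q * (+ p * + c p) ≤⟨ *-mono-≤ (nneg q) (nneg p ⊠ nneg (c p)) (≤-trans (+≤+ (proj₂ (proj₂ iq))) (≤-reflexive (pos-* 64 s))) (≤-trans (multiples-upperℤ p {{nz ip}} N) N+p≤) ⟩
        + 64 * + s * (+ 2 * + N) ∎
        where
        open ≤-Reasoning
        N+p≤ : + N + + p ≤ + 2 * + N
        N+p≤ = cert (gap (+≤+ (p≤N ip))) (ring₃ (+ N) (+ p))

      pair-bound : ∀ p q → InScale κ p → InScale κ q → + k * pair p q ≤ Z + + k * Z * 𝟙 (q ℕ.≟ p)
      pair-bound p q ip iq = go (q ℕ.≟ p)
        where
        open ≤-Reasoning
        X = c p ⊓ c q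
        W = Σ X (λ m → f (p ℕ.* m) * f (q ℕ.* m))
        go : (d : Dec (q ≡ p)) → + k * pair p q ≤ Z + + k * Z * 𝟙 d
        go (no q≢p) = begin
          + k * pair p q ≡⟨ trans (cong (+ k *_) (pair≡ p q ip)) (ring₄ (+ k) (+ p * + q) W) ⟩
          + p * + q * (+ k * W) ≤⟨ *-monoˡ (+ p * + q) (nneg p ⊠ nneg q) (*-monoˡ (+ k) (nneg k) (≤-abs W)) ⟩
          + p * + q * (+ k * abs W) ≤⟨ *-monoˡ (+ p * + q) (nneg p ⊠ nneg q) (correlated p q X ip iq q≢p (ℕₚ.⊓-glb (N₁≤c p ip) (N₁≤c q iq))) ⟩
          + p * + q * + X ≤⟨ pqX≤Z p q ip iq ⟩
          Z ≡⟨ ring₅ Z (+ k) ⟩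
          Z + + k * Z * 0ℤ ∎
        go (yes _) = begin
          + k * pair p q ≡⟨ cong (+ k *_) (pair≡ p q ip) ⟩
          + k * (+ p * + q * W) ≤⟨ *-monoˡ (+ k) (nneg k) (*-monoˡ (+ p * + q) (nneg p ⊠ nneg q) (≤-trans (≤-abs W) (Σ-abs-≤ X (λ m → f (p ℕ.* m) * f (q ℕ.* m)) (λ m → abs-mul-≤1 {f (p ℕ.* m)} {f (q ℕ.* m)} (f≤1 (p ℕ.* m)) (f≤1 (q ℕ.* m)))))) ⟩
          + k * (+ p * + q * + X) ≤⟨ *-monoˡ (+ k) (nneg k) (pqX≤Z p q ip iq) ⟩
          + k * Z ≤⟨ cert 0≤Z (ring₆ Z (+ k)) ⟩
          Z + + k * Z * 1ℤ ∎

      Σh² : + k * Σ C (λ m → h m * h m) ≤ + 2 * Z * (Sc * Sc)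
      Σh² = begin
        + k * Σ C (λ m → h m * h m) ≡⟨ cong (+ k *_) (trans (Σ-cong C (λ m → scaleSum-product κ (term m) (term m)))
            (trans (sym (scaleSum-Σ κ C (λ m p → scaleSum κ (λ q → term m p * term m q)))) (scaleSum-cong κ (λ p _ → sym (scaleSum-Σ κ C (λ m q → term m p * term m q)))))) ⟩
        + k * scaleSum κ (λ p → scaleSum κ (λ q → pair p q)) ≡⟨ trans (sym (scaleSum-*ˡ κ (+ k) (λ p → scaleSum κ (λ q → pair p q)))) (scaleSum-cong κ (λ p _ → sym (scaleSum-*ˡ κ (+ k) (pair p)))) ⟩
        scaleSum κ (λ p → scaleSum κ (λ q → + k * pair p q)) ≤⟨ scaleSum-≤ κ (λ p ip → row p ip) ⟩
        scaleSum κ (λ _ → Sc * Z + + k * Z) ≡⟨ scaleSum-const κ (Sc * Z + + k * Z) ⟩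
        Sc * (Sc * Z + + k * Z) ≤⟨ *-monoˡ Sc (nneg (scaleCount κ)) (+-monoʳ-≤ (Sc * Z) (*-monoʳ Z 0≤Z (+≤+ k≤count))) ⟩
        Sc * (Sc * Z + Sc * Z) ≡⟨ ring₇ Sc Z ⟩
        + 2 * Z * (Sc * Sc) ∎
        where
        open ≤-Reasoning
        row : ∀ p → InScale κ p → scaleSum κ (λ q → + k * pair p q) ≤ Sc * Z + + k * Z
        row p ip = begin
          scaleSum κ (λ q → + k * pair p q) ≤⟨ scaleSum-≤ κ (λ q iq → pair-bound p q ip iq) ⟩
          scaleSum κ (λ q → Z + + k * Z * 𝟙 (q ℕ.≟ p)) ≡⟨ trans (scaleSum-+ κ (λ _ → Z) (λ q → + k * Z * 𝟙 (q ℕ.≟ p))) (cong₂ _+_ (scaleSum-const κ Z) (scaleSum-*ˡ κ (+ k * Z) (λ q → 𝟙 (q ℕ.≟ p)))) ⟩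
          Sc * Z + + k * Z * scaleSum κ (λ q → 𝟙 (q ℕ.≟ p)) ≤⟨ +-monoʳ-≤ (Sc * Z) (≤-trans (*-monoˡ (+ k * Z) (nneg k ⊠ 0≤Z) (scaleSum-indicator κ p)) (≤-reflexive (*-identityʳ (+ k * Z)))) ⟩
          Sc * Z + + k * Z ∎

      exchange : scaleSum κ (λ p → + p * B p) ≡ Σ C (λ m → μ m * h m)
      exchange = begin
        scaleSum κ (λ p → + p * B p) ≡⟨ scaleSum-cong κ (λ p ip → trans (cong (+ p *_) (sym (Σ-cutoff (λ m → μ m * f (p ℕ.* m)) (c≤C p ip)))) (trans (sym (Σ-*ˡ C (+ p) (λ m → 𝟙 (m ℕ.<? c p) * (μ m * f (p ℕ.* m)))))
            (Σ-cong C (λ m → ring₈ (+ p) (𝟙 (m ℕ.<? c p)) (μ m) (f (p ℕ.* m)))))) ⟩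
        scaleSum κ (λ p → Σ C (λ m → μ m * term m p)) ≡⟨ scaleSum-Σ κ C (λ m p → μ m * term m p) ⟩
        Σ C (λ m → scaleSum κ (λ p → μ m * term m p)) ≡⟨ Σ-cong C (λ m → scaleSum-*ˡ κ (μ m) (term m)) ⟩
        Σ C (λ m → μ m * h m) ∎
        where
        open ≡-Reasoning

      V : ℤ
      V = scaleSum κ (λ p → + p * B p)

      V²≤ : V * V ≤ + C * Σ C (λ m → h m * h m)
      V²≤ = begin
        V * V ≡⟨ cong₂ _*_ exchange exchange ⟩
        Σ C (λ m → μ m * h m) * Σ C (λ m → μ m * h m) ≤⟨ Σ-square-≤ C (λ m → μ m * h m) ⟩
        + C * Σ C (λ m → μ m * h m * (μ m * h m)) ≤⟨ *-monoˡ (+ C) (nneg C) (Σ-mono C (λ m → drop (μ m) (h m) (abs-μ-≤1 m))) ⟩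
        + C * Σ C (λ m → h m * h m) ∎
        where
        open ≤-Reasoning
        drop : ∀ u h → abs u ≤ 1ℤ → u * h * (u * h) ≤ h * h
        drop u h u≤ = ≤-trans (≤-reflexive (trans (ring₉ u h) (cong (_* (h * h)) (sym (abs-sq u))))) (≤-trans (*-monoʳ (h * h) (sq h) (*-mono-≤ (abs-nonneg u) (abs-nonneg u) u≤ u≤)) (≤-reflexive (*-identityˡ (h * h))))

    bilinear : + K * abs (scaleSum κ (λ p → + p * Σ (multiples p N) (λ m → μ m * f (p ℕ.* m)))) ≤ + N * + scaleCount κ
    bilinear = sq-cancel-≤ (nneg N ⊠ nneg (scaleCount κ)) (*-cancelˡ (+ 512) (+<+ (ℕ.s≤s ℕ.z≤n)) (begin
      + 512 * (+ K * abs V * (+ K * abs V)) ≡⟨ trans (ring₁₀ (+ K) (abs V)) (cong₂ _*_ (sym k≡) (abs-sq V)) ⟩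
      + k * (V * V) ≤⟨ *-monoˡ (+ k) (nneg k) V²≤ ⟩
      + k * (+ C * H) ≡⟨ ring₁₁ (+ k) (+ C) H ⟩
      + C * (+ k * H) ≤⟨ *-monoˡ (+ C) (nneg C) Σh² ⟩
      + C * (+ 2 * (+ 64 * + s * (+ 2 * + N)) * (Sc * Sc)) ≡⟨ ring₁₂ (+ C) (+ s) (+ N) Sc ⟩
      + 256 * + N * (Sc * Sc) * (+ s * + C) ≤⟨ *-monoˡ (+ 256 * + N * (Sc * Sc)) (nneg 256 ⊠ nneg N ⊠ (nneg (scaleCount κ) ⊠ nneg (scaleCount κ))) sC≤2N ⟩
      + 256 * + N * (Sc * Sc) * (+ 2 * + N) ≡⟨ ring₁₃ (+ N) Sc ⟩
      + 512 * (+ N * Sc * (+ N * Sc)) ∎))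
      where
      open ≤-Reasoning
      H = Σ C (λ m → h m * h m)

-- Kátai's criterion.

module KataiCriterion where
  open import Defs using (μ)
  open ℤ-Arithmetic
  open IntegerSums
  open Moebius
  open Chebyshev using (scaleCount; scaleCount-lower)
  open TuranKubilius
  open GoodScales
  open Twists
  open ScaleSums using (scaleSum-+; scaleSum-*ˡ)
  open SignChanges using (scaleCount-positive)
  open BilinearSums

  private
    ring₁ : ∀ k d n → k * k * (d * d) + n * n - + 2 * n * k * d ≡ (k * d - n) * (k * d - n)
    ring₁ = solve-∀

    ring₂ : ∀ n s → n * n * s + s * (n * n) ≡ + 2 * n * (n * s)
    ring₂ = solve-∀

    ring₃ : ∀ k c n p → + 2 * n - + 2 * (+ 16 * k * c) ≡ (n + p - + 32 * k * c) + (n - p)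
    ring₃ = solve-∀

    ring₄ : ∀ k c p n → + 2 * n - + 2 * (+ 4 * k * (+ 2 * (c + p))) ≡ (n - + 16 * k * c) + (n - + 16 * k * p)
    ring₄ = solve-∀

    ring₅ : ∀ x → x + x ≡ + 2 * x
    ring₅ = solve-∀

    ring₆ : ∀ s k a → + 4 * (s * (k * a)) ≡ + 4 * k * (s * a)
    ring₆ = solve-∀

    ring₇ : ∀ n s → + 4 * (s * n) - (+ 2 * (n * s) + n * s) ≡ n * s
    ring₇ = solve-∀

    ring₈ : ∀ v x → x ≡ v + x + - v
    ring₈ = solve-∀

  Eventually : (ℕ → Set) → Set
  Eventually P = ∃ λ N₀ → ∀ N → N₀ ℕ.≤ N → P N

  eventually-below : ∀ R (P : ℕ → ℕ → Set) → (∀ i → Eventually (P i)) → Eventually (λ N → ∀ i → i ℕ.< R → P i N)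
  eventually-below zero P ev = 0 , λ N _ i ()
  eventually-below (suc R) P ev with eventually-below R P ev | ev R
  ... | N₀ , below | N₁ , top = N₀ ℕ.+ N₁ , λ N ≤N i i<1+R → go N ≤N i (ℕₚ.m≤n⇒m<n∨m≡n (ℕ.s≤s⁻¹ i<1+R))
    where
    go : ∀ N → N₀ ℕ.+ N₁ ℕ.≤ N → ∀ i → i ℕ.< R ⊎ i ≡ R → P i N
    go N ≤N i (inj₁ i<R) = below N (ℕₚ.≤-trans (ℕₚ.m≤m+n N₀ N₁) ≤N) i i<R
    go N ≤N i (inj₂ refl) = top N (ℕₚ.≤-trans (ℕₚ.m≤n+m N₁ N₀) ≤N)

  _=o[N] : (ℕ → ℤ) → Set
  F =o[N] = ∀ k → Eventually (λ N → + k * abs (F N) ≤ + N)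

  module Criterion (f : ℕ → ℤ) (f≤1 : ∀ n → abs (f n) ≤ 1ℤ)
    (uncorrelated : ∀ p q → Prime p → Prime q → 2 ℕ.< p → p ℕ.< q → (λ X → Σ X (λ m → f (p ℕ.* m) * f (q ℕ.* m))) =o[N]) where

    private
      corr : ℕ → ℕ → ℕ → ℤ
      corr p q X = Σ X (λ m → f (p ℕ.* m) * f (q ℕ.* m))

      Bound : ℕ → ℕ → ℕ → ℕ → Set
      Bound k q p X = Prime p → Prime q → 2 ℕ.< p → p ℕ.< q → + k * abs (corr p q X) ≤ + X

      bound : ∀ k q p → Eventually (Bound k q p)
      bound k q p = go (prime? p) (prime? q) (2 ℕ.<? p) (p ℕ.<? q)
        where
        go : Dec (Prime p) → Dec (Prime q) → Dec (2 ℕ.< p) → Dec (p ℕ.< q) → Eventually (Bound k q p)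
        go (yes pp) (yes qq) (yes 2<p) (yes p<q) = proj₁ (uncorrelated p q pp qq 2<p p<q k) , λ X ≤X _ _ _ _ → proj₂ (uncorrelated p q pp qq 2<p p<q k) X ≤X
        -- Pairs outside the hypotheses satisfy `Bound` vacuously with threshold 0, so that a common
        -- threshold can be taken over all p, q below R.
        go (no ¬p) _ _ _ = 0 , λ X _ pp _ _ _ → ⊥-elim (¬p pp)
        go _ (no ¬q) _ _ = 0 , λ X _ _ qq _ _ → ⊥-elim (¬q qq)
        go _ _ (no ¬2<p) _ = 0 , λ X _ _ _ 2<p _ → ⊥-elim (¬2<p 2<p)
        go _ _ _ (no ¬p<q) = 0 , λ X _ _ _ _ p<q → ⊥-elim (¬p<q p<q)

      uniform : ∀ k R → Eventually (λ X → ∀ q → q ℕ.< R → ∀ p → p ℕ.< R → Bound k q p X)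
      uniform k R = eventually-below R (λ q X → ∀ p → p ℕ.< R → Bound k q p X) (λ q → eventually-below R (Bound k q) (bound k q))

      a : ℕ → ℤ
      a n = μ n * f n

      A : ℕ → ℤ
      A N = Σ N a

      -- Averaging p B(p) + A(N) over the scale isolates A(N). Three errors remain, from the
      -- deviations, from rounding and multiples of p², and from the bilinear sum. With K = 4k each
      -- is on average at most N / (4k), and three of the four quarters are used.
      module AtScale (k k′ N N₁ N₂ R κ : ℕ) (k′≡ : + k′ ≡ + 512 * (+ (4 ℕ.* k) * + (4 ℕ.* k))) (1≤κ : 1 ℕ.≤ κ) (32k≤s : 32 ℕ.* k ℕ.≤ 64 ℕ.^ κ) (k′≤count : k′ ℕ.≤ scaleCount κ)
        (64s<R : 64 ℕ.* 64 ℕ.^ κ ℕ.< R) (corrs : ∀ X → N₁ ℕ.≤ X → ∀ q → q ℕ.< R → ∀ p → p ℕ.< R → Bound k′ q p X)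
        (R≤N : R ℕ.≤ N) (RN₁≤N : R ℕ.* N₁ ℕ.≤ N) (16kR≤N : 16 ℕ.* k ℕ.* R ℕ.≤ N)
        (dev-small : + (4 ℕ.* k ℕ.* (4 ℕ.* k)) * scaleSum κ (λ p → deviation a N p * deviation a N p) ≤ + N * + N * + scaleCount κ) where

        s = 64 ℕ.^ κ
        K = 4 ℕ.* k
        Sc = + scaleCount κ
        B : ℕ → ℤ
        B p = Σ (multiples p N) (λ m → μ m * f (p ℕ.* m))

        p<R : ∀ {p} → InScale κ p → p ℕ.< R
        p<R (_ , _ , p≤) = ℕₚ.≤-<-trans p≤ 64s<R

        2<p : ∀ {p} → InScale κ p → 2 ℕ.< p
        2<p (_ , s<p , _) = ℕₚ.≤-<-trans (ℕₚ.≤-trans (ℕₚ.m≤m+n 2 62) (ℕₚ.^-monoʳ-≤ 64 {1} {κ} 1≤κ)) s<p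

        correlated : ∀ p q X → InScale κ p → InScale κ q → ¬ q ≡ p → N₁ ℕ.≤ X → + k′ * abs (corr p q X) ≤ + X
        correlated p q X ip iq q≢p N₁≤X = go (ℕₚ.<-cmp p q)
          where
          go : _ → + k′ * abs (corr p q X) ≤ + X
          go (tri< p<q _ _) = corrs X N₁≤X q (p<R iq) p (p<R ip) (proj₁ ip) (proj₁ iq) (2<p ip) p<q
          go (tri≈ _ p≡q _) = ⊥-elim (q≢p (sym p≡q))
          go (tri> _ _ q<p) = subst (λ z → + k′ * abs z ≤ + X) (Σ-cong X (λ m → *-comm (f (q ℕ.* m)) (f (p ℕ.* m)))) (corrs X N₁≤X p (p<R ip) q (p<R iq) (proj₁ iq) (proj₁ ip) (2<p iq) q<p)

        V = scaleSum κ (λ p → + p * B p)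

        V≤ : + K * abs V ≤ + N * Sc
        V≤ = Bilinear.bilinear f f≤1 κ N N₁ k′ K correlated (ℕₚ.≤-trans (ℕₚ.*-monoˡ-≤ N₁ (ℕₚ.<⇒≤ 64s<R)) RN₁≤N) (ℕₚ.≤-trans (ℕₚ.<⇒≤ 64s<R) R≤N) k′≤count k′≡

        N>0 : 0ℤ < + 2 * + N
        N>0 = subst (0ℤ <_) (pos-* 2 N) (+<+ (ℕₚ.≤-trans (ℕₚ.≤-trans (ℕₚ.<-≤-trans (ℕₚ.≤-<-trans ℕ.z≤n 64s<R) R≤N) (ℕₚ.m≤m+n N _)) ℕₚ.≤-refl))

        -- 2xy ≤ x² + y² turns the mean square of the deviations into a bound for their mean.
        dev≤ : + K * scaleSum κ (λ p → abs (deviation a N p)) ≤ + N * Sc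
        dev≤ = *-cancelˡ (+ 2 * + N) N>0 (begin
          + 2 * + N * (+ K * scaleSum κ (λ p → abs (dev p))) ≡⟨ trans (sym (*-assoc (+ 2 * + N) (+ K) _)) (sym (scaleSum-*ˡ κ (+ 2 * + N * + K) (λ p → abs (dev p)))) ⟩
          scaleSum κ (λ p → + 2 * + N * + K * abs (dev p)) ≤⟨ scaleSum-≤ κ (λ p _ → am-gm p) ⟩
          scaleSum κ (λ p → + K * + K * (dev p * dev p) + + N * + N) ≡⟨ trans (scaleSum-+ κ (λ p → + K * + K * (dev p * dev p)) (λ _ → + N * + N)) (cong₂ _+_ (scaleSum-*ˡ κ (+ K * + K) (λ p → dev p * dev p)) (scaleSum-const κ (+ N * + N))) ⟩
          + K * + K * scaleSum κ (λ p → dev p * dev p) + Sc * (+ N * + N) ≤⟨ +-monoˡ-≤ (Sc * (+ N * + N)) (subst (λ z → z * scaleSum κ (λ p → dev p * dev p) ≤ + N * + N * Sc) (pos-* K K) dev-small) ⟩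
          + N * + N * Sc + Sc * (+ N * + N) ≡⟨ ring₂ (+ N) Sc ⟩
          + 2 * + N * (+ N * Sc) ∎)
          where
          open ≤-Reasoning
          dev : ℕ → ℤ
          dev p = deviation a N p
          am-gm : ∀ p → + 2 * + N * + K * abs (dev p) ≤ + K * + K * (dev p * dev p) + + N * + N
          am-gm p = subst (λ z → + 2 * + N * + K * abs (dev p) ≤ + K * + K * z + + N * + N) (abs-sq (dev p)) (cert (sq (+ K * abs (dev p) - + N)) (ring₁ (+ K) (abs (dev p)) (+ N)))

        error : ∀ p → InScale κ p → + K * (+ 2 * (+ multiples p N + + p)) ≤ + N
        error p ip@(pp , s<p , p≤) = *-cancelˡ (+ 2) (+<+ (ℕ.s≤s ℕ.z≤n)) (cert (gap c≤ ⊞ gap p-small) (trans (cong (λ z → + 2 * + N - + 2 * (z * (+ 2 * (+ c + + p)))) (pos-* 4 k)) (ring₄ (+ k) (+ c) (+ p) (+ N))))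
          where
          instance p≢0 = prime⇒nonZero pp
          c = multiples p N
          p≤N : + p ≤ + N
          p≤N = +≤+ (ℕₚ.≤-trans (ℕₚ.<⇒≤ (p<R ip)) R≤N)
          32kc≤ : + 32 * + k * + c ≤ + N + + p
          32kc≤ = ≤-trans (*-monoʳ (+ c) (nneg c) (≤-trans (≤-reflexive (sym (pos-* 32 k))) (+≤+ (ℕₚ.≤-trans 32k≤s (ℕₚ.<⇒≤ s<p))))) (multiples-upperℤ p N)
          c≤ : + 16 * + k * + c ≤ + N
          c≤ = *-cancelˡ (+ 2) (+<+ (ℕ.s≤s ℕ.z≤n)) (cert (gap 32kc≤ ⊞ gap p≤N) (ring₃ (+ k) (+ c) (+ N) (+ p)))
          p-small : + 16 * + k * + p ≤ + N
          p-small = ≤-trans (≤-reflexive (sym (trans (pos-* (16 ℕ.* k) p) (cong (_* + p) (pos-* 16 k))))) (+≤+ (ℕₚ.≤-trans (ℕₚ.*-monoʳ-≤ (16 ℕ.* k) (ℕₚ.<⇒≤ (p<R ip))) 16kR≤N))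

        shifted : + K * scaleSum κ (λ p → abs (+ p * B p + A N)) ≤ + 2 * (+ N * Sc)
        shifted = begin
          + K * scaleSum κ (λ p → abs (+ p * B p + A N)) ≤⟨ *-monoˡ (+ K) (nneg K) (scaleSum-≤ κ (λ p ip → deviation-twist f f≤1 (proj₁ ip) N)) ⟩
          + K * scaleSum κ (λ p → abs (deviation a N p) + e p) ≡⟨ trans (cong (+ K *_) (scaleSum-+ κ (λ p → abs (deviation a N p)) e)) (*-distribˡ-+ (+ K) _ (scaleSum κ e)) ⟩
          + K * scaleSum κ (λ p → abs (deviation a N p)) + + K * scaleSum κ e ≤⟨ +-mono-≤ dev≤ (≤-trans (≤-reflexive (sym (scaleSum-*ˡ κ (+ K) e))) (≤-trans (scaleSum-≤ κ error) (≤-reflexive (trans (scaleSum-const κ (+ N)) (*-comm Sc (+ N)))))) ⟩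
          + N * Sc + + N * Sc ≡⟨ ring₅ (+ N * Sc) ⟩
          + 2 * (+ N * Sc) ∎
          where
          open ≤-Reasoning
          e : ℕ → ℤ
          e p = + 2 * (+ multiples p N + + p)

        conclusion : + k * abs (A N) ≤ + N
        conclusion = *-cancelˡ Sc (scaleCount-positive κ 1≤κ) (*-cancelˡ (+ 4) (+<+ (ℕ.s≤s ℕ.z≤n)) (begin
          + 4 * (Sc * (+ k * abs (A N))) ≡⟨ trans (ring₆ Sc (+ k) (abs (A N))) (cong₂ _*_ (sym (pos-* 4 k)) (trans (cong (_* abs (A N)) (sym (abs-of-nonneg (nneg (scaleCount κ))))) (sym (abs-mul Sc (A N))))) ⟩
          + K * abs (Sc * A N) ≡⟨ cong (λ z → + K * abs z) split ⟩
          + K * abs (scaleSum κ (λ p → + p * B p + A N) + - V) ≤⟨ *-monoˡ (+ K) (nneg K) (≤-trans (abs-+ (scaleSum κ (λ p → + p * B p + A N)) (- V)) (+-mono-≤ (scaleSum-abs κ (λ p → + p * B p + A N)) (≤-reflexive (abs-neg V)))) ⟩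
          + K * (scaleSum κ (λ p → abs (+ p * B p + A N)) + abs V) ≡⟨ *-distribˡ-+ (+ K) _ (abs V) ⟩
          + K * scaleSum κ (λ p → abs (+ p * B p + A N)) + + K * abs V ≤⟨ +-mono-≤ shifted V≤ ⟩
          + 2 * (+ N * Sc) + + N * Sc ≤⟨ cert (nneg N ⊠ nneg (scaleCount κ)) (ring₇ (+ N) Sc) ⟩
          + 4 * (Sc * + N) ∎))
          where
          open ≤-Reasoning
          split : Sc * A N ≡ scaleSum κ (λ p → + p * B p + A N) + - V
          split = trans (ring₈ V (Sc * A N)) (cong (_+ - V) (sym (trans (scaleSum-+ κ (λ p → + p * B p) (λ _ → A N)) (cong (λ z → V + z) (scaleSum-const κ (A N))))))

      count-large : ∀ κ → 1 ℕ.≤ κ → ∀ k → k ℕ.≤ κ → k ℕ.≤ scaleCount κ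
      count-large (suc κ) _ k k≤ = ℕₚ.*-cancelˡ-≤ (suc κ) (begin
        suc κ ℕ.* k ≤⟨ ℕₚ.*-mono-≤ (ℕₚ.<⇒≤ (n<2^n (suc κ))) (ℕₚ.≤-trans k≤ (ℕₚ.<⇒≤ (n<2^n (suc κ)))) ⟩
        2 ℕ.^ suc κ ℕ.* 2 ℕ.^ suc κ ≡⟨ trans (sym (ℕₚ.^-distribˡ-+-* 2 (suc κ) (suc κ))) (trans (cong (λ z → 2 ℕ.^ (suc κ ℕ.+ z)) (sym (ℕₚ.+-identityʳ (suc κ)))) (sym (ℕₚ.^-*-assoc 2 2 (suc κ)))) ⟩
        4 ℕ.^ suc κ ≤⟨ ℕₚ.^-monoˡ-≤ (suc κ) (ℕₚ.m≤m+n 4 60) ⟩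
        64 ℕ.^ suc κ ≤⟨ scaleCount-lower κ ⟩
        suc κ ℕ.* scaleCount (suc κ) ∎)
        where open ℕₚ.≤-Reasoning

      assemble : ∀ k k′ κ₀ → k′ ≡ 512 ℕ.* (4 ℕ.* k ℕ.* (4 ℕ.* k)) → κ₀ ≡ suc (k′ ℕ.+ 32 ℕ.* k) → (∃₂ λ n N₂ → GoodScale κ₀ (4 ℕ.* k ℕ.* (4 ℕ.* k)) 1 n N₂) → Eventually (λ N → + k * abs (A N) ≤ + N)
      assemble k k′ κ₀ k′≡ κ₀≡ (n , N₂ , gs) = with-R (suc (64 ℕ.^ (n ℕ.+ κ₀))) ℕₚ.≤-refl
        where
        with-R : ∀ R → 64 ℕ.^ (n ℕ.+ κ₀) ℕ.< R → Eventually (λ N → + k * abs (A N) ≤ + N)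
        with-R R <R = go (uniform k′ R)
          where
          go : Eventually (λ X → ∀ q → q ℕ.< R → ∀ p → p ℕ.< R → Bound k′ q p X) → Eventually (λ N → + k * abs (A N) ≤ + N)
          go (N₁ , corrs) = N₂ ℕ.+ (R ℕ.+ (R ℕ.* N₁ ℕ.+ 16 ℕ.* k ℕ.* R)) , λ N ≤N → at N ≤N
              (gs N (λ _ → a) (λ _ → N) (λ _ m → abs-mul-≤1 {μ m} {f m} (abs-μ-≤1 m) (f≤1 m)) (λ _ _ → ℕₚ.≤-trans (ℕₚ.m≤m+n N₂ _) ≤N , ℕₚ.≤-refl))
            where
            at : ∀ N → N₂ ℕ.+ (R ℕ.+ (R ℕ.* N₁ ℕ.+ 16 ℕ.* k ℕ.* R)) ℕ.≤ N →
              (∃ λ κ → κ₀ ℕ.≤ κ × κ ℕ.< n ℕ.+ κ₀ × (∀ i → i ℕ.< 1 → + (4 ℕ.* k ℕ.* (4 ℕ.* k)) * scaleSum κ (λ p → deviation a N p * deviation a N p) ≤ + N * + N * + scaleCount κ)) → + k * abs (A N) ≤ + N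
            at N ≤N (κ , κ₀≤κ , κ< , dev-small) = AtScale.conclusion k k′ N N₁ N₂ R κ +k′≡ 1≤κ 32k≤s (count-large κ 1≤κ k′ (ℕₚ.≤-trans k′≤κ₀ κ₀≤κ))
                (ℕₚ.≤-<-trans (ℕₚ.^-monoʳ-≤ 64 κ<) <R) corrs (ℕₚ.≤-trans (ℕₚ.m≤m+n R _) r₁) (ℕₚ.≤-trans (ℕₚ.m≤m+n (R ℕ.* N₁) _) r₂) (ℕₚ.≤-trans (ℕₚ.m≤n+m (16 ℕ.* k ℕ.* R) (R ℕ.* N₁)) r₂) (dev-small 0 (ℕ.s≤s ℕ.z≤n))
              where
              r₁ : R ℕ.+ (R ℕ.* N₁ ℕ.+ 16 ℕ.* k ℕ.* R) ℕ.≤ N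
              r₁ = ℕₚ.≤-trans (ℕₚ.m≤n+m _ N₂) ≤N
              r₂ : R ℕ.* N₁ ℕ.+ 16 ℕ.* k ℕ.* R ℕ.≤ N
              r₂ = ℕₚ.≤-trans (ℕₚ.m≤n+m _ R) r₁
              +k′≡ : + k′ ≡ + 512 * (+ (4 ℕ.* k) * + (4 ℕ.* k))
              +k′≡ = trans (cong +_ k′≡) (trans (pos-* 512 (4 ℕ.* k ℕ.* (4 ℕ.* k))) (cong (+ 512 *_) (pos-* (4 ℕ.* k) (4 ℕ.* k))))
              1≤κ : 1 ℕ.≤ κ
              1≤κ = ℕₚ.≤-trans (ℕₚ.≤-trans (ℕ.s≤s ℕ.z≤n) (ℕₚ.≤-reflexive (sym κ₀≡))) κ₀≤κ
              k′≤κ₀ : k′ ℕ.≤ κ₀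
              k′≤κ₀ = ℕₚ.≤-trans (ℕₚ.≤-trans (ℕₚ.m≤m+n k′ (32 ℕ.* k)) (ℕₚ.n≤1+n _)) (ℕₚ.≤-reflexive (sym κ₀≡))
              32k≤s : 32 ℕ.* k ℕ.≤ 64 ℕ.^ κ
              32k≤s = ℕₚ.≤-trans (ℕₚ.≤-trans (ℕₚ.≤-trans (ℕₚ.m≤n+m (32 ℕ.* k) (suc k′)) (ℕₚ.≤-reflexive (sym κ₀≡))) (ℕₚ.≤-trans κ₀≤κ (ℕₚ.<⇒≤ (n<2^n κ)))) (ℕₚ.^-monoˡ-≤ κ (ℕₚ.m≤m+n 2 62))

    katai : (λ N → Σ N (λ n → μ n * f n)) =o[N]
    katai k = with-parameters _ _ refl refl
      where
      with-parameters : ∀ k′ κ₀ → k′ ≡ 512 ℕ.* (4 ℕ.* k ℕ.* (4 ℕ.* k)) → κ₀ ≡ suc (k′ ℕ.+ 32 ℕ.* k) → Eventually (λ N → + k * abs (A N) ≤ + N)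
      with-parameters k′ κ₀ k′≡ κ₀≡ = assemble k k′ κ₀ k′≡ κ₀≡ (good-scale κ₀ (subst (1 ℕ.≤_) (sym κ₀≡) (ℕ.s≤s ℕ.z≤n)) (4 ℕ.* k ℕ.* (4 ℕ.* k)) 0)

-- Assembling the theorem.

module Conclusion where
  open import Defs
  open import Data.Nat.DivMod using (m%n<n)
  open import Data.Nat.Divisibility using (_∣_; divides)
  open import Data.Nat.Primality using (Prime; prime[2])
  open ℤ-Arithmetic
  open IntegerSums
  open Moebius
  open ThueMorse using (T; abs-T; T-t)
  open SignFlips using (Odd)
  open ScaleSums using (M)
  open Mertens using (mertens)
  open Correlations using (module Correlation)
  open KataiCriterion

  private
    ring₁ : ∀ p m → p ℕ.* p ℕ.* (m ℕ.* m) ≡ p ℕ.* m ℕ.* (p ℕ.* m)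
    ring₁ = ℕR.solve-∀

    ring₂ : ∀ s u t → + 2 * (s + u * t) ≡ + 2 * s + (u - u * (1ℤ - + 2 * t))
    ring₂ = solve-∀

    ring₃ : ∀ m f u x → m - f + (u - x) ≡ (m + u) - (f + x)
    ring₃ = solve-∀

    ring₄ : ∀ k s → + 2 * (k * s) ≡ k * (+ 2 * s)
    ring₄ = solve-∀

    ring₅ : ∀ n → n + n ≡ + 2 * n
    ring₅ = solve-∀

  odd-prime : ∀ p → Prime p → 2 ℕ.< p → Odd p
  odd-prime p pp 2<p = go (p ℕ.% 2) refl (m%n<n p 2)
    where
    go : ∀ r → p ℕ.% 2 ≡ r → r ℕ.< 2 → Odd p
    go 0 eq _ = ⊥-elim (ℕₚ.<⇒≢ 2<p (prime∣prime⇒≡ pp prime[2] (divides (p ℕ./ 2) (trans (ThueMorse.halves p) (trans (cong (ℕ._+ 2 ℕ.* (p ℕ./ 2)) eq) (ℕₚ.*-comm 2 (p ℕ./ 2)))))))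
    go 1 eq _ = p ℕ./ 2 , trans (ThueMorse.halves p) (cong (ℕ._+ 2 ℕ.* (p ℕ./ 2)) eq)
    go (suc (suc _)) _ (ℕ.s≤s (ℕ.s≤s ()))

  odd-square : ∀ {p} → Odd p → Odd (p ℕ.* p)
  odd-square o = SignFlips.odd-* o o

  -- For f(n) = T(n²) the correlation of p and q is that of the coefficients p² and q². These must
  -- be odd, which is why the criterion only asks for 2 < p.
  uncorrelated : ∀ p q → Prime p → Prime q → 2 ℕ.< p → p ℕ.< q → (λ X → Σ X (λ m → T (p ℕ.* m ℕ.* (p ℕ.* m)) * T (q ℕ.* m ℕ.* (q ℕ.* m)))) =o[N]
  uncorrelated p q pp qq 2<p p<q k = proj₁ bound , λ X ≤X → subst (λ z → + k * abs z ≤ + X) (Σ-cong X (λ m → cong₂ (λ x y → T x * T y) (ring₁ p m) (ring₁ q m))) (proj₂ bound X ≤X)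
    where
    open Correlation (p ℕ.* p) (q ℕ.* q) (ℕₚ.*-mono-< p<q p<q) (odd-square (odd-prime p pp 2<p)) (odd-square (odd-prime q qq (ℕₚ.<-trans 2<p p<q))) using (g; correlation)
    bound : Eventually (λ X → + k * abs (Σ X g) ≤ + X)
    bound = correlation k

  thue-morse-orthogonal : (λ N → Σ N (λ n → μ n * T (n ℕ.* n))) =o[N]
  thue-morse-orthogonal = Criterion.katai (λ n → T (n ℕ.* n)) (λ n → ≤-reflexive (abs-T (n ℕ.* n))) uncorrelated

  S-split : ∀ N → + 2 * S N ≡ M N - Σ N (λ n → μ n * T (n ℕ.* n))
  S-split zero = refl
  S-split (suc N) = trans (ring₂ (S N) (μ N) (+ t (N ℕ.* N))) (trans (cong (λ z → z + (μ N - μ N * (1ℤ - + 2 * + t (N ℕ.* N)))) (S-split N))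
    (trans (cong (λ z → M N - F + (μ N - μ N * z)) (sym (T-t (N ℕ.* N)))) (ring₃ (M N) F (μ N) (μ N * T (N ℕ.* N)))))
    where
    F = Σ N (λ n → μ n * T (n ℕ.* n))

  S=o[N] : ∀ (k : ℕ) → ∃ λ N₀ → ∀ (N : ℕ) → N₀ ℕ.≤ N → suc k ℕ.* ∣ S N ∣ ℕ.≤ N
  -- The bound for M is available at powers of two, and 2ᴷ ≥ K.
  S=o[N] k = go (mertens (suc k)) (thue-morse-orthogonal (suc k))
    where
    K = suc k
    go : Eventually (λ N → + (2 ℕ.^ K) * abs (M N) ≤ + N) → Eventually (λ N → + K * abs (Σ N (λ n → μ n * T (n ℕ.* n))) ≤ + N) → ∃ λ N₀ → ∀ N → N₀ ℕ.≤ N → K ℕ.* ∣ S N ∣ ℕ.≤ N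
    go (N₁ , m) (N₂ , f) = N₁ ℕ.+ N₂ , λ N ≤N → drop‿+≤+ (≤-trans (≤-reflexive (pos-* K ∣ S N ∣)) (at N (ℕₚ.≤-trans (ℕₚ.m≤m+n N₁ N₂) ≤N) (ℕₚ.≤-trans (ℕₚ.m≤n+m N₂ N₁) ≤N)))
      where
      at : ∀ N → N₁ ℕ.≤ N → N₂ ℕ.≤ N → + K * abs (S N) ≤ + N
      at N N₁≤ N₂≤ = *-cancelˡ (+ 2) (+<+ (ℕ.s≤s ℕ.z≤n)) (begin
        + 2 * (+ K * abs (S N)) ≡⟨ trans (ring₄ (+ K) (abs (S N))) (cong (+ K *_) (sym (abs-mul (+ 2) (S N)))) ⟩
        + K * abs (+ 2 * S N) ≡⟨ cong (λ z → + K * abs z) (S-split N) ⟩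
        + K * abs (M N + - F) ≤⟨ *-monoˡ (+ K) (nneg K) (≤-trans (abs-+ (M N) (- F)) (+-monoʳ-≤ (abs (M N)) (≤-reflexive (abs-neg F)))) ⟩
        + K * (abs (M N) + abs F) ≡⟨ *-distribˡ-+ (+ K) (abs (M N)) (abs F) ⟩
        + K * abs (M N) + + K * abs F ≤⟨ +-mono-≤ (≤-trans (*-monoʳ (abs (M N)) (abs-nonneg (M N)) (+≤+ (ℕₚ.<⇒≤ (n<2^n K)))) (m N N₁≤)) (f N N₂≤) ⟩
        + N + + N ≡⟨ ring₅ (+ N) ⟩
        + 2 * + N ∎)
        where
        open ≤-Reasoning
        F = Σ N (λ n → μ n * T (n ℕ.* n))

open import Defs
open import Data.Nat using (_*_; _≤_)
open import Data.Integer using (∣_∣)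

theorem1 : ∀ (k : ℕ) → ∃ λ N₀ → ∀ (N : ℕ) → N₀ ≤ N → suc k * ∣ S N ∣ ≤ N
theorem1 = Conclusion.S=o[N]
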